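{- Let $t\geq 1$ be an integer. Every graph with thickness $t$ is: $\lceil\frac{9}{2}t\rceil$-choosable with defect $1$ and clustering $2$; $\lceil \frac{21}{5} t\rceil$-choosable with clustering $9$; and $4t$-choosable with clustering $228t-51$.
   Context: Graphs are finite and simple. The thickness of a graph $G$ is the minimum integer $t$ such that $G$ is the union of $t$ planar subgraphs. In a coloured graph the monochromatic subgraph is the spanning subgraph of edges whose endpoints have the same colour; its connected components are monochromatic components. A colouring has defect $d$ if the monochromatic subgraph has maximum degree at most $d$, and clustering $c$ if every monochromatic component has at most $c$ vertices. A $k$-list-assignment $L$ assigns to each vertex $v$ a set $L(v)$ of at least $k$ colours; an $L$-colouring colours each $v$ with a colour from $L(v)$. $G$ is $k$-choosable with defect $d$ and clustering $c$ if for every $k$-list-assignment $L$, $G$ has an $L$-colouring with defect $d$ and clustering $c$ (and similarly with only one of these conditions).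
   Formalization: A planar graph is taken to be one with a plane drawing by polygonal arcs whose vertices and bends have rational rather than real coordinates; every planar graph has such a drawing (perturb a polygonal drawing), but this is not proved. -}

module Defs where

open import Data.Nat using (ℕ; zero; suc; _+_; _*_; _∸_; _≤_; _<_; _≡ᵇ_)
open import Data.Bool using (Bool; true; false; _∧_)
open import Data.Fin using (Fin; toℕ)
open import Data.List using (List; []; _∷_; _++_; length; filterᵇ; allFin)
open import Data.List.Relation.Unary.All using (All)
open import Data.List.Relation.Unary.Unique.Propositional using (Unique)
open import Data.List.Membership.Propositional using (_∈_)
open import Data.Product using (Σ; ∃; _×_; _,_)
open import Data.Sum using (_⊎_)
open import Data.Empty using (⊥)
open import Data.Unit using (⊤)
open import Relation.Nullary using (¬_)
open import Relation.Binary.PropositionalEquality using (_≡_)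
open import Function.Definitions using (Injective)
open import Data.Rational using (ℚ; 0ℚ; 1ℚ) renaming (_+_ to _+q_; _*_ to _*q_; _-_ to _-q_; _≤_ to _≤q_)

record Graph (n : ℕ) : Set where
  field
    adj    : Fin n → Fin n → Bool
    sym    : ∀ u v → adj u v ≡ adj v u
    irrefl : ∀ v → adj v v ≡ false
open Graph public

Edge : ∀ {n} → Graph n → Fin n → Fin n → Set
Edge G u v = adj G u v ≡ true

_⊆G_ : ∀ {n} → Graph n → Graph n → Set
H ⊆G G = ∀ u v → Edge H u v → Edge G u v

-- Planarity: drawings in the plane with polygonal arcs (Diestel's
-- convention), with points having rational coordinates.

Point : Set
Point = ℚ × ℚ

OnSeg : Point → Point → Point → Set
OnSeg (p₁ , p₂) (q₁ , q₂) (x₁ , x₂) =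
  Σ ℚ λ l → (0ℚ ≤q l) × (l ≤q 1ℚ)
          × (x₁ ≡ p₁ +q (l *q (q₁ -q p₁)))
          × (x₂ ≡ p₂ +q (l *q (q₂ -q p₂)))

OnPath : List Point → Point → Set
OnPath []            x = ⊥
OnPath (p ∷ [])      x = x ≡ p
OnPath (p ∷ q ∷ ps)  x = OnSeg p q x ⊎ OnPath (q ∷ ps) x

SimplePath : List Point → Set
SimplePath []           = ⊤
SimplePath (p ∷ [])     = ⊤
SimplePath (p ∷ q ∷ ps) =
  (∀ x → OnSeg p q x → OnPath (q ∷ ps) x → x ≡ q) × SimplePath (q ∷ ps)

-- An edge {u,v} is represented once, by the pair with toℕ u < toℕ v
OEdge : ∀ {n} → Graph n → Fin n → Fin n → Set
OEdge G u v = Edge G u v × (toℕ u < toℕ v)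

record PlaneDrawing {n : ℕ} (G : Graph n) : Set where
  field
    pos       : Fin n → Point
    pos-inj   : Injective _≡_ _≡_ pos
    bends     : Fin n → Fin n → List Point
  arc : Fin n → Fin n → List Point
  arc u v = pos u ∷ (bends u v ++ (pos v ∷ []))
  field
    arc-simple  : ∀ u v → OEdge G u v → SimplePath (arc u v)
    arc-novert  : ∀ u v → OEdge G u v → ∀ w → OnPath (arc u v) (pos w) → (w ≡ u) ⊎ (w ≡ v)
    arc-disjoint : ∀ u v u' v' → OEdge G u v → OEdge G u' v' → ¬ ((u ≡ u') × (v ≡ v')) →
                   ∀ x → OnPath (arc u v) x → OnPath (arc u' v') x → Σ (Fin n) λ w → x ≡ pos w

Planar : ∀ {n} → Graph n → Set
Planar G = PlaneDrawing G

PlanarDecomposition : ∀ {n} → Graph n → (t : ℕ) → Set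
PlanarDecomposition {n} G t =
  Σ (Fin t → Graph n) λ Hs →
    (∀ i → Hs i ⊆G G) × (∀ i → Planar (Hs i))
    × (∀ u v → Edge G u v → Σ (Fin t) λ i → Edge (Hs i) u v)

HasThickness : ∀ {n} → Graph n → ℕ → Set
HasThickness G t = PlanarDecomposition G t × (∀ s → s < t → ¬ PlanarDecomposition G s)

Colouring : ℕ → Set
Colouring n = Fin n → ℕ

IsListAssignment : ∀ {n} → (Fin n → List ℕ) → ℕ → Set
IsListAssignment L k = ∀ v → Unique (L v) × (k ≤ length (L v))

IsLColouring : ∀ {n} → (Fin n → List ℕ) → Colouring n → Set
IsLColouring L c = ∀ v → c v ∈ L v

MonoEdge : ∀ {n} → Graph n → Colouring n → Fin n → Fin n → Set
MonoEdge G c u v = Edge G u v × (c u ≡ c v)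

monoDeg : ∀ {n} → Graph n → Colouring n → Fin n → ℕ
monoDeg {n} G c v = length (filterᵇ (λ u → adj G v u ∧ (c u ≡ᵇ c v)) (allFin n))

HasDefect : ∀ {n} → Graph n → Colouring n → ℕ → Set
HasDefect G c d = ∀ v → monoDeg G c v ≤ d

data MonoReach {n : ℕ} (G : Graph n) (c : Colouring n) (v : Fin n) : Fin n → Set where
  here : MonoReach G c v v
  step : ∀ {u w} → MonoReach G c v u → MonoEdge G c u w → MonoReach G c v w

HasClustering : ∀ {n} → Graph n → Colouring n → ℕ → Set
HasClustering G c k =
  ∀ v (ws : List _) → Unique ws → All (MonoReach G c v) ws → length ws ≤ k

ChoosableDefectClustering : ∀ {n} → Graph n → (k d cl : ℕ) → Set
ChoosableDefectClustering {n} G k d cl =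
  ∀ (L : Fin n → List ℕ) → IsListAssignment L k →
    Σ (Colouring n) λ c → IsLColouring L c × HasDefect G c d × HasClustering G c cl

ChoosableClustering : ∀ {n} → Graph n → (k cl : ℕ) → Set
ChoosableClustering {n} G k cl =
  ∀ (L : Fin n → List ℕ) → IsListAssignment L k →
    Σ (Colouring n) λ c → IsLColouring L c × HasClustering G c cl

module Submission where

{- The edge bound for plane graphs is obtained by linear algebra over GF(2) rather than from Euler's formula.  In a plane
graph of minimum degree two, the parity of the number of segments of an even edge set above a point is constant along each
side of each edge and around each corner, so it is constant on the classes of darts that make up the faces.  As every
class has at least three darts, 3|S| edges on S would leave a nonzero even edge set with parity zero on all sides of all
edges; but the two sides of each of its edges have different parities.

Hence a graph of thickness t has fewer than 3t|S| edges on every nonempty vertex set S.  A smallest set whose edges outweigh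
those leaving it then satisfies a local degree condition relative to its remaining lists, once the other vertices are
coloured.  Under that condition, a list colouring that minimises the number of monochromatic edges (and then the number of
their ends at certain tight vertices) has monochromatic degree at most one or two.  In the latter case the monochromatic
components are paths and cycles, and recolouring suitable vertices cuts the long ones. -}

open import Defs hiding (sym)
open import Data.Bool using (Bool; true; false; _∧_; _xor_; not; T; if_then_else_)
import Data.Bool.Properties as Bool
open import Data.Bool.Properties using (xor-comm; xor-assoc; xor-same; xor-identityʳ; ∧-distribˡ-xor; ∧-distribʳ-xor; ∧-comm; ∧-assoc; ∧-zeroʳ; ∧-identityʳ)
open import Data.Empty using (⊥; ⊥-elim)
import Data.Fin as Fin
open import Data.Fin using (Fin; zero; suc; toℕ; finToFun; funToFin; combine)
import Data.Fin.Properties as Fin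
open import Data.List using (List; []; _∷_; _++_; length; filterᵇ; allFin; map; tabulate; filter; concatMap; lookup; cartesianProduct; take)
open import Data.List.Membership.Propositional using (_∈_; _∉_; lose; find)
open import Data.List.Membership.Propositional.Properties using (∈-allFin; ∈-filter⁺; ∈-filter⁻; ∈-map⁺; ∈-map⁻; ∈-++⁺ˡ; ∈-++⁺ʳ; ∈-++⁻; ∈-∃++; ∈-concatMap⁺; ∈-lookup; ∈-cartesianProduct⁺)
open import Data.List.Properties using (length-map; length-++; length-tabulate; length-take; take++drop≡id; filter-++)
open import Data.List.Relation.Unary.All using (All; []; _∷_)
import Data.List.Relation.Unary.All as All
import Data.List.Relation.Unary.All.Properties as All
open import Data.List.Relation.Unary.AllPairs using (AllPairs; []; _∷_)
open import Data.List.Relation.Unary.Any using (Any; any?; here; there; index)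
open import Data.List.Relation.Unary.Any.Properties using (lookup-index)
open import Data.List.Relation.Unary.Unique.Propositional using (Unique)
import Data.List.Relation.Unary.Unique.Propositional.Properties as Unique
open import Data.Maybe using (Maybe; just; nothing)
import Data.Maybe.Properties as Maybe
open import Data.Nat
open import Data.Nat.DivMod using (m≡m%n+[m/n]*n; m%n<n)
open import Data.Nat.Properties
open import Data.Nat.Tactic.RingSolver using (solve-∀)
open import Data.Product using (Σ; _×_; _,_; proj₁; proj₂)
open import Data.Product.Properties using (≡-dec)
import Data.Rational as ℚ
open import Data.Rational using (ℚ; 0ℚ; 1ℚ; positive; nonNegative; 1/_) renaming (_+_ to _+q_; _*_ to _*q_; _-_ to _-q_; -_ to -q_; _≤_ to _≤q_; _<_ to _<q_)
import Data.Rational.Properties as ℚ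
open import Data.Rational.Solver using (module +-*-Solver)
import Data.Sum as Sum
open import Data.Sum using (_⊎_; inj₁; inj₂)
open import Function using (_∘_; id; case_of_)
open import Relation.Binary using (DecidableEquality; Tri; tri<; tri≈; tri>)
open import Relation.Binary.PropositionalEquality hiding ([_])
open import Relation.Nullary using (¬_; Dec; yes; no)
open import Relation.Nullary.Decidable using (⌊_⌋; T?; _×-dec_; ¬?; decidable-stable; toWitness)

-- Classical reasoning towards ⊥

-- A recolouring that costs nothing may join two long paths into a new long component; this obstacle
-- shapes the clustering proofs. Such a recolouring is only planned: the paths that it would join
-- contain further vertices with recolourings of their own, and one of those is tried first. Plans
-- therefore form a stack. Each plan adds more vertices to choose from than it can obstruct, and the
-- clustering bounds are chosen to make this count work.
--
-- The list sizes come from one scheme. A local theorem asks for `α * deg + ε * τ + 1 ≤ β * length`,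
-- where `τ` counts tight neighbours and `β = α + suc ε`; by the edge bound, lists of size `k`
-- suffice if `γ * (t * 6) ≤ 2 * β * k`, where `2 * β = suc ε + γ`.
--
-- In the plane, a face is replaced by a class of darts on which every even edge set has the same
-- parity. Such classes may merge faces, which only lowers their number. The sweep direction is
-- tilted until no two relevant points are level.
--
-- Optimality and reachability are treated classically, under double negation; a finite search over
-- the lists then returns an actual colouring.

em : ∀ {a} {P : Set a} → ¬ ¬ Dec P
em k = k (no (λ p → k (yes p)))

¬¬-Fin : ∀ {n} {P : Fin n → Set} → (∀ i → ¬ ¬ P i) → ¬ ¬ (∀ i → P i)
¬¬-Fin {zero}  f k = k (λ ())
¬¬-Fin {suc n} f k = f zero λ p → ¬¬-Fin (f ∘ suc) λ q → k λ { zero → p ; (suc i) → q i }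

-- Descent on a bound for `f x`: if no element is least, each one can be replaced by one with a
-- smaller value.
¬¬-minimal : ∀ {a} {A : Set a} (f : A → ℕ) → A → ¬ ¬ (Σ A λ x → ∀ y → f x ≤ f y)
¬¬-minimal {A = A} f x k = go (f x) x ≤-refl
  where
  go : ∀ b x → f x ≤ b → ⊥
  go zero    x le = k (x , λ y → ≤-trans le z≤n)
  go (suc b) x le = k (x , λ y → ≮⇒≥ λ lt → go b y (s≤s⁻¹ (≤-trans lt le)))

-- Booleans and sums over Fin n

infix 4 _==_
_==_ : ∀ {n} → Fin n → Fin n → Bool
u == v = ⌊ u Fin.≟ v ⌋

==-true : ∀ {n} {u v : Fin n} → (u == v) ≡ true → u ≡ v
==-true {u = u} {v} e with u Fin.≟ v
... | yes p = p
==-true () | no _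

==-refl : ∀ {n} (u : Fin n) → (u == u) ≡ true
==-refl u with u Fin.≟ u
... | yes _ = refl
... | no ne = ⊥-elim (ne refl)

==-false : ∀ {n} {u v : Fin n} → u ≢ v → (u == v) ≡ false
==-false {u = u} {v} ne with u Fin.≟ v
... | yes p = ⊥-elim (ne p)
... | no _ = refl

≡ᵇ-true : ∀ {a b : ℕ} → (a ≡ᵇ b) ≡ true → a ≡ b
≡ᵇ-true {a} {b} e = ≡ᵇ⇒≡ a b (subst T (sym e) _)

≡ᵇ-refl : ∀ (a : ℕ) → (a ≡ᵇ a) ≡ true
≡ᵇ-refl zero = refl
≡ᵇ-refl (suc a) = ≡ᵇ-refl a

≡ᵇ-≢ : ∀ {a b : ℕ} → a ≢ b → (a ≡ᵇ b) ≡ false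
≡ᵇ-≢ {a} {b} ne with a ≡ᵇ b in e
... | true  = ⊥-elim (ne (≡ᵇ-true e))
... | false = refl

≡ᵇ-sym : ∀ (a b : ℕ) → (a ≡ᵇ b) ≡ (b ≡ᵇ a)
≡ᵇ-sym zero    zero    = refl
≡ᵇ-sym zero    (suc b) = refl
≡ᵇ-sym (suc a) zero    = refl
≡ᵇ-sym (suc a) (suc b) = ≡ᵇ-sym a b

∧-true : ∀ {a b} → a ∧ b ≡ true → a ≡ true × b ≡ true
∧-true {true} {true} _ = refl , refl

∧-intro : ∀ {a b} → a ≡ true → b ≡ true → a ∧ b ≡ true
∧-intro refl refl = refl

not-true : ∀ {b : Bool} → b ≢ true → b ≡ false
not-true {true}  h = ⊥-elim (h refl)
not-true {false} h = refl

true≢false : ∀ {b : Bool} → b ≡ true → b ≡ false → ⊥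
true≢false refl ()

b2n : Bool → ℕ
b2n true  = 1
b2n false = 0

b2n≤1 : ∀ b → b2n b ≤ 1
b2n≤1 true  = ≤-refl
b2n≤1 false = z≤n

b2n-mono : ∀ {a b} → (a ≡ true → b ≡ true) → b2n a ≤ b2n b
b2n-mono {true}  h rewrite h refl = ≤-refl
b2n-mono {false} h = z≤n

+-interchange : ∀ a b c d → (a + b) + (c + d) ≡ (a + c) + (b + d)
+-interchange a b c d = begin
  (a + b) + (c + d) ≡⟨ +-assoc a b _ ⟩
  a + (b + (c + d)) ≡⟨ cong (a +_) (sym (+-assoc b c d)) ⟩
  a + ((b + c) + d) ≡⟨ cong (λ z → a + (z + d)) (+-comm b c) ⟩
  a + ((c + b) + d) ≡⟨ cong (a +_) (+-assoc c b d) ⟩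
  a + (c + (b + d)) ≡⟨ sym (+-assoc a c _) ⟩
  (a + c) + (b + d) ∎
  where open ≡-Reasoning

opaque
  ∑ : ∀ {n} → (Fin n → ℕ) → ℕ
  ∑ {zero}  f = 0
  ∑ {suc n} f = f zero + ∑ (f ∘ suc)

  ∑-cong : ∀ {n} {f g : Fin n → ℕ} → (∀ i → f i ≡ g i) → ∑ f ≡ ∑ g
  ∑-cong {zero}  h = refl
  ∑-cong {suc n} h = cong₂ _+_ (h zero) (∑-cong (h ∘ suc))

  ∑-mono : ∀ {n} {f g : Fin n → ℕ} → (∀ i → f i ≤ g i) → ∑ f ≤ ∑ g
  ∑-mono {zero}  h = z≤n
  ∑-mono {suc n} h = +-mono-≤ (h zero) (∑-mono (h ∘ suc))

  ∑-+ : ∀ {n} (f g : Fin n → ℕ) → ∑ (λ i → f i + g i) ≡ ∑ f + ∑ g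
  ∑-+ {zero}  f g = refl
  ∑-+ {suc n} f g = trans (cong (f zero + g zero +_) (∑-+ (f ∘ suc) (g ∘ suc)))
                          (+-interchange (f zero) (g zero) _ _)

  ∑-zero : ∀ n → ∑ {n} (λ _ → 0) ≡ 0
  ∑-zero zero    = refl
  ∑-zero (suc n) = ∑-zero n

  ∑-const : ∀ n k → ∑ {n} (λ _ → k) ≡ n * k
  ∑-const zero    k = refl
  ∑-const (suc n) k = cong (k +_) (∑-const n k)

  ∑-≤n : ∀ {n} {f : Fin n → ℕ} → (∀ i → f i ≤ 1) → ∑ f ≤ n
  ∑-≤n {zero}  h = z≤n
  ∑-≤n {suc n} h = +-mono-≤ (h zero) (∑-≤n (h ∘ suc))

  ∑-* : ∀ {n} k (f : Fin n → ℕ) → ∑ (λ i → k * f i) ≡ k * ∑ f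
  ∑-* {zero}  k f = sym (*-zeroʳ k)
  ∑-* {suc n} k f = trans (cong (k * f zero +_) (∑-* k (f ∘ suc)))
                          (sym (*-distribˡ-+ k (f zero) _))

  ∑-swap : ∀ {m n} (f : Fin m → Fin n → ℕ) → ∑ (λ i → ∑ (f i)) ≡ ∑ (λ j → ∑ (λ i → f i j))
  ∑-swap {zero}  {n} f = sym (∑-zero n)
  ∑-swap {suc m} {n} f = trans (cong (∑ (f zero) +_) (∑-swap (f ∘ suc)))
                               (sym (∑-+ (f zero) (λ j → ∑ (λ i → f (suc i) j))))

  ∑-update : ∀ {n} (v : Fin n) (f g : Fin n → ℕ) → (∀ u → u ≢ v → f u ≡ g u) →
             ∑ f + g v ≡ ∑ g + f v
  ∑-update {suc n} zero f g h
    rewrite ∑-cong {f = f ∘ suc} {g ∘ suc} (λ i → h (suc i) λ ()) =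
    trans (+-assoc (f zero) _ _) (trans (+-comm (f zero) _) (cong (_+ f zero) (+-comm _ (g zero))))
  ∑-update {suc n} (suc v) f g h =
    trans (+-assoc (f zero) _ _) (trans (cong₂ _+_ (h zero λ ()) (∑-update v (f ∘ suc) (g ∘ suc) λ u ne → h (suc u) (ne ∘ Fin.suc-injective)))
          (sym (+-assoc (g zero) _ _)))

  ∑-≥ : ∀ {n} (v : Fin n) (f : Fin n → ℕ) → f v ≤ ∑ f
  ∑-≥ {suc n} zero    f = m≤m+n _ _
  ∑-≥ {suc n} (suc v) f = ≤-trans (∑-≥ v (f ∘ suc)) (m≤n+m _ _)

count : ∀ {n} → (Fin n → Bool) → ℕ
count p = ∑ (λ i → b2n (p i))

count≤n : ∀ {n} (p : Fin n → Bool) → count p ≤ n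
count≤n p = ∑-≤n (λ i → b2n≤1 (p i))

-- Lists without repetition

Unique-tail : ∀ {a} {A : Set a} {x : A} {xs} → Unique (x ∷ xs) → Unique xs
Unique-tail (_ ∷ u) = u

Unique-head : ∀ {a} {A : Set a} {x : A} {xs} → Unique (x ∷ xs) → x ∉ xs
Unique-head (h ∷ _) i = All.lookup h i refl

Unique-cons : ∀ {a} {A : Set a} {x : A} {xs} → x ∉ xs → Unique xs → Unique (x ∷ xs)
Unique-cons h u = All.tabulate (λ i e → h (subst (_∈ _) (sym e) i)) ∷ u

Unique-++ : ∀ {a} {A : Set a} {xs ys : List A} → Unique xs → Unique ys →
            (∀ {z} → z ∈ xs → z ∈ ys → ⊥) → Unique (xs ++ ys)
Unique-++ ux uy d = Unique.++⁺ ux uy (λ (i , j) → d i j)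

Unique-⊆-length : ∀ {a} {A : Set a} (xs : List A) {ys : List A} → Unique xs →
                  (∀ {z} → z ∈ xs → z ∈ ys) → length xs ≤ length ys
Unique-⊆-length []       u s = z≤n
Unique-⊆-length (x ∷ xs) {ys} u s with ∈-∃++ (s (here refl))
... | as , bs , refl = begin
  suc (length xs)          ≤⟨ s≤s (Unique-⊆-length xs (Unique-tail u) s′) ⟩
  suc (length (as ++ bs))  ≡⟨ cong suc (length-++ as) ⟩
  suc (length as + length bs) ≡⟨ sym (+-suc _ _) ⟩
  length as + length (x ∷ bs) ≡⟨ sym (length-++ as) ⟩
  length (as ++ x ∷ bs)    ∎
  where
  open ≤-Reasoning
  s′ : ∀ {z} → z ∈ xs → z ∈ as ++ bs
  s′ {z} i with ∈-++⁻ as (s (there i))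
  ... | inj₁ j = ∈-++⁺ˡ j
  ... | inj₂ (here refl) = ⊥-elim (Unique-head u i)
  ... | inj₂ (there j) = ∈-++⁺ʳ as j

Unique-⊂-length : ∀ {a} {A : Set a} (xs : List A) {ys : List A} {v : A} → Unique xs →
                  (∀ {z} → z ∈ xs → z ∈ ys) → v ∈ ys → v ∉ xs → length xs < length ys
Unique-⊂-length xs u s i h = Unique-⊆-length (_ ∷ xs) (Unique-cons h u)
  λ { (here refl) → i ; (there j) → s j }

fresh : ∀ (xs ys : List ℕ) → Unique xs → length ys < length xs → Σ ℕ λ a → a ∈ xs × a ∉ ys
fresh [] ys u ()
fresh (x ∷ xs) ys u lt with Any? x ys
  where
  open import Data.List.Membership.DecPropositional _≟_ renaming (_∈?_ to Any?)
... | no h = x , here refl , h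
... | yes i with ∈-∃++ i
... | as , bs , refl with fresh xs (as ++ bs) (Unique-tail u) lt′
  where
  lt′ : length (as ++ bs) < length xs
  lt′ = s≤s⁻¹ (subst (_< suc (length xs)) (trans (length-++ as) (trans (+-suc _ _) (cong suc (sym (length-++ as))))) lt)
... | a , i₁ , i₂ = a , there i₁ , λ j → case′ (∈-++⁻ as j)
  where
  case′ : a ∈ as ⊎ a ∈ x ∷ bs → ⊥
  case′ (inj₁ j) = i₂ (∈-++⁺ˡ j)
  case′ (inj₂ (here refl)) = Unique-head u i₁
  case′ (inj₂ (there j)) = i₂ (∈-++⁺ʳ as j)

sat : ∀ {n} → (Fin n → Bool) → List (Fin n)
sat p = filterᵇ p (allFin _)

sat-∈ : ∀ {n} {p : Fin n → Bool} {u} → p u ≡ true → u ∈ sat p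
sat-∈ {p = p} {u} e = ∈-filter⁺ (T? ∘ p) (∈-allFin u) (subst T (sym e) _)

T-true : ∀ {b} → T b → b ≡ true
T-true {true} _ = refl

∈-sat : ∀ {n} (p : Fin n → Bool) {u} → u ∈ sat p → p u ≡ true
∈-sat p i = T-true (proj₂ (∈-filter⁻ (T? ∘ p) {xs = allFin _} i))

sat-unique : ∀ {n} (p : Fin n → Bool) → Unique (sat p)
sat-unique p = Unique.filter⁺ (T? ∘ p) (Unique.allFin⁺ _)

opaque
  unfolding ∑

  length-filterᵇ-tabulate : ∀ {n} {A : Set} (p : A → Bool) (f : Fin n → A) →
    length (filterᵇ p (tabulate f)) ≡ count (p ∘ f)
  length-filterᵇ-tabulate {zero}  p f = refl
  length-filterᵇ-tabulate {suc n} p f with p (f zero)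
  ... | true  = cong suc (length-filterᵇ-tabulate p (f ∘ suc))
  ... | false = length-filterᵇ-tabulate p (f ∘ suc)

sat-length : ∀ {n} (p : Fin n → Bool) → length (sat p) ≡ count p
sat-length p = length-filterᵇ-tabulate p id

list≤count : ∀ {n} (p : Fin n → Bool) {xs} → Unique xs → (∀ {u} → u ∈ xs → p u ≡ true) → length xs ≤ count p
list≤count p {xs} u h = subst (length xs ≤_) (sat-length p) (Unique-⊆-length xs u (λ i → sat-∈ {p = p} (h i)))

count≤list : ∀ {n} (p : Fin n → Bool) xs → (∀ u → p u ≡ true → u ∈ xs) → count p ≤ length xs
count≤list p xs h = subst (_≤ length xs) (sat-length p)
  (Unique-⊆-length (sat p) (sat-unique p) (λ {z} i → h z (∈-sat p i)))

Unique-length≤n : ∀ {n} {xs : List (Fin n)} → Unique xs → length xs ≤ n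
Unique-length≤n {n} {xs} u = ≤-trans (list≤count (λ _ → true) u (λ _ → refl)) (count≤n (λ _ → true))

count-two : ∀ {n} (p : Fin n → Bool) → count p ≡ 2 →
  Σ (Fin n) λ x → Σ (Fin n) λ y → x ≢ y × p x ≡ true × p y ≡ true × (∀ u → p u ≡ true → u ≡ x ⊎ u ≡ y)
count-two p e with sat p in eq | sat-length p | sat-unique p
... | [] | l | _ = case (trans l e) of λ ()
... | x ∷ [] | l | _ = case (trans l e) of λ ()
... | x ∷ y ∷ z ∷ _ | l | _ = case (trans l e) of λ ()
... | x ∷ y ∷ [] | _ | (ne ∷ _) ∷ _ =
  x , y , ne , ∈-sat p (subst (x ∈_) (sym eq) (here refl)) , ∈-sat p (subst (y ∈_) (sym eq) (there (here refl))) ,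
  λ u pu → memb (subst (u ∈_) eq (sat-∈ {p = p} pu))
  where
  memb : ∀ {u} → u ∈ x ∷ y ∷ [] → u ≡ x ⊎ u ≡ y
  memb (here e) = inj₁ e
  memb (there (here e)) = inj₂ e

sumL : ∀ {a} {A : Set a} → (A → ℕ) → List A → ℕ
sumL f []       = 0
sumL f (x ∷ xs) = f x + sumL f xs

sumL-mono : ∀ {a} {A : Set a} {f g : A → ℕ} xs → (∀ {x} → x ∈ xs → f x ≤ g x) → sumL f xs ≤ sumL g xs
sumL-mono []       h = z≤n
sumL-mono (x ∷ xs) h = +-mono-≤ (h (here refl)) (sumL-mono xs (h ∘ there))

sumL-+ : ∀ {a} {A : Set a} (f g : A → ℕ) xs → sumL (λ x → f x + g x) xs ≡ sumL f xs + sumL g xs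
sumL-+ f g []       = refl
sumL-+ f g (x ∷ xs) = trans (cong (f x + g x +_) (sumL-+ f g xs)) (+-interchange (f x) (g x) _ _)

sumL-const : ∀ {a} {A : Set a} k (xs : List A) → sumL (λ _ → k) xs ≡ length xs * k
sumL-const k []       = refl
sumL-const k (x ∷ xs) = cong (k +_) (sumL-const k xs)

sumL-∑ : ∀ {a} {A : Set a} {n} (f : A → Fin n → ℕ) xs → sumL (λ x → ∑ (f x)) xs ≡ ∑ (λ i → sumL (λ x → f x i) xs)
sumL-∑ {n = n} f [] = sym (∑-zero n)
sumL-∑ f (x ∷ xs) = trans (cong (∑ (f x) +_) (sumL-∑ f xs)) (sym (∑-+ (f x) _))

sumL-filterᵇ : ∀ {a} {A : Set a} (p : A → Bool) xs → sumL (b2n ∘ p) xs ≡ length (filterᵇ p xs)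
sumL-filterᵇ p [] = refl
sumL-filterᵇ p (x ∷ xs) with p x
... | true  = cong suc (sumL-filterᵇ p xs)
... | false = sumL-filterᵇ p xs

sumL-occurs : ∀ (b : ℕ) (w : ℕ) xs → Unique xs → sumL (λ a → b2n (b ≡ᵇ a) * w) xs ≤ w
sumL-occurs b w [] u = z≤n
sumL-occurs b w (x ∷ xs) u with b ≡ᵇ x in e
... | true  = ≤-reflexive (trans (cong (w + 0 +_) (none xs (λ i → Unique-head u (subst (_∈ xs) (≡ᵇ-true {b} e) i)))) (trans (+-identityʳ _) (+-identityʳ w)))
  where
  none : ∀ xs → b ∉ xs → sumL (λ a → b2n (b ≡ᵇ a) * w) xs ≡ 0
  none [] h = refl
  none (y ∷ ys) h rewrite ≡ᵇ-≢ {b} {y} (λ e → h (here e)) = none ys (h ∘ there)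
... | false = sumL-occurs b w xs (Unique-tail u)

-- Local recolouring

recolour : ∀ {n} → Colouring n → Fin n → ℕ → Colouring n
recolour c v a u = if u == v then a else c u

recolour-at : ∀ {n} (c : Colouring n) v a → recolour c v a v ≡ a
recolour-at c v a rewrite ==-refl v = refl

recolour-off : ∀ {n} (c : Colouring n) {v a u} → u ≢ v → recolour c v a u ≡ c u
recolour-off c ne rewrite ==-false ne = refl

deg : ∀ {n} → Graph n → Fin n → ℕ
deg G v = count (adj G v)

cdeg : ∀ {n} → Graph n → Colouring n → Fin n → ℕ → ℕ
cdeg G c v a = count (λ u → adj G v u ∧ (c u ≡ᵇ a))

Mono : ∀ {n} → Graph n → Colouring n → Fin n → Fin n → Set
Mono G c u w = adj G u w ≡ true × c u ≡ c w

Mono-sym : ∀ {n} (G : Graph n) {c u w} → Mono G c u w → Mono G c w u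
Mono-sym G {u = u} {w} (e , q) = trans (Graph.sym G w u) e , sym q

adj-≢ : ∀ {n} (G : Graph n) {u w} → adj G u w ≡ true → u ≢ w
adj-≢ G {u} e refl = true≢false e (irrefl G u)

-- Monochromatic edges weigh n + 1, plus one for each marked end, so that an optimal colouring minimises the number of
-- monochromatic edges first and their marked ends second.
module Energy {n} (G : Graph n) (L : Fin n → List ℕ) (mk : Fin n → Bool) where

  w : Fin n → Fin n → ℕ
  w u v = (suc n + b2n (mk u)) + b2n (mk v)

  w-sym : ∀ u v → w u v ≡ w v u
  w-sym u v = trans (+-assoc (suc n) _ _) (trans (cong (suc n +_) (+-comm (b2n (mk u)) _)) (sym (+-assoc (suc n) _ _)))

  term : Colouring n → Fin n → ℕ → Fin n → ℕ
  term c v a u = b2n (adj G v u ∧ (c u ≡ᵇ a)) * w v u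

  W : Colouring n → Fin n → ℕ → ℕ
  W c v a = ∑ (term c v a)

  mdeg : Colouring n → Fin n → ℕ → ℕ
  mdeg c v a = count (λ u → adj G v u ∧ (c u ≡ᵇ a) ∧ mk u)

  Φ : Colouring n → ℕ
  Φ c = ∑ (λ v → W c v (c v))

  W-split : ∀ c v a → W c v a ≡ (suc n + b2n (mk v)) * cdeg G c v a + mdeg c v a
  W-split c v a = trans (∑-cong pt) (trans (∑-+ _ _) (cong (_+ mdeg c v a) (∑-* (suc n + b2n (mk v)) _)))
    where
    pt : ∀ u → term c v a u ≡ (suc n + b2n (mk v)) * b2n (adj G v u ∧ (c u ≡ᵇ a)) + b2n (adj G v u ∧ (c u ≡ᵇ a) ∧ mk u)
    pt u with adj G v u | c u ≡ᵇ a
    ... | true  | true  = trans (+-identityʳ _) (cong (_+ b2n (mk u)) (sym (*-identityʳ (suc n + b2n (mk v)))))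
    ... | true  | false = sym (trans (+-identityʳ _) (*-zeroʳ (suc n + b2n (mk v))))
    ... | false | _     = sym (trans (+-identityʳ _) (*-zeroʳ (suc n + b2n (mk v))))

  -- `Φ` counts every monochromatic edge from both of its ends, so the change at `v` enters twice.
  -- The equation is arranged to avoid subtraction.
  Φ-recolour : ∀ c v a → Φ (recolour c v a) + (W c v (c v) + W c v (c v)) ≡ Φ c + (W c v a + W c v a)
  Φ-recolour c v a = goal
    where
    open ≡-Reasoning
    c′ = recolour c v a
    F H t₁ t₂ : Fin n → ℕ
    F u = W c′ u (c′ u)
    H u = W c u (c u)
    t₁ u = term c u (c u) v
    t₂ u = b2n (adj G u v ∧ (a ≡ᵇ c u)) * w u v
    off : ∀ u → u ≢ v → F u + t₁ u ≡ H u + t₂ u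
    off u ne = begin
      F u + t₁ u                     ≡⟨ cong (λ b → W c′ u b + t₁ u) (recolour-off c ne) ⟩
      W c′ u (c u) + t₁ u            ≡⟨ ∑-update v _ _ (λ x nx → cong (λ b → b2n (adj G u x ∧ (b ≡ᵇ c u)) * w u x) (recolour-off c nx)) ⟩
      W c u (c u) + term c′ u (c u) v ≡⟨ cong (λ b → H u + b2n (adj G u v ∧ (b ≡ᵇ c u)) * w u v) (recolour-at c v a) ⟩
      H u + t₂ u                     ∎
    Fv : F v ≡ W c v a
    Fv = trans (cong (W c′ v) (recolour-at c v a)) (∑-cong pt)
      where
      pt : ∀ x → term c′ v a x ≡ term c v a x
      pt x with x Fin.≟ v
      ... | yes refl rewrite irrefl G v = refl
      ... | no ne = refl
    t₁v : t₁ v ≡ 0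
    t₁v rewrite irrefl G v = refl
    t₂v : t₂ v ≡ 0
    t₂v rewrite irrefl G v = refl
    Σt₁ : ∑ t₁ ≡ W c v (c v)
    Σt₁ = ∑-cong λ u → cong₂ (λ p q → b2n p * q) (cong₂ _∧_ (Graph.sym G u v) (≡ᵇ-sym (c v) (c u))) (w-sym u v)
    Σt₂ : ∑ t₂ ≡ W c v a
    Σt₂ = ∑-cong λ u → cong₂ (λ p q → b2n p * q) (cong₂ _∧_ (Graph.sym G u v) (≡ᵇ-sym a (c u))) (w-sym u v)
    tot : Φ c′ + W c v (c v) + (H v + 0) ≡ Φ c + W c v a + (W c v a + 0)
    tot = begin
      Φ c′ + W c v (c v) + (H v + 0)    ≡⟨ cong₂ (λ p q → Φ c′ + p + (H v + q)) (sym Σt₁) (sym t₂v) ⟩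
      Φ c′ + ∑ t₁ + (H v + t₂ v)        ≡⟨ cong (_+ (H v + t₂ v)) (sym (∑-+ F t₁)) ⟩
      ∑ (λ u → F u + t₁ u) + (H v + t₂ v) ≡⟨ ∑-update v _ _ off ⟩
      ∑ (λ u → H u + t₂ u) + (F v + t₁ v) ≡⟨ cong₂ _+_ (∑-+ H t₂) (cong₂ _+_ Fv t₁v) ⟩
      Φ c + ∑ t₂ + (W c v a + 0)        ≡⟨ cong (λ z → Φ c + z + (W c v a + 0)) Σt₂ ⟩
      Φ c + W c v a + (W c v a + 0)     ∎
    goal : Φ c′ + (W c v (c v) + W c v (c v)) ≡ Φ c + (W c v a + W c v a)
    goal = begin
      Φ c′ + (W c v (c v) + W c v (c v))     ≡⟨ sym (+-assoc (Φ c′) _ _) ⟩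
      Φ c′ + W c v (c v) + W c v (c v)       ≡⟨ cong (Φ c′ + W c v (c v) +_) (sym (+-identityʳ _)) ⟩
      Φ c′ + W c v (c v) + (H v + 0)         ≡⟨ tot ⟩
      Φ c + W c v a + (W c v a + 0)          ≡⟨ cong (Φ c + W c v a +_) (+-identityʳ _) ⟩
      Φ c + W c v a + W c v a                ≡⟨ +-assoc (Φ c) _ _ ⟩
      Φ c + (W c v a + W c v a)              ∎

  -- Optimality is global, so a colouring reached by moves of no cost is again optimal and obeys all
  -- local inequalities afresh.
  Good : Colouring n → Set
  Good c = IsLColouring L c × (∀ c′ → IsLColouring L c′ → Φ c ≤ Φ c′)

  recolour-L : ∀ {c v a} → IsLColouring L c → a ∈ L v → IsLColouring L (recolour c v a)
  recolour-L {c} {v} l i u with u Fin.≟ v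
  ... | yes refl = i
  ... | no _ = l u

  good-min : ∀ {c v a} → Good c → a ∈ L v → W c v (c v) ≤ W c v a
  good-min {c} {v} {a} (l , m) i = ≮⇒≥ λ lt → <⇒≱ (lem lt) (m _ (recolour-L {c} {v} {a} l i))
    where
    lem : W c v a < W c v (c v) → Φ (recolour c v a) < Φ c
    lem lt = ≰⇒> λ le → <-irrefl (sym (Φ-recolour c v a)) (begin-strict
      Φ c + (W c v a + W c v a)             <⟨ +-monoʳ-< (Φ c) (+-mono-< lt lt) ⟩
      Φ c + (W c v (c v) + W c v (c v))     ≤⟨ +-monoˡ-≤ _ le ⟩
      Φ (recolour c v a) + (W c v (c v) + W c v (c v)) ∎)
      where open ≤-Reasoning

  good-recolour : ∀ {c v a} → Good c → a ∈ L v → W c v a ≤ W c v (c v) → Good (recolour c v a)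
  good-recolour {c} {v} {a} (l , m) i le = recolour-L l i , λ c′ l′ → ≤-trans lem (m c′ l′)
    where
    lem : Φ (recolour c v a) ≤ Φ c
    lem = +-cancelʳ-≤ (W c v (c v) + W c v (c v)) _ _ (≤-trans (≤-reflexive (Φ-recolour c v a)) (+-monoʳ-≤ (Φ c) (+-mono-≤ le le)))

  exists-good : ∀ c → IsLColouring L c → ¬ ¬ (Σ (Colouring n) Good)
  exists-good c l k = ¬¬-minimal {A = Σ (Colouring n) (IsLColouring L)} (Φ ∘ proj₁) (c , l)
    λ ((c′ , l′) , h) → k (c′ , l′ , λ c″ l″ → h (c″ , l″))

  mdeg≤n : ∀ c v a → mdeg c v a ≤ n
  mdeg≤n c v a = count≤n _

  -- An edge weighs at least `suc n`, while all marked neighbours together contribute at most `n`;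
  -- marks cannot make up for one more monochromatic edge.
  cdeg-min : ∀ {c v a} → Good c → a ∈ L v → cdeg G c v (c v) ≤ cdeg G c v a
  cdeg-min {c} {v} {a} g i = ≮⇒≥ λ lt → <⇒≱ (begin-strict
    W c v a                                ≡⟨ W-split c v a ⟩
    k * cdeg G c v a + mdeg c v a          <⟨ +-monoʳ-< (k * cdeg G c v a) (≤-trans (s≤s (mdeg≤n c v a)) (m≤m+n (suc n) _)) ⟩
    k * cdeg G c v a + k                   ≡⟨ trans (+-comm _ k) (sym (*-suc k _)) ⟩
    k * suc (cdeg G c v a)                 ≤⟨ *-monoʳ-≤ k lt ⟩
    k * cdeg G c v (c v)                   ≤⟨ m≤m+n _ _ ⟩
    k * cdeg G c v (c v) + mdeg c v (c v)  ≡⟨ sym (W-split c v (c v)) ⟩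
    W c v (c v)                            ∎) (good-min {c} {v} {a} g i)
    where
    open ≤-Reasoning
    k = suc n + b2n (mk v)

  mdeg-min : ∀ {c v a} → Good c → a ∈ L v → cdeg G c v (c v) ≡ cdeg G c v a → mdeg c v (c v) ≤ mdeg c v a
  mdeg-min {c} {v} {a} g i e = +-cancelˡ-≤ (k * cdeg G c v (c v)) _ _
    (subst₂ _≤_ (W-split c v (c v)) (trans (W-split c v a) (cong (λ z → k * z + mdeg c v a) (sym e))) (good-min {c} {v} {a} g i))
    where k = suc n + b2n (mk v)

  -- With equally many edges and no marked neighbour on the new side, `W` does not increase.
  good-flip : ∀ {c v a} → Good c → a ∈ L v → cdeg G c v a ≡ cdeg G c v (c v) → mdeg c v a ≡ 0 → Good (recolour c v a)
  good-flip {c} {v} {a} g i e z = good-recolour {c} {v} {a} g i (begin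
    W c v a                                ≡⟨ W-split c v a ⟩
    k * cdeg G c v a + mdeg c v a          ≡⟨ cong₂ (λ x y → k * x + y) e z ⟩
    k * cdeg G c v (c v) + 0               ≤⟨ +-monoʳ-≤ (k * cdeg G c v (c v)) z≤n ⟩
    k * cdeg G c v (c v) + mdeg c v (c v)  ≡⟨ sym (W-split c v (c v)) ⟩
    W c v (c v)                            ∎)
    where
    open ≤-Reasoning
    k = suc n + b2n (mk v)

  -- A neighbour has one colour, which occurs at most once in the list, so the left side counts it
  -- at most once.
  sumL-colours : ∀ (c : Colouring n) v (h : Fin n → ℕ) → Unique (L v) →
    sumL (λ a → ∑ (λ u → b2n (adj G v u ∧ (c u ≡ᵇ a)) * h u)) (L v) ≤ ∑ (λ u → b2n (adj G v u) * h u)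
  sumL-colours c v h uq = ≤-trans (≤-reflexive (sumL-∑ _ (L v))) (∑-mono pt)
    where
    pt : ∀ u → sumL (λ a → b2n (adj G v u ∧ (c u ≡ᵇ a)) * h u) (L v) ≤ b2n (adj G v u) * h u
    pt u with adj G v u
    ... | true  = ≤-trans (sumL-occurs (c u) (h u) (L v) uq) (≤-reflexive (sym (+-identityʳ (h u))))
    ... | false = ≤-trans (≤-reflexive (sumL-const 0 (L v))) (≤-reflexive (*-zeroʳ (length (L v))))

  sumL-cdeg : ∀ (c : Colouring n) v → Unique (L v) → sumL (cdeg G c v) (L v) ≤ deg G v
  sumL-cdeg c v uq = subst₂ _≤_
    (sumL-cong (λ a → ∑-cong (λ u → *-identityʳ _)) (L v)) (∑-cong (λ u → *-identityʳ _)) (sumL-colours c v (λ _ → 1) uq)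
    where
    sumL-cong : ∀ {f g : ℕ → ℕ} → (∀ a → f a ≡ g a) → ∀ xs → sumL f xs ≡ sumL g xs
    sumL-cong h [] = refl
    sumL-cong h (x ∷ xs) = cong₂ _+_ (h x) (sumL-cong h xs)

  -- Averaging: among the available colours, the present one is rarest in the neighbourhood.
  mono-deg-bound : ∀ {c} v → Good c → Unique (L v) → length (L v) * cdeg G c v (c v) ≤ deg G v
  mono-deg-bound {c} v g uq = begin
    length (L v) * cdeg G c v (c v)       ≡⟨ sym (sumL-const _ (L v)) ⟩
    sumL (λ _ → cdeg G c v (c v)) (L v)   ≤⟨ sumL-mono (L v) (λ {a} i → cdeg-min {c} {v} {a} g i) ⟩
    sumL (cdeg G c v) (L v)               ≤⟨ sumL-cdeg c v uq ⟩
    deg G v                               ∎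
    where open ≤-Reasoning

nbr-colour : ∀ {n} (G : Graph n) (c : Colouring n) {v u a} → adj G v u ≡ true → c u ≡ a → (adj G v u ∧ (c u ≡ᵇ a)) ≡ true
nbr-colour G c {u = u} e refl = ∧-intro e (≡ᵇ-refl (c u))

nbr-colour⁻ : ∀ {n} (G : Graph n) (c : Colouring n) {v u a} → (adj G v u ∧ (c u ≡ᵇ a)) ≡ true → adj G v u ≡ true × c u ≡ a
nbr-colour⁻ G c {v} {u} {a} e = proj₁ (∧-true e) , ≡ᵇ-true {c u} {a} (proj₂ (∧-true {adj G v u} e))

-- Recolouring vertices of monochromatic degree two by colours that occur twice in their neighbourhood
module Flipping {n} (G : Graph n) (L : Fin n → List ℕ) (mk : Fin n → Bool)
                (uq : ∀ v → Unique (L v)) (hdeg : ∀ v → deg G v < 3 * length (L v)) where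

  open Energy G L mk public

  m : Colouring n → Fin n → ℕ
  m c v = cdeg G c v (c v)

  -- The free moves: each trades the two monochromatic edges at `v` for two others, and by
  -- `good-flip` it keeps the colouring optimal.
  Flippable : Colouring n → Fin n → ℕ → Set
  Flippable c v a = m c v ≡ 2 × a ∈ L v × a ≢ c v × cdeg G c v a ≡ 2 × mdeg c v a ≡ 0

  flip? : Colouring n → Fin n → ℕ → Bool
  flip? c v a = not (a ≡ᵇ c v) ∧ ((cdeg G c v a ≡ᵇ 2) ∧ (mdeg c v a ≡ᵇ 0))

  flip?-flippable : ∀ {c v a} → m c v ≡ 2 → a ∈ L v → flip? c v a ≡ true → Flippable c v a
  flip?-flippable {c} {v} {a} two i e =
    two , i , (λ q → case trans (sym (proj₁ (∧-true e))) (cong not (trans (cong (_≡ᵇ c v) q) (≡ᵇ-refl (c v)))) of λ ()) ,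
    ≡ᵇ-true (proj₁ (∧-true (proj₂ (∧-true {not (a ≡ᵇ c v)} e)))) ,
    ≡ᵇ-true (proj₂ (∧-true {cdeg G c v a ≡ᵇ 2} (proj₂ (∧-true {not (a ≡ᵇ c v)} e))))

  flippable-flip? : ∀ {c v a} → Flippable c v a → flip? c v a ≡ true
  flippable-flip? {c} {v} {a} (_ , _ , ne , e₁ , e₂) rewrite ≡ᵇ-≢ {a} {c v} ne | e₁ | e₂ = refl

  alts : Colouring n → Fin n → List ℕ
  alts c v = filterᵇ (flip? c v) (L v)

  m≤2 : ∀ {c} v → Good c → m c v ≤ 2
  m≤2 {c} v g = s≤s⁻¹ (*-cancelˡ-< (length (L v)) (m c v) 3 (≤-trans (s≤s (mono-deg-bound v g (uq v)))
    (≤-trans (hdeg v) (≤-reflexive (*-comm 3 (length (L v)))))))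

  cdeg-cong : ∀ {c c′ : Colouring n} {v} a → (∀ u → adj G v u ≡ true → c u ≡ c′ u) → cdeg G c v a ≡ cdeg G c′ v a
  cdeg-cong {c} {c′} {v} a h = ∑-cong pt
    where
    pt : ∀ u → b2n (adj G v u ∧ (c u ≡ᵇ a)) ≡ b2n (adj G v u ∧ (c′ u ≡ᵇ a))
    pt u with adj G v u in e
    ... | true  = cong (λ z → b2n (z ≡ᵇ a)) (h u e)
    ... | false = refl

  mdeg-cong : ∀ {c c′ : Colouring n} {v} a → (∀ u → adj G v u ≡ true → c u ≡ c′ u) → mdeg c v a ≡ mdeg c′ v a
  mdeg-cong {c} {c′} {v} a h = ∑-cong pt
    where
    pt : ∀ u → b2n (adj G v u ∧ (c u ≡ᵇ a) ∧ mk u) ≡ b2n (adj G v u ∧ (c′ u ≡ᵇ a) ∧ mk u)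
    pt u with adj G v u in e
    ... | true  = cong (λ z → b2n ((z ≡ᵇ a) ∧ mk u)) (h u e)
    ... | false = refl

  Flippable-cong : ∀ {c c′ : Colouring n} {v a} → c v ≡ c′ v → (∀ u → adj G v u ≡ true → c u ≡ c′ u) →
                   Flippable c v a → Flippable c′ v a
  Flippable-cong {c} {c′} {v} {a} e h (p , q , r , s , t) =
    trans (sym (trans (cdeg-cong (c v) h) (cong (cdeg G c′ v) e))) p , q , (λ x → r (trans x (sym e))) ,
    trans (sym (cdeg-cong a h)) s , trans (sym (mdeg-cong a h)) t

  flip-good : ∀ {c v a} → Good c → Flippable c v a → Good (recolour c v a)
  flip-good {c} {v} {a} g (p , q , r , s , t) = good-flip {c} {v} {a} g q (trans s (sym p)) t

  Flips : Colouring n → List (Fin n × ℕ) → Set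
  Flips c us = Unique (map proj₁ us) × (∀ {u a} → (u , a) ∈ us → Flippable c u a)
             × (∀ {p q} → p ∈ us → q ∈ us → adj G (proj₁ p) (proj₁ q) ≡ false)

  -- Independence leaves the neighbourhoods of the remaining vertices alone, so the flips can be
  -- made one after another.
  flips : ∀ {c} us → Good c → Flips c us →
    Σ (Colouring n) λ c′ → Good c′ × (∀ u → u ∉ map proj₁ us → c′ u ≡ c u) × (∀ {u a} → (u , a) ∈ us → c′ u ≡ a)
  flips {c} [] g f = c , g , (λ _ _ → refl) , λ ()
  flips {c} ((v , a) ∷ us) g (un , fl , ind)
    with flips {recolour c v a} us (flip-good g (fl (here refl))) (Unique-tail un , fl′ , λ i j → ind (there i) (there j))
    where
    v∉ : v ∉ map proj₁ us
    v∉ = Unique-head un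
    fl′ : ∀ {u b} → (u , b) ∈ us → Flippable (recolour c v a) u b
    fl′ {u} {b} i = Flippable-cong {c} {recolour c v a} (sym (recolour-off c ne)) (λ x e → sym (recolour-off c λ { refl → true≢false e (ind (there i) (here refl)) })) (fl (there i))
      where
      ne : u ≢ v
      ne refl = v∉ (∈-map⁺ proj₁ i)
  ... | c′ , g′ , off , on = c′ , g′ ,
    (λ u h → trans (off u (h ∘ there)) (recolour-off c (λ e → h (here e)))) ,
    λ { (here refl) → trans (off v (Unique-head un)) (recolour-at c v a) ; (there i) → on i }

  ∈-proj₁ : ∀ {us : List (Fin n × ℕ)} {u} → u ∈ map proj₁ us → Σ ℕ λ a → (u , a) ∈ us
  ∈-proj₁ i with ∈-map⁻ proj₁ i
  ... | (_ , a) , j , refl = a , j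

  _∈?V_ : (u : Fin n) (us : List (Fin n)) → Dec (u ∈ us)
  _∈?V_ = DM._∈?_
    where import Data.List.Membership.DecPropositional (Fin._≟_ {n}) as DM

  -- After the flips `z` has one more monochromatic neighbour for each of them, and the colouring is
  -- still optimal, so `m≤2` applies to it.
  attract : ∀ {c z} us → Good c → Flips c us → (∀ {u b} → (u , b) ∈ us → b ≡ c z × adj G z u ≡ true) →
            m c z + length us ≤ 2
  attract {c} {z} us g f h with flips us g f
  ... | c′ , g′ , off , on = begin
    m c z + length us                        ≡⟨ cong₂ _+_ (sym (sat-length p)) (sym (length-map proj₁ us)) ⟩
    length (sat p) + length (map proj₁ us)   ≡⟨ sym (length-++ (sat p)) ⟩
    length (sat p ++ map proj₁ us)           ≤⟨ list≤count p′ (Unique-++ (sat-unique p) (proj₁ f) disj) ok ⟩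
    cdeg G c′ z (c z)                        ≡⟨ cong (cdeg G c′ z) (sym (off z z∉)) ⟩
    m c′ z                                   ≤⟨ m≤2 z g′ ⟩
    2                                        ∎
    where
    open ≤-Reasoning
    p p′ : Fin n → Bool
    p u = adj G z u ∧ (c u ≡ᵇ c z)
    p′ u = adj G z u ∧ (c′ u ≡ᵇ c z)
    colour : ∀ {u} → u ∈ map proj₁ us → c u ≢ c z
    colour i e with ∈-proj₁ i
    ... | a , j with proj₁ (proj₂ (proj₂ (proj₁ (proj₂ f) j)))
    ... | ne = ne (trans (proj₁ (h j)) (sym e))
    z∉ : z ∉ map proj₁ us
    z∉ i = colour i refl
    disj : ∀ {u} → u ∈ sat p → u ∈ map proj₁ us → ⊥
    disj i j = colour j (proj₂ (nbr-colour⁻ G c {z} {_} {c z} (∈-sat p i)))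
    ok : ∀ {u} → u ∈ sat p ++ map proj₁ us → p′ u ≡ true
    ok {u} i with ∈-++⁻ (sat p) i
    ... | inj₁ j = let (e , q) = nbr-colour⁻ G c {z} {u} {c z} (∈-sat p j) in
      nbr-colour G c′ e (trans (off u (disj j)) q)
    ... | inj₂ j with ∈-proj₁ j
    ... | a , k = nbr-colour G c′ (proj₂ (h k)) (trans (on k) (proj₁ (h k)))

  -- After the flips `v` still has its monochromatic neighbours, whereas `a` has lost `length us`
  -- occurrences around `v`; yet `a` must not have become rarer than the colour of `v`.
  repel : ∀ {c v a} us → Good c → Flips c us → a ∈ L v → a ≢ c v →
          (∀ {u b} → (u , b) ∈ us → b ≢ c v × adj G v u ≡ true × c u ≡ a) →
          length us + m c v ≤ cdeg G c v a
  repel {c} {v} {a} us g f a∈ a≢ h with flips us g f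
  ... | c′ , g′ , off , on = begin
    length us + m c v                        ≤⟨ +-monoʳ-≤ (length us) m≤m′ ⟩
    length us + cdeg G c′ v (c v)            ≡⟨ cong (λ b → length us + cdeg G c′ v b) (sym (off v v∉)) ⟩
    length us + m c′ v                       ≤⟨ +-monoʳ-≤ (length us) (cdeg-min {c′} {v} {a} g′ a∈) ⟩
    length us + cdeg G c′ v a                ≡⟨ cong₂ _+_ (sym (length-map proj₁ us)) (sym (sat-length p′)) ⟩
    length (map proj₁ us) + length (sat p′)  ≡⟨ sym (length-++ (map proj₁ us)) ⟩
    length (map proj₁ us ++ sat p′)          ≤⟨ list≤count p (Unique-++ (proj₁ f) (sat-unique p′) disj) ok ⟩
    cdeg G c v a                             ∎
    where
    open ≤-Reasoning
    p p′ : Fin n → Bool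
    p u = adj G v u ∧ (c u ≡ᵇ a)
    p′ u = adj G v u ∧ (c′ u ≡ᵇ a)
    v∉ : v ∉ map proj₁ us
    v∉ i with ∈-proj₁ i
    ... | b , j = adj-≢ G (proj₁ (proj₂ (h j))) refl
    disj : ∀ {u} → u ∈ map proj₁ us → u ∈ sat p′ → ⊥
    disj i j with ∈-proj₁ i
    ... | b , k = proj₁ (proj₂ (proj₂ (proj₁ (proj₂ f) k)))
      (trans (sym (on k)) (trans (proj₂ (nbr-colour⁻ G c′ {v} {_} {a} (∈-sat p′ j))) (sym (proj₂ (proj₂ (h k))))))
    ok : ∀ {u} → u ∈ map proj₁ us ++ sat p′ → p u ≡ true
    ok {u} i with ∈-++⁻ (map proj₁ us) i
    ... | inj₁ j with ∈-proj₁ j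
    ... | b , k = nbr-colour G c (proj₁ (proj₂ (h k))) (proj₂ (proj₂ (h k)))
    ok {u} i | inj₂ j = let (e , q) = nbr-colour⁻ G c′ {v} {u} {a} (∈-sat p′ j) in
      nbr-colour G c e (trans (sym (off u (λ k → disj k j))) q)
    m≤m′ : m c v ≤ cdeg G c′ v (c v)
    m≤m′ = ∑-mono λ u → b2n-mono λ e → let (e₁ , q) = nbr-colour⁻ G c {v} {u} {c v} e in
      nbr-colour G c′ e₁ (trans (off u (λ i → absurd i q)) q)
      where
      absurd : ∀ {u} → u ∈ map proj₁ us → c u ≢ c v
      absurd i q with ∈-proj₁ i
      ... | b , k = a≢ (trans (sym (proj₂ (proj₂ (h k)))) q)

  flip-nbr : ∀ {c v a x} → Good c → Flippable c v a → adj G v x ≡ true → c x ≡ a → m c x ≤ 1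
  flip-nbr {c} {v} {a} {x} g f e q = s≤s⁻¹ (≤-trans (≤-reflexive (+-comm 1 (m c x)))
    (attract {c} {x} ((v , a) ∷ []) g
      ([] ∷ [] , (λ { (here refl) → f }) , λ { (here refl) (here refl) → irrefl G v })
      λ { (here refl) → sym q , trans (Graph.sym G x v) e }))

odds : ∀ {A : Set} → List A → List A
odds (a ∷ b ∷ c ∷ xs) = b ∷ odds (c ∷ xs)
odds _ = []

-- On a path where no two adjacent vertices are unsuitable, `b` or `c` is suitable. The vertex `d`
-- opens the next block and is never picked there, so picked vertices are not adjacent along the
-- path.
thirds : ∀ {A : Set} → (A → Bool) → List A → List A
thirds ok (a ∷ b ∷ c ∷ d ∷ xs) = (if ok b then b else c) ∷ thirds ok (d ∷ xs)
thirds ok _ = []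

data Interior {A : Set} : List A → A → Set where
  at   : ∀ {a b c xs} → Interior (a ∷ b ∷ c ∷ xs) b
  skip : ∀ {a v xs} → Interior xs v → Interior (a ∷ xs) v

Interior-∈ : ∀ {A : Set} {a : A} {xs v} → Interior (a ∷ xs) v → v ∈ xs
Interior-∈ at = here refl
Interior-∈ (skip {xs = _ ∷ _} i) = there (Interior-∈ i)

odds-interior : ∀ {A : Set} (xs : List A) {v} → v ∈ odds xs → Interior xs v
odds-interior (a ∷ b ∷ c ∷ xs) (here refl) = at
odds-interior (a ∷ b ∷ c ∷ xs) (there i) = skip (skip (odds-interior (c ∷ xs) i))

thirds-interior : ∀ {A : Set} ok (xs : List A) {v} → v ∈ thirds ok xs → Interior xs v
thirds-interior ok (a ∷ b ∷ c ∷ d ∷ xs) (here e) with ok b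
... | true  rewrite e = at
... | false rewrite e = skip at
thirds-interior ok (a ∷ b ∷ c ∷ d ∷ xs) (there i) = skip (skip (skip (thirds-interior ok (d ∷ xs) i)))

odds-length : ∀ {A : Set} (xs : List A) → length xs ≤ 2 * length (odds xs) + 2
odds-length [] = z≤n
odds-length (a ∷ []) = s≤s z≤n
odds-length (a ∷ b ∷ []) = ≤-refl
odds-length (a ∷ b ∷ c ∷ xs) = ≤-trans (s≤s (s≤s (odds-length (c ∷ xs))))
  (≤-reflexive (cong (_+ 2) (sym (*-suc 2 (length (odds (c ∷ xs)))))))

thirds-length : ∀ {A : Set} ok (xs : List A) → length xs ≤ 3 * length (thirds ok xs) + 3
thirds-length ok [] = z≤n
thirds-length ok (a ∷ []) = s≤s z≤n
thirds-length ok (a ∷ b ∷ []) = s≤s (s≤s z≤n)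
thirds-length ok (a ∷ b ∷ c ∷ []) = ≤-refl
thirds-length ok (a ∷ b ∷ c ∷ d ∷ xs) = ≤-trans (s≤s (s≤s (s≤s (thirds-length ok (d ∷ xs)))))
  (≤-reflexive (cong (_+ 3) (sym (*-suc 3 (length (thirds ok (d ∷ xs)))))))

lastOf : ∀ {A : Set} → A → List A → A
lastOf x []       = x
lastOf x (y ∷ ys) = lastOf y ys

lastOf-∈ : ∀ {A : Set} (x : A) ys → lastOf x ys ∈ x ∷ ys
lastOf-∈ x []       = here refl
lastOf-∈ x (y ∷ ys) = there (lastOf-∈ y ys)

-- Paths of a monochromatic subgraph of maximum degree two
module Paths {n} (G : Graph n) (c : Colouring n) (h : ∀ v → cdeg G c v (c v) ≤ 2) where

  private
    V = Fin n
    M = Mono G c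
    md : V → ℕ
    md v = cdeg G c v (c v)

  M-list : ∀ {v} xs → Unique xs → (∀ {u} → u ∈ xs → M v u) → length xs ≤ md v
  M-list {v} xs un f = list≤count (λ u → adj G v u ∧ (c u ≡ᵇ c v)) un
    (λ i → let (e , q) = f i in nbr-colour G c e (sym q))

  -- The list w ∷ ws runs from w to an end of its component; p is the vertex before w.
  data Path (p : Maybe V) (w : V) : List V → Set where
    stop : (∀ u → M w u → p ≡ just u) → Path p w []
    next : ∀ {w′ ws} → (∀ u → M w u → p ≡ just u ⊎ u ≡ w′) → M w w′ → Path (just w) w′ ws → Path p w (w′ ∷ ws)

  two-nbrs : ∀ {v x y} → x ≢ y → M v x → M v y → md v ≡ 2
  two-nbrs {v} {x} {y} ne ex ey = ≤-antisym (h v)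
    (M-list (x ∷ y ∷ []) ((ne ∷ []) ∷ [] ∷ []) λ { (here refl) → ex ; (there (here refl)) → ey })

  path-closed : ∀ {p w ws} → Path p w ws → ∀ {z u} → z ∈ w ∷ ws → M z u → u ∈ w ∷ ws ⊎ p ≡ just u
  path-closed (stop f) (here refl) e = inj₂ (f _ e)
  path-closed (next f _ P) (here refl) e with f _ e
  ... | inj₁ q = inj₂ q
  ... | inj₂ refl = inj₁ (there (here refl))
  path-closed (next f e′ P) (there i) e with path-closed P i e
  ... | inj₁ j = inj₁ (there j)
  ... | inj₂ refl = inj₁ (here refl)

  -- Together with `path-back` this expresses that a path is connected: a set closed under
  -- monochromatic edges contains all of it or none.
  path-within : ∀ {p w ws} {S : V → Set} → (∀ {z u} → S z → M z u → S u) → Path p w ws → S w → ∀ {z} → z ∈ w ∷ ws → S z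
  path-within cl P s (here refl) = s
  path-within cl (next f e P) s (there i) = path-within cl P (cl s e) i

  path-back : ∀ {p w ws} {S : V → Set} → (∀ {z u} → S z → M z u → S u) → Path p w ws → ∀ {z} → z ∈ w ∷ ws → S z → S w
  path-back cl P (here refl) s = s
  path-back cl (next f e P) (there i) s = cl (path-back cl P i s) (Mono-sym G e)

  path-end : ∀ {q w ws} → M w q → q ∉ w ∷ ws → Path (just q) w ws → Unique (w ∷ ws) →
             ∀ {z} → z ∈ w ∷ ws → md z ≤ 1 → z ≡ lastOf w ws
  path-end e q∉ (stop f) un (here refl) le = refl
  path-end e q∉ (next f e′ P) un (here refl) le =
    ⊥-elim (<⇒≱ (≤-reflexive (sym (two-nbrs (λ { refl → q∉ (there (here refl)) }) e e′))) le)
  path-end e q∉ (next f e′ P) un (there i) le =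
    path-end (Mono-sym G e′) (Unique-head un) P (Unique-tail un) i le

  path-ends : ∀ {w ws} → Path nothing w ws → Unique (w ∷ ws) → ∀ {z} → z ∈ w ∷ ws → md z ≤ 1 → z ≡ w ⊎ z ≡ lastOf w ws
  path-ends P un (here refl) le = inj₁ refl
  path-ends (next f e′ P) un (there i) le = inj₂ (path-end (Mono-sym G e′) (Unique-head un) P (Unique-tail un) i le)

  path-interior : ∀ {p w ws} → Path p w ws → Unique (w ∷ ws) → ∀ {v} → Interior (w ∷ ws) v → md v ≡ 2
  path-interior (next f e (next f′ e′ P)) un at =
    two-nbrs (λ { refl → Unique-head un (there (here refl)) }) (Mono-sym G e) e′
  path-interior (next f e P) un (skip i) = path-interior P (Unique-tail un) i
  path-interior (stop f) un (skip ())

  -- Consecutive vertices a, b, c: the neighbours of b are a and c.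
  path-nbrs : ∀ {p w w′ ws} → Path p w (w′ ∷ ws) → ∀ {u} → M w′ u → u ≡ w ⊎ (Σ V λ z → Σ (List V) λ zs → ws ≡ z ∷ zs × u ≡ z)
  path-nbrs (next _ _ (stop f)) e with f _ e
  ... | refl = inj₁ refl
  path-nbrs (next _ _ (next {w′ = z} {zs} f _ _)) e with f _ e
  ... | inj₁ refl = inj₁ refl
  ... | inj₂ q = inj₂ (z , zs , refl , q)

  Indep : List V → Set
  Indep xs = ∀ {v w} → v ∈ xs → w ∈ xs → ¬ M v w

  Indep-cons : ∀ {x xs} → (∀ {y} → y ∈ xs → ¬ M x y) → Indep xs → Indep (x ∷ xs)
  Indep-cons f g (here refl) (here refl) (e , _) = adj-≢ G e refl
  Indep-cons f g (here refl) (there j) e = f j e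
  Indep-cons f g (there i) (here refl) e = f i (Mono-sym G e)
  Indep-cons f g (there i) (there j) e = g i j e

  odds-indep : ∀ {p w ws} → Path p w ws → Unique (w ∷ ws) → Indep (odds (w ∷ ws))
  odds-indep (stop _) un ()
  odds-indep (next _ _ (stop _)) un ()
  odds-indep {w = a} P@(next {w′ = b} _ _ (next {w′ = d} {ws} _ _ P′)) un =
    Indep-cons far (odds-indep P′ (Unique-tail (Unique-tail un)))
    where
    far : ∀ {y} → y ∈ odds (d ∷ ws) → ¬ M b y
    far i e with path-nbrs P e
    ... | inj₁ refl = Unique-head un (there (there (Interior-∈ (odds-interior (d ∷ ws) i))))
    ... | inj₂ (_ , _ , refl , refl) = Unique-head (Unique-tail (Unique-tail un)) (Interior-∈ (odds-interior (d ∷ ws) i))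

  thirds-indep : ∀ ok {p w ws} → Path p w ws → Unique (w ∷ ws) → Indep (thirds ok (w ∷ ws))
  thirds-indep ok (stop _) un ()
  thirds-indep ok (next _ _ (stop _)) un ()
  thirds-indep ok (next _ _ (next _ _ (stop _))) un ()
  thirds-indep ok {w = a} P@(next {w′ = b} _ _ P₁@(next {w′ = d} _ _ (next {w′ = e} {ws} _ _ P′))) un =
    Indep-cons far (thirds-indep ok P′ (Unique-tail (Unique-tail (Unique-tail un))))
    where
    un₁ = Unique-tail un
    un₂ = Unique-tail un₁
    un₃ = Unique-tail un₂
    far : ∀ {y} → y ∈ thirds ok (e ∷ ws) → ¬ M (if ok b then b else d) y
    far {y} i with Interior-∈ (thirds-interior ok (e ∷ ws) i) | ok b
    ... | j | true  = λ mm → case₁ (path-nbrs P mm)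
      where
      case₁ : _ → ⊥
      case₁ (inj₁ refl) = Unique-head un (there (there (there j)))
      case₁ (inj₂ (_ , _ , refl , refl)) = Unique-head un₂ (there j)
    ... | j | false = λ mm → case₂ (path-nbrs P₁ mm)
      where
      case₂ : _ → ⊥
      case₂ (inj₁ refl) = Unique-head un₁ (there (there j))
      case₂ (inj₂ (_ , _ , refl , refl)) = Unique-head un₃ j

  private
    M? : ∀ v u → Dec (M v u)
    M? v u = (adj G v u Bool.≟ true) ×-dec (c v ≟ c u)

    Prev : Maybe V → V → List V → Set
    Prev p w acc = (p ≡ nothing × md w ≤ 1) ⊎ Σ V λ q → p ≡ just q × q ∈ acc × M w q

    -- The predecessor uses one of at most two places, and a first vertex has only one place; either
    -- way `u` is the only neighbour ahead.
    one-more : ∀ {p w acc u} → Prev p w acc → M w u → p ≢ just u → ∀ x → M w x → p ≡ just x ⊎ x ≡ u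
    one-more {p} {w} {u = u} pr e nq x e′ with Maybe.≡-dec Fin._≟_ p (just x) | x Fin.≟ u
    ... | yes q | _ = inj₁ q
    ... | no _ | yes q = inj₂ q
    ... | no np | no nu with pr
    ... | inj₁ (_ , le) = ⊥-elim (<⇒≱ (≤-reflexive (sym (two-nbrs nu e′ e))) le)
    ... | inj₂ (q , refl , _ , eq) = ⊥-elim (<⇒≱ (M-list (x ∷ u ∷ q ∷ [])
              ((nu ∷ (λ { refl → np refl }) ∷ []) ∷ ((λ { refl → nq refl }) ∷ []) ∷ [] ∷ [])
              λ { (here refl) → e′ ; (there (here refl)) → e ; (there (there (here refl))) → eq }) (h w))

    prev-∈ : ∀ {p w acc x} → Prev p w acc → p ≡ just x → x ∈ acc
    prev-∈ (inj₂ (_ , refl , i , _)) refl = i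

    -- The walk never returns: all monochromatic neighbours of visited vertices are visited, apart
    -- from the last step to `w`. The fuel `k` cannot run out, as visited vertices are distinct.
    build : ∀ k acc p w → n < k + length (w ∷ acc) → Unique (w ∷ acc) →
            (∀ {z u} → z ∈ acc → M z u → u ∈ acc ⊎ (p ≡ just z × u ≡ w)) → Prev p w acc →
            Σ (List V) λ ws → Path p w ws × Unique (w ∷ ws) × (∀ {u} → u ∈ w ∷ ws → u ∉ acc)
    build zero acc p w lt un inv pr = ⊥-elim (<⇒≱ lt (Unique-length≤n un))
    build (suc k) acc p w lt un inv pr with Fin.any? (λ u → _×-dec_ (M? w u) (¬? (Maybe.≡-dec Fin._≟_ p (just u))))
    ... | no none = [] , stop (λ u e → lem u e) , [] ∷ [] , λ { (here refl) → Unique-head un }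
      where
      lem : ∀ u → M w u → p ≡ just u
      lem u e with Maybe.≡-dec Fin._≟_ p (just u)
      ... | yes q = q
      ... | no nq = ⊥-elim (none (u , e , nq))
    ... | yes (u , e , nq) with build k (w ∷ acc) (just w) u
            (subst (n <_) (sym (+-suc k _)) lt) (Unique-cons u∉ un) inv′ (inj₂ (w , refl , here refl , Mono-sym G e))
      where
      others = one-more pr e nq
      u∉ : u ∉ w ∷ acc
      u∉ (here refl) = adj-≢ G (proj₁ e) refl
      u∉ (there i) with inv i (Mono-sym G e)
      ... | inj₁ j = Unique-head un j
      ... | inj₂ (q , _) = nq q
      inv′ : ∀ {z x} → z ∈ w ∷ acc → M z x → x ∈ w ∷ acc ⊎ (just w ≡ just z × x ≡ u)
      inv′ (here refl) e′ with others _ e′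
      ... | inj₂ q = inj₂ (refl , q)
      ... | inj₁ q = inj₁ (there (prev-∈ pr q))
      inv′ (there i) e′ with inv i e′
      ... | inj₁ j = inj₁ (there j)
      ... | inj₂ (_ , refl) = inj₁ (here refl)
    ... | ws , P , un′ , dis = u ∷ ws , next others e P ,
        Unique-cons (λ i → dis i (here refl)) un′ , λ { (here refl) → Unique-head un ; (there i) j → dis i (there j) }
      where others = one-more pr e nq

  path-from : ∀ w → md w ≤ 1 → Σ (List V) λ ws → Path nothing w ws × Unique (w ∷ ws)
  path-from w le with build n [] nothing w (≤-reflexive (trans (cong suc (sym (+-identityʳ n))) (sym (+-suc n 0)))) ([] ∷ []) (λ ()) (inj₁ (refl , le))
  ... | ws , P , un , _ = ws , P , un

reach-cons : ∀ {n} {G : Graph n} {c u v w} → Mono G c u v → MonoReach G c v w → MonoReach G c u w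
reach-cons e here = step here e
reach-cons e (step r f) = step (reach-cons e r) f

reach-sym : ∀ {n} {G : Graph n} {c u v} → MonoReach G c u v → MonoReach G c v u
reach-sym here = here
reach-sym {G = G} (step r f) = reach-cons (Mono-sym G f) (reach-sym r)

reach-trans : ∀ {n} {G : Graph n} {c u v w} → MonoReach G c u v → MonoReach G c v w → MonoReach G c u w
reach-trans r here = r
reach-trans r (step s f) = step (reach-trans r s) f

reach-within : ∀ {n} {G : Graph n} {c} {S : Fin n → Set} → (∀ {z u} → S z → Mono G c z u → S u) →
               ∀ {u v} → S u → MonoReach G c u v → S v
reach-within cl s here = s
reach-within cl s (step r f) = cl (reach-within cl s r) f

-- Breaking up large monochromatic components by flips.  A stack of planned flips is kept together with the components
-- that they would join; a flip that joins few vertices is carried out and shrinks what an earlier plan would join.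
module Process {n} (G : Graph n) (L : Fin n → List ℕ) (mk : Fin n → Bool)
               (uq : ∀ v → Unique (L v)) (hdeg : ∀ v → deg G v < 3 * length (L v)) where

  open Flipping G L mk uq hdeg public

  V : Set
  V = Fin n

  module _ {c} (g : Good c) where
    open Paths G c (λ v → m≤2 v g) public

  -- The points in which the two clustering theorems differ: the vertices that may be flipped
  -- (`ok`), the component size `N`, the way of choosing vertices on a path, and a number `κ`
  -- bounding how many chosen vertices one plan or one blocked end can obstruct.
  record Spec : Set where
    field
      ok            : V → Bool
      N κ           : ℕ
      1≤N           : 1 ≤ N
      pick          : List V → List V
      pick-interior : ∀ xs {v} → v ∈ pick xs → Interior xs v
      pick-unique   : ∀ {xs} → Unique xs → Unique (pick xs)
      pick-indep    : ∀ {c} (g : Good c) {p w ws} → Path g p w ws → Unique (w ∷ ws) →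
                      ∀ {u v} → u ∈ pick (w ∷ ws) → v ∈ pick (w ∷ ws) → ¬ Mono G c u v
      pick-ok       : ∀ {c v a x ws u} (g : Good c) → Flippable c v a → adj G v x ≡ true → c x ≡ a →
                      Path g nothing x ws → Unique (x ∷ ws) → u ∈ pick (x ∷ ws) → ok u ≡ true
      pick-ok-large : ∀ {c x ws u} (g : Good c) → N < length (x ∷ ws) →
                      Path g nothing x ws → Unique (x ∷ ws) → u ∈ pick (x ∷ ws) → ok u ≡ true
      cycle-ok      : ∀ {c v} → Good c → m c v ≡ 2 → (∀ {u} → Mono G c v u → m c u ≡ 2) →
                      ok v ≡ true ⊎ Σ V λ u → Mono G c v u × ok u ≡ true
      -- The factors of `κ` count obstructions: one plan without blocked ends, one plan with two of
      -- them, and for the root two ends without a plan. Strictness at the root is what makes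
      -- `gain-total` strict.
      gain₁         : ∀ xs → N ≤ length xs → κ * 1 ≤ length (pick xs)
      gain₂         : ∀ xs ys → N ≤ length xs + length ys → κ * 3 ≤ length (pick xs) + length (pick ys)
      gain-large    : ∀ xs → N < length xs → κ * 2 < length (pick xs)

  module Run (S : Spec) where
    open Spec S public

    -- The flip of v to a joins the path components us of its neighbours x and y; further flips may be planned at Ws,
    -- and flips joining an end of a component in Bs are blocked.
    record Entry : Set where
      constructor entry
      field
        v        : V
        a        : ℕ
        x y      : V
        us Ws Bs : List V

    open Entry

    record Parts (c : Colouring n) (us Ws : List V) : Set where
      field
        closed : ∀ {z u} → z ∈ us → Mono G c z u → u ∈ us
        Ws⊆    : ∀ {w} → w ∈ Ws → w ∈ us
        Ws-m   : ∀ {w} → w ∈ Ws → m c w ≡ 2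
        Ws-ok  : ∀ {w} → w ∈ Ws → ok w ≡ true
        Ws-un  : Unique Ws
        Ws-ind : ∀ {u w} → u ∈ Ws → w ∈ Ws → ¬ Mono G c u w

    record EntryOK (c : Colouring n) (e : Entry) : Set where
      field
        flp    : Flippable c (v e) (a e)
        x-adj  : adj G (v e) (x e) ≡ true
        y-adj  : adj G (v e) (y e) ≡ true
        x-col  : c (x e) ≡ a e
        y-col  : c (y e) ≡ a e
        only   : ∀ {u} → adj G (v e) u ≡ true → c u ≡ a e → u ≡ x e ⊎ u ≡ y e
        x-in   : x e ∈ us e
        y-in   : y e ∈ us e
        us-un  : Unique (us e)
        parts  : Parts c (us e) (Ws e)
        -- An end may be missing from `Bs` only if it is `x` or `y` and has a monochromatic
        -- neighbour: this flip and a second, nonadjacent one towards it would give it degree three.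
        ends   : ∀ {z} → z ∈ us e → m c z ≤ 1 →
                 (z ∈ Bs e × (m c z ≡ 1 ⊎ (z ≡ x e ⊎ z ≡ y e))) ⊎ (m c z ≡ 1 × (z ≡ x e ⊎ z ≡ y e))
        gain   : N ≤ length (us e) → κ * suc (length (Bs e)) ≤ length (Ws e)
      open Parts parts public

    isolated : ∀ {c} → Good c → ∀ {z} → m c z ≤ 1 → m c z ≢ 1 → ∀ {u} → Mono G c z u → ⊥
    isolated g {z} le ne e = ne (≤-antisym le (M-list g (_ ∷ []) ([] ∷ []) λ { (here refl) → e }))

    path-parts : ∀ {c} (g : Good c) {w ws} → Path g nothing w ws → Unique (w ∷ ws) →
                 (∀ {u} → u ∈ pick (w ∷ ws) → ok u ≡ true) → Parts c (w ∷ ws) (pick (w ∷ ws))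
    path-parts g P un oks = record
      { closed = λ i e → case path-closed g P i e of λ { (inj₁ j) → j }
      ; Ws⊆    = λ i → there (Interior-∈ (pick-interior _ i))
      ; Ws-m   = λ i → path-interior g P un (pick-interior _ i)
      ; Ws-ok  = oks
      ; Ws-un  = pick-unique un
      ; Ws-ind = pick-indep g P un
      }

    -- Says, as an induction principle, that `us` is no larger than the union of the components of
    -- `x` and `y`.
    Within : Colouring n → Entry → Set₁
    Within c e = ∀ {P : V → Set} → (∀ {z u} → P z → Mono G c z u → P u) → P (x e) → P (y e) → ∀ {z} → z ∈ us e → P z

    record Attached (c : Colouring n) (v : V) (a : ℕ) : Set₁ where
      constructor attached
      field
        x y      : V
        us Ws Bs : List V
        okay     : EntryOK c (entry v a x y us Ws Bs)
        within   : Within c (entry v a x y us Ws Bs)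

    module _ {c v a} (g : Good c) (f : Flippable c v a)
             {x y} (x≢y : x ≢ y) (xa : adj G v x ≡ true) (xc : c x ≡ a) (ya : adj G v y ≡ true) (yc : c y ≡ a)
             (only : ∀ {u} → adj G v u ≡ true → c u ≡ a → u ≡ x ⊎ u ≡ y)
             {xs} (P : Path g nothing x xs) (unx : Unique (x ∷ xs)) where

      private
        PX : Parts c (x ∷ xs) (pick (x ∷ xs))
        PX = path-parts g P unx (pick-ok g f xa xc P unx)
        module PP = Parts PX

      -- By `flip-nbr`, `y` has monochromatic degree at most one, so it is the other end of the path
      -- from `x`. No end is left over to be blocked.
      attach-same : y ∈ x ∷ xs → Attached c v a
      attach-same y∈ = attached x y (x ∷ xs) (pick (x ∷ xs)) [] (record
        { flp = f
        ; x-adj = xa ; y-adj = ya ; x-col = xc ; y-col = yc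
        ; only = only
        ; x-in = here refl ; y-in = y∈ ; us-un = unx
        ; parts = PX
        ; ends = λ i le → inj₂ (one i le , pos i le)
        ; gain = gain₁ (x ∷ xs)
        }) (λ cl px _ i → path-within g cl P px i)
        where
        y-last : y ≡ lastOf x xs
        y-last with path-ends g P unx y∈ (flip-nbr g f ya yc)
        ... | inj₁ e = ⊥-elim (x≢y (sym e))
        ... | inj₂ e = e
        pos : ∀ {z} → z ∈ x ∷ xs → m c z ≤ 1 → z ≡ x ⊎ z ≡ y
        pos i le with path-ends g P unx i le
        ... | inj₁ e = inj₁ e
        ... | inj₂ e = inj₂ (trans e (sym y-last))
        one : ∀ {z} → z ∈ x ∷ xs → m c z ≤ 1 → m c z ≡ 1
        one {z} i le = decidable-stable (m c z ≟ 1) λ ne →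
          let cl : ∀ {t u} → t ≡ z → Mono G c t u → u ≡ z
              cl = λ { refl e → ⊥-elim (isolated g le ne e) }
              x≡z = path-back g cl P i refl
          in x≢y (trans x≡z (sym (path-within g cl P x≡z y∈)))

      module _ {ys} (y∉ : y ∉ x ∷ xs) (Q : Path g nothing y ys) (uny : Unique (y ∷ ys)) where

        private
          PY : Parts c (y ∷ ys) (pick (y ∷ ys))
          PY = path-parts g Q uny (pick-ok g f ya yc Q uny)
          module QQ = Parts PY
          us₂ Ws₂ Bs₂ : List V
          us₂ = (x ∷ xs) ++ (y ∷ ys)
          Ws₂ = pick (x ∷ xs) ++ pick (y ∷ ys)
          Bs₂ = lastOf x xs ∷ lastOf y ys ∷ []

          dis : ∀ {z} → z ∈ x ∷ xs → z ∈ y ∷ ys → ⊥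
          dis i j = y∉ (path-back g PP.closed Q j i)

          ind : ∀ {u w} → u ∈ pick (x ∷ xs) ⊎ u ∈ pick (y ∷ ys) → w ∈ pick (x ∷ xs) ⊎ w ∈ pick (y ∷ ys) → ¬ Mono G c u w
          ind (inj₁ i) (inj₁ j) e = PP.Ws-ind i j e
          ind (inj₁ i) (inj₂ j) e = dis (PP.closed (PP.Ws⊆ i) e) (QQ.Ws⊆ j)
          ind (inj₂ i) (inj₁ j) e = dis (PP.Ws⊆ j) (QQ.closed (QQ.Ws⊆ i) e)
          ind (inj₂ i) (inj₂ j) e = QQ.Ws-ind i j e

          PXY : Parts c us₂ Ws₂
          PXY = record
            { closed = λ i e → case ∈-++⁻ (x ∷ xs) i of λ
                { (inj₁ j) → ∈-++⁺ˡ (PP.closed j e) ; (inj₂ j) → ∈-++⁺ʳ (x ∷ xs) (QQ.closed j e) }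
            ; Ws⊆ = λ i → case ∈-++⁻ (pick (x ∷ xs)) i of λ
                { (inj₁ j) → ∈-++⁺ˡ (PP.Ws⊆ j) ; (inj₂ j) → ∈-++⁺ʳ (x ∷ xs) (QQ.Ws⊆ j) }
            ; Ws-m = λ i → case ∈-++⁻ (pick (x ∷ xs)) i of λ { (inj₁ j) → PP.Ws-m j ; (inj₂ j) → QQ.Ws-m j }
            ; Ws-ok = λ i → case ∈-++⁻ (pick (x ∷ xs)) i of λ { (inj₁ j) → PP.Ws-ok j ; (inj₂ j) → QQ.Ws-ok j }
            ; Ws-un = Unique-++ PP.Ws-un QQ.Ws-un (λ i j → dis (PP.Ws⊆ i) (QQ.Ws⊆ j))
            ; Ws-ind = λ i j → ind (∈-++⁻ (pick (x ∷ xs)) i) (∈-++⁻ (pick (x ∷ xs)) j)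
            }

          end : ∀ {w ws} → Path g nothing w ws → Unique (w ∷ ws) → w ≡ x ⊎ w ≡ y →
                lastOf w ws ∈ Bs₂ → ∀ {z} → z ∈ w ∷ ws → m c z ≤ 1 →
                (z ∈ Bs₂ × (m c z ≡ 1 ⊎ (z ≡ x ⊎ z ≡ y))) ⊎ (m c z ≡ 1 × (z ≡ x ⊎ z ≡ y))
          end {w} {ws} R un side l∈ {z} i le = go (m c z ≟ 1) (path-ends g R un i le)
            where
            go : Dec (m c z ≡ 1) → z ≡ w ⊎ z ≡ lastOf w ws →
                 (z ∈ Bs₂ × (m c z ≡ 1 ⊎ (z ≡ x ⊎ z ≡ y))) ⊎ (m c z ≡ 1 × (z ≡ x ⊎ z ≡ y))
            go (yes e) (inj₁ q) = inj₂ (e , subst (λ t → t ≡ x ⊎ t ≡ y) (sym q) side)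
            go (yes e) (inj₂ q) = inj₁ (subst (_∈ Bs₂) (sym q) l∈ , inj₁ e)
            -- An end of degree zero is a component by itself, hence both the first and the last
            -- vertex of its path.
            go (no ne) _ = inj₁ (subst (_∈ Bs₂) last≡z l∈ , inj₂ (subst (λ t → t ≡ x ⊎ t ≡ y) w≡z side))
              where
              cl : ∀ {t u} → t ≡ z → Mono G c t u → u ≡ z
              cl refl e = ⊥-elim (isolated g le ne e)
              w≡z : w ≡ z
              w≡z = path-back g cl R i refl
              last≡z : lastOf w ws ≡ z
              last≡z = path-within g cl R w≡z (lastOf-∈ w ws)

        attach-two : Attached c v a
        attach-two = attached x y us₂ Ws₂ Bs₂ (record
          { flp = f
          ; x-adj = xa ; y-adj = ya ; x-col = xc ; y-col = yc
          ; only = only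
          ; x-in = here refl ; y-in = ∈-++⁺ʳ (x ∷ xs) (here refl) ; us-un = Unique-++ unx uny dis
          ; parts = PXY
          ; ends = λ i le → case ∈-++⁻ (x ∷ xs) i of λ
              { (inj₁ j) → end P unx (inj₁ refl) (here refl) j le ; (inj₂ j) → end Q uny (inj₂ refl) (there (here refl)) j le }
          ; gain = λ le → ≤-trans (gain₂ (x ∷ xs) (y ∷ ys) (subst (N ≤_) (length-++ (x ∷ xs)) le))
                                  (≤-reflexive (sym (length-++ (pick (x ∷ xs)))))
          }) (λ cl px py i → case ∈-++⁻ (x ∷ xs) i of λ
            { (inj₁ j) → path-within g cl P px j ; (inj₂ j) → path-within g cl Q py j })

    attach : ∀ {c v a} → Good c → Flippable c v a → Attached c v a
    attach {c} {v} {a} g f = go (count-two _ (proj₁ (proj₂ (proj₂ (proj₂ f)))))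
      where
      go : (Σ V λ x → Σ V λ y → x ≢ y × (adj G v x ∧ (c x ≡ᵇ a)) ≡ true × (adj G v y ∧ (c y ≡ᵇ a)) ≡ true ×
             (∀ u → (adj G v u ∧ (c u ≡ᵇ a)) ≡ true → u ≡ x ⊎ u ≡ y)) → Attached c v a
      go (x , y , x≢y , ex , ey , on) = go₁ (path-from g x (flip-nbr g f xa xc)) (path-from g y (flip-nbr g f ya yc))
        where
        xa = proj₁ (nbr-colour⁻ G c {v} {x} ex)
        xc = proj₂ (nbr-colour⁻ G c {v} {x} ex)
        ya = proj₁ (nbr-colour⁻ G c {v} {y} ey)
        yc = proj₂ (nbr-colour⁻ G c {v} {y} ey)
        only : ∀ {u} → adj G v u ≡ true → c u ≡ a → u ≡ x ⊎ u ≡ y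
        only e q = on _ (nbr-colour G c e q)
        go₁ : (Σ (List V) λ ws → Path g nothing x ws × Unique (x ∷ ws)) →
              (Σ (List V) λ ws → Path g nothing y ws × Unique (y ∷ ws)) → Attached c v a
        go₁ (xs , P , unx) (ys , Q , uny) with y ∈?V (x ∷ xs)
        ... | yes y∈ = attach-same g f x≢y xa xc ya yc only P unx y∈
        ... | no y∉  = attach-two g f x≢y xa xc ya yc only P unx y∉ Q uny

module Search {n} (G : Graph n) (L : Fin n → List ℕ) (mk : Fin n → Bool)
              (uq : ∀ v → Unique (L v)) (hdeg : ∀ v → deg G v < 3 * length (L v))
              (S : Process.Spec G L mk uq hdeg) where

  open Process G L mk uq hdeg
  open Run S public
  open Entry

  Small : Colouring n → V → Set
  Small c u = ∀ ws → Unique ws → All (MonoReach G c u) ws → length ws ≤ N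

  -- The component of the root is to be broken; it stays unchanged until one of its vertices in W₀ is flipped.
  module Rooted (us₀ W₀ B₀ : List V) (κB₀<W₀ : κ * length B₀ < length W₀) (B : List V) where

    seen Wl Bl Jl : List Entry → List V
    seen []      = us₀
    seen (e ∷ σ) = us e ++ seen σ
    Wl []      = W₀
    Wl (e ∷ σ) = Ws e ++ Wl σ
    Bl []      = B₀
    Bl (e ∷ σ) = Bs e ++ Bl σ
    Jl = map v

    -- `B` bounds the vertices in components that are still too large. It is the measure of the
    -- outer induction, and the flips that are carried out keep it valid.
    Cover : Colouring n → Set
    Cover c = ∀ u → ¬ Small c u → u ∈ B

    NoConflict : V → ℕ → List Entry → Set
    NoConflict u b σ = ∀ {h} → h ∈ σ → adj G (v h) u ≡ true → a h ≢ b

    record Cand (c : Colouring n) (e : Entry) (σ : List Entry) : Set where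
      field
        okay  : EntryOK c e
        v∈    : v e ∈ Wl σ
        v∉    : v e ∉ Jl σ
        apart : ∀ {z} → z ∈ us e → z ∉ seen σ
        free  : NoConflict (v e) (a e) σ
      open EntryOK okay public

    record RootOK (c : Colouring n) : Set where
      field
        parts : Parts c us₀ W₀
        ends  : ∀ {z} → z ∈ us₀ → m c z ≤ 1 → z ∈ B₀ × m c z ≡ 1
      open Parts parts public

    Valid : Colouring n → List Entry → Set
    Valid c []      = RootOK c
    Valid c (e ∷ σ) = Valid c σ × Cand c e σ × N ≤ length (us e)

    record State (c : Colouring n) : Set where
      constructor state
      field
        good  : Good c
        cover : Cover c

    -- The continuation kept with a planned flip: once a flip inside `us e` has been made, the same
    -- plan would join strictly fewer vertices, and the search resumes with it above the older
    -- plans.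
    Handler : Entry → List Entry → Set
    Handler e σ = ∀ c e′ → State c → Valid c σ → Cand c e′ σ → v e′ ≡ v e → a e′ ≡ a e → length (us e′) < length (us e) → ⊥

    Handlers : List Entry → Set
    Handlers []      = ∀ c u → State c → u ∈ W₀ → Small c u → ⊥
    Handlers (e ∷ σ) = Handler e σ × Handlers σ

    root-ok : ∀ {c} σ → Valid c σ → RootOK c
    root-ok [] val = val
    root-ok (e ∷ σ) (val , _) = root-ok σ val

    seen-closed : ∀ {c} σ → Valid c σ → ∀ {z u} → z ∈ seen σ → Mono G c z u → u ∈ seen σ
    seen-closed [] r i e = RootOK.closed r i e
    seen-closed (f ∷ σ) (val , cd , _) i e with ∈-++⁻ (us f) i
    ... | inj₁ j = ∈-++⁺ˡ (Cand.closed cd j e)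
    ... | inj₂ j = ∈-++⁺ʳ (us f) (seen-closed σ val j e)

    W-seen : ∀ {c} σ → Valid c σ → ∀ {w} → w ∈ Wl σ → w ∈ seen σ
    W-seen [] r i = RootOK.Ws⊆ r i
    W-seen (f ∷ σ) (val , cd , _) i with ∈-++⁻ (Ws f) i
    ... | inj₁ j = ∈-++⁺ˡ (Cand.Ws⊆ cd j)
    ... | inj₂ j = ∈-++⁺ʳ (us f) (W-seen σ val j)

    W-facts : ∀ {c} σ → Valid c σ → ∀ {w} → w ∈ Wl σ → m c w ≡ 2 × ok w ≡ true
    W-facts [] r i = RootOK.Ws-m r i , RootOK.Ws-ok r i
    W-facts (f ∷ σ) (val , cd , _) i with ∈-++⁻ (Ws f) i
    ... | inj₁ j = Cand.Ws-m cd j , Cand.Ws-ok cd j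
    ... | inj₂ j = W-facts σ val j

    W-unique : ∀ {c} σ → Valid c σ → Unique (Wl σ)
    W-unique [] r = RootOK.Ws-un r
    W-unique (f ∷ σ) (val , cd , _) = Unique-++ (Cand.Ws-un cd) (W-unique σ val)
      (λ i j → Cand.apart cd (Cand.Ws⊆ cd i) (W-seen σ val j))

    W-indep : ∀ {c} σ → Valid c σ → ∀ {u w} → u ∈ Wl σ → w ∈ Wl σ → ¬ Mono G c u w
    W-indep [] r i j = RootOK.Ws-ind r i j
    W-indep (f ∷ σ) (val , cd , _) i j e with ∈-++⁻ (Ws f) i | ∈-++⁻ (Ws f) j
    ... | inj₁ i′ | inj₁ j′ = Cand.Ws-ind cd i′ j′ e
    ... | inj₁ i′ | inj₂ j′ = Cand.apart cd (Cand.closed cd (Cand.Ws⊆ cd i′) e) (W-seen σ val j′)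
    ... | inj₂ i′ | inj₁ j′ = Cand.apart cd (Cand.Ws⊆ cd j′) (seen-closed σ val (W-seen σ val i′) e)
    ... | inj₂ i′ | inj₂ j′ = W-indep σ val i′ j′ e

    J⊆W : ∀ {c} σ → Valid c σ → ∀ {h} → h ∈ σ → v h ∈ Wl σ
    J⊆W (f ∷ σ) (val , cd , _) (here refl) = ∈-++⁺ʳ (Ws f) (Cand.v∈ cd)
    J⊆W (f ∷ σ) (val , cd , _) (there i) = ∈-++⁺ʳ (Ws f) (J⊆W σ val i)

    J-unique : ∀ {c} σ → Valid c σ → Unique (Jl σ)
    J-unique [] r = []
    J-unique (f ∷ σ) (val , cd , _) = Unique-cons (Cand.v∉ cd) (J-unique σ val)

    J-okay : ∀ {c} σ → Valid c σ → ∀ {h} → h ∈ σ → EntryOK c h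
    J-okay (f ∷ σ) (val , cd , _) (here refl) = Cand.okay cd
    J-okay (f ∷ σ) (val , cd , _) (there i) = J-okay σ val i

    J-free : ∀ {c} σ → Valid c σ → ∀ {h k} → h ∈ σ → k ∈ σ → adj G (v h) (v k) ≡ true → a h ≢ a k
    J-free (f ∷ σ) (val , cd , _) (here refl) (here refl) e = ⊥-elim (adj-≢ G e refl)
    J-free (f ∷ σ) (val , cd , _) (here refl) (there j) e q = Cand.free cd j (trans (Graph.sym G _ _) e) (sym q)
    J-free (f ∷ σ) (val , cd , _) (there i) (here refl) e = Cand.free cd i e
    J-free (f ∷ σ) (val , cd , _) (there i) (there j) e = J-free σ val i j e

    -- The plans and blocked ends, at `κ` vertices each, are too few to obstruct all chosen
    -- vertices.
    gain-total : ∀ {c} σ → Valid c σ → κ * (length σ + length (Bl σ)) < length (Wl σ)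
    gain-total [] r = κB₀<W₀
    gain-total (f ∷ σ) (val , cd , big) = begin-strict
      κ * (suc (length σ) + length (Bs f ++ Bl σ))              ≡⟨ cong (λ t → κ * (suc (length σ) + t)) (length-++ (Bs f)) ⟩
      κ * (suc (length σ) + (length (Bs f) + length (Bl σ)))    ≡⟨ cong (κ *_) (+-interchange 1 (length σ) (length (Bs f)) (length (Bl σ))) ⟩
      κ * (suc (length (Bs f)) + (length σ + length (Bl σ)))    ≡⟨ *-distribˡ-+ κ (suc (length (Bs f))) _ ⟩
      κ * suc (length (Bs f)) + κ * (length σ + length (Bl σ))  <⟨ +-mono-≤-< (Cand.gain cd big) (gain-total σ val) ⟩
      length (Ws f) + length (Wl σ)                             ≡⟨ sym (length-++ (Ws f)) ⟩
      length (Ws f ++ Wl σ)                                     ∎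
      where open ≤-Reasoning

    module Flip {c e} (g : Good c) (okay : EntryOK c e) where

      open EntryOK okay
      private
        c′ : Colouring n
        c′ = recolour c (v e) (a e)

      v-m : m c (v e) ≡ 2
      v-m = proj₁ flp

      Same : ℕ → V → Set
      Same b z = ∀ {u} → adj G z u ≡ true → (c u ≡ b → c′ u ≡ b) × (c′ u ≡ b → c u ≡ b)

      same : ∀ {b z} → (adj G z (v e) ≡ true → c (v e) ≢ b) → (adj G z (v e) ≡ true → a e ≢ b) → Same b z
      same {b} {z} h₁ h₂ {u} ea = go (u Fin.≟ v e)
        where
        go : Dec (u ≡ v e) → (c u ≡ b → c′ u ≡ b) × (c′ u ≡ b → c u ≡ b)
        go (yes refl) = (λ q → ⊥-elim (h₁ ea q)) , λ q → ⊥-elim (h₂ ea (trans (sym (recolour-at c (v e) (a e))) q))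
        go (no ne) = trans (recolour-off c ne) , trans (sym (recolour-off c ne))

      same-cdeg : ∀ {b z} → Same b z → cdeg G c z b ≡ cdeg G c′ z b
      same-cdeg {b} {z} s = ≤-antisym
        (∑-mono λ u → b2n-mono λ t → let (ea , q) = nbr-colour⁻ G c {z} {u} {b} t in nbr-colour G c′ ea (proj₁ (s ea) q))
        (∑-mono λ u → b2n-mono λ t → let (ea , q) = nbr-colour⁻ G c′ {z} {u} {b} t in nbr-colour G c ea (proj₂ (s ea) q))

      same-mdeg : ∀ {b z} → Same b z → mdeg c z b ≡ 0 → mdeg c′ z b ≡ 0
      same-mdeg {b} {z} s zero′ = n≤0⇒n≡0 (≤-trans (∑-mono λ u → b2n-mono λ t →
        let (ea , q) = ∧-true {adj G z u} t
            (ec , mku) = ∧-true {c′ u ≡ᵇ b} q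
        in ∧-intro ea (∧-intro (proj₂ (∧-true (nbr-colour G c {z} {u} {b} ea (proj₂ (s ea) (≡ᵇ-true {c′ u} {b} ec))))) mku))
        (≤-reflexive zero′))

      record Still (z : V) : Set where
        constructor still
        field
          col  : c′ z ≡ c z
          near : Same (c z) z

      still-m : ∀ {z} → Still z → m c z ≡ m c′ z
      still-m {z} (still q s) = trans (same-cdeg s) (cong (cdeg G c′ z) (sym q))

      still-mono : ∀ {z u} → Still z → Mono G c′ z u → Mono G c z u
      still-mono (still q s) (ea , eq) = ea , sym (proj₂ (s ea) (trans (sym eq) q))

      outside : ∀ {z} → z ≢ v e → ¬ Mono G c z (v e) → z ∉ us e → Still z
      outside {z} ne nm z∉ = still (recolour-off c ne) (same (λ ea q → nm (ea , sym q)) h₂)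
        where
        h₂ : adj G z (v e) ≡ true → a e ≢ c z
        h₂ ea q with only (trans (Graph.sym G _ _) ea) (sym q)
        ... | inj₁ refl = z∉ x-in
        ... | inj₂ refl = z∉ y-in

      parts-still : ∀ {us Ws} → (∀ {z} → z ∈ us → Still z) → Parts c us Ws → Parts c′ us Ws
      parts-still st p = record
        { closed = λ i e′ → P.closed i (still-mono (st i) e′)
        ; Ws⊆ = P.Ws⊆
        ; Ws-m = λ i → trans (sym (still-m (st (P.Ws⊆ i)))) (P.Ws-m i)
        ; Ws-ok = P.Ws-ok
        ; Ws-un = P.Ws-un
        ; Ws-ind = λ i j e′ → P.Ws-ind i j (still-mono (st (P.Ws⊆ i)) e′)
        }
        where module P = Parts p

      flippable-still : ∀ {z b} → Still z → Same b z → Flippable c z b → Flippable c′ z b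
      flippable-still st s (p , q , r , t , w) =
        trans (sym (still-m st)) p , q , (λ eq → r (trans eq (Still.col st))) , trans (sym (same-cdeg s)) t , same-mdeg s w

      entry-still : ∀ {f} → (∀ {z} → z ∈ us f → Still z) → Still (v f) → Same (a f) (v f) → EntryOK c f → EntryOK c′ f
      entry-still {f} st sv sa o = record
        { flp = flippable-still sv sa O.flp
        ; x-adj = O.x-adj ; y-adj = O.y-adj
        ; x-col = trans (Still.col (st O.x-in)) O.x-col
        ; y-col = trans (Still.col (st O.y-in)) O.y-col
        ; only = λ ea q → O.only ea (proj₂ (sa ea) q)
        ; x-in = O.x-in ; y-in = O.y-in ; us-un = O.us-un
        ; parts = parts-still st O.parts
        ; ends = λ i le → subst (λ k → _ × (k ≡ 1 ⊎ _) ⊎ k ≡ 1 × _) (still-m (st i)) (O.ends i (subst (_≤ 1) (sym (still-m (st i))) le))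
        ; gain = O.gain
        }
        where module O = EntryOK o

      -- The conflict condition guarantees that the plans of σ survive the flip.
      plan-still : ∀ {f} → EntryOK c f → (adj G (v f) (v e) ≡ true → a f ≢ a e) → Same (a f) (v f)
      plan-still {f} o nk = same h₁ (λ ea q → nk ea (sym q))
        where
        module O = EntryOK o
        h₁ : adj G (v f) (v e) ≡ true → c (v e) ≢ a f
        h₁ ea q = <⇒≱ (≤-reflexive (sym v-m)) (flip-nbr g O.flp ea q)

      valid-still : ∀ τ → (∀ {z} → z ∈ seen τ → Still z) → NoConflict (v e) (a e) τ → Valid c τ → Valid c′ τ
      valid-still [] st nc r = record
        { parts = parts-still st (RootOK.parts r)
        ; ends = λ i le → subst (λ k → _ × k ≡ 1) (still-m (st i)) (RootOK.ends r i (subst (_≤ 1) (sym (still-m (st i))) le))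
        }
      valid-still (f ∷ τ) st nc (val , cd , big) =
        valid-still τ (st ∘ ∈-++⁺ʳ (us f)) (nc ∘ there) val ,
        record
          { okay = entry-still (st ∘ ∈-++⁺ˡ) (st (∈-++⁺ʳ (us f) (W-seen τ val (Cand.v∈ cd))))
                     (plan-still (Cand.okay cd) (nc (here refl))) (Cand.okay cd)
          ; v∈ = Cand.v∈ cd ; v∉ = Cand.v∉ cd ; apart = Cand.apart cd ; free = Cand.free cd
          } , big

      module _ (v∉ : v e ∉ us e) where

        private
          K : V → Set
          K z = z ≡ v e ⊎ z ∈ us e

          K-closed : ∀ {z u} → K z → Mono G c′ z u → K u
          K-closed {z} {u} k (ea , q) = go k (u Fin.≟ v e)
            where
            go : K z → Dec (u ≡ v e) → K u
            go _ (yes p) = inj₁ p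
            go (inj₁ refl) (no ne) with only ea (trans (sym (recolour-off c ne)) (trans (sym q) (recolour-at c (v e) (a e))))
            ... | inj₁ refl = inj₂ x-in
            ... | inj₂ refl = inj₂ y-in
            go (inj₂ i) (no ne) = inj₂ (closed i (ea , trans (sym (recolour-off c (λ { refl → v∉ i }))) (trans q (recolour-off c ne))))

        flip-small : length (us e) < N → ∀ {u} → K u → Small c′ u
        flip-small lt k ws un rs = ≤-trans (Unique-⊆-length ws {v e ∷ us e} un
          (λ i → conv (reach-within K-closed k (All.lookup rs i)))) lt
          where
          conv : ∀ {z} → K z → z ∈ v e ∷ us e
          conv (inj₁ refl) = here refl
          conv (inj₂ i) = there i

        -- Components of the new colouring that meet `v e ∷ us e` stay inside it and so have at most
        -- `N` vertices; every other one lies in an old component.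
        flip-cover : length (us e) < N → Cover c → Cover c′
        flip-cover lt cov u ns = cov u λ sm → ns (go (u Fin.≟ v e) (u ∈?V us e) sm)
          where
          go : Dec (u ≡ v e) → Dec (u ∈ us e) → Small c u → Small c′ u
          go (yes p) _ sm = flip-small lt (inj₁ p)
          go (no _) (yes i) sm = flip-small lt (inj₂ i)
          go (no p) (no q) sm ws un rs = sm ws un (All.map old rs)
            where
            old′ : ∀ {t} → MonoReach G c′ u t → MonoReach G c u t × ¬ K t
            old′ here = here , λ { (inj₁ r) → p r ; (inj₂ r) → q r }
            old′ (step {s} {t} r (ea , eq)) = let (r₁ , nk) = old′ r
                                                  nt : ¬ K t
                                                  nt k = nk (K-closed k (Mono-sym G (ea , eq)))
              in step r₁ (ea , trans (sym (recolour-off c (nk ∘ inj₁))) (trans eq (recolour-off c (nt ∘ inj₁)))) , nt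
            old : ∀ {t} → MonoReach G c′ u t → MonoReach G c u t
            old r = proj₁ (old′ r)

    -- The flipped vertex was chosen in the root or in the component of one plan. Plans above that
    -- one are dropped, plans below it survive unchanged, and the plan itself is renewed with a
    -- smaller component.
    carry-out : ∀ σ {c e} → State c → Valid c σ → Handlers σ → Cand c e σ → length (us e) < N → ⊥
    carry-out [] {c} {e} (state g cov) val hs cd lt =
      hs (recolour c (v e) (a e)) (v e) (state (flip-good g (Cand.flp cd)) (F.flip-cover v∉ lt cov)) (Cand.v∈ cd) (F.flip-small v∉ lt (inj₁ refl))
      where
      module F = Flip g (Cand.okay cd)
      v∉ : v e ∉ us e
      v∉ i = Cand.apart cd i (W-seen [] val (Cand.v∈ cd))
    carry-out (f ∷ τ) {c} {e} st@(state g cov) (val , cf , big) (h , hs) cd lt with ∈-++⁻ (Ws f) (Cand.v∈ cd)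
    ... | inj₂ j = carry-out τ st val hs (record
      { okay = Cand.okay cd ; v∈ = j ; v∉ = Cand.v∉ cd ∘ there
      ; apart = λ i k → Cand.apart cd i (∈-++⁺ʳ (us f) k) ; free = Cand.free cd ∘ there }) lt
    ... | inj₁ j = h c′ f′ (state g′ (F.flip-cover v∉ lt cov)) val′ (record
      { okay = A.okay ; v∈ = Cand.v∈ cf ; v∉ = Cand.v∉ cf
      ; apart = λ i → Cand.apart cf (proj₁ (inside i)) ; free = Cand.free cf }) refl refl
      (Unique-⊂-length (us f′) (EntryOK.us-un A.okay) (proj₁ ∘ inside) v∈f (λ i → proj₂ (inside i) refl))
      where
      module F = Flip g (Cand.okay cd)
      c′ : Colouring n
      c′ = recolour c (v e) (a e)
      g′ : Good c′
      g′ = flip-good g (Cand.flp cd)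
      v∈f : v e ∈ us f
      v∈f = Cand.Ws⊆ cf j
      v∉ : v e ∉ us e
      v∉ i = Cand.apart cd i (∈-++⁺ˡ v∈f)
      still : ∀ {z} → z ∈ seen τ → F.Still z
      still i = F.outside (λ { refl → Cand.apart cf v∈f i }) (λ mm → Cand.apart cf v∈f (seen-closed τ val i mm))
        (λ k → Cand.apart cd k (∈-++⁺ʳ (us f) i))
      val′ : Valid c′ τ
      val′ = F.valid-still τ still (Cand.free cd ∘ there) val
      nk : adj G (v f) (v e) ≡ true → a f ≢ a e
      nk = Cand.free cd (here refl)
      att : Attached c′ (v f) (a f)
      att = attach g′ (F.flippable-still (still (W-seen τ val (Cand.v∈ cf))) (F.plan-still (Cand.okay cf) nk) (Cand.flp cf))
      module A = Attached att
      f′ : Entry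
      f′ = entry (v f) (a f) A.x A.y A.us A.Ws A.Bs
      -- Closed under the new colouring and containing the neighbours that the renewed plan would
      -- join: so that plan stays inside `us f` and no longer reaches `v e`.
      P : V → Set
      P z = z ∈ us f × z ≢ v e
      end-P : ∀ {z} → adj G (v f) z ≡ true → c′ z ≡ a f → P z
      end-P {z} ea q = fin , λ { refl → <⇒≱ (≤-reflexive (sym F.v-m)) (flip-nbr g (Cand.flp cf) ea q₀) }
        where
        q₀ : c z ≡ a f
        q₀ = proj₂ (F.plan-still (Cand.okay cf) nk ea) q
        fin : z ∈ us f
        fin with Cand.only cf ea q₀
        ... | inj₁ refl = Cand.x-in cf
        ... | inj₂ refl = Cand.y-in cf
      P-closed : ∀ {z u} → P z → Mono G c′ z u → P u
      P-closed {z} {u} (i , ne) (ea , q) = go (u Fin.≟ v e)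
        where
        z-col : c′ z ≡ c z
        z-col = recolour-off c ne
        go : Dec (u ≡ v e) → P u
        go (no nu) = Cand.closed cf i (ea , trans (sym z-col) (trans q (recolour-off c nu))) , nu
        go (yes refl) with Cand.only cd (trans (Graph.sym G _ _) ea) (trans (sym z-col) (trans q (recolour-at c (v e) (a e))))
        ... | inj₁ refl = ⊥-elim (Cand.apart cd (Cand.x-in cd) (∈-++⁺ˡ i))
        ... | inj₂ refl = ⊥-elim (Cand.apart cd (Cand.y-in cd) (∈-++⁺ˡ i))
      inside : ∀ {z} → z ∈ us f′ → P z
      inside = A.within P-closed (end-P (EntryOK.x-adj A.okay) (EntryOK.x-col A.okay)) (end-P (EntryOK.y-adj A.okay) (EntryOK.y-col A.okay))

    -- The obligation left to each clustering theorem: some flip of a chosen vertex must reach only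
    -- components that have not been seen.
    Counting : Set
    Counting = ∀ {c} σ → Good c → Valid c σ →
      (∀ w b → w ∈ Wl σ → w ∉ Jl σ → Flippable c w b → NoConflict w b σ →
        (∀ {u} → adj G w u ≡ true → c u ≡ b → u ∉ seen σ) → ⊥) → ⊥

    module _ (counting : Counting) where

      -- Two nested descents. The stack is bounded because planned vertices are distinct; at a fixed
      -- height, `inner` descends on the number of vertices that the top plan would join.
      solve : ∀ k σ {c} → State c → Valid c σ → Handlers σ → n < k + length σ → ⊥
      solve zero σ st val hs lt =
        <⇒≱ lt (subst (_≤ n) (length-map v σ) (Unique-length≤n (J-unique σ val)))
      solve (suc k) σ {c} st val hs lt = counting σ (State.good st) val
        λ w b w∈ w∉ fl nc out →
          let att = attach (State.good st) fl
              module A = Attached att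
              e₀ = entry w b A.x A.y A.us A.Ws A.Bs
              P-closed : ∀ {z u} → z ∉ seen σ → Mono G c z u → u ∉ seen σ
              P-closed ni e i = ni (seen-closed σ val i (Mono-sym G e))
              ok-e = A.okay
          in inner (length A.us) {c} {e₀} st val (record
            { okay = A.okay ; v∈ = w∈ ; v∉ = w∉
            ; apart = A.within P-closed (out (EntryOK.x-adj ok-e) (EntryOK.x-col ok-e)) (out (EntryOK.y-adj ok-e) (EntryOK.y-col ok-e))
            ; free = nc }) ≤-refl
        where
        inner : ∀ s {c e} → State c → Valid c σ → Cand c e σ → length (us e) ≤ s → ⊥
        inner s {c} {e} st val cd le = go (N ≤? length (us e)) s le
          where
          go : Dec (N ≤ length (us e)) → ∀ s → length (us e) ≤ s → ⊥
          go (no small) _ _ = carry-out σ st val hs cd (≰⇒> small)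
          go (yes big) zero le = solve k (e ∷ σ) st (val , cd , big)
            ((λ _ _ _ _ _ _ _ lt′ → <⇒≱ (≤-trans lt′ le) z≤n) , hs) (subst (n <_) (sym (+-suc k _)) lt)
          go (yes big) (suc s) le = solve k (e ∷ σ) st (val , cd , big)
            ((λ c₁ e₁ st₁ val₁ cd₁ _ _ lt′ → inner s {c₁} {e₁} st₁ val₁ cd₁ (s≤s⁻¹ (≤-trans lt′ le))) , hs)
            (subst (n <_) (sym (+-suc k _)) lt)

-- Choosing a root component and breaking all large components

module Clustered {n} (G : Graph n) (L : Fin n → List ℕ) (mk : Fin n → Bool)
                 (uq : ∀ v → Unique (L v)) (hdeg : ∀ v → deg G v < 3 * length (L v))
                 (S : Process.Spec G L mk uq hdeg)
                 (counting : ∀ us₀ W₀ B₀ κB B → Search.Rooted.Counting G L mk uq hdeg S us₀ W₀ B₀ κB B) where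

  open Process G L mk uq hdeg
  open Search G L mk uq hdeg S

  _∖_ : List V → V → List V
  B ∖ u = filter (λ t → ¬? (t Fin.≟ u)) B

  ∖-∈ : ∀ {B u t} → t ∈ B → t ≢ u → t ∈ B ∖ u
  ∖-∈ {u = u} i ne = ∈-filter⁺ (λ t → ¬? (t Fin.≟ u)) i ne

  ∖-length : ∀ {u} B → u ∈ B → length (B ∖ u) < length B
  ∖-length {u} (x ∷ B) i with x Fin.≟ u
  ... | yes _ = s≤s (length-filter (λ t → ¬? (t Fin.≟ u)) B)
    where open import Data.List.Properties using (length-filter)
  ∖-length {u} (x ∷ B) (here refl) | no ne = ⊥-elim (ne refl)
  ∖-length {u} (x ∷ B) (there i) | no ne = s≤s (∖-length B i)

  not-small : ∀ {c u w} → MonoReach G c w u → ¬ Small c u → ¬ Small c w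
  not-small r ns sm = ns λ ws un rs → sm ws un (All.map (reach-trans r) rs)

  Continue : (B : List V) → Set
  Continue B = ∀ c u → Good c → u ∈ B → Small c u → (∀ w → ¬ Small c w → w ∈ B) → ⊥

  module _ {c} (g : Good c) {B} (cov : ∀ w → ¬ Small c w → w ∈ B) {u} (ns : ¬ Small c u) (k : Continue B) where

    root-path : ∀ {z zs} → MonoReach G c u z → Path g nothing z zs → Unique (z ∷ zs) → ⊥
    root-path {z} {zs} r P un = solve (counting us₀ (pick us₀) B₀ big B) (suc n) [] (state g cov) rok
      (λ c′ w st w∈ sm → k c′ w (State.good st) (cov w (not-small (reach (PP.Ws⊆ w∈)) ns)) sm (State.cover st))
      (≤-reflexive (cong suc (sym (+-identityʳ n))))
      where
      us₀ = z ∷ zs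
      B₀ = z ∷ lastOf z zs ∷ []
      closed : ∀ {t w} → t ∈ us₀ → Mono G c t w → w ∈ us₀
      closed i e = case path-closed g P i e of λ { (inj₁ j) → j }
      u∈ : u ∈ us₀
      u∈ = reach-within closed (here refl) (reach-sym r)
      reach : ∀ {t} → t ∈ us₀ → MonoReach G c t u
      reach i = path-within g {S = λ t → MonoReach G c t u} (λ rt e → reach-cons (Mono-sym G e) rt) P (reach-sym r) i
      large : N < length us₀
      large = ≰⇒> λ le → ns λ ws unw rs → ≤-trans (Unique-⊆-length ws unw (λ i → reach-within closed u∈ (All.lookup rs i))) le
      big : κ * 2 < length (pick us₀)
      big = gain-large us₀ large
      open Rooted us₀ (pick us₀) B₀ big B
      PX : Run.Parts S c us₀ (pick us₀)
      PX = path-parts g P un (pick-ok-large g large P un)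
      module PP = Parts PX
      two : 2 ≤ length us₀
      two = ≤-trans (s≤s 1≤N) large
      rok : RootOK c
      rok = record { parts = PX ; ends = λ i le → end i le , one i le }
        where
        end : ∀ {t} → t ∈ us₀ → m c t ≤ 1 → t ∈ B₀
        end i le with path-ends g P un i le
        ... | inj₁ refl = here refl
        ... | inj₂ refl = there (here refl)
        one : ∀ {t} → t ∈ us₀ → m c t ≤ 1 → m c t ≡ 1
        one {t} i le = decidable-stable (m c t ≟ 1) λ ne →
          let cl : ∀ {s w} → s ≡ t → Mono G c s w → w ≡ t
              cl = λ { refl e → ⊥-elim (isolated g le ne e) }
              z≡t = path-back g cl P i refl
          in <⇒≱ two (Unique-⊆-length us₀ {t ∷ []} un λ j → here (path-within g cl P z≡t j))

    -- A cycle has no ends that could block, so `B₀` is empty and one suitable vertex is enough.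
    root-cycle : (∀ w → Dec (MonoReach G c u w)) → (∀ {w} → MonoReach G c u w → m c w ≡ 2) → ⊥
    root-cycle dec two = go (cycle-ok g (two here) (λ e → two (step here e)))
      where
      us₀ = filter dec (allFin n)
      ∈us₀ : ∀ {w} → MonoReach G c u w → w ∈ us₀
      ∈us₀ r = ∈-filter⁺ dec (∈-allFin _) r
      reach : ∀ {w} → w ∈ us₀ → MonoReach G c u w
      reach i = proj₂ (∈-filter⁻ dec {xs = allFin n} i)
      single : ∀ {w} → MonoReach G c u w → ok w ≡ true → ⊥
      single {w} r okw = solve (counting us₀ (w ∷ []) [] big B) (suc n) [] (state g cov) rok
        (λ { c′ t st (here refl) sm → k c′ t (State.good st) (cov t (not-small (reach-sym r) ns)) sm (State.cover st) })
        (≤-reflexive (cong suc (sym (+-identityʳ n))))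
        where
        big : κ * 0 < 1
        big = s≤s (≤-reflexive (*-zeroʳ κ))
        open Rooted us₀ (w ∷ []) [] big B
        rok : RootOK c
        rok = record
          { parts = record
            { closed = λ i e → ∈us₀ (step (reach i) e)
            ; Ws⊆ = λ { (here refl) → ∈us₀ r }
            ; Ws-m = λ { (here refl) → two r }
            ; Ws-ok = λ { (here refl) → okw }
            ; Ws-un = [] ∷ []
            ; Ws-ind = λ { (here refl) (here refl) (e , _) → adj-≢ G e refl }
            }
          ; ends = λ i le → ⊥-elim (<⇒≱ (≤-reflexive (sym (two (reach i)))) le)
          }
      go : ok u ≡ true ⊎ (Σ V λ w → Mono G c u w × ok w ≡ true) → ⊥
      go (inj₁ e) = single here e
      go (inj₂ (w , e , o)) = single (step here e) o

    root : ⊥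
    root = em {P = Σ V λ z → MonoReach G c u z × m c z ≤ 1} λ
      { (yes (z , r , le)) → let (zs , P , un) = path-from g z le in root-path r P un
      ; (no none) → ¬¬-Fin {P = λ w → Dec (MonoReach G c u w)} (λ w → em) λ dec →
          root-cycle dec (λ {w} r → ≤-antisym (m≤2 w g) (≰⇒> λ le → none (w , r , le)))
      }

  -- Each round takes from `B` a vertex whose component has become small; by `flip-cover` none has
  -- to be put back.
  break : ∀ b {c} B → length B ≤ b → Good c → (∀ w → ¬ Small c w → w ∈ B) →
          (∀ c′ → Good c′ → (∀ u → Small c′ u) → ⊥) → ⊥
  break b {c} B le g cov k = ¬¬-Fin {P = Small c} (λ u ns → root g cov ns (cont b le)) (k c g)
    where
    cont : ∀ b → length B ≤ b → Continue B
    cont zero le c′ u g′ u∈ sm cov′ = <⇒≱ (∖-length B u∈) (≤-trans le z≤n)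
    cont (suc b) le c′ u g′ u∈ sm cov′ = break b {c′} (B ∖ u) (s≤s⁻¹ (≤-trans (∖-length B u∈) le)) g′
      (λ w nsw → ∖-∈ (cov′ w nsw) λ { refl → nsw sm }) k

  clustered : ∀ c → IsLColouring L c → ¬ ¬ (Σ (Colouring n) λ c′ → IsLColouring L c′ × HasClustering G c′ N)
  clustered c l k = exists-good c l λ (c₀ , g) → break n (allFin n) (≤-reflexive (length-tabulate id)) g (λ w _ → ∈-allFin w)
    λ c′ g′ all → k (c′ , proj₁ g′ , all)

-- Flips obstructed by ends of components already seen

module Blocking {n} (G : Graph n) (L : Fin n → List ℕ) (mk : Fin n → Bool)
                (uq : ∀ v → Unique (L v)) (hdeg : ∀ v → deg G v < 3 * length (L v))
                (S : Process.Spec G L mk uq hdeg) where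

  open Process G L mk uq hdeg
  open Search G L mk uq hdeg S public

  module At (us₀ W₀ B₀ : List V) (κB₀<W₀ : κ * length B₀ < length W₀) (B : List V) where

    open Rooted us₀ W₀ B₀ κB₀<W₀ B public
    open Entry

    module _ {c} σ (g : Good c) (val : Valid c σ) where

      record Free (w : V) (b : ℕ) : Set where
        constructor isfree
        field
          w∈ : w ∈ Wl σ
          w∉ : w ∉ Jl σ
          fl : Flippable c w b
          nc : NoConflict w b σ

      -- The end z of a seen component is also approached by the plan that reached it, unless z has a neighbour there.
      Anchored : V → Set
      Anchored z = m c z ≡ 1 ⊎ Σ Entry λ f → f ∈ σ × adj G (v f) z ≡ true × c z ≡ a f

      record Blocked (w : V) (b : ℕ) (z : V) : Set where
        constructor blocked
        field
          z∈  : z ∈ Bl σ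
          wz  : adj G w z ≡ true
          col : c z ≡ b
          anc : Anchored z

      apart-adj : ∀ {w b f} → Free w b → f ∈ σ → a f ≡ b → w ≢ v f × adj G w (v f) ≡ false
      apart-adj {w} {b} {f} (isfree _ w∉ fl nc) i q =
        (λ { refl → w∉ (∈-map⁺ v i) }) , not-true λ e → nc i (trans (Graph.sym G _ _) e) q

      plan-flip : ∀ {f} → f ∈ σ → Flippable c (v f) (a f)
      plan-flip i = EntryOK.flp (J-okay σ val i)

      -- Both flips together would give `z` monochromatic degree three.
      no-two : ∀ {w b z f} → Free w b → adj G w z ≡ true → c z ≡ b → f ∈ σ → adj G (v f) z ≡ true → c z ≡ a f → m c z ≡ 1 → ⊥
      no-two {w} {b} {z} {f} fr wz col i fz cf one = <⇒≱ (≤-reflexive (cong (λ t → suc (suc t)) (sym one)))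
        (≤-trans (≤-reflexive (+-comm 2 (m c z))) (attract {c} {z} ((w , b) ∷ (v f , a f) ∷ []) g
          ( (((proj₁ ap) ∷ []) ∷ [] ∷ [])
          , (λ { (here refl) → Free.fl fr ; (there (here refl)) → plan-flip i })
          , λ { (here refl) (here refl) → irrefl G w ; (here refl) (there (here refl)) → proj₂ ap
              ; (there (here refl)) (here refl) → trans (Graph.sym G _ _) (proj₂ ap) ; (there (here refl)) (there (here refl)) → irrefl G (v f) })
          λ { (here refl) → sym col , trans (Graph.sym G _ _) wz ; (there (here refl)) → sym cf , trans (Graph.sym G _ _) fz }))
        where ap = apart-adj fr i (trans (sym cf) col)

      -- A neighbour of the new colour has monochromatic degree at most one, so in a seen component
      -- it is an end; `no-two` excludes the ends that are not listed as blocked.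
      classify : ∀ {w b z} → Free w b → adj G w z ≡ true → c z ≡ b → ∀ τ → (∀ {f} → f ∈ τ → f ∈ σ) → Valid c τ →
                 z ∈ seen τ → z ∈ Bl τ × Anchored z
      classify fr wz col [] sub r i = let (zb , one) = RootOK.ends r i (flip-nbr g (Free.fl fr) wz col) in zb , inj₁ one
      classify {w} {b} {z} fr wz col (f ∷ τ) sub (val′ , cd , _) i with ∈-++⁻ (us f) i
      ... | inj₂ j = let (zb , an) = classify fr wz col τ (sub ∘ there) val′ j in ∈-++⁺ʳ (Bs f) zb , an
      ... | inj₁ j with Cand.ends cd j (flip-nbr g (Free.fl fr) wz col)
      ... | inj₁ (zb , inj₁ one) = ∈-++⁺ˡ zb , inj₁ one
      ... | inj₁ (zb , inj₂ (inj₁ refl)) = ∈-++⁺ˡ zb , inj₂ (f , sub (here refl) , Cand.x-adj cd , Cand.x-col cd)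
      ... | inj₁ (zb , inj₂ (inj₂ refl)) = ∈-++⁺ˡ zb , inj₂ (f , sub (here refl) , Cand.y-adj cd , Cand.y-col cd)
      ... | inj₂ (one , inj₁ refl) = ⊥-elim (no-two fr wz col (sub (here refl)) (Cand.x-adj cd) (Cand.x-col cd) one)
      ... | inj₂ (one , inj₂ refl) = ⊥-elim (no-two fr wz col (sub (here refl)) (Cand.y-adj cd) (Cand.y-col cd) one)

      blocker : (∀ w b → Free w b → (∀ {t} → adj G w t ≡ true → c t ≡ b → t ∉ seen σ) → ⊥) →
                ∀ {w b} → Free w b → Σ V (Blocked w b)
      blocker none {w} {b} fr = go (count-two _ (proj₁ (proj₂ (proj₂ (proj₂ (Free.fl fr))))))
        where
        go : (Σ V λ x → Σ V λ y → x ≢ y × (adj G w x ∧ (c x ≡ᵇ b)) ≡ true × (adj G w y ∧ (c y ≡ᵇ b)) ≡ true ×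
               (∀ u → (adj G w u ∧ (c u ≡ᵇ b)) ≡ true → u ≡ x ⊎ u ≡ y)) → Σ V (Blocked w b)
        go (x , y , _ , ex , ey , on) = go₁ (x ∈?V seen σ) (y ∈?V seen σ)
          where
          nx = nbr-colour⁻ G c {w} {x} ex
          ny = nbr-colour⁻ G c {w} {y} ey
          go₁ : Dec (x ∈ seen σ) → Dec (y ∈ seen σ) → Σ V (Blocked w b)
          go₁ (yes i) _ = let (zb , an) = classify fr (proj₁ nx) (proj₂ nx) σ id val i in x , blocked zb (proj₁ nx) (proj₂ nx) an
          go₁ (no _) (yes i) = let (zb , an) = classify fr (proj₁ ny) (proj₂ ny) σ id val i in y , blocked zb (proj₁ ny) (proj₂ ny) an
          go₁ (no p) (no q) = ⊥-elim (none w b fr λ e ec → out (on _ (nbr-colour G c e ec)))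
            where
            out : ∀ {t} → t ≡ x ⊎ t ≡ y → t ∉ seen σ
            out (inj₁ refl) = p
            out (inj₂ refl) = q

      -- If they were not adjacent, both flips could be made, and with the anchor of `z`, a
      -- neighbour or a plan, they would bring its degree to three. Hence nonadjacent flips to one
      -- colour have different blocking ends.
      clique : ∀ {w w′ b z} → Free w b → Free w′ b → w ≢ w′ → Blocked w b z → Blocked w′ b z → adj G w w′ ≡ true
      clique {w} {w′} {b} {z} fr fr′ ne (blocked _ wz col anc) (blocked _ wz′ _ _) with adj G w w′ in e
      ... | true = refl
      ... | false = ⊥-elim (absurd anc)
        where
        e′ : adj G w′ w ≡ false
        e′ = trans (Graph.sym G _ _) e
        absurd : Anchored z → ⊥
        absurd (inj₁ one) = <⇒≱ (≤-reflexive (cong (λ t → suc (suc t)) (sym one)))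
          (≤-trans (≤-reflexive (+-comm 2 (m c z))) (attract {c} {z} ((w , b) ∷ (w′ , b) ∷ []) g
            ( ((ne ∷ []) ∷ [] ∷ [])
            , (λ { (here refl) → Free.fl fr ; (there (here refl)) → Free.fl fr′ })
            , λ { (here refl) (here refl) → irrefl G w ; (here refl) (there (here refl)) → e
                ; (there (here refl)) (here refl) → e′ ; (there (here refl)) (there (here refl)) → irrefl G w′ })
            λ { (here refl) → sym col , trans (Graph.sym G _ _) wz ; (there (here refl)) → sym col , trans (Graph.sym G _ _) wz′ }))
        absurd (inj₂ (f , i , fz , cf)) = <⇒≱ (s≤s (s≤s (s≤s z≤n))) (≤-trans (m≤n+m 3 (m c z))
          (attract {c} {z} ((w , b) ∷ (w′ , b) ∷ (v f , a f) ∷ []) g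
            ( ((ne ∷ proj₁ ap ∷ []) ∷ (proj₁ ap′ ∷ []) ∷ [] ∷ [])
            , (λ { (here refl) → Free.fl fr ; (there (here refl)) → Free.fl fr′ ; (there (there (here refl))) → plan-flip i })
            , λ { (here refl) (here refl) → irrefl G w ; (here refl) (there (here refl)) → e ; (here refl) (there (there (here refl))) → proj₂ ap
                ; (there (here refl)) (here refl) → e′ ; (there (here refl)) (there (here refl)) → irrefl G w′
                ; (there (here refl)) (there (there (here refl))) → proj₂ ap′
                ; (there (there (here refl))) (here refl) → trans (Graph.sym G _ _) (proj₂ ap)
                ; (there (there (here refl))) (there (here refl)) → trans (Graph.sym G _ _) (proj₂ ap′)
                ; (there (there (here refl))) (there (there (here refl))) → irrefl G (v f) })
            λ { (here refl) → sym col , trans (Graph.sym G _ _) wz ; (there (here refl)) → sym col , trans (Graph.sym G _ _) wz′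
              ; (there (there (here refl))) → sym cf , trans (Graph.sym G _ _) fz }))
          where
          ap  = apart-adj fr i (trans (sym cf) col)
          ap′ = apart-adj fr′ i (trans (sym cf) col)

double<-triple : ∀ {d l} → 2 * d < 5 * l → d < 3 * l
double<-triple {d} {l} lt = *-cancelˡ-< 2 d (3 * l) (≤-trans lt (≤-trans (*-monoˡ-≤ l (m≤m+n 5 1)) (≤-reflexive (*-assoc 2 3 l))))

Unique-map-filter : ∀ {A B : Set} (f : A → B) (p : A → Bool) {xs} → Unique (map f xs) → Unique (map f (filterᵇ p xs))
Unique-map-filter f p un = AP.map⁺ (AP.filter⁺ (T? ∘ p) (AP.map⁻ un))
  where import Data.List.Relation.Unary.AllPairs.Properties as AP

∈-filterᵇ⁻ : ∀ {A : Set} (p : A → Bool) {x} xs → x ∈ filterᵇ p xs → x ∈ xs × p x ≡ true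
∈-filterᵇ⁻ p xs i = let (j , t) = ∈-filter⁻ (T? ∘ p) {xs = xs} i in j , T-true t

∈-filterᵇ⁺ : ∀ {A : Set} (p : A → Bool) {x} {xs} → x ∈ xs → p x ≡ true → x ∈ filterᵇ p xs
∈-filterᵇ⁺ p i e = ∈-filter⁺ (T? ∘ p) i (subst T (sym e) _)

-- A local colouring theorem with clustering nine

module Nine {n} (G : Graph n) (L : Fin n → List ℕ) (uq : ∀ v → Unique (L v)) where

  -- Here the degree condition has no slack, so no alternative colour is guaranteed. Tight vertices
  -- are not flipped, and being marked they make monochromatic edges at them dearer.
  tight : Fin n → Bool
  tight u = 2 * deg G u + 1 ≡ᵇ 5 * length (L u)

  τ : Fin n → ℕ
  τ v = count (λ u → adj G v u ∧ tight u)

  module _ (hB : ∀ v → 2 * deg G v + 2 * τ v + 1 ≤ 5 * length (L v)) where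

    hdeg : ∀ v → deg G v < 3 * length (L v)
    hdeg v = double<-triple {deg G v} {length (L v)} (≤-trans (≤-reflexive (+-comm 1 (2 * deg G v)))
      (≤-trans (+-monoˡ-≤ 1 (m≤m+n (2 * deg G v) (2 * τ v))) (hB v)))

    open Process G L tight uq hdeg

    -- Without tight neighbours the extra unit comes from not being tight; otherwise from
    -- `2 * τ v + 1 ≥ τ v + 2`.
    loose : ∀ {v} → tight v ≡ false → 2 * deg G v + τ v + 2 ≤ 5 * length (L v)
    loose {v} nt with τ v in eq
    ... | zero = ≤-trans (≤-reflexive (lem₀ (2 * deg G v))) (≤∧≢⇒< (≤-trans (≤-reflexive lem₁) (hB v))
          λ e → true≢false (trans (cong (_≡ᵇ 5 * length (L v)) e) (≡ᵇ-refl (5 * length (L v)))) nt)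
      where
      lem₀ : ∀ d → d + 0 + 2 ≡ suc (d + 1)
      lem₀ = solve-∀
      lem₁ : 2 * deg G v + 1 ≡ 2 * deg G v + 2 * τ v + 1
      lem₁ rewrite eq = cong (_+ 1) (sym (+-identityʳ _))
    ... | suc t = ≤-trans (≤-trans (m≤m+n _ t) (≤-reflexive (lem (2 * deg G v) t))) (subst (λ z → 2 * deg G v + 2 * z + 1 ≤ _) eq (hB v))
      where
      lem : ∀ d t → d + suc t + 2 + t ≡ d + 2 * suc t + 1
      lem = solve-∀

    weigh : ∀ (c : Colouring n) v a → ∑ (λ u → b2n (adj G v u ∧ (c u ≡ᵇ a)) * (2 + b2n (tight u))) ≡ 2 * cdeg G c v a + mdeg c v a
    weigh c v a = trans (∑-cong pt) (trans (∑-+ _ _) (cong (_+ mdeg c v a) (∑-* 2 _)))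
      where
      pt : ∀ u → b2n (adj G v u ∧ (c u ≡ᵇ a)) * (2 + b2n (tight u)) ≡ 2 * b2n (adj G v u ∧ (c u ≡ᵇ a)) + b2n (adj G v u ∧ (c u ≡ᵇ a) ∧ tight u)
      pt u with adj G v u | c u ≡ᵇ a | tight u
      ... | true  | true  | true  = refl
      ... | true  | true  | false = refl
      ... | true  | false | _     = refl
      ... | false | _     | _     = refl

    weigh-all : ∀ v → ∑ (λ u → b2n (adj G v u) * (2 + b2n (tight u))) ≡ 2 * deg G v + τ v
    weigh-all v = trans (∑-cong pt) (trans (∑-+ _ _) (cong (_+ τ v) (∑-* 2 _)))
      where
      pt : ∀ u → b2n (adj G v u) * (2 + b2n (tight u)) ≡ 2 * b2n (adj G v u) + b2n (adj G v u ∧ tight u)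
      pt u with adj G v u | tight u
      ... | true  | true  = refl
      ... | true  | false = refl
      ... | false | _     = refl

    -- A vertex of monochromatic degree two that saw its own colour at a tight neighbour would see too much of every colour.
    no-tight : ∀ {c v o} → Good c → m c v ≡ 2 → Mono G c v o → tight o ≡ false
    no-tight {c} {v} {o} g two (ea , ec) = not-true λ t → <⇒≱ (short t) (hB v)
      where
      short : tight o ≡ true → 5 * length (L v) < 2 * deg G v + 2 * τ v + 1
      short t = begin-strict
        5 * length (L v)                                  ≡⟨ trans (*-comm 5 (length (L v))) (sym (sumL-const 5 (L v))) ⟩
        sumL (λ _ → 5) (L v)                              ≤⟨ sumL-mono (L v) each ⟩
        sumL (λ a → ∑ (λ u → b2n (adj G v u ∧ (c u ≡ᵇ a)) * (2 + b2n (tight u)))) (L v) ≤⟨ sumL-colours c v (λ u → 2 + b2n (tight u)) (uq v) ⟩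
        ∑ (λ u → b2n (adj G v u) * (2 + b2n (tight u)))   ≡⟨ weigh-all v ⟩
        2 * deg G v + τ v                                 ≤⟨ +-monoʳ-≤ (2 * deg G v) (m≤n*m (τ v) 2) ⟩
        2 * deg G v + 2 * τ v                             <⟨ ≤-reflexive (+-comm 1 (2 * deg G v + 2 * τ v)) ⟩
        2 * deg G v + 2 * τ v + 1                         ∎
        where
        open ≤-Reasoning
        own : 1 ≤ mdeg c v (c v)
        own = ≤-trans (≤-reflexive (cong b2n (sym (∧-intro ea (∧-intro (trans (cong (_≡ᵇ c v) (sym ec)) (≡ᵇ-refl (c v))) t)))))
          (∑-≥ o (λ u → b2n (adj G v u ∧ (c u ≡ᵇ c v) ∧ tight u)))
        each : ∀ {a} → a ∈ L v → 5 ≤ ∑ (λ u → b2n (adj G v u ∧ (c u ≡ᵇ a)) * (2 + b2n (tight u)))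
        each {a} i = ≤-trans (go (≤-trans (≤-reflexive (sym two)) (cdeg-min {c} {v} {a} g i))) (≤-reflexive (sym (weigh c v a)))
          where
          go : 2 ≤ cdeg G c v a → 5 ≤ 2 * cdeg G c v a + mdeg c v a
          go le with m≤n⇒m<n∨m≡n le
          ... | inj₁ lt = ≤-trans (≤-trans (n≤1+n 5) (*-monoʳ-≤ 2 lt)) (m≤m+n _ _)
          ... | inj₂ e = +-mono-≤ (*-monoʳ-≤ 2 le) (≤-trans own (mdeg-min {c} {v} {a} g i (trans two e)))

    -- The conflicts of v with vertices that can take a colour available to v each cost v a unit of degree, and so leave
    -- one more colour available.
    alts-many : ∀ {c v} → Good c → m c v ≡ 2 → tight v ≡ false → (Rs : List (Fin n × ℕ)) → Unique (map proj₁ Rs) →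
      (∀ {u e} → (u , e) ∈ Rs → Flippable c u e × e ≢ c v × adj G v u ≡ true × c u ≢ c v) →
      (∀ {p q} → p ∈ Rs → q ∈ Rs → ¬ Mono G c (proj₁ p) (proj₁ q)) →
      suc (length Rs) ≤ length (alts c v)
    alts-many {c} {v} g two nt Rs un h ind = +-cancelˡ-≤ (5 * ℓ) _ _ total
      where
      open ≤-Reasoning
      ℓ = length (L v)
      R : Fin n → Bool
      R u = ⌊ u ∈?V map proj₁ Rs ⌋
      R-∈ : ∀ {u} → R u ≡ true → u ∈ map proj₁ Rs
      R-∈ {u} e with u ∈?V map proj₁ Rs
      ... | yes i = i
      R-∈ {u} () | no _
      ∈-R : ∀ {u} → u ∈ map proj₁ Rs → R u ≡ true
      ∈-R {u} i with u ∈?V map proj₁ Rs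
      ... | yes _ = refl
      ... | no ni = ⊥-elim (ni i)
      -- A neighbour weighs two, or three if tight, and one less if it is a conflict.
      w₀ hw : Fin n → ℕ
      w₀ u = 2 + b2n (tight u)
      hw u = w₀ u ∸ b2n (R u)
      hw+R : ∀ u → hw u + b2n (R u) ≡ w₀ u
      hw+R u = m∸n+n≡m (≤-trans (b2n≤1 (R u)) (s≤s z≤n))
      r : ℕ → ℕ
      r a = count (λ u → (adj G v u ∧ (c u ≡ᵇ a)) ∧ R u)
      D : ℕ → ℕ
      D a = ∑ (λ u → b2n (adj G v u ∧ (c u ≡ᵇ a)) * hw u)
      split : ∀ b u → b2n b * hw u + b2n (b ∧ R u) ≡ b2n b * w₀ u
      split true  u = trans (cong (_+ b2n (R u)) (+-identityʳ (hw u))) (trans (hw+R u) (sym (+-identityʳ (w₀ u))))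
      split false u = refl
      D+r : ∀ a → D a + r a ≡ 2 * cdeg G c v a + mdeg c v a
      D+r a = trans (sym (∑-+ _ _)) (trans (∑-cong λ u → split (adj G v u ∧ (c u ≡ᵇ a)) u) (weigh c v a))
      all+ρ : ∑ (λ u → b2n (adj G v u) * hw u) + count (λ u → adj G v u ∧ R u) ≡ 2 * deg G v + τ v
      all+ρ = trans (sym (∑-+ _ _)) (trans (∑-cong λ u → split (adj G v u) u) (weigh-all v))
      ρ≥ : length Rs ≤ count (λ u → adj G v u ∧ R u)
      ρ≥ = ≤-trans (≤-reflexive (sym (length-map proj₁ Rs)))
        (list≤count _ un λ i → ∧-intro (proj₁ (proj₂ (proj₂ (h (proj₂ (∈-proj₁ i)))))) (∈-R i))
      Ra : ℕ → List (Fin n × ℕ)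
      Ra a = filterᵇ (λ p → c (proj₁ p) ≡ᵇ a) Rs
      r≤ : ∀ a → r a ≤ length (Ra a)
      r≤ a = ≤-trans (count≤list _ (map proj₁ (Ra a)) memb) (≤-reflexive (length-map proj₁ (Ra a)))
        where
        memb : ∀ u → ((adj G v u ∧ (c u ≡ᵇ a)) ∧ R u) ≡ true → u ∈ map proj₁ (Ra a)
        memb u e with ∈-proj₁ (R-∈ {u} (proj₂ (∧-true {adj G v u ∧ (c u ≡ᵇ a)} e)))
        ... | b , i = ∈-map⁺ proj₁ (∈-filterᵇ⁺ _ i (proj₂ (∧-true {adj G v u} (proj₁ (∧-true e)))))
      room : ∀ {a} → a ∈ L v → a ≢ c v → r a + 2 ≤ cdeg G c v a
      room {a} i ne = ≤-trans (+-mono-≤ (r≤ a) (≤-reflexive (sym two)))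
        (repel {c} {v} {a} (Ra a) g (Unique-map-filter proj₁ _ un , (λ j → proj₁ (h (proj₁ (sub j)))) , indep) i ne
          λ j → let (k , q) = sub j ; (_ , e≢ , ea , _) = h k in e≢ , ea , ≡ᵇ-true {_} {a} q)
        where
        sub : ∀ {p} → p ∈ Ra a → p ∈ Rs × (c (proj₁ p) ≡ᵇ a) ≡ true
        sub j = ∈-filterᵇ⁻ _ Rs j
        indep : ∀ {p q} → p ∈ Ra a → q ∈ Ra a → adj G (proj₁ p) (proj₁ q) ≡ false
        indep {p} {q} j k = not-true λ e → ind (proj₁ (sub j)) (proj₁ (sub k))
          (e , trans (≡ᵇ-true {c (proj₁ p)} {a} (proj₂ (sub j))) (sym (≡ᵇ-true {c (proj₁ q)} {a} (proj₂ (sub k)))))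
      r-own : r (c v) ≡ 0
      r-own = n≤0⇒n≡0 (≤-trans (∑-mono λ u → b2n-mono {b = false} λ e → ⊥-elim (
        let (b , i) = ∈-proj₁ (R-∈ {u} (proj₂ (∧-true {adj G v u ∧ (c u ≡ᵇ c v)} e)))
        in proj₂ (proj₂ (proj₂ (h i))) (≡ᵇ-true {c u} (proj₂ (∧-true {adj G v u} (proj₁ (∧-true e))))))) (≤-reflexive (∑-zero n)))
      -- Every available colour accounts for five units, with one unit granted to the own colour and
      -- to each alternative. Summed over the list, this forces many alternatives.
      each : ∀ {a} → a ∈ L v → 5 ≤ D a + (b2n (flip? c v a) + b2n (c v ≡ᵇ a))
      each {a} i with a ≟ c v
      ... | yes refl rewrite ≡ᵇ-refl a = begin
        5                         ≤⟨ s≤s (m≤m+n 4 (mdeg c v a)) ⟩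
        suc (4 + mdeg c v a)      ≡⟨ cong (λ t → suc (2 * t + mdeg c v a)) (sym two) ⟩
        suc (2 * cdeg G c v a + mdeg c v a) ≡⟨ cong suc (sym (D+r a)) ⟩
        suc (D a + r a)           ≡⟨ cong (λ t → suc (D a + t)) r-own ⟩
        suc (D a + 0)             ≡⟨ cong suc (+-identityʳ (D a)) ⟩
        suc (D a)                 ≡⟨ +-comm 1 (D a) ⟩
        D a + 1                   ∎
      ... | no ne rewrite ≡ᵇ-≢ {a} {c v} ne | ≡ᵇ-≢ {c v} {a} (ne ∘ sym) = go (cdeg G c v a) (mdeg c v a) (D a) (r a) (D+r a) (room i ne)
        where
        go : ∀ d k D₁ r₁ → D₁ + r₁ ≡ 2 * d + k → r₁ + 2 ≤ d → 5 ≤ D₁ + (b2n ((d ≡ᵇ 2) ∧ (k ≡ᵇ 0)) + 0)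
        go d k D₁ r₁ e le with d ≡ᵇ 2 in e₂ | k ≡ᵇ 0 in e₀
        ... | true | true = go₂ (≡ᵇ-true {d} e₂)
          where
          go₂ : d ≡ 2 → 5 ≤ D₁ + 1
          go₂ refl with n≤0⇒n≡0 (+-cancelʳ-≤ 2 r₁ 0 le)
          ... | refl = ≤-trans (s≤s (m≤m+n 4 k)) (≤-reflexive (trans (cong suc (trans (sym e) (+-identityʳ D₁))) (+-comm 1 D₁)))
        ... | true | false = go₂ (≡ᵇ-true {d} e₂) k e₀ e
          where
          go₂ : d ≡ 2 → ∀ k → (k ≡ᵇ 0) ≡ false → D₁ + r₁ ≡ 2 * d + k → 5 ≤ D₁ + 0
          go₂ refl (suc k) _ e with n≤0⇒n≡0 (+-cancelʳ-≤ 2 r₁ 0 le)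
          ... | refl = ≤-trans (m≤m+n 5 k) (≤-reflexive (trans (sym (+-suc 4 k)) (sym e)))
        -- With three or more occurrences, `r₁ + 2 ≤ d` leaves at least `d + 2 ≥ 5` after the
        -- conflicts are deducted.
        ... | false | _ = ≤-trans (+-cancelʳ-≤ r₁ 5 D₁ (≤-trans big (≤-reflexive (sym e)))) (≤-reflexive (sym (+-identityʳ D₁)))
          where
          three : 3 ≤ d
          three = ≤∧≢⇒< (≤-trans (m≤n+m 2 r₁) le) λ q → true≢false (cong (_≡ᵇ 2) (sym q)) e₂
          big : 5 + r₁ ≤ 2 * d + k
          big = ≤-trans (≤-trans (≤-reflexive (lem r₁)) (+-mono-≤ three (≤-trans le (≤-reflexive (sym (+-identityʳ d)))))) (m≤m+n (2 * d) k)
            where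
            lem : ∀ r → 5 + r ≡ 3 + (r + 2)
            lem = solve-∀
      total : 5 * ℓ + suc (length Rs) ≤ 5 * ℓ + length (alts c v)
      total = s≤s⁻¹ (begin
        suc (5 * ℓ + suc (length Rs))  ≡⟨ lem (5 * ℓ) (length Rs) ⟩
        5 * ℓ + length Rs + 2          ≡⟨ cong (λ t → t + length Rs + 2) (trans (*-comm 5 ℓ) (sym (sumL-const 5 (L v)))) ⟩
        sumL (λ _ → 5) (L v) + length Rs + 2 ≤⟨ +-monoˡ-≤ 2 (+-mono-≤ (sumL-mono (L v) each) ρ≥) ⟩
        sumL (λ a → D a + (b2n (flip? c v a) + b2n (c v ≡ᵇ a))) (L v) + ρ + 2
          ≡⟨ cong (λ t → t + ρ + 2) (trans (sumL-+ D _ (L v)) (cong (sumL D (L v) +_) (sumL-+ _ _ (L v)))) ⟩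
        sumL D (L v) + (sumL (b2n ∘ flip? c v) (L v) + sumL (λ a → b2n (c v ≡ᵇ a)) (L v)) + ρ + 2
          ≤⟨ +-monoˡ-≤ 2 (+-monoˡ-≤ ρ (+-mono-≤ (sumL-colours c v hw (uq v)) (+-mono-≤ (≤-reflexive (sumL-filterᵇ (flip? c v) (L v))) occurs))) ⟩
        Σh + (A + 1) + ρ + 2           ≡⟨ lem₂ Σh A ρ ⟩
        (Σh + ρ + 2) + suc A           ≡⟨ cong (λ t → t + 2 + suc A) all+ρ ⟩
        (2 * deg G v + τ v + 2) + suc A ≤⟨ +-monoˡ-≤ (suc A) (loose nt) ⟩
        5 * ℓ + suc A                  ≡⟨ +-suc (5 * ℓ) A ⟩
        suc (5 * ℓ + A)                ∎)
        where
        A = length (alts c v)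
        ρ = count (λ u → adj G v u ∧ R u)
        Σh = ∑ (λ u → b2n (adj G v u) * hw u)
        lem : ∀ x y → suc (x + suc y) ≡ x + y + 2
        lem = solve-∀
        lem₂ : ∀ x y z → x + (y + 1) + z + 2 ≡ (x + z + 2) + suc y
        lem₂ = solve-∀
        occurs : sumL (λ a → b2n (c v ≡ᵇ a)) (L v) ≤ 1
        occurs = ≤-trans (sumL-mono (L v) (λ _ → ≤-reflexive (sym (*-identityʳ _)))) (sumL-occurs (c v) 1 (L v) (uq v))

    tight-nbrs : ∀ {c u} → Good c → m c u ≡ 2 → tight u ≡ true → ∀ {t} → Mono G c u t → m c t ≤ 1
    tight-nbrs {c} g two tu {t} e = s≤s⁻¹ (≤∧≢⇒< (m≤2 t g) λ q → true≢false tu (no-tight g q (Mono-sym G e)))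

    -- By `tight-nbrs`, neither neighbour of `u` has another monochromatic neighbour.
    tight-component : ∀ {c u} (g : Good c) → m c u ≡ 2 → tight u ≡ true → ∀ {w ws} → Path g nothing w ws → u ∈ w ∷ ws →
      Σ (Fin n) λ x → Σ (Fin n) λ y → Mono G c u x × Mono G c u y × (∀ {z} → z ∈ w ∷ ws → z ∈ u ∷ x ∷ y ∷ [])
    tight-component {c} {u} g two tu {w} {ws} P i = go (count-two _ two)
      where
      go : (Σ V λ x → Σ V λ y → x ≢ y × (adj G u x ∧ (c x ≡ᵇ c u)) ≡ true × (adj G u y ∧ (c y ≡ᵇ c u)) ≡ true ×
             (∀ t → (adj G u t ∧ (c t ≡ᵇ c u)) ≡ true → t ≡ x ⊎ t ≡ y)) →
           Σ V λ x → Σ V λ y → Mono G c u x × Mono G c u y × (∀ {z} → z ∈ w ∷ ws → z ∈ u ∷ x ∷ y ∷ [])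
      go (x , y , _ , ex , ey , on) = x , y , mx , my , λ j → path-within g closed P (path-back g closed P i (here refl)) j
        where
        mx : Mono G c u x
        mx = let (e , q) = nbr-colour⁻ G c {u} {x} ex in e , sym q
        my : Mono G c u y
        my = let (e , q) = nbr-colour⁻ G c {u} {y} ey in e , sym q
        only : ∀ {x t} → Mono G c u x → Mono G c x t → t ≡ u
        only {x} {t} e f = decidable-stable (t Fin.≟ u) λ ne →
          <⇒≱ (s≤s (s≤s z≤n)) (≤-trans (M-list g (t ∷ u ∷ []) ((ne ∷ []) ∷ [] ∷ []) λ { (here refl) → f ; (there (here refl)) → Mono-sym G e })
            (tight-nbrs g two tu e))
        nbr : ∀ {t} → t ≡ x ⊎ t ≡ y → t ∈ u ∷ x ∷ y ∷ []
        nbr (inj₁ e) = there (here e)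
        nbr (inj₂ e) = there (there (here e))
        closed : ∀ {z t} → z ∈ u ∷ x ∷ y ∷ [] → Mono G c z t → t ∈ u ∷ x ∷ y ∷ []
        closed (here refl) (e , q) = nbr (on _ (nbr-colour G c e (sym q)))
        closed (there (here refl)) e = here (only mx e)
        closed (there (there (here refl))) e = here (only my e)

    spec : Spec
    spec = record
      { ok = λ u → not (tight u)
      -- Two paths with nine vertices in all contain at least three chosen ones, since nine exceeds
      -- `2 * 2 + 4`; two paths of four vertices would contain only two. `κ = 1` reflects
      -- `all-blocked`.
      ; N = 9 ; κ = 1
      ; 1≤N = s≤s z≤n
      ; pick = odds
      ; pick-interior = λ xs i → odds-interior xs i
      ; pick-unique = λ {xs} un → odds-unique xs un
      ; pick-indep = λ g P un i j → odds-indep g P un i j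
      ; pick-ok = λ {c} {v} {a} {x} {ws} {u} g f ea ec P un i → cong not (not-true (attached-ok g f ea ec P un (odds-interior _ i)))
      ; pick-ok-large = λ {c} {x} {ws} {u} g lt P un i → cong not (not-true λ t →
          let (_ , _ , _ , _ , s) = tight-component g (path-interior g P un (odds-interior _ i)) t P (there (Interior-∈ (odds-interior _ i)))
          in <⇒≱ (≤-trans (m≤m+n 4 6) lt) (Unique-⊆-length _ un s))
      ; cycle-ok = λ {c} {v} g two nbrs → inj₁ (cong not (not-true λ t → cyc g two nbrs t))
      ; gain₁ = λ xs le → g₁ (length (odds xs)) (≤-trans le (odds-length xs))
      ; gain₂ = λ xs ys le → g₂ (length (odds xs) + length (odds ys))
          (≤-trans le (≤-trans (+-mono-≤ (odds-length xs) (odds-length ys)) (≤-reflexive (lem (length (odds xs)) (length (odds ys))))))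
      ; gain-large = λ xs lt → g₃ (length (odds xs)) (≤-trans lt (odds-length xs))
      }
      where
      odds-unique : ∀ xs → Unique xs → Unique (odds xs)
      odds-unique [] un = []
      odds-unique (_ ∷ []) un = []
      odds-unique (_ ∷ _ ∷ []) un = []
      odds-unique (a ∷ b ∷ c ∷ xs) un = Unique-cons
        (λ i → Unique-head (Unique-tail un) (there (Interior-∈ (odds-interior (c ∷ xs) i))))
        (odds-unique (c ∷ xs) (Unique-tail (Unique-tail un)))
      -- A tight interior vertex `u` would make the component a path of three vertices with `x` next
      -- to `u`. The flip of `v` would then give `x` degree two and a tight monochromatic neighbour,
      -- against `no-tight`.
      attached-ok : ∀ {c v a x ws u} (g : Good c) → Flippable c v a → adj G v x ≡ true → c x ≡ a →
        Path g nothing x ws → Unique (x ∷ ws) → Interior (x ∷ ws) u → tight u ≢ true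
      attached-ok {c} {v} {a} {x} {ws} {u} g f ea ec P un i t = go (tight-component g (path-interior g P un i) t P (there (Interior-∈ i)))
        where
        c′ = recolour c v a
        g′ : Good c′
        g′ = flip-good g f
        bad : Mono G c u x → ⊥
        bad (eu , cu) = true≢false t (no-tight g′ (≤-antisym (m≤2 x g′) two) (trans (Graph.sym G _ _) eu , trans x-off (trans (sym cu) (sym u-off))))
          where
          v≢ : ∀ {z} → c z ≡ a → z ≢ v
          v≢ q refl = proj₁ (proj₂ (proj₂ f)) (sym q)
          x-off : c′ x ≡ c x
          x-off = recolour-off c (v≢ ec)
          u-off : c′ u ≡ c u
          u-off = recolour-off c (v≢ (trans cu ec))
          two : 2 ≤ m c′ x
          two = M-list g′ (v ∷ u ∷ []) (((λ { refl → v≢ (trans cu ec) refl }) ∷ []) ∷ [] ∷ []) λ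
            { (here refl) → trans (Graph.sym G _ _) ea , trans x-off (trans ec (sym (recolour-at c v a)))
            ; (there (here refl)) → trans (Graph.sym G _ _) eu , trans x-off (trans (sym cu) (sym u-off)) }
        go : (Σ V λ p → Σ V λ q → Mono G c u p × Mono G c u q × (∀ {z} → z ∈ x ∷ ws → z ∈ u ∷ p ∷ q ∷ [])) → ⊥
        go (p , q , mp , mq , s) = at-x (s (here refl))
          where
          at-x : x ∈ u ∷ p ∷ q ∷ [] → ⊥
          at-x (here refl) = <⇒≱ (≤-reflexive (sym (path-interior g P un i))) (flip-nbr g f ea ec)
          at-x (there (here refl)) = bad mp
          at-x (there (there (here refl))) = bad mq
      cyc : ∀ {c v} → Good c → m c v ≡ 2 → (∀ {u} → Mono G c v u → m c u ≡ 2) → tight v ≢ true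
      cyc {c} {v} g two nbrs t = let (x , _ , _ , ex , _) = count-two _ two ; (e , q) = nbr-colour⁻ G c {v} {x} ex in
        <⇒≱ (≤-reflexive (sym (nbrs (e , sym q)))) (tight-nbrs g two t (e , sym q))
      g₁ : ∀ o → 9 ≤ 2 * o + 2 → 1 ≤ o
      g₁ zero (s≤s (s≤s ()))
      g₁ (suc o) _ = s≤s z≤n
      lem : ∀ p q → (2 * p + 2) + (2 * q + 2) ≡ 2 * (p + q) + 4
      lem = solve-∀
      g₂ : ∀ o → 9 ≤ 2 * o + 4 → 3 ≤ o
      g₂ 0 (s≤s (s≤s (s≤s (s≤s ()))))
      g₂ 1 (s≤s (s≤s (s≤s (s≤s (s≤s (s≤s ()))))))
      g₂ 2 (s≤s (s≤s (s≤s (s≤s (s≤s (s≤s (s≤s (s≤s ()))))))))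
      g₂ (suc (suc (suc o))) _ = s≤s (s≤s (s≤s z≤n))
      g₃ : ∀ o → 10 ≤ 2 * o + 2 → 2 < o
      g₃ 0 (s≤s (s≤s ()))
      g₃ 1 (s≤s (s≤s (s≤s (s≤s ()))))
      g₃ 2 (s≤s (s≤s (s≤s (s≤s (s≤s (s≤s ()))))))
      g₃ (suc (suc (suc o))) _ = s≤s (s≤s (s≤s z≤n))

    open Blocking G L tight uq hdeg spec

    module _ (us₀ W₀ B₀ : List V) (κB₀<W₀ : 1 * length B₀ < length W₀) (B : List V) where

      open At us₀ W₀ B₀ κB₀<W₀ B
      open Entry

      module _ {c} σ (g : Good c) (val : Valid c σ)
               (block : ∀ {w b} → Free σ g val w b → Σ V (Blocked σ g val w b)) where

        -- Colours for the vertices of As, distinct at neighbours; those outside the plans have distinct blocking ends Zs.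
        record Partial (todo : List V) : Set where
          field
            As    : List (V × ℕ)
            As-un : Unique (map proj₁ As)
            As-W  : ∀ {p} → p ∈ As → proj₁ p ∈ Wl σ × Flippable c (proj₁ p) (proj₂ p)
            J-As  : ∀ {f} → f ∈ σ → (v f , a f) ∈ As
            Zs    : List V
            Zs-un : Unique Zs
            Zs-in : ∀ {z} → z ∈ Zs → z ∈ Bl σ × Σ (V × ℕ) λ p → p ∈ As × Free σ g val (proj₁ p) (proj₂ p) × Blocked σ g val (proj₁ p) (proj₂ p) z
            count-eq : length Zs + length σ + length todo ≡ length (Wl σ)
            todo-un : Unique todo
            todo-in : ∀ {w} → w ∈ todo → w ∈ Wl σ × w ∉ map proj₁ As

        module _ {w todo} (P : Partial (w ∷ todo)) where

          open Partial P
          w-W : w ∈ Wl σ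
          w-W = proj₁ (todo-in (here refl))
          w-As : w ∉ map proj₁ As
          w-As = proj₂ (todo-in (here refl))
          two : m c w ≡ 2
          two = proj₁ (W-facts σ val w-W)

          rivals : List (V × ℕ)
          rivals = filterᵇ (λ q → adj G w (proj₁ q) ∧ flip? c w (proj₂ q)) As

          ∈-rivals : ∀ {u e} → (u , e) ∈ rivals → (u , e) ∈ As × adj G w u ≡ true × flip? c w e ≡ true
          ∈-rivals {u} {e} i = let (j , t) = ∈-filterᵇ⁻ _ As i in j , ∧-true {adj G w u} t

          room : length (map proj₂ rivals) < length (alts c w)
          room = ≤-trans (≤-reflexive (cong suc (length-map proj₂ rivals))) (alts-many {c} {w} g two loose-w rivals
            (Unique-map-filter proj₁ _ As-un) facts
            (λ i j → W-indep σ val (proj₁ (As-W (proj₁ (∈-rivals i)))) (proj₁ (As-W (proj₁ (∈-rivals j))))))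
            where
            loose-w : tight w ≡ false
            loose-w = not-true λ t → case trans (sym (proj₂ (W-facts σ val w-W))) (cong not t) of λ ()
            facts : ∀ {u e} → (u , e) ∈ rivals → Flippable c u e × e ≢ c w × adj G w u ≡ true × c u ≢ c w
            facts {u} {e} i = let (j , ea , te) = ∈-rivals i in
              proj₂ (As-W j) ,
              (λ { refl → case trans (sym (proj₁ (∧-true te))) (cong not (≡ᵇ-refl (c w))) of λ () }) ,
              ea , λ q → W-indep σ val w-W (proj₁ (As-W j)) (ea , sym q)

          Apart : ℕ → Set
          Apart b = ∀ {u e} → (u , e) ∈ As → adj G w u ≡ true → e ≢ b

          apart-free : ∀ {b} → Flippable c w b → Apart b → Free σ g val w b
          apart-free flw ap = isfree w-W w∉J flw λ h e → ap (J-As h) (trans (Graph.sym G _ _) e)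
            where
            w∉J : w ∉ Jl σ
            w∉J k = case ∈-map⁻ v k of λ { (f , h , refl) → w-As (∈-map⁺ proj₁ (J-As h)) }

          -- Two flips blocked by one end have the same colour, so by `clique` their vertices are
          -- adjacent; but neighbours are assigned distinct colours.
          new-end : ∀ {b z} → Apart b → Free σ g val w b → Blocked σ g val w b z → z ∉ Zs
          new-end {b} {z} ap fr bl k = conflict (Zs-in k)
            where
            conflict : (z ∈ Bl σ × Σ (V × ℕ) λ p → p ∈ As × Free σ g val (proj₁ p) (proj₂ p) × Blocked σ g val (proj₁ p) (proj₂ p) z) → ⊥
            conflict (_ , (u , e) , j , fr′ , bl′) = ap j (clique σ g val fr fr″ (λ { refl → w-As (∈-map⁺ proj₁ j) }) bl bl″) e≡b
              where
              e≡b : e ≡ b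
              e≡b = trans (sym (Blocked.col bl′)) (Blocked.col bl)
              fr″ : Free σ g val u b
              fr″ = subst (Free σ g val u) e≡b fr′
              bl″ : Blocked σ g val u b z
              bl″ = subst (λ t → Blocked σ g val u t z) e≡b bl′

          assign : ∀ {b z} → Flippable c w b → Apart b → Free σ g val w b → Blocked σ g val w b z → Partial todo
          assign {b} {z} flw ap fr bl = record
            { As = (w , b) ∷ As
            ; As-un = Unique-cons w-As As-un
            ; As-W = λ { (here refl) → w-W , flw ; (there j) → As-W j }
            ; J-As = there ∘ J-As
            ; Zs = z ∷ Zs
            ; Zs-un = Unique-cons (new-end ap fr bl) Zs-un
            ; Zs-in = λ { (here refl) → Blocked.z∈ bl , (w , b) , here refl , fr , bl
                        ; (there j) → let (zb , q , k , r) = Zs-in j in zb , q , there k , r }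
            ; count-eq = trans (lem (length Zs) (length σ) (length todo)) count-eq
            ; todo-un = Unique-tail todo-un
            ; todo-in = λ j → proj₁ (todo-in (there j)) , λ
                { (here refl) → Unique-head todo-un j ; (there k) → proj₂ (todo-in (there j)) k }
            }
            where
            lem : ∀ x y t → suc x + y + t ≡ x + y + suc t
            lem = solve-∀

          -- By `alts-many` there are more alternatives at `w` than assigned neighbours holding one
          -- of them, so the greedy assignment never gets stuck.
          extend : Partial todo
          extend = go (fresh (alts c w) (map proj₂ rivals) (Unique.filter⁺ (T? ∘ flip? c w) (uq w)) room)
            where
            go : Σ ℕ (λ b → b ∈ alts c w × b ∉ map proj₂ rivals) → Partial todo
            go (b , i , b∉) = assign flw ap fr (proj₂ (block fr))
              where
              fi : b ∈ L w × flip? c w b ≡ true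
              fi = ∈-filterᵇ⁻ (flip? c w) (L w) i
              flw : Flippable c w b
              flw = flip?-flippable {c} {w} {b} two (proj₁ fi) (proj₂ fi)
              ap : Apart b
              ap j ea refl = b∉ (∈-map⁺ proj₂ (∈-filterᵇ⁺ _ j (∧-intro ea (proj₂ fi))))
              fr : Free σ g val w b
              fr = apart-free flw ap

        initial : Partial (filter (λ w → ¬? (w ∈?V Jl σ)) (Wl σ))
        initial = record
          { As = map (λ f → v f , a f) σ
          ; As-un = subst Unique (sym same) (J-unique σ val)
          ; As-W = λ i → case ∈-map⁻ _ i of λ { (f , h , refl) → J⊆W σ val h , EntryOK.flp (J-okay σ val h) }
          ; J-As = ∈-map⁺ (λ f → v f , a f)
          ; Zs = [] ; Zs-un = [] ; Zs-in = λ ()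
          ; count-eq = ≤-antisym (subst₂ _≤_ (trans (length-++ (Jl σ)) (cong (_+ length todo) (length-map v σ))) refl
                (Unique-⊆-length (Jl σ ++ todo) (Unique-++ (J-unique σ val) todo-un (λ i j → proj₂ (todo-mem j) i))
                  λ i → case ∈-++⁻ (Jl σ) i of λ { (inj₁ j) → J-W j ; (inj₂ j) → proj₁ (todo-mem j) }))
              (subst (length (Wl σ) ≤_) (trans (length-++ (Jl σ)) (cong (_+ length todo) (length-map v σ)))
                (Unique-⊆-length (Wl σ) (W-unique σ val) λ {w} i → split w i (w ∈?V Jl σ)))
          ; todo-un = todo-un
          ; todo-in = λ i → proj₁ (todo-mem i) , λ k → proj₂ (todo-mem i) (subst (_ ∈_) same k)
          }
          where
          todo = filter (λ w → ¬? (w ∈?V Jl σ)) (Wl σ)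
          todo-un : Unique todo
          todo-un = Unique.filter⁺ (λ w → ¬? (w ∈?V Jl σ)) (W-unique σ val)
          todo-mem : ∀ {w} → w ∈ todo → w ∈ Wl σ × w ∉ Jl σ
          todo-mem i = ∈-filter⁻ (λ w → ¬? (w ∈?V Jl σ)) {xs = Wl σ} i
          same : map proj₁ (map (λ f → v f , a f) σ) ≡ Jl σ
          same = sym (map-∘ σ)
            where open import Data.List.Properties using (map-∘)
          J-W : ∀ {w} → w ∈ Jl σ → w ∈ Wl σ
          J-W i = case ∈-map⁻ v i of λ { (f , h , refl) → J⊆W σ val h }
          split : ∀ w → w ∈ Wl σ → Dec (w ∈ Jl σ) → w ∈ Jl σ ++ todo
          split w i (yes j) = ∈-++⁺ˡ j
          split w i (no nj) = ∈-++⁺ʳ (Jl σ) (∈-filter⁺ (λ w → ¬? (w ∈?V Jl σ)) i nj)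

        finish : ∀ todo → Partial todo → Partial []
        finish [] P = P
        finish (w ∷ todo) P = finish todo (extend P)

        -- In the complete assignment every chosen vertex is either planned or has a blocked end of
        -- its own.
        all-blocked : length (Wl σ) ≤ length σ + length (Bl σ)
        all-blocked = begin
          length (Wl σ)                    ≡⟨ sym (Partial.count-eq P) ⟩
          length (Partial.Zs P) + length σ + 0 ≡⟨ trans (+-identityʳ _) (+-comm _ (length σ)) ⟩
          length σ + length (Partial.Zs P) ≤⟨ +-monoʳ-≤ (length σ) (Unique-⊆-length (Partial.Zs P) (Partial.Zs-un P) (λ i → proj₁ (Partial.Zs-in P i))) ⟩
          length σ + length (Bl σ)         ∎
          where
          open ≤-Reasoning
          P = finish _ initial

      counting : Counting
      counting {c} σ g val none = <⇒≱ (subst (_< length (Wl σ)) (*-identityˡ _) (gain-total σ val))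
        (all-blocked σ g val (blocker σ g val λ w b fr out → none w b (Free.w∈ fr) (Free.w∉ fr) (Free.fl fr) (Free.nc fr) out))

  nine : (∀ v → 2 * deg G v + 2 * τ v + 1 ≤ 5 * length (L v)) → ∀ c → IsLColouring L c →
         ¬ ¬ (Σ (Colouring n) λ c′ → IsLColouring L c′ × HasClustering G c′ 9)
  nine hB = Clustered.clustered G L tight uq (hdeg hB) (spec hB) (counting hB)

count-false : ∀ {n} (p : Fin n → Bool) → (∀ u → p u ≡ false) → count p ≡ 0
count-false {n} p h = trans (∑-cong (λ u → cong b2n (h u))) (∑-zero n)

∧-falseʳ : ∀ a b → a ∧ b ∧ false ≡ false
∧-falseʳ true true = refl
∧-falseʳ true false = refl
∧-falseʳ false _ = refl

-- A local colouring theorem with clustering linear in the list size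

module Linear {n} (G : Graph n) (L : Fin n → List ℕ) (uq : ∀ v → Unique (L v)) where

  tight : Fin n → Bool
  tight u = deg G u + 1 ≡ᵇ 3 * length (L u)

  module _ (h₁ : ∀ v → deg G v + 1 ≤ 3 * length (L v))
           (h₂ : ∀ u v → adj G u v ≡ true → tight u ≡ true → tight v ≡ true → ⊥)
           (k : ℕ) (2≤k : 2 ≤ k) (ℓ≤k : ∀ v → length (L v) ≤ k) where

    hdeg : ∀ v → deg G v < 3 * length (L v)
    hdeg v = ≤-trans (≤-reflexive (+-comm 1 (deg G v))) (h₁ v)

    unmarked : Fin n → Bool
    unmarked _ = false

    open Process G L unmarked uq hdeg

    ok : Fin n → Bool
    ok u = not (tight u)

    mdeg-zero : ∀ c v a → mdeg c v a ≡ 0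
    mdeg-zero c v a = count-false _ (λ u → ∧-falseʳ (adj G v u) (c u ≡ᵇ a))

    -- Otherwise the own colour occurs twice and every other one at least three times around `v`,
    -- which makes `v` tight.
    alts-nonempty : ∀ {c v} → Good c → m c v ≡ 2 → ok v ≡ true → Σ ℕ (Flippable c v)
    alts-nonempty {c} {v} g two okv with alts c v in eq
    ... | a ∷ as = a , let (i , e) = ∈-filterᵇ⁻ (flip? c v) (L v) (subst (a ∈_) (sym eq) (here refl)) in flip?-flippable {c} {v} {a} two i e
    ... | [] = ⊥-elim (<⇒≱ (≤∧≢⇒< (h₁ v) λ e → case trans (sym okv) (cong not (trans (cong (_≡ᵇ 3 * length (L v)) e) (≡ᵇ-refl (3 * length (L v))))) of λ ()) bound)
      where
      open ≤-Reasoning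
      each : ∀ {a} → a ∈ L v → 3 ≤ cdeg G c v a + b2n (c v ≡ᵇ a)
      each {a} i with a ≟ c v
      ... | yes refl rewrite ≡ᵇ-refl a = ≤-reflexive (cong (_+ 1) (sym two))
      ... | no ne = ≤-trans (≤∧≢⇒< (≤-trans (≤-reflexive (sym two)) (cdeg-min {c} {v} {a} g i)) λ q →
        case subst (a ∈_) eq (∈-filterᵇ⁺ (flip? c v) i (flippable-flip? {c} {v} {a} (two , i , ne , sym q , mdeg-zero c v a))) of λ ()) (m≤m+n _ _)
      bound : 3 * length (L v) ≤ deg G v + 1
      bound = begin
        3 * length (L v)       ≡⟨ trans (*-comm 3 (length (L v))) (sym (sumL-const 3 (L v))) ⟩
        sumL (λ _ → 3) (L v)   ≤⟨ sumL-mono (L v) each ⟩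
        sumL (λ a → cdeg G c v a + b2n (c v ≡ᵇ a)) (L v) ≡⟨ sumL-+ _ _ (L v) ⟩
        sumL (cdeg G c v) (L v) + sumL (λ a → b2n (c v ≡ᵇ a)) (L v)
          ≤⟨ +-mono-≤ (sumL-cdeg c v (uq v)) (≤-trans (sumL-mono (L v) (λ _ → ≤-reflexive (sym (*-identityʳ _)))) (sumL-occurs (c v) 1 (L v) (uq v))) ⟩
        deg G v + 1            ∎

    one-ok : ∀ {u v} → adj G u v ≡ true → tight u ≡ true → ok v ≡ true
    one-ok e t = cong not (not-true (h₂ _ _ e t))

    thirds-ok : ∀ {c} (g : Good c) {p w ws u} → Path g p w ws → u ∈ thirds ok (w ∷ ws) → ok u ≡ true
    thirds-ok g (next {w′ = b} _ _ (next _ _ (next _ _ P))) (there i) = thirds-ok g P i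
    thirds-ok g (next {w′ = b} _ _ (next _ e (next _ _ P))) (here q) with ok b in eq
    ... | true  rewrite q = eq
    ... | false rewrite q = one-ok (proj₁ e) (tight-b (tight b) refl)
      where
      tight-b : ∀ t → tight b ≡ t → tight b ≡ true
      tight-b true e = e
      tight-b false e = case trans (sym eq) (cong not e) of λ ()
    thirds-ok g (stop _) ()
    thirds-ok g (next _ _ (stop _)) ()
    thirds-ok g (next _ _ (next _ _ (stop _))) ()

    -- A plan with two blocked ends may obstruct `3 * (3 * k)` vertices, so `9 * k` chosen ones are
    -- wanted. Two paths with `N₀` vertices in all contain at least `19 * k - 19`, which is enough
    -- from `k = 2` on.
    N₀ : ℕ
    N₀ = 57 * k ∸ 51

    N₀-bound : ∀ {x} → N₀ ≤ x → 57 * k ≤ 51 + x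
    N₀-bound le = ≤-trans (m≤n+m∸n (57 * k) 51) (+-monoʳ-≤ 51 le)

    numeric : ∀ {x} → 57 * k ≤ 57 + 3 * x → 9 * k ≤ x
    numeric {x} le = ≮⇒≥ λ lt → <⇒≱ (begin-strict
      57 + 3 * x          ≡⟨ lem x ⟩
      54 + 3 * suc x      <⟨ +-mono-<-≤ (m≤m+n 55 5) (*-monoʳ-≤ 3 lt) ⟩
      60 + 3 * (9 * k)    ≤⟨ +-mono-≤ (*-monoʳ-≤ 30 2≤k) (≤-reflexive (sym (*-assoc 3 9 k))) ⟩
      30 * k + 27 * k     ≡⟨ sym (*-distribʳ-+ k 30 27) ⟩
      57 * k              ∎) le
      where
      open ≤-Reasoning
      lem : ∀ x → 57 + 3 * x ≡ 54 + 3 * suc x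
      lem = solve-∀

    shape : ∀ {p} e → e ≤ 6 → N₀ ≤ 3 * p + e → 9 * k ≤ p
    shape {p} e le h = numeric (≤-trans (N₀-bound h) (≤-trans (+-monoʳ-≤ 51 (+-monoʳ-≤ (3 * p) le)) (≤-reflexive (lem p))))
      where
      lem : ∀ p → 51 + (3 * p + 6) ≡ 57 + 3 * p
      lem = solve-∀

    spec : Spec
    spec = record
      { ok = ok
      -- Any alternative colour will do here: an obstructed vertex lies in the closed neighbourhood
      -- of a planned vertex or of a blocked end, and these have at most `3 * k` vertices.
      ; N = N₀ ; κ = 3 * k
      ; 1≤N = m<n⇒0<n∸m (≤-trans (m≤m+n 52 62) (*-monoʳ-≤ 57 2≤k))
      ; pick = thirds ok
      ; pick-interior = λ xs i → thirds-interior ok xs i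
      ; pick-unique = λ {xs} un → thirds-unique xs un
      ; pick-indep = λ g P un i j → thirds-indep g ok P un i j
      ; pick-ok = λ g _ _ _ P _ i → thirds-ok g P i
      ; pick-ok-large = λ g _ P _ i → thirds-ok g P i
      ; cycle-ok = λ {c} {v} g two nbrs → cyc {c} {v} two
      ; gain₁ = λ xs le → ≤-trans (≤-trans (≤-reflexive (*-identityʳ (3 * k))) (*-monoˡ-≤ k (m≤m+n 3 6)))
                                   (shape 3 (m≤m+n 3 3) (≤-trans le (thirds-length ok xs)))
      ; gain₂ = λ xs ys le → ≤-trans (≤-reflexive (lem₉ k))
          (shape 6 ≤-refl (≤-trans le (≤-trans (+-mono-≤ (thirds-length ok xs) (thirds-length ok ys)) (≤-reflexive (lem (length (thirds ok xs)) _)))))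
      ; gain-large = λ xs lt → ≤-trans (≤-trans (s≤s (≤-reflexive (lem₆ k))) (+-monoˡ-≤ (6 * k) (≤-trans (s≤s z≤n) (*-monoʳ-≤ 3 2≤k))))
                                      (≤-trans (≤-reflexive (lem₉′ k)) (shape 3 (m≤m+n 3 3) (≤-trans (<⇒≤ lt) (thirds-length ok xs))))
      }
      where
      thirds-unique : ∀ xs → Unique xs → Unique (thirds ok xs)
      thirds-unique [] un = []
      thirds-unique (_ ∷ []) un = []
      thirds-unique (_ ∷ _ ∷ []) un = []
      thirds-unique (_ ∷ _ ∷ _ ∷ []) un = []
      thirds-unique (a ∷ b ∷ d ∷ e ∷ xs) un = Unique-cons (new (ok b)) (thirds-unique (e ∷ xs) (Unique-tail (Unique-tail (Unique-tail un))))
        where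
        new : ∀ t → (if t then b else d) ∉ thirds ok (e ∷ xs)
        new true  i = Unique-head (Unique-tail un) (there (there (Interior-∈ (thirds-interior ok (e ∷ xs) i))))
        new false i = Unique-head (Unique-tail (Unique-tail un)) (there (Interior-∈ (thirds-interior ok (e ∷ xs) i)))
      cyc : ∀ {c v} → m c v ≡ 2 → ok v ≡ true ⊎ Σ V λ u → Mono G c v u × ok u ≡ true
      cyc {c} {v} two with tight v in t | count-two _ two
      ... | false | _ = inj₁ refl
      ... | true | x , _ , _ , ex , _ = let (e , q) = nbr-colour⁻ G c {v} {x} ex in inj₂ (x , (e , sym q) , one-ok e t)
      lem : ∀ p q → (3 * p + 3) + (3 * q + 3) ≡ 3 * (p + q) + 6
      lem = solve-∀
      lem₉ : ∀ k → 3 * k * 3 ≡ 9 * k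
      lem₉ = solve-∀
      lem₆ : ∀ k → 3 * k * 2 ≡ 6 * k
      lem₆ = solve-∀
      lem₉′ : ∀ k → 3 * k + 6 * k ≡ 9 * k
      lem₉′ = solve-∀

    open Blocking G L unmarked uq hdeg spec

    module _ (us₀ W₀ B₀ : List V) (κB₀<W₀ : 3 * k * length B₀ < length W₀) (B : List V) where

      open At us₀ W₀ B₀ κB₀<W₀ B
      open Entry

      ball : V → List V
      ball z = z ∷ sat (adj G z)

      ball-length : ∀ z → length (ball z) ≤ 3 * k
      ball-length z = ≤-trans (≤-reflexive (cong suc (sat-length (adj G z)))) (≤-trans (hdeg z) (*-monoʳ-≤ 3 (ℓ≤k z)))

      balls : List V → List V
      balls = concatMap ball

      balls-length : ∀ zs → length (balls zs) ≤ 3 * k * length zs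
      balls-length [] = z≤n
      balls-length (z ∷ zs) = ≤-trans (≤-reflexive (length-++ (ball z)))
        (≤-trans (+-mono-≤ (ball-length z) (balls-length zs)) (≤-reflexive (sym (*-suc (3 * k) (length zs)))))

      ∈-balls : ∀ {z u} zs → z ∈ zs → u ∈ ball z → u ∈ balls zs
      ∈-balls zs i j = ∈-concatMap⁺ ball (lose i j)

      counting : Counting
      counting {c} σ g val none = <⇒≱ (gain-total σ val) (begin
        length (Wl σ)                                 ≤⟨ Unique-⊆-length (Wl σ) (W-unique σ val) (λ {w} i → covered w i (w ∈?V Jl σ)) ⟩
        length (balls (Jl σ ++ Bl σ))                 ≤⟨ balls-length (Jl σ ++ Bl σ) ⟩
        3 * k * length (Jl σ ++ Bl σ)                 ≡⟨ cong (3 * k *_) (trans (length-++ (Jl σ)) (cong (_+ length (Bl σ)) (length-map v σ))) ⟩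
        3 * k * (length σ + length (Bl σ))            ∎)
        where
        open ≤-Reasoning
        covered : ∀ w → w ∈ Wl σ → Dec (w ∈ Jl σ) → w ∈ balls (Jl σ ++ Bl σ)
        covered w i (yes j) = ∈-balls (Jl σ ++ Bl σ) (∈-++⁺ˡ j) (here refl)
        covered w i (no w∉) = go (any? (λ f → (adj G (v f) w Bool.≟ true) ×-dec (a f ≟ proj₁ alt)) σ)
          where
          alt : Σ ℕ (Flippable c w)
          alt = alts-nonempty g (proj₁ (W-facts σ val i)) (proj₂ (W-facts σ val i))
          go : Dec (Any (λ f → adj G (v f) w ≡ true × a f ≡ proj₁ alt) σ) → w ∈ balls (Jl σ ++ Bl σ)
          go (yes h) = let (f , fi , e , _) = find h in
            ∈-balls (Jl σ ++ Bl σ) (∈-++⁺ˡ (∈-map⁺ v fi)) (there (sat-∈ {p = adj G (v f)} e))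
          go (no h) = let (z , bl) = blocker σ g val (λ w b fr out → none w b (Free.w∈ fr) (Free.w∉ fr) (Free.fl fr) (Free.nc fr) out)
                                       (isfree i w∉ (proj₂ alt) λ fi e q → h (lose fi (e , q)))
            in ∈-balls (Jl σ ++ Bl σ) (∈-++⁺ʳ (Jl σ) (Blocked.z∈ bl)) (there (sat-∈ {p = adj G z} (trans (Graph.sym G _ _) (Blocked.wz bl))))

    linear : ∀ c → IsLColouring L c → ¬ ¬ (Σ (Colouring n) λ c′ → IsLColouring L c′ × HasClustering G c′ (57 * k ∸ 51))
    linear = Clustered.clustered G L unmarked uq hdeg spec counting

-- A local colouring theorem with defect one

module Matching {n} (G : Graph n) (L : Fin n → List ℕ) (uq : ∀ v → Unique (L v)) where

  open Energy G L (λ _ → false)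

  matching : (∀ v → deg G v + 1 ≤ 2 * length (L v)) → ∀ c → IsLColouring L c →
             ¬ ¬ (Σ (Colouring n) λ c′ → IsLColouring L c′ × HasDefect G c′ 1)
  matching h c l k = exists-good c l λ (c′ , g) → k (c′ , proj₁ g , λ v →
    ≤-trans (≤-reflexive (sat-length _)) (s≤s⁻¹ (*-cancelˡ-< (length (L v)) _ 2 (≤-trans (s≤s (mono-deg-bound v g (uq v)))
      (≤-trans (≤-trans (≤-reflexive (+-comm 1 (deg G v))) (h v)) (≤-reflexive (*-comm 2 (length (L v)))))))))

defect-clustering : ∀ {n} (G : Graph n) c → HasDefect G c 1 → HasClustering G c 2
defect-clustering {n} G c h v ws un rs = ≤-trans (Unique-⊆-length ws {v ∷ sat p} un (λ i → reach-within closed (here refl) (All.lookup rs i))) (s≤s (h v))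
  where
  p : Fin n → Bool
  p u = adj G v u ∧ (c u ≡ᵇ c v)
  closed : ∀ {z u} → z ∈ v ∷ sat p → Mono G c z u → u ∈ v ∷ sat p
  closed (here refl) (e , q) = there (sat-∈ {p = p} (nbr-colour G c e (sym q)))
  closed {z} {u} (there i) (e , q) = decidable-stable ((u ∈? (v ∷ sat p))) λ ni → <⇒≱ (s≤s (s≤s z≤n)) (≤-trans (two ni) (≤-trans (≤-reflexive (sym (sat-length _))) (h z)))
    where
    open import Data.List.Membership.DecPropositional (Fin._≟_ {n}) using (_∈?_)
    nz = nbr-colour⁻ G c {v} {z} {c v} (∈-sat p i)
    two : u ∉ v ∷ sat p → 2 ≤ cdeg G c z (c z)
    two ni = list≤count (λ x → adj G z x ∧ (c x ≡ᵇ c z)) {v ∷ u ∷ []} (((λ { refl → ni (here refl) }) ∷ []) ∷ [] ∷ [])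
      λ { (here refl) → nbr-colour G c (trans (Graph.sym G _ _) (proj₁ nz)) (sym (proj₂ nz)) ; (there (here refl)) → nbr-colour G c e (sym q) }

-- Sparse induced subgraphs

induce : ∀ {n} → Graph n → (Fin n → Bool) → Graph n
induce G Y = record
  { adj    = λ u v → adj G u v ∧ (Y u ∧ Y v)
  ; sym    = λ u v → cong₂ _∧_ (Graph.sym G u v) (∧-comm (Y u) (Y v))
  ; irrefl = λ v → cong (_∧ (Y v ∧ Y v)) (irrefl G v)
  }

degIn : ∀ {n} → Graph n → (Fin n → Bool) → Fin n → ℕ
degIn G Y v = count (λ u → adj G v u ∧ Y u)

size : ∀ {n} → (Fin n → Bool) → ℕ
size Y = count Y

-- Twice the number of edges within Y
degSum : ∀ {n} → Graph n → (Fin n → Bool) → ℕ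
degSum G Y = ∑ (λ v → b2n (Y v) * degIn G Y v)

remove : ∀ {n} → (Fin n → Bool) → Fin n → Fin n → Bool
remove Y v u = Y u ∧ not (u == v)

remove-at : ∀ {n} (Y : Fin n → Bool) v → remove Y v v ≡ false
remove-at Y v rewrite ==-refl v with Y v
... | true = refl
... | false = refl

remove-off : ∀ {n} (Y : Fin n → Bool) {u v} → u ≢ v → remove Y v u ≡ Y u
remove-off Y {u} ne rewrite ==-false ne with Y u
... | true = refl
... | false = refl

remove-⊆ : ∀ {n} (Y : Fin n → Bool) {u v} → remove Y v u ≡ true → Y u ≡ true
remove-⊆ Y e = proj₁ (∧-true e)

∑-remove : ∀ {n} (Y : Fin n → Bool) (f : Fin n → ℕ) {v} → Y v ≡ true →
           ∑ (λ u → b2n (Y u) * f u) ≡ ∑ (λ u → b2n (remove Y v u) * f u) + f v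
∑-remove Y f {v} y = trans (trans (sym (+-identityʳ _)) (cong (λ t → ∑ (λ u → b2n (Y u) * f u) + b2n t * f v) (sym (remove-at Y v))))
  (trans (∑-update v _ _ (λ u ne → cong (λ t → b2n t * f u) (sym (remove-off Y ne))))
         (cong (∑ (λ u → b2n (remove Y v u) * f u) +_) (trans (cong (λ t → b2n t * f v) y) (*-identityˡ (f v)))))

size-remove : ∀ {n} (Y : Fin n → Bool) {v} → Y v ≡ true → size Y ≡ suc (size (remove Y v))
size-remove Y {v} y = trans (∑-cong (λ u → sym (*-identityʳ _))) (trans (∑-remove Y (λ _ → 1) y)
  (trans (cong (_+ 1) (∑-cong (λ u → *-identityʳ _))) (+-comm _ 1)))

module _ {n} (G : Graph n) where

  degIn-remove : ∀ (Y : Fin n → Bool) {v} u → Y v ≡ true → degIn G Y u ≡ degIn G (remove Y v) u + b2n (adj G u v)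
  degIn-remove Y {v} u y = trans (∑-cong pt) (trans (∑-remove Y (λ x → b2n (adj G u x)) y) (cong (_+ b2n (adj G u v)) (sym (∑-cong pt′))))
    where
    comm : ∀ a b → b2n (a ∧ b) ≡ b2n b * b2n a
    comm true  true  = refl
    comm true  false = refl
    comm false true  = refl
    comm false false = refl
    pt : ∀ x → b2n (adj G u x ∧ Y x) ≡ b2n (Y x) * b2n (adj G u x)
    pt x = comm (adj G u x) (Y x)
    pt′ : ∀ x → b2n (adj G u x ∧ remove Y v x) ≡ b2n (remove Y v x) * b2n (adj G u x)
    pt′ x = comm (adj G u x) (remove Y v x)

  degIn-mono : ∀ {Y Z : Fin n → Bool} v → (∀ u → Y u ≡ true → Z u ≡ true) → degIn G Y v ≤ degIn G Z v
  degIn-mono v h = ∑-mono λ u → b2n-mono λ e → ∧-intro (proj₁ (∧-true e)) (h u (proj₂ (∧-true {adj G v u} e)))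

  degSum-remove : ∀ (Y : Fin n → Bool) {v} → Y v ≡ true → degSum G Y ≡ degSum G (remove Y v) + (degIn G Y v + degIn G Y v)
  degSum-remove Y {v} y = begin
    degSum G Y                                                    ≡⟨ ∑-cong (λ u → trans (cong (b2n (Y u) *_) (degIn-remove Y u y)) (*-distribˡ-+ (b2n (Y u)) _ _)) ⟩
    ∑ (λ u → b2n (Y u) * d u + b2n (Y u) * b2n (adj G u v))       ≡⟨ ∑-+ _ _ ⟩
    ∑ (λ u → b2n (Y u) * d u) + ∑ (λ u → b2n (Y u) * b2n (adj G u v)) ≡⟨ cong₂ _+_ (∑-remove Y d y) (∑-cong swap) ⟩
    (degSum G (remove Y v) + d v) + degIn G Y v                   ≡⟨ +-assoc (degSum G (remove Y v)) (d v) _ ⟩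
    degSum G (remove Y v) + (d v + degIn G Y v)                   ≡⟨ cong (λ t → degSum G (remove Y v) + (t + degIn G Y v)) (sym dv) ⟩
    degSum G (remove Y v) + (degIn G Y v + degIn G Y v)           ∎
    where
    open ≡-Reasoning
    d : Fin n → ℕ
    d = degIn G (remove Y v)
    dv : degIn G Y v ≡ d v
    dv = trans (degIn-remove Y v y) (trans (cong (λ t → d v + b2n t) (irrefl G v)) (+-identityʳ _))
    swap : ∀ u → b2n (Y u) * b2n (adj G u v) ≡ b2n (adj G v u ∧ Y u)
    swap u rewrite Graph.sym G u v with Y u | adj G v u
    ... | true  | true  = refl
    ... | true  | false = refl
    ... | false | true  = refl
    ... | false | false = refl

-- A smallest vertex set Y whose edges outweigh those leaving it has the local property required by the colouring
-- theorems, relative to a colouring of the rest of U.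
module Peel {n} (G : Graph n) (U : Fin n → Bool) (k α ε : ℕ) where

  -- The local condition weighs degrees by `α`, tight neighbours by `ε` and list sizes by `β`. Since
  -- `β = α + δ`, the weight left for edges inside `Y` is `α`; since `δ` exceeds `ε` by one, a
  -- vertex with deficit one that loses an edge has surplus `ε`.
  β δ : ℕ
  β = α + suc ε
  δ = suc ε

  -- For `Y` inside `U`, with `e` edges inside and `f` edges to the rest of `U`, half of `X Y < Z Y`
  -- reads `(2 * β - δ) * e + β * f < β * k * size Y`.
  X Z : (Fin n → Bool) → ℕ
  X Y = 2 * β * ∑ (λ v → b2n (Y v) * degIn G U v)
  Z Y = 2 * (β * k) * size Y + δ * degSum G Y

  X-remove : ∀ Y {v} → Y v ≡ true → X Y ≡ X (remove Y v) + 2 * (β * degIn G U v)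
  X-remove Y {v} y = trans (cong (2 * β *_) (∑-remove Y (degIn G U) y)) (trans (*-distribˡ-+ (2 * β) _ (degIn G U v))
    (cong (X (remove Y v) +_) (*-assoc 2 β (degIn G U v))))

  Z-remove : ∀ Y {v} → Y v ≡ true → Z Y ≡ Z (remove Y v) + 2 * (β * k + δ * degIn G Y v)
  Z-remove Y {v} y = trans (cong₂ (λ p q → 2 * (β * k) * p + δ * q) (size-remove Y y) (degSum-remove G Y y))
    (lem (β * k) δ (size (remove Y v)) (degSum G (remove Y v)) (degIn G Y v))
    where
    lem : ∀ b d s D e → 2 * b * suc s + d * (D + (e + e)) ≡ (2 * b * s + d * D) + 2 * (b + d * e)
    lem = solve-∀

  record Minimal (Y : Fin n → Bool) : Set where
    field
      Y⊆U  : ∀ {u} → Y u ≡ true → U u ≡ true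
      X<Z  : X Y < Z Y
      least : ∀ W → (∀ {u} → W u ≡ true → U u ≡ true) → size W < size Y → Z W ≤ X W

  minimal : X U < Z U → ¬ ¬ (Σ (Fin n → Bool) Minimal)
  minimal lt r = ¬¬-minimal {A = Σ (Fin n → Bool) λ Y → (∀ {u} → Y u ≡ true → U u ≡ true) × X Y < Z Y}
    (size ∘ proj₁) (U , (λ e → e) , lt) λ ((Y , s , l) , mn) → r (Y , record
      { Y⊆U = s ; X<Z = l ; least = λ W sW lW → ≮⇒≥ λ l′ → <⇒≱ lW (mn (W , sW , l′)) })

  -- Equality in the bound that minimality gives for a single vertex, see `star₀`. By
  -- `tight-saturated` the tight vertices are among these.
  saturated : (Fin n → Bool) → Fin n → Bool
  saturated Y u = Y u ∧ (β * degIn G U u + 1 ≡ᵇ β * k + δ * degIn G Y u)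

  module _ {Y} (M : Minimal Y) where

    open Minimal M

    -- Removing a vertex of `T` lowers `X` by at least `2 * ε` more than `Z`, also after earlier
    -- removals; and what remains, being smaller than `Y`, has `Z ≤ X`.
    shed : ∀ W T → (∀ {u} → W u ≡ true → Y u ≡ true) → size W < size Y → Unique T →
           (∀ {u} → u ∈ T → W u ≡ true × β * k + δ * degIn G W u + ε ≤ β * degIn G U u) →
           Z W + 2 * (ε * length T) ≤ X W
    shed W [] s lt un h = ≤-trans (≤-reflexive (trans (cong (λ t → Z W + 2 * t) (*-zeroʳ ε)) (+-identityʳ _))) (least W (Y⊆U ∘ s) lt)
    shed W (u ∷ T) s lt un h = begin
      Z W + 2 * (ε * suc (length T))        ≡⟨ cong (_+ 2 * (ε * suc (length T))) (Z-remove W wu) ⟩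
      Z W′ + 2 * (β * k + δ * degIn G W u) + 2 * (ε * suc (length T)) ≡⟨ lem (Z W′) (β * k + δ * degIn G W u) ε (length T) ⟩
      (Z W′ + 2 * (ε * length T)) + 2 * (β * k + δ * degIn G W u + ε) ≤⟨ +-mono-≤ (shed W′ T (s ∘ remove-⊆ W) smaller (Unique-tail un) h′) (*-monoʳ-≤ 2 (proj₂ (h (here refl)))) ⟩
      X W′ + 2 * (β * degIn G U u)          ≡⟨ sym (X-remove W wu) ⟩
      X W                                   ∎
      where
      open ≤-Reasoning
      W′ = remove W u
      wu = proj₁ (h (here refl))
      smaller : size W′ < size Y
      smaller = ≤-trans (≤-reflexive (sym (size-remove W wu))) (<⇒≤ lt)
      h′ : ∀ {x} → x ∈ T → W′ x ≡ true × β * k + δ * degIn G W′ x + ε ≤ β * degIn G U x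
      h′ {x} i = trans (remove-off W λ { refl → Unique-head un i }) (proj₁ (h (there i))) ,
        ≤-trans (+-monoˡ-≤ ε (+-monoʳ-≤ (β * k) (*-monoʳ-≤ δ (degIn-mono G x λ _ → remove-⊆ W)))) (proj₂ (h (there i)))
      lem : ∀ z a e l → z + 2 * a + 2 * (e * suc l) ≡ (z + 2 * (e * l)) + 2 * (a + e)
      lem = solve-∀

    -- Once `v` is removed, each saturated neighbour has lost an edge worth `δ` and so has surplus
    -- `ε`; all of them can then be shed.
    star : ∀ {v} → Y v ≡ true → β * degIn G U v + ε * count (λ u → adj G v u ∧ saturated Y u) < β * k + δ * degIn G Y v
    star {v} y = *-cancelˡ-< 2 _ _ (+-cancelˡ-< (Z W) _ _ (begin-strict
      Z W + 2 * (β * degIn G U v + ε * count p)          ≡⟨ lem (Z W) (β * degIn G U v) (ε * count p) ⟩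
      Z W + 2 * (ε * count p) + 2 * (β * degIn G U v)    ≡⟨ cong (λ t → Z W + 2 * (ε * t) + 2 * (β * degIn G U v)) (sym (sat-length p)) ⟩
      Z W + 2 * (ε * length (sat p)) + 2 * (β * degIn G U v) ≤⟨ +-monoˡ-≤ _ (shed W (sat p) (remove-⊆ Y) (≤-reflexive (sym (size-remove Y y))) (sat-unique p) facts) ⟩
      X W + 2 * (β * degIn G U v)                        ≡⟨ sym (X-remove Y y) ⟩
      X Y                                                <⟨ X<Z ⟩
      Z Y                                                ≡⟨ Z-remove Y y ⟩
      Z W + 2 * (β * k + δ * degIn G Y v)                ∎))
      where
      open ≤-Reasoning
      W = remove Y v
      p : Fin n → Bool
      p u = adj G v u ∧ saturated Y u
      lem : ∀ z a b → z + 2 * (a + b) ≡ z + 2 * b + 2 * a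
      lem = solve-∀
      facts : ∀ {u} → u ∈ sat p → W u ≡ true × β * k + δ * degIn G W u + ε ≤ β * degIn G U u
      facts {u} i = trans (remove-off Y λ { refl → adj-≢ G ea refl }) (proj₁ (∧-true su)) , ≤-reflexive (suc-injective (trans (lem₂ (β * k) ε (degIn G W u)) eq))
        where
        ea = proj₁ (∧-true {adj G v u} (∈-sat p i))
        su : saturated Y u ≡ true
        su = proj₂ (∧-true {adj G v u} (∈-sat p i))
        lem₂ : ∀ b e d → suc (b + suc e * d + e) ≡ b + suc e * (d + 1)
        lem₂ = solve-∀
        eq : β * k + δ * (degIn G W u + 1) ≡ suc (β * degIn G U u)
        eq = trans (cong (λ t → β * k + δ * t) (trans (cong (λ b → degIn G W u + b2n b) (sym (trans (Graph.sym G u v) ea))) (sym (degIn-remove G Y u y))))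
          (trans (sym (≡ᵇ-true {β * degIn G U u + 1} (proj₂ (∧-true {Y u} su)))) (+-comm _ 1))

-- Finite search turns the classical existence of a colouring into a colouring.

cons : ∀ {n} {A : Set} → A → (Fin n → A) → Fin (suc n) → A
cons a f zero    = a
cons a f (suc i) = f i

-- Functions are rebuilt value by value, so `P` has to respect pointwise equality.
search : ∀ {n} (L : Fin n → List ℕ) (P : (Fin n → ℕ) → Set) → (∀ c → Dec (P c)) →
         (∀ {c c′} → (∀ i → c i ≡ c′ i) → P c → P c′) → Dec (Σ (Fin n → ℕ) λ c → (∀ i → c i ∈ L i) × P c)
search {zero} L P P? resp with P? (λ ())
... | yes p = yes ((λ ()) , (λ ()) , p)
... | no np = no λ (c , _ , p) → np (resp (λ ()) p)
search {suc n} L P P? resp with any? (λ a → search (L ∘ suc) (P ∘ cons a) (P? ∘ cons a) (λ h → resp λ { zero → refl ; (suc i) → h i })) (L zero)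
... | yes h = let (a , i , c , j , p) = find h in yes (cons a c , (λ { zero → i ; (suc u) → j u }) , p)
... | no nh = no λ (c , j , p) → nh (lose (j zero) (c ∘ suc , j ∘ suc , resp (λ { zero → refl ; (suc i) → refl }) p))

first : ∀ {n} → (Fin n → Bool) → ℕ
first {zero}  p = 0
first {suc n} p = if p zero then 0 else suc (first (p ∘ suc))

first-cong : ∀ {n} {p q : Fin n → Bool} → (∀ i → p i ≡ q i) → first p ≡ first q
first-cong {zero}  h = refl
first-cong {suc n} {p} {q} h rewrite h zero = cong (λ t → if q zero then 0 else suc t) (first-cong {p = p ∘ suc} {q ∘ suc} (h ∘ suc))

first-∈ : ∀ {n} (p : Fin n → Bool) {i} → p i ≡ true → Σ (Fin n) λ j → p j ≡ true × toℕ j ≡ first p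
first-∈ {suc n} p {i} e with p zero in e₀
... | true = zero , e₀ , refl
first-∈ {suc n} p {zero} e | false = ⊥-elim (true≢false e e₀)
first-∈ {suc n} p {suc i} e | false = let (j , pj , q) = first-∈ (p ∘ suc) e in suc j , pj , cong suc q

module _ {n} (G : Graph n) (N : ℕ) where

  -- Clustering quantifies over all lists of reachable vertices. A labelling that is constant on
  -- components and has small classes certifies the same bound by finitely many checks.
  Labels : Colouring n → (Fin n → ℕ) → Set
  Labels c lab = (∀ u w → adj G u w ≡ true → c u ≡ c w → lab u ≡ lab w) × (∀ v → count (λ u → lab u ≡ᵇ lab v) ≤ N)

  vertices : Fin n → List ℕ
  vertices _ = map toℕ (allFin n)

  Labelled : Colouring n → Set
  Labelled c = Σ (Fin n → ℕ) λ lab → (∀ v → lab v ∈ vertices v) × Labels c lab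

  Labels? : ∀ c lab → Dec (Labels c lab)
  Labels? c lab = Fin.all? (λ u → Fin.all? λ w → (adj G u w Bool.≟ true) →-dec ((c u ≟ c w) →-dec (lab u ≟ lab w)))
    ×-dec Fin.all? (λ v → _ ≤? N)
    where open import Relation.Nullary.Decidable using (_→-dec_)

  Labelled? : ∀ c → Dec (Labelled c)
  Labelled? c = search vertices (Labels c) (Labels? c) λ {l} {l′} h (p , q) →
    (λ u w e m → trans (sym (h u)) (trans (p u w e m) (h w))) ,
    λ v → ≤-trans (≤-reflexive (∑-cong λ u → cong₂ (λ x y → b2n (x ≡ᵇ y)) (sym (h u)) (sym (h v)))) (q v)

  labelled-clustering : ∀ {c} → Labelled c → HasClustering G c N
  labelled-clustering {c} (lab , _ , p , q) v ws un rs = ≤-trans (list≤count (λ u → lab u ≡ᵇ lab v) un λ {u} i →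
    subst (λ t → (t ≡ᵇ lab v) ≡ true) (reach-within {S = λ u → lab v ≡ lab u} (λ {z} {u} e (a , m) → trans e (p z u a m)) refl (All.lookup rs i)) (≡ᵇ-refl (lab v))) (q v)

  -- The label of a vertex is the least vertex of its component.
  clustering-labelled : ∀ {c} → HasClustering G c N → ¬ ¬ Labelled c
  clustering-labelled {c} h k = ¬¬-Fin {P = λ v → ∀ u → Dec (MonoReach G c v u)} (λ v → ¬¬-Fin (λ u → em)) λ R →
    let r : Fin n → Fin n → Bool
        r v u = ⌊ R v u ⌋
        r-true : ∀ {v u} → r v u ≡ true → MonoReach G c v u
        r-true {v} {u} e = dec-true (R v u) e
        true-r : ∀ {v u} → MonoReach G c v u → r v u ≡ true
        true-r {v} {u} x = true-dec (R v u) x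
    in k ((λ v → first (r v)) ,
      (λ v → let (j , _ , q) = first-∈ (r v) {v} (true-r here) in subst (_∈ vertices v) q (∈-map⁺ toℕ (∈-allFin j))) ,
      (λ u w e m → first-cong {p = r u} {r w} λ i → iff (λ t → true-r (reach-cons (Mono-sym G (e , m)) (r-true t))) (λ t → true-r (reach-cons (e , m) (r-true t)))) ,
      λ v → ≤-trans (≤-reflexive (sym (sat-length _))) (h v _ (sat-unique _) (All.tabulate λ {u} i →
        let (j , pj , q) = first-∈ (r v) {v} (true-r here)
            (j′ , pj′ , q′) = first-∈ (r u) {u} (true-r here)
            same : j′ ≡ j
            same = Fin.toℕ-injective (trans q′ (trans (≡ᵇ-true {first (r u)} (∈-sat _ i)) (sym q)))
        in reach-trans (r-true pj) (reach-sym (subst (MonoReach G c u) same (r-true pj′))))))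
    where
    dec-true : ∀ {A : Set} (d : Dec A) → ⌊ d ⌋ ≡ true → A
    dec-true (yes a) _ = a
    dec-true (no _) ()
    true-dec : ∀ {A : Set} (d : Dec A) → A → ⌊ d ⌋ ≡ true
    true-dec (yes _) _ = refl
    true-dec (no na) a = ⊥-elim (na a)
    iff : ∀ {a b} → (a ≡ true → b ≡ true) → (b ≡ true → a ≡ true) → a ≡ b
    iff {true} f g = sym (f refl)
    iff {false} {true} f g = g refl
    iff {false} {false} f g = refl

  find-clustering : ∀ L → ¬ ¬ (Σ (Colouring n) λ c → IsLColouring L c × HasClustering G c N) →
                    Σ (Colouring n) λ c → IsLColouring L c × HasClustering G c N
  find-clustering L nn with search L Labelled Labelled? (λ h (lab , i , p , q) → lab , i , (λ u w e m → p u w e (trans (h u) (trans m (sym (h w))))) , q)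
  ... | yes (c , l , x) = c , l , labelled-clustering x
  ... | no none = ⊥-elim (nn λ (c , l , x) → clustering-labelled x λ y → none (c , l , y))

find-defect : ∀ {n} (G : Graph n) d L → ¬ ¬ (Σ (Colouring n) λ c → IsLColouring L c × HasDefect G c d) →
              Σ (Colouring n) λ c → IsLColouring L c × HasDefect G c d
find-defect G d L = decidable-stable (search L (λ c → HasDefect G c d) (λ c → Fin.all? λ v → _ ≤? d)
  λ {c} {c′} h p v → ≤-trans (≤-reflexive (trans (sat-length _) (trans (∑-cong λ u → cong₂ (λ x y → b2n (adj G v u ∧ (x ≡ᵇ y))) (sym (h u)) (sym (h v))) (sym (sat-length _))))) (p v))

-- Colourings of sparse graphs from local colouring theorems

-- Defect and clustering depend only on the monochromatic subgraph, so they can be verified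
-- separately on two sides joined by no monochromatic edge.
record Gluable {n} (Q : Graph n → Colouring n → Set) : Set where
  field
    glue  : ∀ {G₁ c₁ G₂ c₂ G c} (Y : Fin n → Bool) → Q G₁ c₁ → Q G₂ c₂ →
            (∀ {u w} → Mono G c u w → Y u ≡ true → Y w ≡ true × Mono G₁ c₁ u w) →
            (∀ {u w} → Mono G c u w → Y u ≡ false → Y w ≡ false × Mono G₂ c₂ u w) → Q G c
    empty : ∀ {G c} → (∀ {u w} → ¬ Mono G c u w) → Q G c

clustering-gluable : ∀ {n} N → 1 ≤ N → Gluable {n} (λ G c → HasClustering G c N)
clustering-gluable {n} N 1≤N = record { glue = glue ; empty = empty }
  where
  glue : ∀ {G₁ c₁ G₂ c₂ G c} (Y : Fin n → Bool) → HasClustering G₁ c₁ N → HasClustering G₂ c₂ N →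
            (∀ {u w} → Mono G c u w → Y u ≡ true → Y w ≡ true × Mono G₁ c₁ u w) →
            (∀ {u w} → Mono G c u w → Y u ≡ false → Y w ≡ false × Mono G₂ c₂ u w) → HasClustering G c N
  glue {G₁} {c₁} {G₂} {c₂} {G} {c} Y q₁ q₂ h₁ h₂ v ws un rs with Y v in e
  ... | true  = q₁ v ws un (All.map (λ r → proj₂ (reach-within {S = λ u → Y u ≡ true × MonoReach G₁ c₁ v u} (λ (y , s) m → proj₁ (h₁ m y) , step s (proj₂ (h₁ m y))) (e , here) r)) rs)
  ... | false = q₂ v ws un (All.map (λ r → proj₂ (reach-within {S = λ u → Y u ≡ false × MonoReach G₂ c₂ v u} (λ (y , s) m → proj₁ (h₂ m y) , step s (proj₂ (h₂ m y))) (e , here) r)) rs)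
  empty : ∀ {G c} → (∀ {u w} → ¬ Mono G c u w) → HasClustering G c N
  empty no-edge v ws un rs = ≤-trans (Unique-⊆-length ws {v ∷ []} un (λ i → here (sym (reach-within {S = v ≡_} (λ _ m → ⊥-elim (no-edge m)) refl (All.lookup rs i))))) 1≤N

defect-gluable : ∀ {n} d → Gluable {n} (λ G c → HasDefect G c d)
defect-gluable {n} d = record
  { glue = λ {G₁} {c₁} {G₂} {c₂} {G} {c} → glue {G₁} {c₁} {G₂} {c₂} {G} {c} ; empty = λ {G} {c} → empty {G} {c} }
  where
  deg≤ : ∀ {G c G′ c′} v → (∀ {u} → Mono G c v u → Mono G′ c′ v u) → monoDeg G c v ≤ monoDeg G′ c′ v
  deg≤ {G} {c} {G′} {c′} v h = subst₂ _≤_ (sym (sat-length _)) (sym (sat-length _)) (∑-mono λ u → b2n-mono λ e →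
    let (ea , q) = nbr-colour⁻ G c {v} {u} {c v} e ; (ea′ , q′) = h (ea , sym q) in nbr-colour G′ c′ ea′ (sym q′))
  glue : ∀ {G₁ c₁ G₂ c₂ G c} (Y : Fin n → Bool) → HasDefect G₁ c₁ d → HasDefect G₂ c₂ d →
            (∀ {u w} → Mono G c u w → Y u ≡ true → Y w ≡ true × Mono G₁ c₁ u w) →
            (∀ {u w} → Mono G c u w → Y u ≡ false → Y w ≡ false × Mono G₂ c₂ u w) → HasDefect G c d
  glue {G₁} {c₁} {G₂} {c₂} {G} {c} Y q₁ q₂ h₁ h₂ v with Y v in e
  ... | true  = ≤-trans (deg≤ {G} {c} {G₁} {c₁} v (λ m → proj₂ (h₁ m e))) (q₁ v)
  ... | false = ≤-trans (deg≤ {G} {c} {G₂} {c₂} v (λ m → proj₂ (h₂ m e))) (q₂ v)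
  empty : ∀ {G c} → (∀ {u w} → ¬ Mono G c u w) → HasDefect G c d
  empty {G} {c} no-edge v = ≤-trans (≤-reflexive (trans (sat-length _) (count-false _ λ u → not-true λ e →
    let (ea , q) = nbr-colour⁻ G c {v} {u} {c v} e in no-edge {v} {u} (ea , sym q)))) z≤n

module Assemble {n} (G : Graph n) (L : Fin n → List ℕ) (uq : ∀ v → Unique (L v)) (k : ℕ) (len : ∀ v → length (L v) ≡ k) (1≤k : 1 ≤ k)
                (α ε : ℕ) (dense : ∀ U → 1 ≤ size U → Peel.X G U k α ε U < Peel.Z G U k α ε U)
                (Q : Graph n → Colouring n → Set) (gl : Gluable Q)
                (local : ∀ H L′ → (∀ v → Unique (L′ v)) → (∀ v → length (L′ v) ≤ k) →
                  (∀ v → α * deg H v + ε * count (λ u → adj H v u ∧ (α * deg H u + 1 ≡ᵇ (α + suc ε) * length (L′ u))) + 1 ≤ (α + suc ε) * length (L′ v)) →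
                  ∀ c → IsLColouring L′ c → ¬ ¬ (Σ (Colouring n) λ c′ → IsLColouring L′ c′ × Q H c′)) where

  open Gluable gl

  Coloured : (Fin n → Bool) → Set
  Coloured U = Σ (Colouring n) λ c → (∀ {v} → U v ≡ true → c v ∈ L v) × Q (induce G U) c

  some-colour : (xs : List ℕ) → 1 ≤ length xs → Σ ℕ (_∈ xs)
  some-colour (x ∷ xs) _ = x , here refl

  module Step (U Y : Fin n → Bool) (M : Peel.Minimal G U k α ε Y) (c₁ : Colouring n) where

    open Peel G U k α ε
    open Minimal M

    rest : Fin n → Bool
    rest u = U u ∧ not (Y u)

    H : Graph n
    H = induce G Y

    outer : Fin n → List ℕ
    outer v = map c₁ (sat (λ u → adj G v u ∧ rest u))

    open import Data.List.Membership.DecPropositional _≟_ using (_∈?_)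

    -- `H` keeps all `n` vertices, those outside `Y` being isolated; a dummy list of one colour
    -- satisfies the local condition there.
    L′ : Fin n → List ℕ
    L′ v = if Y v then filter (λ a → ¬? (a ∈? outer v)) (L v) else 0 ∷ []

    L′-in : ∀ {v} → Y v ≡ true → L′ v ≡ filter (λ a → ¬? (a ∈? outer v)) (L v)
    L′-in y rewrite y = refl

    L′-unique : ∀ v → Unique (L′ v)
    L′-unique v with Y v
    ... | true  = Unique.filter⁺ (λ a → ¬? (a ∈? outer v)) (uq v)
    ... | false = [] ∷ []

    L′-length : ∀ v → length (L′ v) ≤ k
    L′-length v with Y v
    ... | true  = ≤-trans (length-filter (λ a → ¬? (a ∈? outer v)) (L v)) (≤-reflexive (len v))
      where open import Data.List.Properties using (length-filter)
    ... | false = 1≤k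

    out : Fin n → ℕ
    out v = count (λ u → adj G v u ∧ rest u)

    degIn-split : ∀ v → degIn G U v ≡ degIn G Y v + out v
    degIn-split v = trans (∑-cong pt) (∑-+ _ _)
      where
      pt : ∀ u → b2n (adj G v u ∧ U u) ≡ b2n (adj G v u ∧ Y u) + b2n (adj G v u ∧ rest u)
      pt u with adj G v u | Y u in y | U u in e
      ... | false | _     | _     = refl
      ... | true  | true  | true  = refl
      ... | true  | true  | false = ⊥-elim (true≢false (Y⊆U y) e)
      ... | true  | false | true  = refl
      ... | true  | false | false = refl

    room : ∀ {v} → Y v ≡ true → k ≤ length (L′ v) + out v
    room {v} y = subst₂ _≤_ (len v) eq (Unique-⊆-length (L v) {L′ v ++ outer v} (uq v) λ {a} i → split i (a ∈? outer v))
      where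
      eq : length (L′ v ++ outer v) ≡ length (L′ v) + out v
      eq = trans (length-++ (L′ v)) (cong (length (L′ v) +_) (trans (length-map c₁ (sat (λ u → adj G v u ∧ rest u))) (sat-length _)))
      split : ∀ {a} → a ∈ L v → Dec (a ∈ outer v) → a ∈ L′ v ++ outer v
      split i (yes o) = ∈-++⁺ʳ (L′ v) o
      split i (no no′) = ∈-++⁺ˡ (subst (_ ∈_) (sym (L′-in y)) (∈-filter⁺ (λ a → ¬? (a ∈? outer v)) i no′))

    deg-in : ∀ {v} → Y v ≡ true → deg H v ≡ degIn G Y v
    deg-in {v} y = ∑-cong λ u → cong (λ t → b2n (adj G v u ∧ (t ∧ Y u))) y

    tightH : Fin n → Bool
    tightH u = α * deg H u + 1 ≡ᵇ β * length (L′ u)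

    star₀ : ∀ {v} → Y v ≡ true → β * degIn G U v + 1 ≤ β * k + δ * degIn G Y v
    star₀ {v} y = ≤-trans (≤-trans (≤-reflexive (+-comm _ 1)) (s≤s (m≤m+n _ _))) (star M y)

    widen : ∀ {v} → Y v ≡ true → β * k + δ * degIn G Y v ≤ β * length (L′ v) + (β * out v + δ * degIn G Y v)
    widen {v} y = ≤-trans (+-monoˡ-≤ _ (≤-trans (*-monoʳ-≤ β (room y)) (≤-reflexive (*-distribˡ-+ β (length (L′ v)) (out v)))))
      (≤-reflexive (+-assoc (β * length (L′ v)) _ _))

    regroup : ∀ v x → α * degIn G Y v + x + (β * out v + δ * degIn G Y v) ≡ β * degIn G U v + x
    regroup v x = trans (lem α (suc ε) (degIn G Y v) (out v) x) (cong (λ t → β * t + x) (sym (degIn-split v)))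
      where
      lem : ∀ a d y o x → a * y + x + ((a + d) * o + d * y) ≡ (a + d) * (y + o) + x
      lem = solve-∀

    -- Tightness bounds `β * k + δ * degIn G Y u` from above by the very number that `star₀` puts
    -- below it.
    tight-saturated : ∀ {u} → Y u ≡ true → tightH u ≡ true → saturated Y u ≡ true
    tight-saturated {u} y t = ∧-intro y (subst (λ s → (β * degIn G U u + 1 ≡ᵇ s) ≡ true) (≤-antisym (star₀ y) (begin
      β * k + δ * degIn G Y u                                  ≤⟨ widen y ⟩
      β * length (L′ u) + (β * out u + δ * degIn G Y u)        ≡⟨ cong (_+ (β * out u + δ * degIn G Y u)) (sym (≡ᵇ-true {α * deg H u + 1} t)) ⟩
      α * deg H u + 1 + (β * out u + δ * degIn G Y u)          ≡⟨ cong (λ s → α * s + 1 + (β * out u + δ * degIn G Y u)) (deg-in y) ⟩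
      α * degIn G Y u + 1 + (β * out u + δ * degIn G Y u)      ≡⟨ regroup u 1 ⟩
      β * degIn G U u + 1                                      ∎)) (≡ᵇ-refl (β * degIn G U u + 1)))
      where open ≤-Reasoning

    hyp : ∀ v → α * deg H v + ε * count (λ u → adj H v u ∧ tightH u) + 1 ≤ β * length (L′ v)
    hyp v = go (Y v) refl
      where
      open ≤-Reasoning
      go : ∀ b → Y v ≡ b → α * deg H v + ε * count (λ u → adj H v u ∧ tightH u) + 1 ≤ β * length (L′ v)
      -- Adding this term to both sides avoids subtracting `out v` from `k`.
      go true y = +-cancelʳ-≤ (β * out v + δ * degIn G Y v) _ _ (begin
        α * deg H v + ε * count (λ u → adj H v u ∧ tightH u) + 1 + (β * out v + δ * degIn G Y v)
          ≡⟨ cong₂ (λ s t → s + t) (trans (+-assoc (α * deg H v) _ 1) (cong (λ s → α * s + (ε * count (λ u → adj H v u ∧ tightH u) + 1)) (deg-in y))) refl ⟩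
        α * degIn G Y v + (ε * count (λ u → adj H v u ∧ tightH u) + 1) + (β * out v + δ * degIn G Y v)
          ≡⟨ regroup v _ ⟩
        β * degIn G U v + (ε * count (λ u → adj H v u ∧ tightH u) + 1)
          ≤⟨ +-monoʳ-≤ (β * degIn G U v) (+-monoˡ-≤ 1 (*-monoʳ-≤ ε (∑-mono λ u → b2n-mono (sub u)))) ⟩
        β * degIn G U v + (ε * count (λ u → adj G v u ∧ saturated Y u) + 1)
          ≡⟨ trans (sym (+-assoc (β * degIn G U v) _ 1)) (+-comm _ 1) ⟩
        suc (β * degIn G U v + ε * count (λ u → adj G v u ∧ saturated Y u))
          ≤⟨ star M y ⟩
        β * k + δ * degIn G Y v
          ≤⟨ widen y ⟩
        β * length (L′ v) + (β * out v + δ * degIn G Y v) ∎)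
        where
        sub : ∀ u → (adj H v u ∧ tightH u) ≡ true → (adj G v u ∧ saturated Y u) ≡ true
        sub u e = let (a , t) = ∧-true {adj H v u} e ; (a₁ , a₂) = ∧-true {adj G v u} a in
          ∧-intro a₁ (tight-saturated (proj₂ (∧-true {Y v} a₂)) t)
      go false y = begin
        α * deg H v + ε * count (λ u → adj H v u ∧ tightH u) + 1
          ≡⟨ cong₂ (λ s t → α * s + ε * t + 1) (count-false _ no-edge) (count-false _ λ u → cong (_∧ tightH u) (no-edge u)) ⟩
        α * 0 + ε * 0 + 1     ≡⟨ cong₂ (λ s t → s + t + 1) (*-zeroʳ α) (*-zeroʳ ε) ⟩
        1                     ≤⟨ ≤-trans (s≤s z≤n) (m≤n+m (suc ε) α) ⟩
        β                     ≡⟨ sym (*-identityʳ β) ⟩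
        β * 1                 ≡⟨ cong (λ xs → β * length xs) (sym L′-out) ⟩
        β * length (L′ v)     ∎
        where
        no-edge : ∀ u → adj H v u ≡ false
        no-edge u rewrite y = ∧-zeroʳ (adj G v u)
        L′-out : L′ v ≡ 0 ∷ []
        L′-out rewrite y = refl

    nonempty : ∀ v → 1 ≤ length (L′ v)
    nonempty v = n≢0⇒n>0 λ e → <⇒≱ (s≤s z≤n) (≤-trans (m≤n+m 1 _) (≤-trans (hyp v) (≤-reflexive (trans (cong (β *_) e) (*-zeroʳ β)))))

    join : Σ (Colouring n) (λ c → IsLColouring L′ c × Q H c) → (∀ {v} → rest v ≡ true → c₁ v ∈ L v) → Q (induce G rest) c₁ → Coloured U
    join (c₂ , l₂ , q₂) l₁ q₁ = c , c-L , glue Y q₂ q₁ inside outside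
      where
      c : Colouring n
      c v = if Y v then c₂ v else c₁ v
      c-in : ∀ {v} → Y v ≡ true → c v ≡ c₂ v
      c-in y rewrite y = refl
      c-out : ∀ {v} → Y v ≡ false → c v ≡ c₁ v
      c-out y rewrite y = refl
      fresh₂ : ∀ {v} → Y v ≡ true → c₂ v ∈ L v × c₂ v ∉ outer v
      fresh₂ {v} y = ∈-filter⁻ (λ a → ¬? (a ∈? outer v)) {xs = L v} (subst (c₂ v ∈_) (L′-in y) (l₂ v))
      c-L : ∀ {v} → U v ≡ true → c v ∈ L v
      c-L {v} uv = go (Y v) refl
        where
        go : ∀ b → Y v ≡ b → c v ∈ L v
        go true y = subst (_∈ L v) (sym (c-in y)) (proj₁ (fresh₂ y))
        go false y = subst (_∈ L v) (sym (c-out y)) (l₁ (∧-intro uv (cong not y)))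
      cross : ∀ {u w} → adj G u w ≡ true → U w ≡ true → Y u ≡ true → Y w ≡ false → c u ≢ c w
      cross {u} {w} ea uw yu yw q = proj₂ (fresh₂ yu) (subst (_∈ outer u) (trans (sym (c-out yw)) (trans (sym q) (c-in yu)))
        (∈-map⁺ c₁ (sat-∈ {p = λ x → adj G u x ∧ rest x} (∧-intro ea (∧-intro uw (cong not yw))))))
      edge : ∀ {u w} → adj (induce G U) u w ≡ true → adj G u w ≡ true × U u ≡ true × U w ≡ true
      edge {u} {w} e = let (a , b) = ∧-true {adj G u w} e ; (p , q) = ∧-true {U u} b in a , p , q
      inside : ∀ {u w} → Mono (induce G U) c u w → Y u ≡ true → Y w ≡ true × Mono H c₂ u w
      inside {u} {w} (e , q) yu = go (Y w) refl
        where
        go : ∀ b → Y w ≡ b → Y w ≡ true × Mono H c₂ u w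
        go true yw = yw , ∧-intro (proj₁ (edge e)) (∧-intro yu yw) , trans (sym (c-in yu)) (trans q (c-in yw))
        go false yw = ⊥-elim (cross (proj₁ (edge e)) (proj₂ (proj₂ (edge e))) yu yw q)
      outside : ∀ {u w} → Mono (induce G U) c u w → Y u ≡ false → Y w ≡ false × Mono (induce G rest) c₁ u w
      outside {u} {w} (e , q) yu = go (Y w) refl
        where
        go : ∀ b → Y w ≡ b → Y w ≡ false × Mono (induce G rest) c₁ u w
        go false yw = yw , ∧-intro (proj₁ (edge e)) (∧-intro (∧-intro (proj₁ (proj₂ (edge e))) (cong not yu)) (∧-intro (proj₂ (proj₂ (edge e))) (cong not yw))) ,
          trans (sym (c-out yu)) (trans q (c-out yw))
        go true yw = ⊥-elim (cross (trans (Graph.sym G _ _) (proj₁ (edge e))) (proj₁ (proj₂ (edge e))) yw yu (sym q))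

  colour : ∀ b U → size U ≤ b → ¬ ¬ Coloured U
  colour zero U le r = r ((λ _ → 0) , (λ {v} uv → ⊥-elim (none uv)) , empty (λ {u} {w} (e , _) → none (proj₁ (∧-true {U u} (proj₂ (∧-true {adj G u w} e))))))
    where
    none : ∀ {v} → U v ≢ true
    none {v} uv = <⇒≱ (≤-reflexive (cong b2n (sym uv))) (≤-trans (∑-≥ v (b2n ∘ U)) le)
  colour (suc b) U le r with size U ≤? b
  ... | yes le′ = colour b U le′ r
  ... | no nle = Peel.minimal G U k α ε (dense U (≤-trans (s≤s z≤n) (≰⇒> nle))) λ (Y , M) →
    colour b (rest Y) (smaller Y M) λ (c₁ , l₁ , q₁) →
    let open Step U Y M c₁ in
    local H L′ L′-unique L′-length hyp (λ v → proj₁ (some-colour (L′ v) (nonempty v))) (λ v → proj₂ (some-colour (L′ v) (nonempty v)))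
      λ found → r (join found l₁ q₁)
    where
    rest : (Fin n → Bool) → Fin n → Bool
    rest Y u = U u ∧ not (Y u)
    smaller : ∀ Y → Peel.Minimal G U k α ε Y → size (rest Y) ≤ b
    smaller Y M = s≤s⁻¹ (≤-trans (s≤s (m≤m+n _ _)) (≤-trans (≤-trans (+-monoʳ-≤ (suc (size (rest Y))) z≤n) total) le))
      where
      open Peel.Minimal M
      no-gain : ∀ W → size W ≡ 0 → Peel.Z G U k α ε W ≤ Peel.X G U k α ε W
      no-gain W e = ≤-trans (≤-reflexive zero-Z) z≤n
        where
        off : ∀ u → W u ≡ false
        off u = not-true λ w → <⇒≱ (≤-reflexive (cong b2n (sym w))) (≤-trans (∑-≥ u (b2n ∘ W)) (≤-reflexive e))
        zero-Z : Peel.Z G U k α ε W ≡ 0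
        zero-Z = cong₂ _+_ (trans (cong (2 * ((α + suc ε) * k) *_) e) (*-zeroʳ (2 * ((α + suc ε) * k))))
          (trans (cong (suc ε *_) (trans (∑-cong λ u → cong (λ t → b2n t * degIn G W u) (off u)) (∑-zero n))) (*-zeroʳ (suc ε)))
      -- The empty set has `Z` equal to zero, so `Y` is nonempty and the recursion makes progress.
      pos : 1 ≤ size Y
      pos = n≢0⇒n>0 λ e → <⇒≱ X<Z (no-gain Y e)
      total : suc (size (rest Y)) + 0 ≤ size U
      total = begin
        suc (size (rest Y)) + 0     ≡⟨ +-identityʳ _ ⟩
        1 + size (rest Y)           ≤⟨ +-monoˡ-≤ _ pos ⟩
        size Y + size (rest Y)      ≡⟨ sym (∑-+ _ _) ⟩
        ∑ (λ u → b2n (Y u) + b2n (rest Y u)) ≤⟨ ∑-mono pt ⟩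
        size U                      ∎
        where
        open ≤-Reasoning
        pt : ∀ u → b2n (Y u) + b2n (rest Y u) ≤ b2n (U u)
        pt u with Y u in y | U u in e
        ... | true  | true  = ≤-refl
        ... | true  | false = ⊥-elim (true≢false (Y⊆U y) e)
        ... | false | true  = ≤-refl
        ... | false | false = z≤n

  coloured : ¬ ¬ (Σ (Colouring n) λ c → IsLColouring L c × Q G c)
  coloured r = colour n (λ _ → true) (count≤n _) λ (c , l , q) → r (c , (λ v → l refl) ,
    -- Gluing with all vertices on one side carries `Q` from the graph induced on everything over to
    -- `G`.
    glue {G₂ = induce G (λ _ → true)} {c₂ = c} (λ _ → true) q q (λ {u} {w} (e , m) _ → refl , ∧-intro e refl , m) λ _ ())

-- Signs of rational numbers

mul-pos : ∀ {p q} → 0ℚ <q p → 0ℚ <q q → 0ℚ <q p *q q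
mul-pos {p} {q} hp hq = ℚ.positive⁻¹ (p *q q) {{ℚ.pos*pos⇒pos p {{positive hp}} q {{positive hq}}}}

add-pos : ∀ {p q} → 0ℚ <q p → 0ℚ <q q → 0ℚ <q p +q q
add-pos hp hq = ℚ.+-mono-< hp hq

neg-pos : ∀ {p} → p <q 0ℚ → 0ℚ <q -q p
neg-pos h = ℚ.neg-antimono-< h

pos-neg : ∀ {p} → 0ℚ <q p → -q p <q 0ℚ
pos-neg h = ℚ.neg-antimono-< h

neg-neg : ∀ p → -q (-q p) ≡ p
neg-neg = solve 1 (λ p → :- (:- p) := p) refl
  where open +-*-Solver

unneg-pos : ∀ {p} → -q p <q 0ℚ → 0ℚ <q p
unneg-pos {p} h = subst (0ℚ <q_) (neg-neg p) (neg-pos h)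

unneg-neg : ∀ {p} → 0ℚ <q -q p → p <q 0ℚ
unneg-neg {p} h = subst (_<q 0ℚ) (neg-neg p) (pos-neg h)

sub-pos : ∀ {p q} → p <q q → 0ℚ <q q -q p
sub-pos {p} {q} h = subst (_<q q -q p) (ℚ.+-inverseʳ p) (ℚ.+-monoˡ-< (-q p) h)

mul-neg-pos : ∀ {p q} → p <q 0ℚ → 0ℚ <q q → p *q q <q 0ℚ
mul-neg-pos {p} {q} hp hq = unneg-neg (subst (0ℚ <q_) (sym (ℚ.neg-distribˡ-* p q)) (mul-pos (neg-pos hp) hq))

mul-pos-neg : ∀ {p q} → 0ℚ <q p → q <q 0ℚ → p *q q <q 0ℚ
mul-pos-neg {p} {q} hp hq = subst (_<q 0ℚ) (ℚ.*-comm q p) (mul-neg-pos hq hp)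

mul-neg-neg : ∀ {p q} → p <q 0ℚ → q <q 0ℚ → 0ℚ <q p *q q
mul-neg-neg {p} {q} hp hq = subst (0ℚ <q_) (lem p q) (mul-pos (neg-pos hp) (neg-pos hq))
  where
  open +-*-Solver
  lem : ∀ p q → (-q p) *q (-q q) ≡ p *q q
  lem = solve 2 (λ p q → (:- p) :* (:- q) := p :* q) refl

factor-pos : ∀ {p q} → 0ℚ <q q → 0ℚ <q p *q q → 0ℚ <q p
factor-pos {p} {q} hq h with ℚ.<-cmp 0ℚ p
... | tri< lt _ _ = lt
... | tri≈ _ refl _ = ⊥-elim (ℚ.<-irrefl (sym (ℚ.*-zeroˡ q)) h)
... | tri> _ _ gt = ⊥-elim (ℚ.<-asym h (mul-neg-pos gt hq))

factor-neg : ∀ {p q} → 0ℚ <q q → p *q q <q 0ℚ → p <q 0ℚ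
factor-neg {p} {q} hq h = unneg-neg (factor-pos hq (subst (0ℚ <q_) (ℚ.neg-distribˡ-* p q) (neg-pos h)))

third-neg : ∀ {p q r} → p +q q +q r ≡ 0ℚ → 0ℚ <q p → 0ℚ <q q → r <q 0ℚ
third-neg {p} {q} {r} e hp hq = unneg-neg (subst (0ℚ <q_) (trans (lem p q r) (trans (cong (_-q r) e) (ℚ.+-identityˡ (-q r)))) (add-pos hp hq))
  where
  open +-*-Solver
  lem : ∀ p q r → p +q q ≡ p +q q +q r -q r
  lem = solve 3 (λ p q r → p :+ q := p :+ q :+ r :- r) refl

third-pos : ∀ {p q r} → p +q q +q r ≡ 0ℚ → p <q 0ℚ → q <q 0ℚ → 0ℚ <q r
third-pos {p} {q} {r} e hp hq = unneg-pos (third-neg (trans (lem p q r) (cong -q_ e)) (neg-pos hp) (neg-pos hq))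
  where
  open +-*-Solver
  lem : ∀ p q r → (-q p) +q (-q q) +q (-q r) ≡ -q (p +q q +q r)
  lem = solve 3 (λ p q r → (:- p) :+ (:- q) :+ (:- r) := :- (p :+ q :+ r)) refl

rotate : ∀ {p q r} → p +q q +q r ≡ 0ℚ → q +q r +q p ≡ 0ℚ
rotate {p} {q} {r} e = trans (lem p q r) e
  where
  open +-*-Solver
  lem : ∀ p q r → q +q r +q p ≡ p +q q +q r
  lem = solve 3 (λ p q r → q :+ r :+ p := p :+ q :+ r) refl

inverse : ∀ {w} → 0ℚ <q w → Σ ℚ λ i → 0ℚ <q i × i *q w ≡ 1ℚ
inverse {w} h = (1/ w) {{nz}} , factor-pos h (subst (0ℚ <q_) (sym inv) (ℚ.positive⁻¹ 1ℚ)) , inv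
  where
  nz : ℚ.NonZero w
  nz = ℚ.>-nonZero h
  inv : (1/ w) {{nz}} *q w ≡ 1ℚ
  inv = ℚ.*-inverseˡ w {{nz}}

-- The orientation of a triple of points

opaque

  -- Twice the signed area of the triangle, positive when `r` lies to the left of the line from `p`
  -- to `q`.
  o : Point → Point → Point → ℚ
  o (p₁ , p₂) (q₁ , q₂) (r₁ , r₂) = (q₁ -q p₁) *q (r₂ -q p₂) -q (q₂ -q p₂) *q (r₁ -q p₁)

module _ where
  open +-*-Solver

  opaque
    unfolding o

    o-cyc : ∀ p q r → o q r p ≡ o p q r
    o-cyc (p₁ , p₂) (q₁ , q₂) (r₁ , r₂) = solve 6 (λ p₁ p₂ q₁ q₂ r₁ r₂ →
      let o p₁ p₂ q₁ q₂ r₁ r₂ = (q₁ :- p₁) :* (r₂ :- p₂) :- (q₂ :- p₂) :* (r₁ :- p₁) in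
      o q₁ q₂ r₁ r₂ p₁ p₂ := o p₁ p₂ q₁ q₂ r₁ r₂) refl p₁ p₂ q₁ q₂ r₁ r₂

    o-swap : ∀ p q r → o p r q ≡ -q (o p q r)
    o-swap (p₁ , p₂) (q₁ , q₂) (r₁ , r₂) = solve 6 (λ p₁ p₂ q₁ q₂ r₁ r₂ →
      let o p₁ p₂ q₁ q₂ r₁ r₂ = (q₁ :- p₁) :* (r₂ :- p₂) :- (q₂ :- p₂) :* (r₁ :- p₁) in
      o p₁ p₂ r₁ r₂ q₁ q₂ := :- (o p₁ p₂ q₁ q₂ r₁ r₂)) refl p₁ p₂ q₁ q₂ r₁ r₂

    o-base : ∀ p q → o p q p ≡ 0ℚ
    o-base (p₁ , p₂) (q₁ , q₂) = solve 4 (λ p₁ p₂ q₁ q₂ →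
      (q₁ :- p₁) :* (p₂ :- p₂) :- (q₂ :- p₂) :* (p₁ :- p₁) := con 0ℚ) refl p₁ p₂ q₁ q₂

    o-tip : ∀ p q → o p q q ≡ 0ℚ
    o-tip (p₁ , p₂) (q₁ , q₂) = solve 4 (λ p₁ p₂ q₁ q₂ →
      (q₁ :- p₁) :* (q₂ :- p₂) :- (q₂ :- p₂) :* (q₁ :- p₁) := con 0ℚ) refl p₁ p₂ q₁ q₂

    o-line : ∀ p q x → OnSeg p q x → o p q x ≡ 0ℚ
    o-line (p₁ , p₂) (q₁ , q₂) (x₁ , x₂) (l , _ , _ , refl , refl) = solve 5 (λ p₁ p₂ q₁ q₂ l →
      (q₁ :- p₁) :* ((p₂ :+ l :* (q₂ :- p₂)) :- p₂) :- (q₂ :- p₂) :* ((p₁ :+ l :* (q₁ :- p₁)) :- p₁) := con 0ℚ) refl p₁ p₂ q₁ q₂ l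

  onseg-start : ∀ p q → OnSeg p q p
  onseg-start (p₁ , p₂) (q₁ , q₂) = 0ℚ , ℚ.≤-refl , ℚ.<⇒≤ (ℚ.positive⁻¹ 1ℚ) , lem p₁ q₁ , lem p₂ q₂
    where
    lem : ∀ p q → p ≡ p +q 0ℚ *q (q -q p)
    lem = solve 2 (λ p q → p := p :+ con 0ℚ :* (q :- p)) refl

  onseg-sym : ∀ p q x → OnSeg p q x → OnSeg q p x
  onseg-sym (p₁ , p₂) (q₁ , q₂) (x₁ , x₂) (l , h₀ , h₁ , e₁ , e₂) = 1ℚ -q l ,
    subst (_≤q 1ℚ -q l) (ℚ.+-inverseʳ l) (ℚ.+-monoˡ-≤ (-q l) h₁) ,
    subst (1ℚ -q l ≤q_) (ℚ.+-identityʳ 1ℚ) (ℚ.+-monoʳ-≤ 1ℚ (ℚ.neg-antimono-≤ h₀)) ,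
    trans e₁ (lem p₁ q₁ l) , trans e₂ (lem p₂ q₂ l)
    where
    lem : ∀ p q l → p +q l *q (q -q p) ≡ q +q (1ℚ -q l) *q (p -q q)
    lem = solve 3 (λ p q l → p :+ l :* (q :- p) := q :+ (con 1ℚ :- l) :* (p :- q)) refl

onseg-end : ∀ p q → OnSeg p q q
onseg-end p q = onseg-sym q p q (onseg-start q p)

CrossFree : Point → Point → Point → Point → Set
CrossFree a b c d = ∀ x → OnSeg a b x → OnSeg c d x → (x ≡ a ⊎ x ≡ b) × (x ≡ c ⊎ x ≡ d)

opaque
  unfolding o

  -- Cramer's rule: `l` and `m` are the parameters of the meeting point on the two segments, with
  -- common denominator `w`.
  proper-crossing : ∀ {a b c d} → CrossFree a b c d → o c d a <q 0ℚ → 0ℚ <q o c d b → 0ℚ <q o a b c → o a b d <q 0ℚ → ⊥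
  proper-crossing {a@(a₁ , a₂)} {b@(b₁ , b₂)} {c@(c₁ , c₂)} {d@(d₁ , d₂)} cf ha hb hc hd with inverse {o c d b -q o c d a} (sub-pos (ℚ.<-trans ha hb))
  ... | i , hi , inv = absurd (proj₁ (cf x on₁ on₂))
    where
    w l m : ℚ
    w = o c d b -q o c d a
    l = (-q o c d a) *q i
    m = o a b c *q i
    x : Point
    x = a₁ +q l *q (b₁ -q a₁) , a₂ +q l *q (b₂ -q a₂)
    w′ : w ≡ o a b c -q o a b d
    w′ = solve 8 (λ a₁ a₂ b₁ b₂ c₁ c₂ d₁ d₂ →
      let o p₁ p₂ q₁ q₂ r₁ r₂ = (q₁ :- p₁) :* (r₂ :- p₂) :- (q₂ :- p₂) :* (r₁ :- p₁) in
      o c₁ c₂ d₁ d₂ b₁ b₂ :- o c₁ c₂ d₁ d₂ a₁ a₂ := o a₁ a₂ b₁ b₂ c₁ c₂ :- o a₁ a₂ b₁ b₂ d₁ d₂) refl a₁ a₂ b₁ b₂ c₁ c₂ d₁ d₂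
      where open +-*-Solver
    unit : ∀ {s} → s ≤q w → s *q i ≤q 1ℚ
    unit {s} le = subst (s *q i ≤q_) (trans (ℚ.*-comm w i) inv) (ℚ.*-monoʳ-≤-nonNeg i {{nonNegative (ℚ.<⇒≤ hi)}} le)
    on₁ : OnSeg a b x
    on₁ = l , ℚ.<⇒≤ (mul-pos (neg-pos ha) hi) , unit { -q o c d a } (subst (_≤q w) (ℚ.+-identityˡ (-q o c d a)) (ℚ.+-monoˡ-≤ (-q o c d a) (ℚ.<⇒≤ hb))) , refl , refl
    -- The coordinates agree only modulo `i *q w ≡ 1ℚ`, so the polynomial identities below carry a
    -- multiple of `1ℚ -q i *q w`, which is then dropped.
    meet : ∀ k → 1ℚ -q i *q w ≡ 0ℚ → ∀ s → s +q k *q (1ℚ -q i *q w) ≡ s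
    meet k e s = trans (cong (λ z → s +q k *q z) e) (trans (cong (s +q_) (ℚ.*-zeroʳ k)) (ℚ.+-identityʳ s))
    zero′ : 1ℚ -q i *q w ≡ 0ℚ
    zero′ = trans (cong (λ z → 1ℚ -q z) inv) (ℚ.+-inverseʳ 1ℚ)
    on₂ : OnSeg c d x
    on₂ = m , ℚ.<⇒≤ (mul-pos hc hi) , unit {o a b c} (subst (o a b c ≤q_) (sym w′) (subst (_≤q o a b c -q o a b d) (ℚ.+-identityʳ _) (ℚ.+-monoʳ-≤ (o a b c) (ℚ.<⇒≤ (neg-pos hd))))) ,
      trans (solve 9 (λ i a₁ a₂ b₁ b₂ c₁ c₂ d₁ d₂ →
        let o p₁ p₂ q₁ q₂ r₁ r₂ = (q₁ :- p₁) :* (r₂ :- p₂) :- (q₂ :- p₂) :* (r₁ :- p₁)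
            A = o c₁ c₂ d₁ d₂ a₁ a₂ ; B = o c₁ c₂ d₁ d₂ b₁ b₂ ; C = o a₁ a₂ b₁ b₂ c₁ c₂ in
        a₁ :+ (:- A) :* i :* (b₁ :- a₁) := (c₁ :+ C :* i :* (d₁ :- c₁)) :+ (a₁ :- c₁) :* (con 1ℚ :- i :* (B :- A))) refl i a₁ a₂ b₁ b₂ c₁ c₂ d₁ d₂)
        (meet (a₁ -q c₁) zero′ _) ,
      trans (solve 9 (λ i a₁ a₂ b₁ b₂ c₁ c₂ d₁ d₂ →
        let o p₁ p₂ q₁ q₂ r₁ r₂ = (q₁ :- p₁) :* (r₂ :- p₂) :- (q₂ :- p₂) :* (r₁ :- p₁)
            A = o c₁ c₂ d₁ d₂ a₁ a₂ ; B = o c₁ c₂ d₁ d₂ b₁ b₂ ; C = o a₁ a₂ b₁ b₂ c₁ c₂ in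
        a₂ :+ (:- A) :* i :* (b₂ :- a₂) := (c₂ :+ C :* i :* (d₂ :- c₂)) :+ (a₂ :- c₂) :* (con 1ℚ :- i :* (B :- A))) refl i a₁ a₂ b₁ b₂ c₁ c₂ d₁ d₂)
        (meet (a₂ -q c₂) zero′ _)
      where open +-*-Solver
    absurd : x ≡ a ⊎ x ≡ b → ⊥
    absurd (inj₁ e) = ℚ.<-irrefl (trans (cong (o c d) (sym e)) (o-line c d x on₂)) ha
    absurd (inj₂ e) = ℚ.<-irrefl (sym (trans (cong (o c d) (sym e)) (o-line c d x on₂))) hb

_≟P_ : DecidableEquality Point
_≟P_ = ≡-dec ℚ._≟_ ℚ._≟_

dec-yes : ∀ {a} {A : Set a} (d : Dec A) → A → ⌊ d ⌋ ≡ true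
dec-yes (yes _) _ = refl
dec-yes (no na) a = ⊥-elim (na a)

dec-no : ∀ {a} {A : Set a} (d : Dec A) → ¬ A → ⌊ d ⌋ ≡ false
dec-no (yes a) na = ⊥-elim (na a)
dec-no (no _) _ = refl

<⇒≱q : ∀ {p q} → p <q q → ¬ (q ≤q p)
<⇒≱q l h = ℚ.<-irrefl refl (ℚ.<-≤-trans l h)

-- Points are ordered by x + εy; for suitable ε no two relevant points are level.
module Sweep (ε : ℚ) where

  opaque

    X : Point → ℚ
    X (p₁ , p₂) = p₁ +q ε *q p₂

    lt le eq : Point → Point → Bool
    lt p q = ⌊ X p ℚ.<? X q ⌋
    le p q = ⌊ X p ℚ.≤? X q ⌋
    eq p q = ⌊ p ≟P q ⌋

    gt0 : ℚ → Bool
    gt0 r = ⌊ 0ℚ ℚ.<? r ⌋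

    lt-true : ∀ {p q} → X p <q X q → lt p q ≡ true
    lt-true {p} {q} = dec-yes (X p ℚ.<? X q)
    lt-false : ∀ {p q} → X q ≤q X p → lt p q ≡ false
    lt-false {p} {q} h = dec-no (X p ℚ.<? X q) λ l → <⇒≱q l h
    le-true : ∀ {p q} → X p ≤q X q → le p q ≡ true
    le-true {p} {q} = dec-yes (X p ℚ.≤? X q)
    le-false : ∀ {p q} → X q <q X p → le p q ≡ false
    le-false {p} {q} h = dec-no (X p ℚ.≤? X q) (<⇒≱q h)
    gt0-true : ∀ {r} → 0ℚ <q r → gt0 r ≡ true
    gt0-true {r} = dec-yes (0ℚ ℚ.<? r)
    gt0-false : ∀ {r} → r ≤q 0ℚ → gt0 r ≡ false
    gt0-false {r} h = dec-no (0ℚ ℚ.<? r) λ l → <⇒≱q l h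
    gt0-zero : ∀ {r} → r ≡ 0ℚ → gt0 r ≡ false
    gt0-zero e = gt0-false (ℚ.≤-reflexive e)
    eq-refl : ∀ p → eq p p ≡ true
    eq-refl p = dec-yes (p ≟P p) refl
    eq-false : ∀ {p q} → p ≢ q → eq p q ≡ false
    eq-false {p} {q} = dec-no (p ≟P q)

  <⇒≢ᵖ : ∀ {p q} → X p <q X q → p ≢ q
  <⇒≢ᵖ h refl = ℚ.<-irrefl refl h
  >⇒≢ᵖ : ∀ {p q} → X q <q X p → p ≢ q
  >⇒≢ᵖ h refl = ℚ.<-irrefl refl h

  -- The direction from q to b precedes that from q to p in counterclockwise order, starting from straight down.
  before : Point → Point → Point → Bool
  before q b p = if lt q b then (if lt q p then gt0 (o q b p) else true) else (if lt q p then false else gt0 (o q b p))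

  leq : Point → Point → Point → Bool
  leq q b p = not (before q p b)

  -- q lies below or on the segment from c to e, where X c < X e
  under : Point → Point → Point → Bool
  under q c e = le c q ∧ (lt q e ∧ not (gt0 (o c e q)))

  und : Point → Point → Point → Bool
  und q c e = under q c e xor under q e c

  -- The share of the segment ce in the parity of the segments above a point near q, just counterclockwise (Lc) or
  -- clockwise (Rc) of the direction from q to p.
  Lc Rc : Point → Point → Point → Point → Bool
  Lc q p c e = und q c e xor ((eq c q ∧ leq q e p) xor (eq e q ∧ leq q c p))
  Rc q p c e = und q c e xor ((eq c q ∧ before q e p) xor (eq e q ∧ before q c p))

  -- Detects a point in the open strip above the segment: an end of another segment there changes
  -- the number of segments above as one moves along `ab`.
  sec : Point → Point → Point → Bool
  sec a b q = lt a q ∧ (lt q b ∧ gt0 (o a b q))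

  opaque
    unfolding X o

    on-segment : ∀ {p q r} → X p <q X q → X q <q X r → o p r q ≡ 0ℚ → OnSeg p r q
    on-segment {p@(p₁ , p₂)} {q@(q₁ , q₂)} {r@(r₁ , r₂)} h₁ h₂ z with inverse {X r -q X p} (sub-pos (ℚ.<-trans h₁ h₂))
    ... | i , hi , inv = l , ℚ.<⇒≤ (mul-pos (sub-pos h₁) hi) ,
        subst (l ≤q_) (trans (ℚ.*-comm w i) inv) (ℚ.*-monoʳ-≤-nonNeg i {{nonNegative (ℚ.<⇒≤ hi)}} (ℚ.+-monoˡ-≤ (-q X p) (ℚ.<⇒≤ h₂))) ,
        trans (solve 8 (λ e i p₁ p₂ q₁ q₂ r₁ r₂ →
          let x = λ a b → a :+ e :* b ; W = x r₁ r₂ :- x p₁ p₂ ; O = (r₁ :- p₁) :* (q₂ :- p₂) :- (r₂ :- p₂) :* (q₁ :- p₁) in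
          q₁ := (p₁ :+ (x q₁ q₂ :- x p₁ p₂) :* i :* (r₁ :- p₁)) :+ (q₁ :- p₁) :* (con 1ℚ :- i :* W) :+ (:- (e :* i)) :* O) refl ε i p₁ p₂ q₁ q₂ r₁ r₂)
          (clean (q₁ -q p₁) (-q (ε *q i)) _) ,
        trans (solve 8 (λ e i p₁ p₂ q₁ q₂ r₁ r₂ →
          let x = λ a b → a :+ e :* b ; W = x r₁ r₂ :- x p₁ p₂ ; O = (r₁ :- p₁) :* (q₂ :- p₂) :- (r₂ :- p₂) :* (q₁ :- p₁) in
          q₂ := (p₂ :+ (x q₁ q₂ :- x p₁ p₂) :* i :* (r₂ :- p₂)) :+ (q₂ :- p₂) :* (con 1ℚ :- i :* W) :+ i :* O) refl ε i p₁ p₂ q₁ q₂ r₁ r₂)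
          (clean (q₂ -q p₂) i _)
      where
      open +-*-Solver
      w l : ℚ
      w = X r -q X p
      l = (X q -q X p) *q i
      clean : ∀ s k t → t +q s *q (1ℚ -q i *q w) +q k *q o p r q ≡ t
      clean s k t = trans (cong₂ (λ a b → t +q s *q a +q k *q b) (trans (cong (λ y → 1ℚ -q y) inv) (ℚ.+-inverseʳ 1ℚ)) z)
        (trans (cong₂ (λ a b → t +q a +q b) (ℚ.*-zeroʳ s) (ℚ.*-zeroʳ k)) (trans (ℚ.+-identityʳ _) (ℚ.+-identityʳ t)))

  opaque
    unfolding X o

    -- a (B - D) + b (D - A) + d (D - C) = 0 for a = o C D A, b = o C D B and d = o A B D; the other three relations used
    -- below are instances of it.
    relation : ∀ A B C D → o C D A *q (X B -q X D) +q o C D B *q (X D -q X A) +q o A B D *q (X D -q X C) ≡ 0ℚ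
    relation (a₁ , a₂) (b₁ , b₂) (c₁ , c₂) (d₁ , d₂) = solve 9 (λ e a₁ a₂ b₁ b₂ c₁ c₂ d₁ d₂ →
       let o = λ p₁ p₂ q₁ q₂ r₁ r₂ → (q₁ :- p₁) :* (r₂ :- p₂) :- (q₂ :- p₂) :* (r₁ :- p₁)
           x = λ p q → p :+ e :* q in
       o c₁ c₂ d₁ d₂ a₁ a₂ :* (x b₁ b₂ :- x d₁ d₂) :+ o c₁ c₂ d₁ d₂ b₁ b₂ :* (x d₁ d₂ :- x a₁ a₂) :+ o a₁ a₂ b₁ b₂ d₁ d₂ :* (x d₁ d₂ :- x c₁ c₂) := con 0ℚ)
       refl ε a₁ a₂ b₁ b₂ c₁ c₂ d₁ d₂
      where open +-*-Solver

  o-flip : ∀ p q r → o q p r ≡ -q o p q r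
  o-flip p q r = trans (sym (o-cyc q p r)) (o-swap p q r)

  -- Four points A, B and C, D with X A < X B and X C < X D, and the four orientations up to a common sign
  record Quad (A B C D : Point) (a b c d : ℚ) : Set where
    field
      r₁ : a *q (X B -q X D) +q b *q (X D -q X A) +q d *q (X D -q X C) ≡ 0ℚ
      r₂ : a *q (X B -q X C) +q b *q (X C -q X A) +q c *q (X D -q X C) ≡ 0ℚ
      r₃ : c *q (X D -q X B) +q d *q (X B -q X C) +q b *q (X B -q X A) ≡ 0ℚ
      r₄ : c *q (X D -q X A) +q d *q (X A -q X C) +q a *q (X B -q X A) ≡ 0ℚ

  quad : ∀ A B C D → Quad A B C D (o C D A) (o C D B) (o A B C) (o A B D)
  quad A B C D = record
    { r₁ = relation A B C D
    ; r₂ = trans (fix (o C D A) (o C D B) (o A B C) (X B) (X A) (X C) (X D)) (trans (cong₂ (λ p q → -q (p *q (X B -q X C) +q q *q (X C -q X A) +q o A B C *q (X C -q X D))) (sym (o-flip C D A)) (sym (o-flip C D B))) (cong -q_ (relation A B D C)))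
    ; r₃ = relation C D A B
    ; r₄ = trans (fix (o A B C) (o A B D) (o C D A) (X D) (X C) (X A) (X B)) (trans (cong₂ (λ p q → -q (p *q (X D -q X A) +q q *q (X A -q X C) +q o C D A *q (X A -q X B))) (sym (o-flip A B C)) (sym (o-flip A B D))) (cong -q_ (relation C D B A)))
    }
    where
    fix : ∀ a b c xb xa xc xd → a *q (xb -q xc) +q b *q (xc -q xa) +q c *q (xd -q xc) ≡
                                 -q ((-q a) *q (xb -q xc) +q (-q b) *q (xc -q xa) +q c *q (xc -q xd))
    fix = solve 7 (λ a b c xb xa xc xd → a :* (xb :- xc) :+ b :* (xc :- xa) :+ c :* (xd :- xc) :=
                                 :- ((:- a) :* (xb :- xc) :+ (:- b) :* (xc :- xa) :+ c :* (xc :- xd))) refl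
      where open +-*-Solver

  -- The mirror image: crossings with `C` and `B` below reduce to those with `C` and `B` above.
  quad-neg : ∀ {A B C D a b c d} → Quad A B C D a b c d → Quad A B C D (-q a) (-q b) (-q c) (-q d)
  quad-neg {A} {B} {C} {D} {a} {b} {c} {d} Q = record
    { r₁ = neg a b d (X B -q X D) (X D -q X A) (X D -q X C) (Quad.r₁ Q) ; r₂ = neg a b c (X B -q X C) (X C -q X A) (X D -q X C) (Quad.r₂ Q)
    ; r₃ = neg c d b (X D -q X B) (X B -q X C) (X B -q X A) (Quad.r₃ Q) ; r₄ = neg c d a (X D -q X A) (X A -q X C) (X B -q X A) (Quad.r₄ Q) }
    where
    neg : ∀ a b c x y z → a *q x +q b *q y +q c *q z ≡ 0ℚ → (-q a) *q x +q (-q b) *q y +q (-q c) *q z ≡ 0ℚ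
    neg a b c x y z e = trans (solve 6 (λ a b c x y z → (:- a) :* x :+ (:- b) :* y :+ (:- c) :* z := :- (a :* x :+ b :* y :+ c :* z)) refl a b c x y z) (cong -q_ e)
      where open +-*-Solver

  sub-neg : ∀ {p q} → p <q q → p -q q <q 0ℚ
  sub-neg {p} {q} h = subst (p -q q <q_) (ℚ.+-inverseʳ q) (ℚ.+-monoˡ-< (-q q) h)

  -- The sign of c in a x + b y + c z = 0, where the signs of x, y, z are those of the differences of abscissas
  module Balance (a b c x y z : ℚ) (e : a *q x +q b *q y +q c *q z ≡ 0ℚ) (hz : 0ℚ <q z) where

    pp-pp : 0ℚ <q a → 0ℚ <q x → 0ℚ <q b → 0ℚ <q y → c <q 0ℚ
    pp-pp ha hx hb hy = factor-neg {c} {z} hz (third-neg {a *q x} {b *q y} {c *q z} e (mul-pos {a} {x} ha hx) (mul-pos {b} {y} hb hy))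

    pp-nn : 0ℚ <q a → 0ℚ <q x → b <q 0ℚ → y <q 0ℚ → c <q 0ℚ
    pp-nn ha hx hb hy = factor-neg {c} {z} hz (third-neg {a *q x} {b *q y} {c *q z} e (mul-pos {a} {x} ha hx) (mul-neg-neg {b} {y} hb hy))

    nn-pp : a <q 0ℚ → x <q 0ℚ → 0ℚ <q b → 0ℚ <q y → c <q 0ℚ
    nn-pp ha hx hb hy = factor-neg {c} {z} hz (third-neg {a *q x} {b *q y} {c *q z} e (mul-neg-neg {a} {x} ha hx) (mul-pos {b} {y} hb hy))

    np-np : a <q 0ℚ → 0ℚ <q x → b <q 0ℚ → 0ℚ <q y → 0ℚ <q c
    np-np ha hx hb hy = factor-pos {c} {z} hz (third-pos {a *q x} {b *q y} {c *q z} e (mul-neg-pos {a} {x} ha hx) (mul-neg-pos {b} {y} hb hy))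

    np-pn : a <q 0ℚ → 0ℚ <q x → 0ℚ <q b → y <q 0ℚ → 0ℚ <q c
    np-pn ha hx hb hy = factor-pos {c} {z} hz (third-pos {a *q x} {b *q y} {c *q z} e (mul-neg-pos {a} {x} ha hx) (mul-pos-neg {b} {y} hb hy))

    pn-np : 0ℚ <q a → x <q 0ℚ → b <q 0ℚ → 0ℚ <q y → 0ℚ <q c
    pn-np ha hx hb hy = factor-pos {c} {z} hz (third-pos {a *q x} {b *q y} {c *q z} e (mul-pos-neg {a} {x} ha hx) (mul-neg-pos {b} {y} hb hy))

  module _ {A B C D a b c d} (Q : Quad A B C D a b c d) where
    open Quad Q

    -- The two segments cross, with C and B above.
    Cross : Set
    Cross = a <q 0ℚ × 0ℚ <q b × 0ℚ <q c × d <q 0ℚ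

    private
      module R₁ = Balance a b d (X B -q X D) (X D -q X A) (X D -q X C) r₁
      module R₁′ = Balance d a b (X D -q X C) (X B -q X D) (X D -q X A) (rotate {b *q (X D -q X A)} {d *q (X D -q X C)} {a *q (X B -q X D)} (rotate {a *q (X B -q X D)} {b *q (X D -q X A)} {d *q (X D -q X C)} r₁))
      module R₂ = Balance a b c (X B -q X C) (X C -q X A) (X D -q X C) r₂
      module R₃ = Balance c d b (X D -q X B) (X B -q X C) (X B -q X A) r₃
      module R₃′ = Balance b c d (X B -q X A) (X D -q X B) (X B -q X C) (rotate {d *q (X B -q X C)} {b *q (X B -q X A)} {c *q (X D -q X B)} (rotate {c *q (X D -q X B)} {d *q (X B -q X C)} {b *q (X B -q X A)} r₃))
      module R₄ = Balance c d a (X D -q X A) (X A -q X C) (X B -q X A) r₄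

    -- The name records the order of the abscissas. Given this order, two orientations determine the
    -- other two through the linear relations of `Quad`; the next three lemmas are alike.
    cross-CADB : X C <q X A → X A <q X D → X D <q X B → a <q 0ℚ → d <q 0ℚ → Cross
    cross-CADB h₁ h₂ h₃ ha hd = ha , hb , R₂.np-pn (sub-pos CD) ha (sub-pos (ℚ.<-trans CD h₃)) hb (sub-neg h₁) , hd
      where
      CD : X C <q X D
      CD = ℚ.<-trans h₁ h₂
      hb : 0ℚ <q b
      hb = R₁′.np-np (sub-pos h₂) hd (sub-pos CD) ha (sub-pos h₃)

    cross-CABD : X C <q X A → X A <q X B → X B <q X D → a <q 0ℚ → 0ℚ <q b → Cross
    cross-CABD h₁ h₂ h₃ ha hb = ha , hb , R₂.np-pn (sub-pos CD) ha (sub-pos (ℚ.<-trans h₁ h₂)) hb (sub-neg h₁) ,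
      R₁.nn-pp (sub-pos CD) ha (sub-neg h₃) hb (sub-pos (ℚ.<-trans h₂ h₃))
      where
      CD : X C <q X D
      CD = ℚ.<-trans (ℚ.<-trans h₁ h₂) h₃

    cross-ACDB : X A <q X C → X C <q X D → X D <q X B → 0ℚ <q c → d <q 0ℚ → Cross
    cross-ACDB h₁ h₂ h₃ hc hd = R₄.pp-nn (sub-pos AB) hc (sub-pos (ℚ.<-trans h₁ h₂)) hd (sub-neg h₁) ,
      R₃.pn-np (sub-pos AB) hc (sub-neg h₃) hd (sub-pos (ℚ.<-trans h₂ h₃)) , hc , hd
      where
      AB : X A <q X B
      AB = ℚ.<-trans (ℚ.<-trans h₁ h₂) h₃

    cross-ACBD : X A <q X C → X C <q X B → X B <q X D → 0ℚ <q b → 0ℚ <q c → Cross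
    cross-ACBD h₁ h₂ h₃ hb hc = R₄.pp-nn (sub-pos AB) hc (sub-pos (ℚ.<-trans AB h₃)) hd (sub-neg h₁) , hb , hc , hd
      where
      AB : X A <q X B
      AB = ℚ.<-trans h₁ h₂
      hd : d <q 0ℚ
      hd = R₃′.pp-pp (sub-pos h₂) hb (sub-pos AB) hc (sub-pos h₃)

  no-cross : ∀ {A B C D} → CrossFree A B C D → ¬ Cross (quad A B C D)
  no-cross cf (ha , hb , hc , hd) = proper-crossing cf ha hb hc hd

  no-cross⁻ : ∀ {A B C D} → CrossFree A B C D → ¬ Cross (quad-neg (quad A B C D))
  no-cross⁻ {A} {B} {C} {D} cf (ha , hb , hc , hd) = proper-crossing {B} {A} {C} {D} cf′ (unneg-neg {o C D B} hb) (unneg-pos {o C D A} ha)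
    (subst (0ℚ <q_) (sym (o-flip A B C)) hc) (subst (_<q 0ℚ) (sym (o-flip A B D)) hd)
    where
    cf′ : CrossFree B A C D
    cf′ x i j = let (e , k) = cf x (onseg-sym B A x i) j in Sum.swap e , k

-- The contribution of one segment along another

module Share (ε : ℚ) where

  open Sweep ε public

  und-in : ∀ {q c e} → X c ≤q X q → X q <q X e → und q c e ≡ not (gt0 (o c e q))
  und-in {q} {c} {e} h₁ h₂ rewrite le-true {c} {q} h₁ | lt-true {q} {e} h₂ | le-false {e} {q} h₂ = xor-identityʳ _

  und-left : ∀ {q c e} → X q <q X c → X c <q X e → und q c e ≡ false
  und-left {q} {c} {e} h₁ h₂ rewrite le-false {c} {q} h₁ | le-false {e} {q} (ℚ.<-trans h₁ h₂) = refl

  und-right : ∀ {q c e} → X c <q X e → X e ≤q X q → und q c e ≡ false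
  und-right {q} {c} {e} h₁ h₂ rewrite le-true {c} {q} (ℚ.<⇒≤ (ℚ.<-≤-trans h₁ h₂)) | lt-false {q} {e} h₂ | le-true {e} {q} h₂
    | lt-false {q} {c} (ℚ.<⇒≤ (ℚ.<-≤-trans h₁ h₂)) = refl

  Lc-far : ∀ {q p c e} → c ≢ q → e ≢ q → Lc q p c e ≡ und q c e
  Lc-far {q} {p} {c} {e} h₁ h₂ rewrite eq-false {c} {q} h₁ | eq-false {e} {q} h₂ = xor-identityʳ _

  Rc-far : ∀ {q p c e} → c ≢ q → e ≢ q → Rc q p c e ≡ und q c e
  Rc-far {q} {p} {c} {e} h₁ h₂ rewrite eq-false {c} {q} h₁ | eq-false {e} {q} h₂ = xor-identityʳ _

  L-end : ∀ {a b c} → X a <q X b → X c <q X a → Lc a b c a ≡ false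
  L-end {a} {b} {c} h₁ h₂ rewrite und-right {a} {c} {a} h₂ ℚ.≤-refl | eq-false {c} {a} (<⇒≢ᵖ h₂) | eq-refl a
    | lt-true {a} {b} h₁ | lt-false {a} {c} (ℚ.<⇒≤ h₂) = refl

  L-start : ∀ {a b e} → X a <q X b → X a <q X e → Lc a b a e ≡ gt0 (o a b e)
  L-start {a} {b} {e} h₁ h₂ rewrite und-in {a} {a} {e} ℚ.≤-refl h₂ | gt0-zero (o-base a e) | eq-refl a | eq-false {e} {a} (>⇒≢ᵖ h₂)
    | lt-true {a} {b} h₁ | lt-true {a} {e} h₂ = lem (gt0 (o a b e))
    where
    lem : ∀ t → not (not t xor false) ≡ t
    lem true = refl
    lem false = refl

  R-end : ∀ {a b c} → X a <q X b → X c <q X b → Rc b a c b ≡ gt0 (o a b c)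
  R-end {a} {b} {c} h₁ h₂ rewrite und-right {b} {c} {b} h₂ ℚ.≤-refl | eq-false {c} {b} (<⇒≢ᵖ h₂) | eq-refl b
    | lt-false {b} {c} (ℚ.<⇒≤ h₂) | lt-false {b} {a} (ℚ.<⇒≤ h₁) = cong gt0 (o-cyc a b c)

  R-start : ∀ {a b e} → X a <q X b → X b <q X e → Rc b a b e ≡ false
  R-start {a} {b} {e} h₁ h₂ rewrite und-in {b} {b} {e} ℚ.≤-refl h₂ | gt0-zero (o-base b e) | eq-refl b | eq-false {e} {b} (>⇒≢ᵖ h₂)
    | lt-true {b} {e} h₂ | lt-false {b} {a} (ℚ.<⇒≤ h₁) = refl

  sec-left : ∀ {a b q} → X q ≤q X a → sec a b q ≡ false
  sec-left {a} {b} {q} h rewrite lt-false {a} {q} h = refl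

  sec-right : ∀ {a b q} → X a <q X q → X b ≤q X q → sec a b q ≡ false
  sec-right {a} {b} {q} h₁ h₂ rewrite lt-true {a} {q} h₁ | lt-false {q} {b} h₂ = refl

  sec-in : ∀ {a b q} → X a <q X q → X q <q X b → sec a b q ≡ gt0 (o a b q)
  sec-in {a} {b} {q} h₁ h₂ rewrite lt-true {a} {q} h₁ | lt-true {q} {b} h₂ = refl

  not-gt0 : ∀ {r s} → r ≢ 0ℚ → s ≢ 0ℚ → ¬ (r <q 0ℚ × s <q 0ℚ) → ¬ (0ℚ <q r × 0ℚ <q s) → not (gt0 r) ≡ gt0 s
  not-gt0 {r} {s} nr ns h₁ h₂ = go (ℚ.<-cmp 0ℚ r) (ℚ.<-cmp 0ℚ s)
    where
    go : Tri (0ℚ <q r) (0ℚ ≡ r) (r <q 0ℚ) → Tri (0ℚ <q s) (0ℚ ≡ s) (s <q 0ℚ) → not (gt0 r) ≡ gt0 s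
    go (tri< l _ _) (tri< l′ _ _) = ⊥-elim (h₂ (l , l′))
    go (tri< l _ _) (tri> _ _ g) = trans (cong not (gt0-true l)) (sym (gt0-false (ℚ.<⇒≤ g)))
    go (tri> _ _ g) (tri< l _ _) = trans (cong not (gt0-false (ℚ.<⇒≤ g))) (sym (gt0-true l))
    go (tri> _ _ g) (tri> _ _ g′) = ⊥-elim (h₁ (g , g′))
    go (tri≈ _ e _) _ = ⊥-elim (nr (sym e))
    go _ (tri≈ _ e _) = ⊥-elim (ns (sym e))

  same-gt0 : ∀ {r s} → r ≢ 0ℚ → s ≢ 0ℚ → ¬ (r <q 0ℚ × 0ℚ <q s) → ¬ (0ℚ <q r × s <q 0ℚ) → gt0 r ≡ gt0 s
  same-gt0 {r} {s} nr ns h₁ h₂ = go (ℚ.<-cmp 0ℚ r) (ℚ.<-cmp 0ℚ s)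
    where
    go : Tri (0ℚ <q r) (0ℚ ≡ r) (r <q 0ℚ) → Tri (0ℚ <q s) (0ℚ ≡ s) (s <q 0ℚ) → gt0 r ≡ gt0 s
    go (tri< l _ _) (tri< l′ _ _) = trans (gt0-true l) (sym (gt0-true l′))
    go (tri< l _ _) (tri> _ _ g) = ⊥-elim (h₂ (l , g))
    go (tri> _ _ g) (tri< l _ _) = ⊥-elim (h₁ (g , l))
    go (tri> _ _ g) (tri> _ _ g′) = trans (gt0-false (ℚ.<⇒≤ g)) (sym (gt0-false (ℚ.<⇒≤ g′)))
    go (tri≈ _ e _) _ = ⊥-elim (nr (sym e))
    go _ (tri≈ _ e _) = ⊥-elim (ns (sym e))

  opposite : ∀ {r s} → s ≡ -q r → r ≢ 0ℚ → not (gt0 r) ≡ gt0 s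
  opposite {r} refl nr = not-gt0 {r} { -q r } nr (λ e → nr (trans (sym (neg-neg r)) (cong -q_ e)))
    (λ (h , k) → ℚ.<-asym h (unneg-pos {r} k)) (λ (h , k) → ℚ.<-asym h (unneg-neg {r} k))

  module _ {a b c e} (ab : X a <q X b) (ce : X c <q X e) (cf : CrossFree a b c e) where

    private
      Goal : Set
      Goal = Lc a b c e xor Rc b a c e ≡ sec a b c xor sec a b e

      goal : ∀ {l r s t} → Lc a b c e ≡ l → Rc b a c e ≡ r → sec a b c ≡ s → sec a b e ≡ t → l xor r ≡ s xor t → Goal
      goal refl refl refl refl h = h

      Q = quad a b c e
      Q⁻ = quad-neg (quad a b c e)

      a-off : X c <q X a → X a <q X e → o c e a ≢ 0ℚ
      a-off h₁ h₂ z = absurd (proj₂ (cf a (onseg-start a b) (on-segment {c} {a} {e} h₁ h₂ z)))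
        where
        absurd : a ≡ c ⊎ a ≡ e → ⊥
        absurd (inj₁ q) = >⇒≢ᵖ h₁ q
        absurd (inj₂ q) = <⇒≢ᵖ h₂ q

      b-off : X c <q X b → X b <q X e → o c e b ≢ 0ℚ
      b-off h₁ h₂ z = absurd (proj₂ (cf b (onseg-end a b) (on-segment {c} {b} {e} h₁ h₂ z)))
        where
        absurd : b ≡ c ⊎ b ≡ e → ⊥
        absurd (inj₁ q) = >⇒≢ᵖ h₁ q
        absurd (inj₂ q) = <⇒≢ᵖ h₂ q

      c-off : X a <q X c → X c <q X b → o a b c ≢ 0ℚ
      c-off h₁ h₂ z = absurd (proj₁ (cf c (on-segment {a} {c} {b} h₁ h₂ z) (onseg-start c e)))
        where
        absurd : c ≡ a ⊎ c ≡ b → ⊥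
        absurd (inj₁ q) = >⇒≢ᵖ h₁ q
        absurd (inj₂ q) = <⇒≢ᵖ h₂ q

      e-off : X a <q X e → X e <q X b → o a b e ≢ 0ℚ
      e-off h₁ h₂ z = absurd (proj₁ (cf e (on-segment {a} {e} {b} h₁ h₂ z) (onseg-end c e)))
        where
        absurd : e ≡ a ⊎ e ≡ b → ⊥
        absurd (inj₁ q) = >⇒≢ᵖ h₁ q
        absurd (inj₂ q) = <⇒≢ᵖ h₂ q

      L-in : X c <q X a → X a <q X e → Lc a b c e ≡ not (gt0 (o c e a))
      L-in h₁ h₂ = trans (Lc-far (<⇒≢ᵖ h₁) (>⇒≢ᵖ h₂)) (und-in (ℚ.<⇒≤ h₁) h₂)

      R-in : X c <q X b → X b <q X e → Rc b a c e ≡ not (gt0 (o c e b))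
      R-in h₁ h₂ = trans (Rc-far (<⇒≢ᵖ h₁) (>⇒≢ᵖ h₂)) (und-in (ℚ.<⇒≤ h₁) h₂)

      L-left : X a <q X c → Lc a b c e ≡ false
      L-left h = trans (Lc-far (>⇒≢ᵖ h) (>⇒≢ᵖ (ℚ.<-trans h ce))) (und-left h ce)

      L-right : X e <q X a → Lc a b c e ≡ false
      L-right h = trans (Lc-far (<⇒≢ᵖ (ℚ.<-trans ce h)) (<⇒≢ᵖ h)) (und-right ce (ℚ.<⇒≤ h))

      R-left : X b <q X c → Rc b a c e ≡ false
      R-left h = trans (Rc-far (>⇒≢ᵖ h) (>⇒≢ᵖ (ℚ.<-trans h ce))) (und-left h ce)

      R-right : X e <q X b → Rc b a c e ≡ false
      R-right h = trans (Rc-far (<⇒≢ᵖ (ℚ.<-trans ce h)) (<⇒≢ᵖ h)) (und-right ce (ℚ.<⇒≤ h))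

      case-CAEB : X c <q X a → X a <q X e → X e <q X b → Goal
      case-CAEB h₁ h₂ h₃ = goal (L-in h₁ h₂) (R-right h₃) (sec-left (ℚ.<⇒≤ h₁)) (sec-in h₂ h₃)
        (trans (xor-identityʳ _) (not-gt0 (a-off h₁ h₂) (e-off h₂ h₃)
          (λ (p , q) → no-cross cf (cross-CADB Q h₁ h₂ h₃ p q))
          (λ (p , q) → no-cross⁻ cf (cross-CADB Q⁻ h₁ h₂ h₃ (pos-neg p) (pos-neg q)))))

      case-CABE : X c <q X a → X b <q X e → Goal
      case-CABE h₁ h₃ = goal (L-in h₁ (ℚ.<-trans ab h₃)) (R-in (ℚ.<-trans h₁ ab) h₃) (sec-left (ℚ.<⇒≤ h₁)) (sec-right (ℚ.<-trans ab h₃) (ℚ.<⇒≤ h₃))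
        (trans (cong (λ t → not t xor not (gt0 (o c e b))) (same-gt0 (a-off h₁ (ℚ.<-trans ab h₃)) (b-off (ℚ.<-trans h₁ ab) h₃)
          (λ (p , q) → no-cross cf (cross-CABD Q h₁ ab h₃ p q))
          (λ (p , q) → no-cross⁻ cf (cross-CABD Q⁻ h₁ ab h₃ (pos-neg p) (neg-pos q))))) (xor-same (not (gt0 (o c e b)))))

      case-ACEB : X a <q X c → X e <q X b → Goal
      case-ACEB h₁ h₃ = goal (L-left h₁) (R-right h₃) (sec-in h₁ (ℚ.<-trans ce h₃)) (sec-in (ℚ.<-trans h₁ ce) h₃)
        (sym (trans (cong (_xor gt0 (o a b e)) (same-gt0 (c-off h₁ (ℚ.<-trans ce h₃)) (e-off (ℚ.<-trans h₁ ce) h₃)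
          (λ (p , q) → no-cross⁻ cf (cross-ACDB Q⁻ h₁ ce h₃ (neg-pos p) (pos-neg q)))
          (λ (p , q) → no-cross cf (cross-ACDB Q h₁ ce h₃ p q)))) (xor-same (gt0 (o a b e)))))

      case-ACBE : X a <q X c → X c <q X b → X b <q X e → Goal
      case-ACBE h₁ h₂ h₃ = goal (L-left h₁) (R-in h₂ h₃) (sec-in h₁ h₂) (sec-right (ℚ.<-trans ab h₃) (ℚ.<⇒≤ h₃))
        (trans (not-gt0 (b-off h₂ h₃) (c-off h₁ h₂)
          (λ (p , q) → no-cross⁻ cf (cross-ACBD Q⁻ h₁ h₂ h₃ (neg-pos p) (neg-pos q)))
          (λ (p , q) → no-cross cf (cross-ACBD Q h₁ h₂ h₃ p q))) (sym (xor-identityʳ _)))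

    -- On the way from `a` to `b` along the upper side of `ab`, the segment `ce` starts or stops
    -- being above only where one of its ends lies above `ab`; any other change would be a crossing.
    key : (X c ≡ X a → c ≡ a) → (X c ≡ X b → c ≡ b) → (X e ≡ X a → e ≡ a) → (X e ≡ X b → e ≡ b) →
          Lc a b c e xor Rc b a c e ≡ sec a b c xor sec a b e
    key ca cb ea eb = go (ℚ.<-cmp (X e) (X a)) (ℚ.<-cmp (X c) (X b)) (ℚ.<-cmp (X c) (X a)) (ℚ.<-cmp (X e) (X b))
      where
      same : ∀ {l} → l ≡ false → l xor l ≡ false
      same {l} _ = xor-same l
      go : Tri (X e <q X a) (X e ≡ X a) (X a <q X e) → Tri (X c <q X b) (X c ≡ X b) (X b <q X c) →
           Tri (X c <q X a) (X c ≡ X a) (X a <q X c) → Tri (X e <q X b) (X e ≡ X b) (X b <q X e) → Goal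
      go (tri< h _ _) _ _ _ = goal (L-right h) (R-right (ℚ.<-trans h ab)) (sec-left (ℚ.<⇒≤ (ℚ.<-trans ce h))) (sec-left (ℚ.<⇒≤ h)) refl
      go (tri≈ _ h _) _ _ _ with ea h
      ... | refl = goal (L-end ab ce) (R-right ab) (sec-left (ℚ.<⇒≤ ce)) (sec-left {a} {b} {a} ℚ.≤-refl) refl
      go (tri> _ _ _) (tri> _ _ h) _ _ = goal (L-left (ℚ.<-trans ab h)) (R-left h) (sec-right (ℚ.<-trans ab h) (ℚ.<⇒≤ h))
        (sec-right (ℚ.<-trans (ℚ.<-trans ab h) ce) (ℚ.<⇒≤ (ℚ.<-trans h ce))) refl
      go (tri> _ _ _) (tri≈ _ h _) _ _ with cb h
      ... | refl = goal (L-left ab) (R-start ab ce) (sec-right {a} {b} {b} ab ℚ.≤-refl) (sec-right (ℚ.<-trans ab ce) (ℚ.<⇒≤ ce)) refl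
      go (tri> _ _ ae) (tri< cb′ _ _) (tri< h _ _) (tri< h′ _ _) = case-CAEB h ae h′
      go (tri> _ _ ae) (tri< cb′ _ _) (tri< h _ _) (tri> _ _ h′) = case-CABE h h′
      go (tri> _ _ ae) (tri< cb′ _ _) (tri> _ _ h) (tri< h′ _ _) = case-ACEB h h′
      go (tri> _ _ ae) (tri< cb′ _ _) (tri> _ _ h) (tri> _ _ h′) = case-ACBE h cb′ h′
      go (tri> _ _ ae) (tri< cb′ _ _) (tri< h _ _) (tri≈ _ h′ _) with eb h′
      ... | refl = goal (L-in h ae) (R-end ab cb′) (sec-left (ℚ.<⇒≤ h)) (sec-right {a} {b} {b} ab ℚ.≤-refl)
        (trans (cong (_xor gt0 (o a b c)) (opposite (trans (sym (o-cyc a b c)) (o-flip c b a)) (a-off h ae))) (xor-same (gt0 (o a b c))))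
      go (tri> _ _ ae) (tri< cb′ _ _) (tri> _ _ h) (tri≈ _ h′ _) with eb h′
      ... | refl = goal (L-left h) (R-end ab cb′) (sec-in h cb′) (sec-right {a} {b} {b} ab ℚ.≤-refl) (sym (xor-identityʳ _))
      go (tri> _ _ ae) (tri< cb′ _ _) (tri≈ _ h _) (tri< h′ _ _) with ca h
      ... | refl = goal (L-start ab ce) (R-right h′) (sec-left {a} {b} {a} ℚ.≤-refl) (sec-in ce h′) (xor-identityʳ _)
      go (tri> _ _ ae) (tri< cb′ _ _) (tri≈ _ h _) (tri> _ _ h′) with ca h
      ... | refl = goal (L-start ab ce) (R-in ab h′) (sec-left {a} {b} {a} ℚ.≤-refl) (sec-right ce (ℚ.<⇒≤ h′))
        (trans (cong (gt0 (o a b e) xor_) (opposite {o a e b} {o a b e} (o-swap a e b) (b-off ab h′))) (xor-same (gt0 (o a b e))))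
      go (tri> _ _ ae) (tri< cb′ _ _) (tri≈ _ h _) (tri≈ _ h′ _) with ca h | eb h′
      ... | refl | refl = goal (L-start ab ab) (R-end ab ab) (sec-left {a} {b} {a} ℚ.≤-refl) (sec-right {a} {b} {b} ab ℚ.≤-refl)
        (cong₂ _xor_ (gt0-zero (o-tip a b)) (gt0-zero (o-base a b)))

-- Sums modulo two

⨁ : ∀ {A : Set} → (A → Bool) → List A → Bool
⨁ f []       = false
⨁ f (x ∷ xs) = f x xor ⨁ f xs

xor-interchange : ∀ a b c d → (a xor b) xor (c xor d) ≡ (a xor c) xor (b xor d)
xor-interchange true  true  c d = sym (trans (xor-not c d) refl)
  where
  xor-not : ∀ c d → not c xor not d ≡ c xor d
  xor-not true  true  = refl
  xor-not true  false = refl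
  xor-not false true  = refl
  xor-not false false = refl
xor-interchange true false c d = xor-notʳ c d
  where
  xor-notʳ : ∀ c d → not (c xor d) ≡ not c xor d
  xor-notʳ true  true  = refl
  xor-notʳ true  false = refl
  xor-notʳ false true  = refl
  xor-notʳ false false = refl
xor-interchange false true c d = xor-notˡ c d
  where
  xor-notˡ : ∀ c d → not (c xor d) ≡ c xor not d
  xor-notˡ true  true  = refl
  xor-notˡ true  false = refl
  xor-notˡ false true  = refl
  xor-notˡ false false = refl
xor-interchange false false c d = refl

xor-cancel : ∀ {a b} → a xor b ≡ false → a ≡ b
xor-cancel {true}  {true}  e = refl
xor-cancel {false} {false} e = refl

⨁-cong : ∀ {A : Set} {f g : A → Bool} xs → (∀ {x} → x ∈ xs → f x ≡ g x) → ⨁ f xs ≡ ⨁ g xs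
⨁-cong [] h = refl
⨁-cong (x ∷ xs) h = cong₂ _xor_ (h (here refl)) (⨁-cong xs (h ∘ there))

⨁-xor : ∀ {A : Set} (f g : A → Bool) xs → ⨁ (λ x → f x xor g x) xs ≡ ⨁ f xs xor ⨁ g xs
⨁-xor f g [] = refl
⨁-xor f g (x ∷ xs) = trans (cong ((f x xor g x) xor_) (⨁-xor f g xs)) (xor-interchange (f x) (g x) _ _)

⨁-false : ∀ {A : Set} {f : A → Bool} xs → (∀ {x} → x ∈ xs → f x ≡ false) → ⨁ f xs ≡ false
⨁-false [] h = refl
⨁-false (x ∷ xs) h = cong₂ _xor_ (h (here refl)) (⨁-false xs (h ∘ there))

⨁-∧ : ∀ {A : Set} b (f : A → Bool) xs → ⨁ (λ x → b ∧ f x) xs ≡ b ∧ ⨁ f xs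
⨁-∧ true f xs = refl
⨁-∧ false f xs = ⨁-false xs (λ _ → refl)

⨁-swap : ∀ {A B : Set} (f : A → B → Bool) xs ys → ⨁ (λ x → ⨁ (f x) ys) xs ≡ ⨁ (λ y → ⨁ (λ x → f x y) xs) ys
⨁-swap f [] ys = sym (⨁-false ys (λ _ → refl))
⨁-swap f (x ∷ xs) ys = trans (cong (⨁ (f x) ys xor_) (⨁-swap f xs ys)) (sym (⨁-xor (f x) (λ y → ⨁ (λ x → f x y) xs) ys))

⨁-single : ∀ {A : Set} (f : A → Bool) {x} xs → Unique xs → x ∈ xs → (∀ {y} → y ≢ x → f y ≡ false) → ⨁ f xs ≡ f x
⨁-single f {x} (_ ∷ xs) un (here refl) h = trans (cong (f x xor_) (⨁-false xs (λ i → h λ { refl → Unique-head un i }))) (xor-identityʳ (f x))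
⨁-single f {x} (y ∷ xs) un (there i) h = trans (cong (_xor ⨁ f xs) (h λ { refl → Unique-head un i })) (⨁-single f xs (Unique-tail un) i h)

-- Polygonal arcs as sequences of segments

segs : Point → List Point → List (Point × Point)
segs p []       = []
segs p (q ∷ ps) = (p , q) ∷ segs q ps

telescope : ∀ (r : Point → Bool) p ps → ⨁ (λ s → r (proj₁ s) xor r (proj₂ s)) (segs p ps) ≡ r p xor r (lastOf p ps)
telescope r p [] = sym (xor-same (r p))
telescope r p (q ∷ ps) = trans (cong ((r p xor r q) xor_) (telescope r q ps)) (lem (r p) (r q) (r (lastOf q ps)))
  where
  lem : ∀ a b c → (a xor b) xor (b xor c) ≡ a xor c
  lem a b c = trans (xor-assoc a b (b xor c)) (cong (a xor_) (trans (sym (xor-assoc b b c)) (cong (_xor c) (xor-same b))))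

segs-ends : ∀ {p ps c e} → (c , e) ∈ segs p ps → c ∈ p ∷ ps × e ∈ ps
segs-ends {ps = q ∷ ps} (here refl) = here refl , here refl
segs-ends {ps = q ∷ ps} (there i) = let (j , k) = segs-ends i in there j , there k

penult : Point → List Point → Point
penult p []           = p
penult p (q ∷ [])     = p
penult p (q ∷ r ∷ ps) = penult q (r ∷ ps)

last-seg : ∀ p q ps → (penult p (q ∷ ps) , lastOf q ps) ∈ segs p (q ∷ ps)
last-seg p q []       = here refl
last-seg p q (r ∷ ps) = there (last-seg q r ps)

data Mid (a q b : Point) : Point → List Point → Set where
  here  : ∀ {ps} → Mid a q b a (q ∷ b ∷ ps)
  there : ∀ {p r ps} → Mid a q b r ps → Mid a q b p (r ∷ ps)

Mid-∈ : ∀ {a q b p ps} → Mid a q b p ps → q ∈ ps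
Mid-∈ here = here refl
Mid-∈ (there m) = there (Mid-∈ m)

module Incidence (ε : ℚ) where

  open Share ε public

  -- Reads `F` at the far end of a segment that ends in `q`; in the applications `F` compares
  -- directions at `q`.
  inc : (Point → Bool) → Point → Point × Point → Bool
  inc F q (c , e) = (eq c q ∧ F e) xor (eq e q ∧ F c)

  inc-off : ∀ F {q c e} → c ≢ q → e ≢ q → inc F q (c , e) ≡ false
  inc-off F {q} {c} {e} h₁ h₂ = cong₂ (λ s t → (s ∧ F e) xor (t ∧ F c)) (eq-false h₁) (eq-false h₂)

  inc-start : ∀ F {q e} → e ≢ q → inc F q (q , e) ≡ F e
  inc-start F {q} {e} h = trans (cong₂ (λ s t → (s ∧ F e) xor (t ∧ F q)) (eq-refl q) (eq-false h)) (xor-identityʳ (F e))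

  inc-end : ∀ F {q c} → c ≢ q → inc F q (c , q) ≡ F c
  inc-end F {q} {c} h = cong₂ (λ s t → (s ∧ F q) xor (t ∧ F c)) (eq-false h) (eq-refl q)

  inc-none : ∀ F {q} p ps → q ∉ p ∷ ps → ⨁ (inc F q) (segs p ps) ≡ false
  inc-none F p ps h = ⨁-false (segs p ps) λ i → let (j , k) = segs-ends i in
    inc-off F (λ { refl → h j }) (λ { refl → h (there k) })

  inc-head : ∀ F {p r ps} → Unique (p ∷ r ∷ ps) → ⨁ (inc F p) (segs p (r ∷ ps)) ≡ F r
  inc-head F {p} {r} {ps} un = trans (cong₂ _xor_ (inc-start F (λ { refl → Unique-head un (here refl) })) (inc-none F r ps (Unique-head un))) (xor-identityʳ (F r))

  inc-last : ∀ F {p r} ps → Unique (p ∷ r ∷ ps) → ⨁ (inc F (lastOf r ps)) (segs p (r ∷ ps)) ≡ F (penult p (r ∷ ps))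
  inc-last F {p} {r} [] un = trans (xor-identityʳ _) (inc-end F (λ { refl → Unique-head un (here refl) }))
  inc-last F {p} {r} (s ∷ ps) un = trans (cong₂ _xor_ (inc-off F (λ e → Unique-head un (there (subst (_∈ _) (sym e) (lastOf-∈ s ps))))
    (λ e → Unique-head (Unique-tail un) (subst (_∈ _) (sym e) (lastOf-∈ s ps)))) refl) (inc-last F ps (Unique-tail un))

  inc-mid : ∀ F {a q b p ps} → Mid a q b p ps → Unique (p ∷ ps) → ⨁ (inc F q) (segs p ps) ≡ F a xor F b
  inc-mid F {a} {q} here un = cong₂ _xor_ (inc-end F (λ { refl → Unique-head un (here refl) })) (inc-head F (Unique-tail un))
  inc-mid F {a} {q} (there {p} {r} {ps} m) un = trans (cong₂ _xor_ (lem m) refl) (inc-mid F m (Unique-tail un))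
    where
    lem : Mid a q _ r ps → inc F q (p , r) ≡ false
    lem m = inc-off F (λ { refl → Unique-head un (there (Mid-∈ m)) }) (λ { refl → Unique-head (Unique-tail un) (Mid-∈ m) })

-- `SimplePath` tolerates consecutive equal points. Without these degenerate segments the points of
-- a simple path are distinct.
clean : Point → List Point → List Point
clean p [] = []
clean p (q ∷ ps) with p ≟P q
... | yes _ = clean p ps
... | no _  = q ∷ clean q ps

data Steps : Point → List Point → Set where
  []  : ∀ {p} → Steps p []
  _∷_ : ∀ {p q ps} → p ≢ q → Steps q ps → Steps p (q ∷ ps)

clean-steps : ∀ p ps → Steps p (clean p ps)
clean-steps p [] = []
clean-steps p (q ∷ ps) with p ≟P q
... | yes _ = clean-steps p ps
... | no ne = ne ∷ clean-steps q ps

clean-last : ∀ p ps → lastOf p (clean p ps) ≡ lastOf p ps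
clean-last p [] = refl
clean-last p (q ∷ ps) with p ≟P q
... | yes refl = clean-last p ps
... | no _ = clean-last q ps

clean-on : ∀ p ps x → OnPath (p ∷ clean p ps) x → OnPath (p ∷ ps) x
clean-on p [] x h = h
clean-on p (q ∷ ps) x h with p ≟P q
... | yes refl = inj₂ (clean-on p ps x h)
... | no _ = lift h
  where
  lift : OnSeg p q x ⊎ OnPath (q ∷ clean q ps) x → OnSeg p q x ⊎ OnPath (q ∷ ps) x
  lift (inj₁ s) = inj₁ s
  lift (inj₂ t) = inj₂ (clean-on q ps x t)

clean-simple : ∀ p ps → SimplePath (p ∷ ps) → SimplePath (p ∷ clean p ps)
clean-simple p [] h = h
clean-simple p (q ∷ ps) (h , hs) with p ≟P q
... | yes refl = clean-simple p ps hs
... | no _ = (λ x i j → h x i (clean-on q ps x j)) , clean-simple q ps hs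

on-node : ∀ p ps x → x ∈ p ∷ ps → OnPath (p ∷ ps) x
on-node p [] x (here refl) = refl
on-node p (q ∷ ps) x (here refl) = inj₁ (onseg-start p q)
on-node p (q ∷ ps) x (there i) = inj₂ (on-node q ps x i)

on-seg : ∀ p ps {c e} x → (c , e) ∈ segs p ps → OnSeg c e x → OnPath (p ∷ ps) x
on-seg p (q ∷ ps) x (here refl) s = inj₁ s
on-seg p (q ∷ ps) x (there i) s = inj₂ (on-seg q ps x i s)

simple-unique : ∀ p ps → Steps p ps → SimplePath (p ∷ ps) → Unique (p ∷ ps)
simple-unique p [] st h = [] ∷ []
simple-unique p (q ∷ ps) (ne ∷ st) (h , hs) = Unique-cons
  (λ i → ne (h p (onseg-start p q) (on-node q ps p i))) (simple-unique q ps st hs)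

CrossFree-sym : ∀ {a b c d} → CrossFree a b c d → CrossFree c d a b
CrossFree-sym cf x i j = let (p , q) = cf x j i in q , p

-- A common point can only be `q`, and by simplicity of the rest `q` lies on no later segment except
-- the one starting there.
first-cross : ∀ p q ps → Steps q ps → (∀ x → OnSeg p q x → OnPath (q ∷ ps) x → x ≡ q) → SimplePath (q ∷ ps) →
              ∀ {c e} → (c , e) ∈ segs q ps → CrossFree p q c e
first-cross p q (r ∷ ps) (ne ∷ st) h (h′ , hs) {c} {e} j x on₁ on₂ = inj₂ x≡q , other j
  where
  x≡q : x ≡ q
  x≡q = h x on₁ (on-seg q (r ∷ ps) x j on₂)
  other : (c , e) ∈ segs q (r ∷ ps) → x ≡ c ⊎ x ≡ e
  other (here refl) = inj₁ x≡q
  other (there k) = ⊥-elim (ne (h′ q (onseg-start q r) (on-seg r ps q k (subst (OnSeg c e) x≡q on₂))))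

simple-cross : ∀ p ps → Steps p ps → SimplePath (p ∷ ps) → ∀ {s t} → s ∈ segs p ps → t ∈ segs p ps →
               s ≡ t ⊎ CrossFree (proj₁ s) (proj₂ s) (proj₁ t) (proj₂ t)
simple-cross p (q ∷ ps) st h (here refl) (here refl) = inj₁ refl
simple-cross p (q ∷ ps) (_ ∷ st) (h , hs) (there i) (there j) = simple-cross q ps st hs i j
simple-cross p (q ∷ ps) (_ ∷ st) (h , hs) (here refl) (there j) = inj₂ (first-cross p q ps st h hs j)
simple-cross p (q ∷ ps) (_ ∷ st) (h , hs) (there i) (here refl) = inj₂ (CrossFree-sym (first-cross p q ps st h hs i))

segs-≢ : ∀ {p ps c e} → Unique (p ∷ ps) → (c , e) ∈ segs p ps → c ≢ e
segs-≢ {ps = q ∷ ps} un (here refl) refl = Unique-head un (here refl)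
segs-≢ {ps = q ∷ ps} un (there i) = segs-≢ (Unique-tail un) i

segs-unique : ∀ p ps → Unique (p ∷ ps) → Unique (segs p ps)
segs-unique p [] un = []
segs-unique p (q ∷ ps) un = Unique-cons (λ i → Unique-head un (proj₁ (segs-ends i))) (segs-unique q ps (Unique-tail un))

Mid-segs : ∀ {a q b p ps} → Mid a q b p ps → (a , q) ∈ segs p ps × (q , b) ∈ segs p ps
Mid-segs here = here refl , there (here refl)
Mid-segs (there m) = let (i , j) = Mid-segs m in there i , there j

Mid-≢last : ∀ {a q b p ps} → Mid a q b p ps → Unique (p ∷ ps) → q ≢ lastOf p ps
Mid-≢last {q = q} {b} (here {ps}) un e = Unique-head (Unique-tail un) (subst (_∈ b ∷ ps) (sym e) (lastOf-∈ b ps))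
Mid-≢last (there m) un = Mid-≢last m (Unique-tail un)

CrossFree-flip : ∀ {a b c d} → CrossFree a b c d → CrossFree b a c d
CrossFree-flip {a} {b} cf x i j = let (e , k) = cf x (onseg-sym b a x i) j in Sum.swap e , k

CrossFree-flipʳ : ∀ {a b c d} → CrossFree a b c d → CrossFree a b d c
CrossFree-flipʳ cf = CrossFree-sym (CrossFree-flip (CrossFree-sym cf))

-- The midpoint would have to be an end.
thin : ∀ {p q} → CrossFree p q p q → p ≡ q
thin {p@(p₁ , p₂)} {q@(q₁ , q₂)} cf = ends (proj₁ (cf m on on))
  where
  open +-*-Solver
  m : Point
  m = p₁ +q ℚ.½ *q (q₁ -q p₁) , p₂ +q ℚ.½ *q (q₂ -q p₂)
  on : OnSeg p q m
  on = ℚ.½ , ℚ.<⇒≤ (ℚ.positive⁻¹ ℚ.½) , toWitness {a? = ℚ.½ ℚ.≤? 1ℚ} _ , refl , refl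
  lo : ∀ x y → (x +q ℚ.½ *q (y -q x)) +q (x +q ℚ.½ *q (y -q x)) -q y ≡ x
  lo = solve 2 (λ x y → (x :+ con ℚ.½ :* (y :- x)) :+ (x :+ con ℚ.½ :* (y :- x)) :- y := x) refl
  hi : ∀ x y → (x +q ℚ.½ *q (y -q x)) +q (x +q ℚ.½ *q (y -q x)) -q x ≡ y
  hi = solve 2 (λ x y → (x :+ con ℚ.½ :* (y :- x)) :+ (x :+ con ℚ.½ :* (y :- x)) :- x := y) refl
  dbl : ∀ x → x +q x -q x ≡ x
  dbl = solve 1 (λ x → x :+ x :- x := x) refl
  ends : m ≡ p ⊎ m ≡ q → p ≡ q
  ends (inj₁ e) = cong₂ _,_ (trans (sym (dbl p₁)) (trans (cong (λ t → proj₁ t +q proj₁ t -q p₁) (sym e)) (hi p₁ q₁)))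
                            (trans (sym (dbl p₂)) (trans (cong (λ t → proj₂ t +q proj₂ t -q p₂) (sym e)) (hi p₂ q₂)))
  ends (inj₂ e) = cong₂ _,_ (trans (sym (lo p₁ q₁)) (trans (cong (λ t → proj₁ t +q proj₁ t -q q₁) e) (dbl q₁)))
                            (trans (sym (lo p₂ q₂)) (trans (cong (λ t → proj₂ t +q proj₂ t -q q₂) e) (dbl q₂)))

-- The order of directions at a point

module Order (ε : ℚ) where

  open Incidence ε public

  before-right : ∀ {q x y} → X q <q X x → X q <q X y → before q x y ≡ gt0 (o q x y)
  before-right {q} {x} {y} h₁ h₂ rewrite lt-true {q} {x} h₁ | lt-true {q} {y} h₂ = refl

  before-left : ∀ {q x y} → X x ≤q X q → X y ≤q X q → before q x y ≡ gt0 (o q x y)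
  before-left {q} {x} {y} h₁ h₂ rewrite lt-false {q} {x} h₁ | lt-false {q} {y} h₂ = refl

  before-across : ∀ {q x y} → X q <q X x → X y ≤q X q → before q x y ≡ true
  before-across {q} {x} {y} h₁ h₂ rewrite lt-true {q} {x} h₁ | lt-false {q} {y} h₂ = refl

  before-back : ∀ {q x y} → X x ≤q X q → X q <q X y → before q x y ≡ false
  before-back {q} {x} {y} h₁ h₂ rewrite lt-false {q} {x} h₁ | lt-true {q} {y} h₂ = refl

  before-irrefl : ∀ q x → before q x x ≡ false
  before-irrefl q x = lem (lt q x) (gt0-zero (o-tip q x))
    where
    lem : ∀ b {t} → t ≡ false → (if b then (if b then t else true) else (if b then false else t)) ≡ false
    lem true e = e
    lem false e = e

  gt0-inv : ∀ {r} → gt0 r ≡ true → 0ℚ <q r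
  gt0-inv {r} e = go (ℚ.<-cmp 0ℚ r)
    where
    go : Tri (0ℚ <q r) (0ℚ ≡ r) (r <q 0ℚ) → 0ℚ <q r
    go (tri< h _ _) = h
    go (tri≈ _ h _) = ⊥-elim (true≢false e (gt0-zero (sym h)))
    go (tri> _ _ h) = ⊥-elim (true≢false e (gt0-false (ℚ.<⇒≤ h)))

  -- Directions to the right precede those to the left. On one side the order is that of slopes, and
  -- the linear relation between orientations gives transitivity.
  before-trans : ∀ {q x y w} → X q ≢ X x → X q ≢ X y → X q ≢ X w → before q x y ≡ true → before q y w ≡ true → before q x w ≡ true
  before-trans {q} {x} {y} {w} nx ny nw h₁ h₂ = go (ℚ.<-cmp (X q) (X x)) (ℚ.<-cmp (X q) (X y)) (ℚ.<-cmp (X q) (X w))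
    where
    rel : o q x w *q (X y -q X q) +q o q y w *q (X q -q X x) +q o q x y *q (X q -q X w) ≡ 0ℚ
    rel = trans (sym (cong₂ _+q_ (cong₂ _+q_ (cong (_*q (X y -q X q)) (sym (o-cyc w q x))) (cong (_*q (X q -q X x)) (sym (o-cyc w q y)))) (cong (_*q (X q -q X w)) (o-cyc q x y)))) (relation x y w q)
    right : X q <q X x → X q <q X y → X q <q X w → 0ℚ <q o q x y → 0ℚ <q o q y w → 0ℚ <q o q x w
    right hx hy hw i j = factor-pos {o q x w} {X y -q X q} (sub-pos hy) (third-pos {o q y w *q (X q -q X x)} {o q x y *q (X q -q X w)} {o q x w *q (X y -q X q)}
      (rotate {o q x w *q (X y -q X q)} {o q y w *q (X q -q X x)} {o q x y *q (X q -q X w)} rel)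
      (mul-pos-neg {o q y w} {X q -q X x} j (sub-neg hx)) (mul-pos-neg {o q x y} {X q -q X w} i (sub-neg hw)))
    left : X x <q X q → X y <q X q → X w <q X q → 0ℚ <q o q x y → 0ℚ <q o q y w → 0ℚ <q o q x w
    left hx hy hw i j = unneg-pos {o q x w} (factor-neg { -q o q x w} {X q -q X y} (sub-pos hy)
      (subst (_<q 0ℚ) (lem (o q x w) (X y) (X q)) (third-neg {o q y w *q (X q -q X x)} {o q x y *q (X q -q X w)} {o q x w *q (X y -q X q)}
      (rotate {o q x w *q (X y -q X q)} {o q y w *q (X q -q X x)} {o q x y *q (X q -q X w)} rel)
      (mul-pos {o q y w} {X q -q X x} j (sub-pos hx)) (mul-pos {o q x y} {X q -q X w} i (sub-pos hw)))))
      where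
      open +-*-Solver
      lem : ∀ a y q → a *q (y -q q) ≡ (-q a) *q (q -q y)
      lem = solve 3 (λ a y q → a :* (y :- q) := (:- a) :* (q :- y)) refl
    go : Tri (X q <q X x) (X q ≡ X x) (X x <q X q) → Tri (X q <q X y) (X q ≡ X y) (X y <q X q) → Tri (X q <q X w) (X q ≡ X w) (X w <q X q) → before q x w ≡ true
    go (tri≈ _ e _) _ _ = ⊥-elim (nx e)
    go _ (tri≈ _ e _) _ = ⊥-elim (ny e)
    go _ _ (tri≈ _ e _) = ⊥-elim (nw e)
    go (tri< hx _ _) _ (tri> _ _ hw) = before-across hx (ℚ.<⇒≤ hw)
    go _ (tri> _ _ hy) (tri< hw _ _) = ⊥-elim (true≢false h₂ (before-back (ℚ.<⇒≤ hy) hw))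
    go (tri> _ _ hx) (tri< hy _ _) _ = ⊥-elim (true≢false h₁ (before-back (ℚ.<⇒≤ hx) hy))
    go (tri< hx _ _) (tri< hy _ _) (tri< hw _ _) = trans (before-right hx hw) (gt0-true (right hx hy hw
      (gt0-inv (trans (sym (before-right hx hy)) h₁)) (gt0-inv (trans (sym (before-right hy hw)) h₂))))
    go (tri> _ _ hx) (tri> _ _ hy) (tri> _ _ hw) = trans (before-left (ℚ.<⇒≤ hx) (ℚ.<⇒≤ hw)) (gt0-true (left hx hy hw
      (gt0-inv (trans (sym (before-left (ℚ.<⇒≤ hx) (ℚ.<⇒≤ hy))) h₁)) (gt0-inv (trans (sym (before-left (ℚ.<⇒≤ hy) (ℚ.<⇒≤ hw))) h₂))))

  -- If the directions were equal, one segment would contain the far end of the other.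
  before-total : ∀ {q x y} → X q ≢ X x → X q ≢ X y → X x ≢ X y → CrossFree q x q y → before q y x ≡ not (before q x y)
  before-total {q} {x} {y} nx ny nxy cf = go (ℚ.<-cmp (X q) (X x)) (ℚ.<-cmp (X q) (X y))
    where
    xside : OnSeg q y x → ⊥
    xside on = ends (cf x (onseg-end q x) on)
      where
      ends : (x ≡ q ⊎ x ≡ x) × (x ≡ q ⊎ x ≡ y) → ⊥
      ends (_ , inj₁ e) = nx (cong X (sym e))
      ends (_ , inj₂ e) = nxy (cong X e)
    yside : OnSeg q x y → ⊥
    yside on = ends (cf y on (onseg-end q y))
      where
      ends : (y ≡ q ⊎ y ≡ x) × (y ≡ q ⊎ y ≡ y) → ⊥
      ends (inj₁ e , _) = ny (cong X (sym e))
      ends (inj₂ e , _) = nxy (cong X (sym e))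
    flat : o q x y ≡ 0ℚ → o q y x ≡ 0ℚ
    flat e = trans (o-swap q x y) (cong -q_ e)
    right : X q <q X x → X q <q X y → o q x y ≢ 0ℚ
    right hx hy z = by (ℚ.<-cmp (X x) (X y))
      where
      by : Tri (X x <q X y) (X x ≡ X y) (X y <q X x) → ⊥
      by (tri< h _ _) = xside (on-segment {q} {x} {y} hx h (flat z))
      by (tri≈ _ e _) = nxy e
      by (tri> _ _ h) = yside (on-segment {q} {y} {x} hy h z)
    left : X x <q X q → X y <q X q → o q x y ≢ 0ℚ
    left hx hy z = by (ℚ.<-cmp (X x) (X y))
      where
      by : Tri (X x <q X y) (X x ≡ X y) (X y <q X x) → ⊥
      by (tri< h _ _) = yside (onseg-sym x q y (on-segment {x} {y} {q} h hy (trans (sym (o-cyc x q y)) (flat z))))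
      by (tri≈ _ e _) = nxy e
      by (tri> _ _ h) = xside (onseg-sym y q x (on-segment {y} {x} {q} h hx (trans (sym (o-cyc y q x)) z)))
    go : Tri (X q <q X x) (X q ≡ X x) (X x <q X q) → Tri (X q <q X y) (X q ≡ X y) (X y <q X q) → before q y x ≡ not (before q x y)
    go (tri≈ _ e _) _ = ⊥-elim (nx e)
    go _ (tri≈ _ e _) = ⊥-elim (ny e)
    go (tri< hx _ _) (tri> _ _ hy) = trans (before-back (ℚ.<⇒≤ hy) hx) (cong not (sym (before-across hx (ℚ.<⇒≤ hy))))
    go (tri> _ _ hx) (tri< hy _ _) = trans (before-across hy (ℚ.<⇒≤ hx)) (cong not (sym (before-back (ℚ.<⇒≤ hx) hy)))
    go (tri< hx _ _) (tri< hy _ _) = trans (before-right hy hx) (trans (sym (opposite (o-swap q x y) (right hx hy))) (cong not (sym (before-right hx hy))))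
    go (tri> _ _ hx) (tri> _ _ hy) = trans (before-left (ℚ.<⇒≤ hy) (ℚ.<⇒≤ hx)) (trans (sym (opposite (o-swap q x y) (left hx hy))) (cong not (sym (before-left (ℚ.<⇒≤ hx) (ℚ.<⇒≤ hy)))))

  key-self : ∀ {a b} → X a <q X b → Lc a b a b xor Rc b a a b ≡ sec a b a xor sec a b b
  key-self {a} {b} ab = trans (cong₂ _xor_ (trans (L-start ab ab) (gt0-zero (o-tip a b))) (trans (R-end ab ab) (gt0-zero (o-base a b))))
    (sym (cong₂ _xor_ (sec-left {a} {b} {a} ℚ.≤-refl) (sec-right {a} {b} {b} ab ℚ.≤-refl)))

  Lc-swap : ∀ q p c e → Lc q p c e ≡ Lc q p e c
  Lc-swap q p c e = cong₂ _xor_ (xor-comm (under q c e) (under q e c)) (xor-comm (eq c q ∧ leq q e p) (eq e q ∧ leq q c p))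

  Rc-swap : ∀ q p c e → Rc q p c e ≡ Rc q p e c
  Rc-swap q p c e = cong₂ _xor_ (xor-comm (under q c e) (under q e c)) (xor-comm (eq c q ∧ before q e p) (eq e q ∧ before q c p))

  -- The parts counted below `q` cancel; what remains are the segments at `q` that are passed when
  -- turning from one direction to the other.
  Lc-Rc : ∀ q p p′ s → Lc q p (proj₁ s) (proj₂ s) xor Rc q p′ (proj₁ s) (proj₂ s) ≡ inc (λ x → leq q x p xor before q x p′) q s
  Lc-Rc q p p′ (c , e) = trans (xor-interchange (und q c e) _ (und q c e) _) (trans (vanish (xor-same (und q c e)))
    (trans (xor-interchange (eq c q ∧ leq q e p) (eq e q ∧ leq q c p) (eq c q ∧ before q e p′) (eq e q ∧ before q c p′))
    (cong₂ _xor_ (sym (∧-distribˡ-xor (eq c q) (leq q e p) (before q e p′))) (sym (∧-distribˡ-xor (eq e q) (leq q c p) (before q c p′))))))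
    where
    vanish : ∀ {u t} → u ≡ false → u xor t ≡ t
    vanish refl = refl

-- Polygonal drawings without level points

record Drawing (ε : ℚ) (n m : ℕ) : Set where
  open Sweep ε
  field
    pos : Fin n → Point
    U V : Fin m → Fin n
    hd  : Fin m → Point
    tl  : Fin m → List Point
  nodes : Fin m → List Point
  nodes e = pos (U e) ∷ hd e ∷ tl e
  ss : Fin m → List (Point × Point)
  ss e = segs (pos (U e)) (hd e ∷ tl e)
  field
    end     : ∀ e → lastOf (hd e) (tl e) ≡ pos (V e)
    uniq    : ∀ e → Unique (nodes e)
    pos-inj : ∀ {v w} → pos v ≡ pos w → v ≡ w
    ends    : ∀ {e w} → pos w ∈ nodes e → w ≡ U e ⊎ w ≡ V e
    shared  : ∀ {e f x} → e ≢ f → x ∈ nodes e → x ∈ nodes f → Σ (Fin n) λ w → x ≡ pos w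
    self    : ∀ {e s t} → s ∈ ss e → t ∈ ss e → s ≡ t ⊎ CrossFree (proj₁ s) (proj₂ s) (proj₁ t) (proj₂ t)
    cross   : ∀ {e f a b c d} → e ≢ f → (a , b) ∈ ss e → (c , d) ∈ ss f → CrossFree a b c d
    generic : ∀ {e f x y} → x ∈ nodes e → y ∈ nodes f → X x ≡ X y → x ≡ y
    simple  : ∀ {e f} → U e ≡ U f → V e ≡ V f → e ≡ f
    simple′ : ∀ {e f} → U e ≡ V f → V e ≡ U f → ⊥

-- Parities on the two sides of edges

module Plane {ε n m} (D : Drawing ε n m) where

  open Order ε
  open Drawing D

  loopless : ∀ {e} → U e ≢ V e
  loopless {e} eq′ = Unique-head (uniq e) (subst (_∈ hd e ∷ tl e) (trans (end e) (cong pos (sym eq′))) (lastOf-∈ (hd e) (tl e)))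

  Seg : Fin m → Point → Point → Set
  Seg e a b = (a , b) ∈ ss e ⊎ (b , a) ∈ ss e

  Seg-nodes : ∀ {e a b} → Seg e a b → a ∈ nodes e × b ∈ nodes e
  Seg-nodes (inj₁ i) = let (j , k) = segs-ends i in j , there k
  Seg-nodes (inj₂ i) = let (j , k) = segs-ends i in there k , j

  Seg-≢ : ∀ {e a b} → Seg e a b → a ≢ b
  Seg-≢ {e} (inj₁ i) h = segs-≢ (uniq e) i h
  Seg-≢ {e} (inj₂ i) h = segs-≢ (uniq e) i (sym h)

  X-≢ : ∀ {e f x y} → x ∈ nodes e → y ∈ nodes f → x ≢ y → X x ≢ X y
  X-≢ i j h e = h (generic i j e)

  Seg-X : ∀ {e a b} → Seg e a b → X a ≢ X b
  Seg-X s = let (i , j) = Seg-nodes s in X-≢ i j (Seg-≢ s)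

  cross-free : ∀ {e f a b c d} → e ≢ f → Seg e a b → Seg f c d → CrossFree a b c d
  cross-free h (inj₁ i) (inj₁ j) = cross h i j
  cross-free h (inj₁ i) (inj₂ j) = CrossFree-flipʳ (cross h i j)
  cross-free h (inj₂ i) (inj₁ j) = CrossFree-flip (cross h i j)
  cross-free h (inj₂ i) (inj₂ j) = CrossFree-flip (CrossFree-flipʳ (cross h i j))

  meets : ∀ {e a b c d} → Seg e a b → (c , d) ∈ ss e → ((c , d) ≡ (a , b) ⊎ (c , d) ≡ (b , a)) ⊎ CrossFree a b c d
  meets (inj₁ i) j with self i j
  ... | inj₁ e = inj₁ (inj₁ (sym e))
  ... | inj₂ cf = inj₂ cf
  meets (inj₂ i) j with self i j
  ... | inj₁ e = inj₁ (inj₂ (sym e))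
  ... | inj₂ cf = inj₂ (CrossFree-flip cf)

  edges : List (Fin m)
  edges = allFin m

  Chain : Set
  Chain = Fin m → Bool

  total : Chain → (Point × Point → Bool) → Bool
  total z f = ⨁ (λ e → z e ∧ ⨁ f (ss e)) edges

  total-arcs : ∀ z f (g : Fin m → Bool) → (∀ e → ⨁ f (ss e) ≡ g e) → total z f ≡ ⨁ (λ e → z e ∧ g e) edges
  total-arcs z f g h = ⨁-cong edges λ {e} _ → cong (z e ∧_) (h e)

  total-cong : ∀ z f g → (∀ e {s} → s ∈ ss e → f s ≡ g s) → total z f ≡ total z g
  total-cong z f g h = total-arcs z f (λ e → ⨁ g (ss e)) λ e → ⨁-cong (ss e) (h e)

  total-xor : ∀ z f g → total z f xor total z g ≡ total z (λ s → f s xor g s)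
  total-xor z f g = trans (sym (⨁-xor (λ e → z e ∧ ⨁ f (ss e)) (λ e → z e ∧ ⨁ g (ss e)) edges)) (⨁-cong edges λ {e} _ →
    trans (sym (∧-distribˡ-xor (z e) (⨁ f (ss e)) (⨁ g (ss e)))) (cong (z e ∧_) (sym (⨁-xor f g (ss e)))))

  total-+ : ∀ z z′ f → total (λ e → z e xor z′ e) f ≡ total z f xor total z′ f
  total-+ z z′ f = trans (⨁-cong edges λ {e} _ → ∧-distribʳ-xor (⨁ f (ss e)) (z e) (z′ e)) (⨁-xor (λ e → z e ∧ ⨁ f (ss e)) (λ e → z′ e ∧ ⨁ f (ss e)) edges)

  TL TR : Chain → Point → Point → Bool
  TL z q p = total z λ s → Lc q p (proj₁ s) (proj₂ s)
  TR z q p = total z λ s → Rc q p (proj₁ s) (proj₂ s)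

  TL-TR : ∀ z q p p′ → TL z q p xor TR z q p′ ≡ total z (inc (λ x → leq q x p xor before q x p′) q)
  TL-TR z q p p′ = trans (total-xor z (λ s → Lc q p (proj₁ s) (proj₂ s)) (λ s → Rc q p′ (proj₁ s) (proj₂ s))) (total-cong z (λ s → Lc q p (proj₁ s) (proj₂ s) xor Rc q p′ (proj₁ s) (proj₂ s)) (inc (λ x → leq q x p xor before q x p′) q) λ e {s} _ → Lc-Rc q p p′ s)

  bound : Fin m → Fin n → Bool
  bound e v = (U e == v) xor (V e == v)

  ∂ : Chain → Fin n → Bool
  ∂ z v = ⨁ (λ e → z e ∧ bound e v) edges

  Closed : Chain → Set
  Closed z = ∀ v → ∂ z v ≡ false

  -- Each vertex is an end of evenly many edges of `z`, so its value cancels.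
  closed-sum : ∀ {z} → Closed z → (r : Point → Bool) → ⨁ (λ e → z e ∧ (r (pos (U e)) xor r (pos (V e)))) edges ≡ false
  closed-sum {z} cl r = begin
    ⨁ (λ e → z e ∧ (r (pos (U e)) xor r (pos (V e)))) edges                 ≡⟨ ⨁-cong edges (λ {e} _ → cong (z e ∧_) (expand e)) ⟩
    ⨁ (λ e → z e ∧ ⨁ (λ v → bound e v ∧ r (pos v)) (allFin n)) edges      ≡⟨ ⨁-cong edges (λ {e} _ → sym (⨁-∧ (z e) (λ v → bound e v ∧ r (pos v)) (allFin n))) ⟩
    ⨁ (λ e → ⨁ (λ v → z e ∧ (bound e v ∧ r (pos v))) (allFin n)) edges    ≡⟨ ⨁-swap (λ e v → z e ∧ (bound e v ∧ r (pos v))) edges (allFin n) ⟩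
    ⨁ (λ v → ⨁ (λ e → z e ∧ (bound e v ∧ r (pos v))) edges) (allFin n)    ≡⟨ ⨁-false (allFin n) (λ {v} _ → vanish v) ⟩
    false                                                                   ∎
    where
    open ≡-Reasoning
    pick : ∀ u → ⨁ (λ v → (u == v) ∧ r (pos v)) (allFin n) ≡ r (pos u)
    pick u = trans (⨁-single (λ v → (u == v) ∧ r (pos v)) (allFin n) (Unique.allFin⁺ n) (∈-allFin u) (λ {v} ne → cong (_∧ r (pos v)) (==-false {u = u} {v} (λ e → ne (sym e)))))
      (cong (_∧ r (pos u)) (==-refl u))
    expand : ∀ e → r (pos (U e)) xor r (pos (V e)) ≡ ⨁ (λ v → bound e v ∧ r (pos v)) (allFin n)
    expand e = sym (trans (⨁-cong (allFin n) λ {v} _ → ∧-distribʳ-xor (r (pos v)) (U e == v) (V e == v))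
      (trans (⨁-xor (λ v → (U e == v) ∧ r (pos v)) (λ v → (V e == v) ∧ r (pos v)) (allFin n)) (cong₂ _xor_ (pick (U e)) (pick (V e)))))
    vanish : ∀ v → ⨁ (λ e → z e ∧ (bound e v ∧ r (pos v))) edges ≡ false
    vanish v = trans (⨁-cong edges λ {e} _ → trans (sym (∧-assoc (z e) (bound e v) (r (pos v)))) (∧-comm (z e ∧ bound e v) (r (pos v))))
      (trans (⨁-∧ (r (pos v)) (λ e → z e ∧ bound e v) edges) (trans (cong (r (pos v) ∧_) (cl v)) (∧-zeroʳ (r (pos v)))))

  -- Along a segment, the faces on both sides continue.
  forward : ∀ {z e a b} → Closed z → Seg e a b → X a <q X b → TL z a b ≡ TR z b a
  forward {z} {e} {a} {b} cl sg ab = xor-cancel (begin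
    TL z a b xor TR z b a                                          ≡⟨ total-xor z (λ s → Lc a b (proj₁ s) (proj₂ s)) (λ s → Rc b a (proj₁ s) (proj₂ s)) ⟩
    total z (λ s → Lc a b (proj₁ s) (proj₂ s) xor Rc b a (proj₁ s) (proj₂ s)) ≡⟨ total-arcs z (λ s → Lc a b (proj₁ s) (proj₂ s) xor Rc b a (proj₁ s) (proj₂ s)) (λ f → sec a b (pos (U f)) xor sec a b (lastOf (hd f) (tl f))) (λ f → trans (⨁-cong {f = λ s → Lc a b (proj₁ s) (proj₂ s) xor Rc b a (proj₁ s) (proj₂ s)} {g = λ s → sec a b (proj₁ s) xor sec a b (proj₂ s)} (ss f) (λ {s} i → share f i)) (telescope (sec a b) (pos (U f)) (hd f ∷ tl f))) ⟩
    ⨁ (λ f → z f ∧ (sec a b (pos (U f)) xor sec a b (lastOf (hd f) (tl f)))) edges ≡⟨ ⨁-cong edges (λ {f} _ → cong (λ p → z f ∧ (sec a b (pos (U f)) xor sec a b p)) (end f)) ⟩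
    ⨁ (λ f → z f ∧ (sec a b (pos (U f)) xor sec a b (pos (V f)))) edges ≡⟨ closed-sum cl (sec a b) ⟩
    false                                                          ∎)
    where
    open ≡-Reasoning
    na = proj₁ (Seg-nodes sg)
    nb = proj₂ (Seg-nodes sg)
    Share-of : Point → Point → Set
    Share-of c d = Lc a b c d xor Rc b a c d ≡ sec a b c xor sec a b d
    turn : ∀ {c d} → Share-of d c → Share-of c d
    turn {c} {d} h = trans (cong₂ _xor_ (Lc-swap a b c d) (Rc-swap b a c d)) (trans h (xor-comm (sec a b d) (sec a b c)))
    free : ∀ {f c d} → (c , d) ∈ ss f → CrossFree a b c d → Share-of c d
    free {f} {c} {d} i cf = by (ℚ.<-cmp (X c) (X d))
      where
      nc = proj₁ (Seg-nodes {f} (inj₁ i))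
      nd = proj₂ (Seg-nodes {f} (inj₁ i))
      by : Tri (X c <q X d) (X c ≡ X d) (X d <q X c) → Share-of c d
      by (tri< h _ _) = key ab h cf (generic nc na) (generic nc nb) (generic nd na) (generic nd nb)
      by (tri≈ _ h _) = ⊥-elim (Seg-X {f} (inj₁ i) h)
      by (tri> _ _ h) = turn (key ab h (CrossFree-flipʳ cf) (generic nd na) (generic nd nb) (generic nc na) (generic nc nb))
    share : ∀ f {c d} → (c , d) ∈ ss f → Share-of c d
    share f i with e Fin.≟ f
    ... | no ne = free i (cross-free ne sg (inj₁ i))
    ... | yes refl with meets sg i
    ... | inj₂ cf = free i cf
    ... | inj₁ (inj₁ refl) = key-self ab
    ... | inj₁ (inj₂ refl) = turn (key-self ab)

  before-swap : ∀ {e f q x y} → Seg e q x → Seg f q y → CrossFree q x q y → before q y x ≡ not (before q x y)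
  before-swap {e} {f} {q} {x} {y} s t cf = before-total (Seg-X s) (Seg-X t) (X-≢ (proj₂ (Seg-nodes s)) (proj₂ (Seg-nodes t)) ne) cf
    where
    ne : x ≢ y
    ne refl = Seg-≢ s (thin cf)

  -- Crossing a segment changes the face by its own edge.
  own : ∀ z {e q p} → Seg e q p → TL z q p xor TR z q p ≡ z e
  own z {e} {q} {p} sg = trans (TL-TR z q p p) (trans (total-arcs z (inc F q) (λ f → e == f) arcs)
    (trans (⨁-single (λ f → z f ∧ (e == f)) edges (Unique.allFin⁺ m) (∈-allFin e)
      (λ {f} ne → trans (cong (z f ∧_) (==-false {u = e} {f} (λ h → ne (sym h)))) (∧-zeroʳ (z f))))
      (trans (cong (z e ∧_) (==-refl e)) (∧-identityʳ (z e)))))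
    where
    -- True for the direction to `p` and false for every other one, since two distinct directions
    -- precede each other in exactly one order.
    F : Point → Bool
    F x = leq q x p xor before q x p
    F-p : F p ≡ true
    F-p rewrite before-irrefl q p = refl
    F-x : ∀ {f x} → Seg f q x → CrossFree q p q x → F x ≡ false
    F-x {f} {x} t cf = trans (cong (λ b → not (before q p x) xor b) (before-swap sg t cf)) (xor-same (not (before q p x)))
    none : ∀ {f c d} → (c , d) ∈ ss f → CrossFree q p c d → inc F q (c , d) ≡ false
    none {f} {c} {d} i cf with c ≟P q | d ≟P q
    ... | yes refl | yes refl = ⊥-elim (Seg-≢ {f} (inj₁ i) refl)
    ... | yes refl | no h = trans (inc-start F h) (F-x {f} (inj₁ i) cf)
    ... | no h | yes refl = trans (inc-end F h) (F-x {f} (inj₂ i) (CrossFree-flipʳ cf))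
    ... | no h | no h′ = inc-off F h h′
    self-sum : ∀ {s} → s ∈ ss e → s ≡ (q , p) ⊎ s ≡ (p , q) → inc F q s ≡ true → (∀ {t} → t ∈ ss e → t ≢ s → CrossFree q p (proj₁ t) (proj₂ t)) → ⨁ (inc F q) (ss e) ≡ true
    self-sum {s} i _ h cf = trans (⨁-cong {g = λ t → inc F q t ∧ ⌊ ≟S t s ⌋} (ss e) pt) (trans (⨁-single (λ t → inc F q t ∧ ⌊ ≟S t s ⌋) (ss e) (segs-unique _ _ (uniq e)) i
      (λ {t} ne → trans (cong (inc F q t ∧_) (dec-no (≟S t s) ne)) (∧-zeroʳ (inc F q t)))) (cong₂ _∧_ h (dec-yes (≟S s s) refl)))
      where
      ≟S : DecidableEquality (Point × Point)
      ≟S = ≡-dec _≟P_ _≟P_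
      pt : ∀ {t} → t ∈ ss e → inc F q t ≡ inc F q t ∧ ⌊ ≟S t s ⌋
      pt {t} j = by (≟S t s)
        where
        by : (d : Dec (t ≡ s)) → inc F q t ≡ inc F q t ∧ ⌊ d ⌋
        by (yes _) = sym (∧-identityʳ (inc F q t))
        by (no ne) = trans (none j (cf j ne)) (sym (∧-zeroʳ (inc F q t)))
    own-sum : Seg e q p → ⨁ (inc F q) (ss e) ≡ true
    own-sum (inj₁ i) = self-sum i (inj₁ refl) (trans (inc-start F (λ h → Seg-≢ sg (sym h))) F-p) λ j ne → by (self i j) ne
      where
      by : ∀ {t} → (q , p) ≡ t ⊎ CrossFree q p (proj₁ t) (proj₂ t) → t ≢ (q , p) → CrossFree q p (proj₁ t) (proj₂ t)
      by (inj₁ e) ne = ⊥-elim (ne (sym e))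
      by (inj₂ cf) _ = cf
    own-sum (inj₂ i) = self-sum i (inj₂ refl) (trans (inc-end F (λ h → Seg-≢ sg (sym h))) F-p) λ j ne → by (self i j) ne
      where
      by : ∀ {t} → (p , q) ≡ t ⊎ CrossFree p q (proj₁ t) (proj₂ t) → t ≢ (p , q) → CrossFree q p (proj₁ t) (proj₂ t)
      by (inj₁ e) ne = ⊥-elim (ne (sym e))
      by (inj₂ cf) _ = CrossFree-flip cf
    arcs : ∀ f → ⨁ (inc F q) (ss f) ≡ (e == f)
    arcs f with e Fin.≟ f
    ... | yes refl = own-sum sg
    ... | no ne = ⨁-false (ss f) λ i → none {f} i (cross-free ne sg (inj₁ i))

  -- By `own`, the two sides differ by `z e` at both ends, so the statement for the upper side
  -- implies the one for the lower side.
  across : ∀ {z e a b} → Closed z → Seg e a b → TL z a b ≡ TR z b a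
  across {z} {e} {a} {b} cl sg = by (ℚ.<-cmp (X a) (X b))
    where
    by : Tri (X a <q X b) (X a ≡ X b) (X b <q X a) → TL z a b ≡ TR z b a
    by (tri< h _ _) = forward cl sg h
    by (tri≈ _ h _) = ⊥-elim (Seg-X sg h)
    by (tri> _ _ h) = xor-cancelʳ (TR z a b) (trans (own z sg) (trans (sym (own z (Sum.swap sg))) (trans (xor-comm (TL z b a) (TR z b a))
      (cong (TR z b a xor_) (forward cl (Sum.swap sg) h)))))
      where
      xor-cancelʳ : ∀ {s t} u → s xor u ≡ t xor u → s ≡ t
      xor-cancelʳ {s} {t} u e = trans (sym (undo s)) (trans (cong (_xor u) e) (undo t))
        where
        undo : ∀ s → (s xor u) xor u ≡ s
        undo s = trans (xor-assoc s u u) (trans (cong (s xor_) (xor-same u)) (xor-identityʳ s))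

  at-bend : ∀ {e a q b} → Mid a q b (pos (U e)) (hd e ∷ tl e) → ∀ F z → F a xor F b ≡ false → total z (inc F q) ≡ false
  at-bend {e} {a} {q} {b} mid F z h = trans (total-arcs z (inc F q) (λ _ → false) arcs) (⨁-false edges λ {f} _ → ∧-zeroʳ (z f))
    where
    not-end : ∀ {w} → q ≡ pos w → w ≡ U e ⊎ w ≡ V e → ⊥
    not-end refl (inj₁ refl) = Unique-head (uniq e) (Mid-∈ mid)
    not-end refl (inj₂ refl) = Mid-≢last mid (uniq e) (sym (end e))
    arcs : ∀ f → ⨁ (inc F q) (ss f) ≡ false
    arcs f with e Fin.≟ f
    ... | yes refl = trans (inc-mid F mid (uniq e)) h
    ... | no ne = inc-none F _ _ λ i → let (w , eq′) = shared ne (there (Mid-∈ mid)) i in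
      not-end eq′ (ends (subst (_∈ nodes e) eq′ (there (Mid-∈ mid))))

  -- Only two segments, both of the same edge, meet at a bend, so the parity on each side of the arc
  -- carries over.
  bend : ∀ {e a q b} z → Mid a q b (pos (U e)) (hd e ∷ tl e) → TR z q a ≡ TL z q b × TL z q a ≡ TR z q b
  bend {e} {a} {q} {b} z mid = sym (xor-cancel (trans (TL-TR z q b a) (at-bend {e} mid _ z one))) , xor-cancel (trans (TL-TR z q a b) (at-bend {e} mid _ z two))
    where
    lem₁ : ∀ t → (not t xor false) xor (true xor t) ≡ false
    lem₁ true = refl
    lem₁ false = refl
    lem₂ : ∀ t → (true xor t) xor (not t xor false) ≡ false
    lem₂ true = refl
    lem₂ false = refl
    one : (leq q a b xor before q a a) xor (leq q b b xor before q b a) ≡ false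
    one rewrite before-irrefl q a | before-irrefl q b = lem₁ (before q b a)
    two : (leq q a a xor before q a b) xor (leq q b a xor before q b b) ≡ false
    two rewrite before-irrefl q a | before-irrefl q b = lem₂ (before q a b)

  Dart : Set
  Dart = Fin m × Bool

  rev : Dart → Dart
  rev (e , b) = e , not b

  tail : Dart → Fin n
  tail (e , true)  = U e
  tail (e , false) = V e

  next : Dart → Point
  next (e , true)  = hd e
  next (e , false) = penult (pos (U e)) (hd e ∷ tl e)

  Lft Rgt : Dart → Chain → Bool
  Lft d z = TL z (pos (tail d)) (next d)
  Rgt d z = TR z (pos (tail d)) (next d)

  dart-seg : ∀ d → Seg (proj₁ d) (pos (tail d)) (next d)
  dart-seg (e , true)  = inj₁ (here refl)
  dart-seg (e , false) = inj₂ (subst (λ p → (penult (pos (U e)) (hd e ∷ tl e) , p) ∈ ss e) (end e) (last-seg (pos (U e)) (hd e) (tl e)))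

  own-dart : ∀ d z → Lft d z xor Rgt d z ≡ z (proj₁ d)
  own-dart d z = own z (dart-seg d)

  walk : ∀ {z} e → Closed z → ∀ p r ps → (∀ {s} → s ∈ segs p (r ∷ ps) → s ∈ ss e) →
         (∀ {a q b} → Mid a q b p (r ∷ ps) → Mid a q b (pos (U e)) (hd e ∷ tl e)) →
         TL z p r ≡ TR z (lastOf r ps) (penult p (r ∷ ps)) × TR z p r ≡ TL z (lastOf r ps) (penult p (r ∷ ps))
  walk e cl p r [] hs hm = across {e = e} cl (inj₁ (hs (here refl))) , sym (across {e = e} cl (inj₂ (hs (here refl))))
  walk {z} e cl p r (s ∷ ps) hs hm with walk {z} e cl r s ps (hs ∘ there) (hm ∘ there) | bend {e} z (hm here)
  ... | w₁ , w₂ | b₁ , b₂ = trans (across {e = e} cl (inj₁ (hs (here refl)))) (trans b₁ w₁) ,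
    trans (sym (across {e = e} cl (inj₂ (hs (here refl))))) (trans b₂ w₂)

  Lft-rev : ∀ {z} → Closed z → ∀ d → Lft d z ≡ Rgt (rev d) z
  Lft-rev {z} cl (e , b) with walk {z} e cl (pos (U e)) (hd e) (tl e) id id
  Lft-rev {z} cl (e , true)  | w , _ = trans w (cong (λ p → TR z p (next (e , false))) (end e))
  Lft-rev {z} cl (e , false) | _ , w = trans (cong (λ p → TL z p (next (e , false))) (sym (end e))) (sym w)

  bef : Dart → Dart → Bool
  bef d d′ = before (pos (tail d)) (next d) (next d′)

  bef-irrefl : ∀ d → bef d d ≡ false
  bef-irrefl d = before-irrefl (pos (tail d)) (next d)

  bef-trans : ∀ {c d e} → tail c ≡ tail d → tail d ≡ tail e → bef c d ≡ true → bef d e ≡ true → bef c e ≡ true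
  bef-trans {c} {d} {e} h₁ h₂ b₁ b₂ = before-trans (Seg-X (dart-seg c)) (nx d (sym h₁)) (nx e (sym (trans h₁ h₂))) b₁
    (subst (λ v → before (pos v) (next d) (next e) ≡ true) (sym h₁) b₂)
    where
    nx : ∀ d → tail d ≡ tail c → X (pos (tail c)) ≢ X (next d)
    nx d h = subst (λ v → X (pos v) ≢ X (next d)) h (Seg-X (dart-seg d))

  bef-swap : ∀ {c d} → tail c ≡ tail d → c ≢ d → bef d c ≡ not (bef c d)
  bef-swap {c@(e , b)} {d@(f , b′)} h ne = trans (cong (λ v → before (pos v) (next d) (next c)) (sym h)) (before-swap (dart-seg c) sd (cross-free e≢f (dart-seg c) sd))
    where
    sd : Seg f (pos (tail c)) (next d)
    sd = subst (λ v → Seg f (pos v) (next d)) (sym h) (dart-seg d)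
    e≢f : e ≢ f
    e≢f refl = same b b′ ne h
      where
      same : ∀ b b′ → (e , b) ≢ (e , b′) → tail (e , b) ≢ tail (e , b′)
      same true  true  ne _ = ne refl
      same false false ne _ = ne refl
      same true  false _  h = loopless h
      same false true  _  h = loopless (sym h)

-- Linear algebra modulo two

private
  bit : Fin 2 → Bool
  bit zero    = false
  bit (suc _) = true

  unbit : Bool → Fin 2
  unbit false = zero
  unbit true  = suc zero

  bit-unbit : ∀ b → bit (unbit b) ≡ b
  bit-unbit false = refl
  bit-unbit true  = refl

  unbit-bit : ∀ i → unbit (bit i) ≡ i
  unbit-bit zero       = refl
  unbit-bit (suc zero) = refl

funToFin-cong : ∀ {m n} {f g : Fin m → Fin n} → (∀ i → f i ≡ g i) → funToFin f ≡ funToFin g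
funToFin-cong {zero}  h = refl
funToFin-cong {suc m} h = cong₂ combine (h zero) (funToFin-cong (h ∘ suc))

Additive : ∀ {m} → ((Fin m → Bool) → Bool) → Set
Additive f = ∀ x y → f (λ e → x e xor y e) ≡ f x xor f y

-- Pigeonhole: two of the `2 ^ m` vectors have the same image among `2 ^ k`, and their difference is
-- a nonzero solution.
kernel : ∀ {m k} (f : Fin k → (Fin m → Bool) → Bool) → (∀ i → Additive (f i)) → k < m →
         Σ (Fin m → Bool) λ z → (Σ (Fin m) λ e → z e ≡ true) × (∀ i → f i z ≡ false)
kernel {m} {k} f add lt = collide (Fin.pigeonhole (^-monoʳ-< 2 (s≤s (s≤s z≤n)) lt) image)
  where
  chain : Fin (2 ^ m) → Fin m → Bool
  chain x e = bit (finToFun x e)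
  image : Fin (2 ^ m) → Fin (2 ^ k)
  image x = funToFin {k} {2} (λ i → unbit (f i (chain x)))
  collide : (Σ (Fin (2 ^ m)) λ x → Σ (Fin (2 ^ m)) λ y → x Fin.< y × image x ≡ image y) → _
  collide (x , y , x<y , eq) = (λ e → chain x e xor chain y e) , differ (Fin.any? (λ e → ¬? (chain x e Bool.≟ chain y e))) , zero′
    where
    same : ∀ i → f i (chain x) ≡ f i (chain y)
    same i = trans (sym (bit-unbit _)) (trans (cong bit (trans (sym (Fin.finToFun-funToFin (λ i → unbit (f i (chain x))) i))
      (trans (cong (λ j → finToFun {2} {k} j i) eq) (Fin.finToFun-funToFin (λ i → unbit (f i (chain y))) i)))) (bit-unbit _))
    zero′ : ∀ i → f i (λ e → chain x e xor chain y e) ≡ false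
    zero′ i = trans (add i (chain x) (chain y)) (trans (cong (_xor f i (chain y)) (same i)) (xor-same (f i (chain y))))
    xor-≢ : ∀ {a b} → a ≢ b → a xor b ≡ true
    xor-≢ {true}  {true}  h = ⊥-elim (h refl)
    xor-≢ {true}  {false} h = refl
    xor-≢ {false} {true}  h = refl
    xor-≢ {false} {false} h = ⊥-elim (h refl)
    differ : Dec (Σ (Fin m) λ e → chain x e ≢ chain y e) → Σ (Fin m) λ e → chain x e xor chain y e ≡ true
    differ (yes (e , ne)) = e , xor-≢ ne
    differ (no h) = ⊥-elim (Fin.<⇒≢ x<y (trans (sym (Fin.funToFin-finToFin {m} {2} x)) (trans (funToFin-cong agree) (Fin.funToFin-finToFin {m} {2} y))))
      where
      agree : ∀ e → finToFun {2} {m} x e ≡ finToFun y e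
      agree e = trans (sym (unbit-bit _)) (trans (cong unbit (decidable-stable (chain x e Bool.≟ chain y e) λ ne → h (e , ne))) (unbit-bit _))

kernel-list : ∀ {m} (fs : List ((Fin m → Bool) → Bool)) → (∀ {f} → f ∈ fs → Additive f) → length fs < m →
              Σ (Fin m → Bool) λ z → (Σ (Fin m) λ e → z e ≡ true) × (∀ {f} → f ∈ fs → f z ≡ false)
kernel-list fs add lt with kernel (lookup fs) (λ i → add (∈-lookup i)) lt
... | z , nz , h = z , nz , λ {f} i → trans (cong (λ g → g z) (lookup-index i)) (h (index i))

-- Classes with at least three members

module Classes {A : Set} (_~_ : A → A → Set) (~-refl : ∀ {a} → a ~ a) (~-sym : ∀ {a b} → a ~ b → b ~ a)
               (~-trans : ∀ {a b c} → a ~ b → b ~ c → a ~ c)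
               (φ : A → A) (φ-~ : ∀ a → a ~ φ a) (φ-≢ : ∀ a → φ a ≢ a) (φφ-≢ : ∀ a → φ (φ a) ≢ a) where

  discard : ∀ (P : A → Set) xs → Unique xs → ¬ ¬ (Σ (List A) λ ys → Unique ys × (∀ {x} → x ∈ xs → P x ⊎ x ∈ ys) × (∀ {x} → x ∈ ys → ¬ P x × x ∈ xs))
  discard P [] un k = k ([] , [] , (λ ()) , λ ())
  discard P (x ∷ xs) un k = discard P xs (Unique-tail un) λ (ys , uy , f , g) → em {P = P x} λ
    { (yes p) → k (ys , uy , (λ { (here refl) → inj₁ p ; (there i) → f i }) , λ i → proj₁ (g i) , there (proj₂ (g i)))
    ; (no np) → k (x ∷ ys , Unique-cons (λ i → Unique-head un (proj₂ (g i))) uy ,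
        (λ { (here refl) → inj₂ (here refl) ; (there i) → Sum.map₂ there (f i) }) ,
        λ { (here refl) → np , here refl ; (there i) → proj₁ (g i) , there (proj₂ (g i)) }) }

  -- Discarding the class of `a` removes at least the three distinct elements `a`, `φ a` and
  -- `φ (φ a)`.
  representatives : ∀ k xs → length xs ≤ k → Unique xs → (∀ {a b} → a ~ b → a ∈ xs → b ∈ xs) →
    ¬ ¬ (Σ (List A) λ rs → 3 * length rs ≤ length xs × (∀ {x} → x ∈ xs → Σ A λ r → r ∈ rs × r ~ x))
  representatives k [] le un cl f = f ([] , z≤n , λ ())
  representatives (suc k) xs@(a ∷ _) le un cl f = discard (a ~_) xs un λ (ys , uy , g , h) →
    let shorter : 3 + length ys ≤ length xs
        shorter = Unique-⊆-length (a ∷ φ a ∷ φ (φ a) ∷ ys)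
          (Unique-cons (λ { (here e) → φ-≢ a (sym e) ; (there (here e)) → φφ-≢ a (sym e) ; (there (there i)) → proj₁ (h i) ~-refl })
          (Unique-cons (λ { (here e) → φ-≢ (φ a) (sym e) ; (there i) → proj₁ (h i) (φ-~ a) })
          (Unique-cons (λ i → proj₁ (h i) (~-trans (φ-~ a) (φ-~ (φ a)))) uy)))
          (λ { (here refl) → here refl ; (there (here refl)) → cl (φ-~ a) (here refl)
             ; (there (there (here refl))) → cl (~-trans (φ-~ a) (φ-~ (φ a))) (here refl) ; (there (there (there i))) → proj₂ (h i) })
    in representatives k ys (s≤s⁻¹ (≤-trans (m≤n+m _ 2) (≤-trans shorter le))) uy
      (λ r i → Sum.[ (λ s → ⊥-elim (proj₁ (h i) (~-trans s (~-sym r)))) , id ] (g (cl r (proj₂ (h i)))))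
      λ (rs , le′ , cover) → f (a ∷ rs , ≤-trans (≤-reflexive (*-suc 3 (length rs))) (≤-trans (+-monoʳ-≤ 3 le′) shorter) ,
        λ i → Sum.[ (λ s → a , here refl , s) , (λ j → let (r , m , s) = cover j in r , there m , s) ] (g i))

-- Corners, face traversal and the edge count

module Count {ε n m} (D : Drawing ε n m) where

  open Order ε
  open Drawing D
  open Plane D

  -- A constant value is added once for every edge of `z` at `v`, that is, an even number of times.
  at-vertex : ∀ v F b z → Closed z → (∀ d → tail d ≡ v → F (next d) ≡ b) → total z (inc F (pos v)) ≡ false
  at-vertex v F b z cl h = trans (total-arcs z (inc F (pos v)) (λ e → bound e v ∧ b) arcs)
    (trans (⨁-cong edges λ {e} _ → trans (sym (∧-assoc (z e) (bound e v) b)) (∧-comm (z e ∧ bound e v) b))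
    (trans (⨁-∧ b (λ e → z e ∧ bound e v) edges) (trans (cong (b ∧_) (cl v)) (∧-zeroʳ b))))
    where
    arcs : ∀ e → ⨁ (inc F (pos v)) (ss e) ≡ bound e v ∧ b
    arcs e with U e Fin.≟ v | V e Fin.≟ v
    ... | yes refl | yes eq = ⊥-elim (loopless {e} (sym eq))
    ... | yes refl | no nv = trans (inc-head F (uniq e)) (h (e , true) refl)
    ... | no nu | yes refl = trans (trans (cong (λ q → ⨁ (inc F q) (ss e)) (sym (end e))) (inc-last F (tl e) (uniq e))) (h (e , false) refl)
    ... | no nu | no nv = inc-none F _ _ λ i → Sum.[ (λ q → nu (sym q)) , (λ q → nv (sym q)) ] (ends {e} i)

  darts : List Dart
  darts = map (_, true) edges ++ map (_, false) edges

  ∈-darts : ∀ d → d ∈ darts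
  ∈-darts (e , true)  = ∈-++⁺ˡ (∈-map⁺ (_, true) (∈-allFin e))
  ∈-darts (e , false) = ∈-++⁺ʳ (map (_, true) edges) (∈-map⁺ (_, false) (∈-allFin e))

  darts-unique : Unique darts
  darts-unique = Unique-++ (Unique.map⁺ (λ { refl → refl }) (Unique.allFin⁺ m)) (Unique.map⁺ (λ { refl → refl }) (Unique.allFin⁺ m)) disjoint
    where
    disjoint : ∀ {d} → d ∈ map (_, true) edges → d ∈ map (_, false) edges → ⊥
    disjoint i j with ∈-map⁻ (_, true) i | ∈-map⁻ (_, false) j
    ... | _ , _ , refl | _ , _ , ()

  darts-length : length darts ≡ m + m
  darts-length = trans (length-++ (map (_, true) edges)) (cong₂ _+_ (side true) (side false))
    where
    side : ∀ b → length (map (_, b) edges) ≡ m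
    side b = trans (length-map {A = Fin m} {B = Dart} (_, b) edges) (length-tabulate {A = Fin m} (id {A = Fin m}))

  _≟D_ : DecidableEquality Dart
  _≟D_ = ≡-dec Fin._≟_ Bool._≟_

  bef-asym : ∀ {c d} → tail c ≡ tail d → bef c d ≡ true → bef d c ≡ false
  bef-asym {c} {d} h b with c ≟D d
  ... | yes refl = bef-irrefl c
  ... | no ne = trans (bef-swap {c} {d} h ne) (cong not b)

  AtMost : Dart → Dart → Set
  AtMost m y = y ≡ m ⊎ bef y m ≡ true

  last-dart : ∀ v x xs → (∀ {y} → y ∈ x ∷ xs → tail y ≡ v) → Σ Dart λ m → m ∈ x ∷ xs × (∀ {y} → y ∈ x ∷ xs → AtMost m y)
  last-dart v x [] h = x , here refl , λ { (here refl) → inj₁ refl }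
  last-dart v x (x′ ∷ xs) h with last-dart v x′ xs (h ∘ there)
  ... | m , i , mx with x ≟D m | bef x m in b
  ... | yes refl | _ = m , there i , λ { (here refl) → inj₁ refl ; (there j) → mx j }
  ... | no ne | true = m , there i , λ { (here refl) → inj₂ b ; (there j) → mx j }
  ... | no ne | false = x , here refl , λ { (here refl) → inj₁ refl ; (there j) → inj₂ (up j (mx j)) }
    where
    mv = h (there i)
    xv = h (here refl)
    m<x : bef m x ≡ true
    m<x = trans (bef-swap {x} {m} (trans xv (sym mv)) ne) (cong not b)
    up : ∀ {y} → y ∈ x′ ∷ xs → AtMost m y → bef y x ≡ true
    up j (inj₁ refl) = m<x
    up {y} j (inj₂ b′) = bef-trans {y} {m} {x} (trans (h (there j)) (sym mv)) (trans mv (sym xv)) b′ m<x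

  filtered : ∀ (p : Dart → Bool) {d} → p d ≡ true → d ∈ filterᵇ p darts
  filtered p {d} e = ∈-filter⁺ (T? ∘ p) (∈-darts d) (subst T (sym e) _)

  unfiltered : ∀ (p : Dart → Bool) {d} → d ∈ filterᵇ p darts → p d ≡ true
  unfiltered p i = T-true (proj₂ (∈-filter⁻ (T? ∘ p) {xs = darts} i))

  Pred : Dart → Set
  Pred d = Σ Dart λ c → tail c ≡ tail d × c ≢ d × (∀ z → Closed z → Lft c z ≡ Rgt d z)

  -- Consecutive darts at a vertex bound a common corner.
  corner : ∀ {c d} b → tail c ≡ tail d → (∀ x → tail x ≡ tail d → not (bef c x) xor bef x d ≡ b) → ∀ z → Closed z → Lft c z ≡ Rgt d z
  corner {c} {d} b h f z cl = trans (cong (λ v → TL z (pos v) (next c)) h) (xor-cancel (trans (TL-TR z q (next c) (next d))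
    (at-vertex (tail d) F b z cl λ x e → trans (cong₂ (λ s t → not (before (pos s) (next c) (next x)) xor before (pos t) (next x) (next d)) (sym h) (sym e)) (f x e))))
    where
    q = pos (tail d)
    F : Point → Bool
    F x = leq q x (next c) xor before q x (next d)

  module _ (branching : ∀ d → Σ Dart λ y → y ≢ d × tail y ≡ tail d) where

    -- The last dart before `d`, or the last of all if `d` comes first. In the second case the turn
    -- passes straight down, every dart at the vertex contributes `true`, and evenness of `z` there
    -- makes up for it; `branching` ensures that the result is not `d`.
    preceding : ∀ d → Pred d
    preceding d = choose (filterᵇ below darts) (λ i → let (p , q) = ∧-true (unfiltered below i) in ==-true p , q)
      (λ {x} p q → filtered below {x} (∧-intro (trans (cong (_== tail d) p) (==-refl (tail d))) q))
      where
      below : Dart → Bool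
      below x = (tail x == tail d) ∧ bef x d
      based : Dart → Bool
      based x = tail x == tail d
      choose : (xs : List Dart) → (∀ {x} → x ∈ xs → tail x ≡ tail d × bef x d ≡ true) → (∀ {x} → tail x ≡ tail d → bef x d ≡ true → x ∈ xs) → Pred d
      choose (x ∷ xs) f g with last-dart (tail d) x xs (proj₁ ∘ f)
      ... | c , i , mx = c , cv , (λ { refl → true≢false cd (bef-irrefl c) }) , corner {c} {d} false cv side
        where
        cv = proj₁ (f i)
        cd = proj₂ (f i)
        side : ∀ y → tail y ≡ tail d → not (bef c y) xor bef y d ≡ false
        side y yv with bef y d in b
        ... | true = cong (λ t → not t xor true) (low (mx {y} (g {y} yv b)))
          where
          low : AtMost c y → bef c y ≡ false
          low (inj₁ refl) = bef-irrefl c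
          low (inj₂ b′) = bef-asym {y} {c} (trans yv (sym cv)) b′
        ... | false = cong (λ t → not t xor false) (high (y ≟D d))
          where
          high : Dec (y ≡ d) → bef c y ≡ true
          high (yes refl) = cd
          high (no ne) = bef-trans {c} {d} {y} cv (sym yv) cd (trans (bef-swap {y} {d} yv ne) (cong not b))
      choose [] f g with filterᵇ based darts | filtered based {d} (==-refl (tail d)) | (λ {x} (e : tail x ≡ tail d) → filtered based {x} (trans (cong (_== tail d) e) (==-refl (tail d)))) | (λ {x} → unfiltered based {x})
      ... | x ∷ xs | _ | all | only with last-dart (tail d) x xs (λ {y} i → ==-true (only {y} i))
      ... | c , i , mx = c , cv , c≢d , corner {c} {d} true cv side
        where
        cv : tail c ≡ tail d
        cv = ==-true (only {c} i)
        none : ∀ {y} → tail y ≡ tail d → bef y d ≡ true → ⊥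
        none {y} yv b with g {y} yv b
        ... | ()
        c≢d : c ≢ d
        c≢d refl with branching d
        ... | y , ne , yv with mx {y} (all {y} yv)
        ... | inj₁ e = ne e
        ... | inj₂ b = none {y} yv b
        side : ∀ y → tail y ≡ tail d → not (bef c y) xor bef y d ≡ true
        side y yv = cong₂ (λ s t → not s xor t) (low (mx {y} (all {y} yv))) (not-true (none {y} yv))
          where
          low : AtMost c y → bef c y ≡ false
          low (inj₁ refl) = bef-irrefl c
          low (inj₂ b′) = bef-asym {y} {c} (trans yv (sym cv)) b′

    -- The next dart in a traversal of the face on the left.
    φ : Dart → Dart
    φ d = proj₁ (preceding (rev d))

    φ-tail : ∀ d → tail (φ d) ≡ tail (rev d)
    φ-tail d = proj₁ (proj₂ (preceding (rev d)))

    tail-rev : ∀ d → tail d ≢ tail (rev d)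
    tail-rev (e , true)  h = loopless h
    tail-rev (e , false) h = loopless (sym h)

    φ-≢ : ∀ d → φ d ≢ d
    φ-≢ d e = tail-rev d (trans (cong tail (sym e)) (φ-tail d))

    opposite-dart : ∀ c d → tail c ≡ tail (rev d) → tail (rev c) ≡ tail d → c ≡ rev d
    opposite-dart (e , true)  (f , true)  h k = ⊥-elim (simple′ h (sym (sym k)))
    opposite-dart (e , true)  (f , false) h k = cong (_, true) (simple h k)
    opposite-dart (e , false) (f , true)  h k = cong (_, false) (simple k h)
    opposite-dart (e , false) (f , false) h k = ⊥-elim (simple′ k h)

    φφ-≢ : ∀ d → φ (φ d) ≢ d
    φφ-≢ d e = proj₁ (proj₂ (proj₂ (preceding (rev d)))) (opposite-dart (φ d) d (φ-tail d) (trans (sym (φ-tail (φ d))) (cong tail e)))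

    -- Equality of parities in place of lying on a common orbit of `φ`. It is possibly coarser, but
    -- `φ` stays within a class, so classes still have at least three members.
    _~_ : Dart → Dart → Set
    c ~ d = ∀ z → Closed z → Lft c z ≡ Lft d z

    φ-~ : ∀ d → d ~ φ d
    φ-~ d z cl = trans (Lft-rev cl d) (sym (proj₂ (proj₂ (proj₂ (preceding (rev d)))) z cl))

    -- Supplies the evenness at the one vertex that is left out of the linear system.
    handshake : ∀ z vs → Unique vs → (∀ e → U e ∈ vs × V e ∈ vs) → ⨁ (∂ z) vs ≡ false
    handshake z vs un h = trans (⨁-swap (λ v e → z e ∧ bound e v) vs edges) (⨁-false edges λ {e} _ →
      trans (⨁-∧ (z e) (bound e) vs) (trans (cong (z e ∧_) (trans (⨁-xor (U e ==_) (V e ==_) vs) (cong₂ _xor_ (pick (proj₁ (h e))) (pick (proj₂ (h e)))))) (∧-zeroʳ (z e))))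
      where
      pick : ∀ {u} → u ∈ vs → ⨁ (u ==_) vs ≡ true
      pick {u} i = trans (⨁-single (u ==_) vs un i (λ {v} ne → ==-false {u = u} {v} (λ e → ne (sym e)))) (==-refl u)

    too-many : (S : Fin n → Bool) → (∀ e → S (U e) ≡ true × S (V e) ≡ true) → 1 ≤ size S → 3 * size S ≤ m → ⊥
    too-many S inS 1≤s le with sat S | sat-length S | sat-unique S | (λ {u} → sat-∈ {p = S} {u}) | (λ {u} → ∈-sat S {u})
    ... | [] | len | _ | _ | _ = case (subst (1 ≤_) (sym len) 1≤s) of λ ()
    ... | v₀ ∷ vs | len | un | ∈S | S∈ = representatives _ darts ≤-refl darts-unique (λ _ _ → ∈-darts _) contra
      where
      open Classes _~_ (λ _ _ → refl) (λ h z cl → sym (h z cl)) (λ h k z cl → trans (h z cl) (k z cl)) φ φ-~ φ-≢ φφ-≢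
      contra : (Σ (List Dart) λ rs → 3 * length rs ≤ length darts × (∀ {x} → x ∈ darts → Σ Dart λ r → r ∈ rs × r ~ x)) → ⊥
      contra (rs , le′ , cover) = finish (kernel-list fs additive few)
        where
        fs : List (Chain → Bool)
        fs = map (λ v z → ∂ z v) vs ++ map Lft rs
        additive : ∀ {f} → f ∈ fs → Additive f
        additive i with ∈-++⁻ (map (λ v z → ∂ z v) vs) i
        ... | inj₁ j with ∈-map⁻ (λ v z → ∂ z v) j
        ... | v , _ , refl = λ x y → trans (⨁-cong edges λ {e} _ → ∧-distribʳ-xor (bound e v) (x e) (y e)) (⨁-xor (λ e → x e ∧ bound e v) (λ e → y e ∧ bound e v) edges)
        additive i | inj₂ j with ∈-map⁻ Lft j
        ... | d , _ , refl = λ x y → total-+ x y (λ s → Lc (pos (tail d)) (next d) (proj₁ s) (proj₂ s))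
        -- One condition for each vertex but `v₀`, and one for each class of the `2 * m` darts.
        -- Leaving out `v₀` makes the inequality strict.
        few : length fs < m
        few = *-cancelˡ-< 3 _ _ (begin-strict
          3 * length fs                       ≡⟨ cong (3 *_) (trans (length-++ (map (λ v z → ∂ z v) vs)) (cong₂ _+_ (length-map (λ v z → ∂ z v) vs) (length-map Lft rs))) ⟩
          3 * (length vs + length rs)         ≡⟨ *-distribˡ-+ 3 (length vs) _ ⟩
          3 * length vs + 3 * length rs       <⟨ +-mono-<-≤ (≤-trans (*-monoʳ-< 3 (n<1+n (length vs))) (≤-trans (≤-reflexive (cong (3 *_) len)) le)) (≤-trans le′ (≤-reflexive darts-length)) ⟩
          m + (m + m)                         ≡⟨ lem m ⟩
          3 * m                               ∎)
          where
          open ≤-Reasoning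
          lem : ∀ m → m + (m + m) ≡ 3 * m
          lem = solve-∀
        finish : (Σ Chain λ z → (Σ (Fin m) λ e → z e ≡ true) × (∀ {f} → f ∈ fs → f z ≡ false)) → ⊥
        finish (z , (e , ze) , zero′) = true≢false ze (trans (sym (own-dart (e , true) z)) (cong₂ _xor_ (left (e , true)) (trans (sym (Lft-rev closed (e , false))) (left (e , false)))))
          where
          inner : ∀ {v} → v ∈ vs → ∂ z v ≡ false
          inner i = zero′ (∈-++⁺ˡ (∈-map⁺ (λ v z → ∂ z v) i))
          at-v₀ : ∂ z v₀ ≡ false
          at-v₀ = trans (sym (trans (cong (∂ z v₀ xor_) (⨁-false vs inner)) (xor-identityʳ (∂ z v₀))))
            (handshake z (v₀ ∷ vs) un λ e → ∈S (proj₁ (inS e)) , ∈S (proj₂ (inS e)))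
          closed : Closed z
          closed v with S v in sv
          ... | false = ⨁-false edges λ {e} _ → trans (cong (z e ∧_) (cong₂ _xor_ (==-false {u = U e} {v} (λ { refl → true≢false (proj₁ (inS e)) sv }))
                (==-false {u = V e} {v} (λ { refl → true≢false (proj₂ (inS e)) sv })))) (∧-zeroʳ (z e))
          ... | true with ∈S {v} sv
          ... | here refl = at-v₀
          ... | there i = inner i
          left : ∀ d → Lft d z ≡ false
          left d = let (r , i , s) = cover (∈-darts d) in trans (sym (s z closed)) (zero′ (∈-++⁺ʳ (map (λ v z → ∂ z v) vs) (∈-map⁺ Lft i)))

-- Listing the edges within a vertex set, and generic directions

opaque
  unfolding ∑

  sumL-tabulate : ∀ {A : Set} {n} (f : A → ℕ) (g : Fin n → A) → sumL f (tabulate g) ≡ ∑ (f ∘ g)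
  sumL-tabulate {n = zero}  f g = refl
  sumL-tabulate {n = suc n} f g = cong (f (g zero) +_) (sumL-tabulate f (g ∘ suc))

filterᵇ-product-length : ∀ {A B : Set} (p : A × B → Bool) xs ys →
  length (filterᵇ p (cartesianProduct xs ys)) ≡ sumL (λ x → length (filterᵇ (λ y → p (x , y)) ys)) xs
filterᵇ-product-length p [] ys = refl
filterᵇ-product-length {A} {B} p (x ∷ xs) ys = trans (cong length (filter-++ (T? ∘ p) (map (x ,_) ys) (cartesianProduct xs ys)))
  (trans (length-++ (filterᵇ p (map (x ,_) ys))) (cong₂ _+_ (row ys) (filterᵇ-product-length p xs ys)))
  where
  row : ∀ ys → length (filterᵇ p (map (x ,_) ys)) ≡ length (filterᵇ (λ y → p (x , y)) ys)
  row [] = refl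
  row (y ∷ ys) with p (x , y)
  ... | true  = cong suc (row ys)
  ... | false = row ys

lookup-injective : ∀ {A : Set} {xs : List A} → Unique xs → ∀ i j → lookup xs i ≡ lookup xs j → i ≡ j
lookup-injective {xs = x ∷ xs} un zero    zero    e = refl
lookup-injective {xs = x ∷ xs} un zero    (suc j) e = ⊥-elim (Unique-head un (subst (_∈ xs) (sym e) (∈-lookup j)))
lookup-injective {xs = x ∷ xs} un (suc i) zero    e = ⊥-elim (Unique-head un (subst (_∈ xs) e (∈-lookup i)))
lookup-injective {xs = x ∷ xs} un (suc i) (suc j) e = cong suc (lookup-injective (Unique-tail un) i j e)

count-other : ∀ {n} (p : Fin n → Bool) → 2 ≤ count p → ∀ w → Σ (Fin n) λ u → p u ≡ true × u ≢ w
count-other p two w with sat p | sat-length p | sat-unique p | (λ {u} → ∈-sat p {u})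
... | [] | len | _ | _ = case (subst (2 ≤_) (sym len) two) of λ ()
... | x ∷ [] | len | _ | _ = case (subst (2 ≤_) (sym len) two) of λ { (s≤s ()) }
... | x ∷ y ∷ _ | _ | un | h with x Fin.≟ w
... | no ne = x , h (here refl) , ne
... | yes refl = y , h (there (here refl)) , λ { refl → Unique-head un (here refl) }

module EdgeList {n} (H : Graph n) (S : Fin n → Bool) where

  within : Fin n × Fin n → Bool
  within (u , v) = (adj H u v ∧ (S u ∧ S v)) ∧ (toℕ u <ᵇ toℕ v)

  within-intro : ∀ {u v} → Edge H u v → S u ≡ true → S v ≡ true → toℕ u < toℕ v → within (u , v) ≡ true
  within-intro a b c d = ∧-intro (∧-intro a (∧-intro b c)) (T-true (<⇒<ᵇ d))

  within-elim : ∀ u v → within (u , v) ≡ true → OEdge H u v × S u ≡ true × S v ≡ true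
  within-elim u v e = let (p , q) = ∧-true e ; (a , r) = ∧-true {adj H u v} p ; (b , c) = ∧-true {S u} r in
    (a , <ᵇ⇒< (toℕ u) (toℕ v) (subst T (sym q) _)) , b , c

  es : List (Fin n × Fin n)
  es = filterᵇ within (cartesianProduct (allFin n) (allFin n))

  es-unique : Unique es
  es-unique = Unique.filter⁺ (T? ∘ within) (Unique.cartesianProduct⁺ (Unique.allFin⁺ n) (Unique.allFin⁺ n))

  ∈-es : ∀ {u v} → within (u , v) ≡ true → (u , v) ∈ es
  ∈-es {u} {v} e = ∈-filter⁺ (T? ∘ within) (∈-cartesianProduct⁺ (∈-allFin u) (∈-allFin v)) (subst T (sym e) _)

  es-∈ : ∀ {u v} → (u , v) ∈ es → OEdge H u v × S u ≡ true × S v ≡ true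
  es-∈ {u} {v} i = within-elim u v (T-true (proj₂ (∈-filter⁻ (T? ∘ within) {xs = cartesianProduct (allFin n) (allFin n)} i)))

  es-length : length es ≡ ∑ (λ u → ∑ (λ v → b2n (within (u , v))))
  es-length = trans (filterᵇ-product-length within (allFin n) (allFin n)) (trans (sumL-tabulate {A = Fin n} (λ u → length (sat (λ v → within (u , v)))) id)
    (∑-cong λ u → sat-length (λ v → within (u , v))))

  degSum≤es : degSum H S ≤ 2 * length es
  degSum≤es = begin
    degSum H S                                                      ≡⟨ ∑-cong (λ v → sym (∑-* (b2n (S v)) (λ u → b2n (adj H v u ∧ S u)))) ⟩
    ∑ (λ v → ∑ (λ u → b2n (S v) * b2n (adj H v u ∧ S u)))           ≤⟨ ∑-mono (λ v → ∑-mono (λ u → prod (pt v u))) ⟩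
    ∑ (λ v → ∑ (λ u → g v u + g u v))                               ≡⟨ ∑-cong (λ v → ∑-+ (g v) (λ u → g u v)) ⟩
    ∑ (λ v → ∑ (g v) + ∑ (λ u → g u v))                             ≡⟨ ∑-+ (λ v → ∑ (g v)) (λ v → ∑ (λ u → g u v)) ⟩
    ∑ (λ v → ∑ (g v)) + ∑ (λ v → ∑ (λ u → g u v))                   ≡⟨ cong₂ _+_ (sym es-length) (trans (sym (∑-swap g)) (sym es-length)) ⟩
    length es + length es                                           ≡⟨ cong (length es +_) (sym (+-identityʳ _)) ⟩
    2 * length es                                                   ∎
    where
    open ≤-Reasoning
    g : Fin n → Fin n → ℕ
    g u v = b2n (within (u , v))
    prod : ∀ {a b k} → (a ≡ true → b ≡ true → 1 ≤ k) → b2n a * b2n b ≤ k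
    prod {true} {true}  h = h refl refl
    prod {true} {false} h = z≤n
    prod {false}        h = z≤n
    one : ∀ {u v} → within (u , v) ≡ true → 1 ≤ g u v
    one e = ≤-reflexive (sym (cong b2n e))
    pt : ∀ v u → S v ≡ true → adj H v u ∧ S u ≡ true → 1 ≤ g v u + g u v
    pt v u sv e with ∧-true {adj H v u} e
    ... | a , su with <-cmp (toℕ v) (toℕ u)
    ... | tri< lt _ _ = ≤-trans (one (within-intro a sv su lt)) (m≤m+n _ _)
    ... | tri> _ _ gt = ≤-trans (one (within-intro (trans (Graph.sym H u v) a) su sv gt)) (m≤n+m _ _)
    ... | tri≈ _ eq _ with Fin.toℕ-injective {i = v} {j = u} eq
    ... | refl = ⊥-elim (true≢false a (irrefl H v))

<+1 : ∀ b → b <q b +q 1ℚ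
<+1 b = subst (_<q b +q 1ℚ) (ℚ.+-identityʳ b) (ℚ.+-monoʳ-< b (ℚ.positive⁻¹ 1ℚ))

upper-bound : ∀ bs → Σ ℚ λ ε → ∀ {b} → b ∈ bs → b <q ε
upper-bound [] = 0ℚ , λ ()
upper-bound (b ∷ bs) with upper-bound bs
... | ε , h with ℚ.<-cmp b ε
... | tri< lt _ _ = ε , λ { (here refl) → lt ; (there i) → h i }
... | tri≈ _ refl _ = ε +q 1ℚ , λ { (here refl) → <+1 b ; (there i) → ℚ.<-trans (h i) (<+1 ε) }
... | tri> _ _ gt = b +q 1ℚ , λ { (here refl) → <+1 b ; (there i) → ℚ.<-trans (h i) (ℚ.<-trans gt (<+1 b)) }

-- The only tilt at which points of different height become level. Points of equal height are level
-- only if they are equal, so the value `0ℚ` is a mere default.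
level : Point → Point → ℚ
level (p₁ , p₂) (q₁ , q₂) with p₂ -q q₂ ℚ.≟ 0ℚ
... | yes _ = 0ℚ
... | no ne = (q₁ -q p₁) *q (1/ (p₂ -q q₂)) {{ℚ.≢-nonZero ne}}

level-spec : ∀ ε p q → proj₁ p +q ε *q proj₂ p ≡ proj₁ q +q ε *q proj₂ q → p ≡ q ⊎ ε ≡ level p q
level-spec ε (p₁ , p₂) (q₁ , q₂) h with p₂ -q q₂ ℚ.≟ 0ℚ
... | yes e = inj₁ (cong₂ _,_ p₁≡q₁ p₂≡q₂)
  where
  open +-*-Solver
  p₂≡q₂ : p₂ ≡ q₂
  p₂≡q₂ = trans (solve 2 (λ p q → p := (p :- q) :+ q) refl p₂ q₂) (trans (cong (_+q q₂) e) (ℚ.+-identityˡ q₂))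
  p₁≡q₁ : p₁ ≡ q₁
  p₁≡q₁ = trans (solve 3 (λ p e y → p := p :+ e :* y :- e :* y) refl p₁ ε p₂) (trans (cong₂ (λ s t → s -q ε *q t) h p₂≡q₂)
    (solve 3 (λ p e y → p :+ e :* y :- e :* y := p) refl q₁ ε q₂))
... | no ne = inj₂ (begin
    ε                              ≡⟨ sym (ℚ.*-identityʳ ε) ⟩
    ε *q 1ℚ                        ≡⟨ cong (ε *q_) (sym (ℚ.*-inverseʳ (p₂ -q q₂) {{ℚ.≢-nonZero ne}})) ⟩
    ε *q ((p₂ -q q₂) *q i)         ≡⟨ solve 4 (λ e p q i → e :* ((p :- q) :* i) := (e :* p :- e :* q) :* i) refl ε p₂ q₂ i ⟩
    (ε *q p₂ -q ε *q q₂) *q i      ≡⟨ cong (_*q i) diff ⟩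
    (q₁ -q p₁) *q i                ∎)
  where
  open ≡-Reasoning
  open +-*-Solver
  i : ℚ
  i = (1/ (p₂ -q q₂)) {{ℚ.≢-nonZero ne}}
  diff : ε *q p₂ -q ε *q q₂ ≡ q₁ -q p₁
  diff = trans (solve 3 (λ p x y → x :- y := (p :+ x) :- p :- y) refl p₁ (ε *q p₂) (ε *q q₂)) (trans (cong (λ t → t -q p₁ -q ε *q q₂) h)
    (solve 3 (λ q p y → (q :+ y) :- p :- y := q :- p) refl q₁ p₁ (ε *q q₂)))

opaque
  unfolding Sweep.X

  generic-ε : ∀ ps → Σ ℚ λ ε → ∀ {p q} → p ∈ ps → q ∈ ps → Sweep.X ε p ≡ Sweep.X ε q → p ≡ q
  generic-ε ps with upper-bound (concatMap (λ p → map (level p) ps) ps)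
  ... | ε , h = ε , λ {p} {q} i j e → by i j (level-spec ε p q e)
    where
    by : ∀ {p q} → p ∈ ps → q ∈ ps → p ≡ q ⊎ ε ≡ level p q → p ≡ q
    by i j (inj₁ e) = e
    by {p} {q} i j (inj₂ e) = ⊥-elim (ℚ.<-irrefl (sym e) (h (∈-concatMap⁺ (λ p → map (level p) ps) (lose i (∈-map⁺ (level p) j)))))

-- From a plane drawing of a graph to the sweep

lastOf-snoc : ∀ {A : Set} (x : A) xs y → lastOf x (xs ++ y ∷ []) ≡ y
lastOf-snoc x [] y = refl
lastOf-snoc x (z ∷ xs) y = lastOf-snoc z xs y

start-seg : ∀ {p q ps c d} → Steps p (q ∷ ps) → SimplePath (p ∷ q ∷ ps) → (c , d) ∈ segs p (q ∷ ps) → OnSeg c d p → p ≡ c ⊎ p ≡ d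
start-seg {p} {q} {ps} st h i on with simple-cross p (q ∷ ps) st h (here refl) i
... | inj₁ refl = inj₁ refl
... | inj₂ cf = proj₂ (cf p (onseg-start p q) on)

end-seg : ∀ {p q ps c d} → Steps p (q ∷ ps) → SimplePath (p ∷ q ∷ ps) → (c , d) ∈ segs p (q ∷ ps) → OnSeg c d (lastOf q ps) →
          lastOf q ps ≡ c ⊎ lastOf q ps ≡ d
end-seg {p} {q} {ps} st h i on with simple-cross p (q ∷ ps) st h (last-seg p q ps) i
... | inj₁ e = inj₂ (cong proj₂ e)
... | inj₂ cf = proj₂ (cf (lastOf q ps) (onseg-end (penult p (q ∷ ps)) (lastOf q ps)) on)

module _ {n} {H : Graph n} (P : PlaneDrawing H) where

  open PlaneDrawing P

  record Arc (u v : Fin n) : Set where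
    field
      h      : Point
      t      : List Point
      steps  : Steps (pos u) (h ∷ t)
      simple : SimplePath (pos u ∷ h ∷ t)
      on     : ∀ x → OnPath (pos u ∷ h ∷ t) x → OnPath (arc u v) x
      last   : lastOf h t ≡ pos v

  clean-arc : ∀ {u v} → OEdge H u v → Arc u v
  clean-arc {u} {v} oe = go _ (clean-steps (pos u) rest) (clean-simple (pos u) rest (arc-simple u v oe)) (clean-on (pos u) rest)
    (trans (clean-last (pos u) rest) (lastOf-snoc (pos u) (bends u v) (pos v)))
    where
    rest = bends u v ++ pos v ∷ []
    go : ∀ ps → Steps (pos u) ps → SimplePath (pos u ∷ ps) → (∀ x → OnPath (pos u ∷ ps) x → OnPath (arc u v) x) → lastOf (pos u) ps ≡ pos v → Arc u v
    go [] st s o e = ⊥-elim (<⇒≢ (proj₂ oe) (cong toℕ (pos-inj e)))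
    go (h ∷ t) st s o e = record { h = h ; t = t ; steps = st ; simple = s ; on = o ; last = e }

  module _ (S : Fin n → Bool) where

    open EdgeList H S

    m : ℕ
    m = length es

    src tgt : Fin m → Fin n
    src e = proj₁ (lookup es e)
    tgt e = proj₂ (lookup es e)

    edge : ∀ e → OEdge H (src e) (tgt e) × S (src e) ≡ true × S (tgt e) ≡ true
    edge e = es-∈ (∈-lookup e)

    edge-at : ∀ {u v} → Edge H u v → S u ≡ true → S v ≡ true → toℕ u < toℕ v → Σ (Fin m) λ e → src e ≡ u × tgt e ≡ v
    edge-at a su sv lt = let i = ∈-es (within-intro a su sv lt) ; l = lookup-index i in index i , sym (cong proj₁ l) , sym (cong proj₂ l)

    arcs : ∀ e → Arc (src e) (tgt e)
    arcs e = clean-arc (proj₁ (edge e))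

    module A (e : Fin m) = Arc (arcs e)

    nodes : Fin m → List Point
    nodes e = pos (src e) ∷ A.h e ∷ A.t e

    ε-spec : Σ ℚ λ ε → ∀ {p q} → p ∈ concatMap nodes (allFin m) → q ∈ concatMap nodes (allFin m) → Sweep.X ε p ≡ Sweep.X ε q → p ≡ q
    ε-spec = generic-ε (concatMap nodes (allFin m))

    ∈-nodes : ∀ {e p} → p ∈ nodes e → p ∈ concatMap nodes (allFin m)
    ∈-nodes {e} i = ∈-concatMap⁺ nodes (lose (∈-allFin e) i)

    edge-≡ : ∀ {e f} → src e ≡ src f → tgt e ≡ tgt f → e ≡ f
    edge-≡ {e} {f} h k = lookup-injective es-unique e f (cong₂ _,_ h k)

    on-arc : ∀ e {x} → OnPath (nodes e) x → OnPath (arc (src e) (tgt e)) x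
    on-arc e {x} = A.on e x

    ends : ∀ e {w} → OnPath (nodes e) (pos w) → w ≡ src e ⊎ w ≡ tgt e
    ends e {w} i = arc-novert (src e) (tgt e) (proj₁ (edge e)) w (on-arc e i)

    common : ∀ {e f x} → e ≢ f → OnPath (nodes e) x → OnPath (nodes f) x → Σ (Fin n) λ w → x ≡ pos w
    common {e} {f} {x} ne i j = arc-disjoint (src e) (tgt e) (src f) (tgt f) (proj₁ (edge e)) (proj₁ (edge f)) (λ (h , k) → ne (edge-≡ h k)) x (on-arc e i) (on-arc f j)

    -- A vertex on an arc is one of its ends, and a simple arc meets its ends only in ends of
    -- segments. As different arcs share only vertices, their segments do not cross.
    vertex-on-seg : ∀ e {a b x w} → (a , b) ∈ segs (pos (src e)) (A.h e ∷ A.t e) → OnSeg a b x → x ≡ pos w → x ≡ a ⊎ x ≡ b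
    vertex-on-seg e {a} {b} {x} {w} i on refl with ends e (on-seg (pos (src e)) (A.h e ∷ A.t e) x i on)
    ... | inj₁ refl = start-seg (A.steps e) (A.simple e) i on
    ... | inj₂ refl = subst (λ p → p ≡ a ⊎ p ≡ b) (A.last e) (end-seg (A.steps e) (A.simple e) i (subst (OnSeg a b) (sym (A.last e)) on))

    drawing : Drawing (proj₁ ε-spec) n m
    drawing = record
      { pos = pos ; U = src ; V = tgt ; hd = A.h ; tl = A.t
      ; end = A.last
      ; uniq = λ e → simple-unique _ _ (A.steps e) (A.simple e)
      ; pos-inj = pos-inj
      ; ends = λ {e} {w} i → ends e (on-node _ _ (pos w) i)
      ; shared = λ {e} {f} {x} ne i j → common ne (on-node _ _ x i) (on-node _ _ x j)
      ; self = λ {e} → simple-cross _ _ (A.steps e) (A.simple e)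
      ; cross = λ {e} {f} ne i j x p q → let (w , eq) = common ne (on-seg _ _ x i p) (on-seg _ _ x j q) in
          vertex-on-seg e i p eq , vertex-on-seg f j q eq
      ; generic = λ {e} {f} i j → proj₂ ε-spec (∈-nodes {e} i) (∈-nodes {f} j)
      ; simple = edge-≡
      ; simple′ = λ {e} {f} h k → <-asym (proj₂ (proj₁ (edge e))) (subst₂ (λ u v → toℕ u < toℕ v) (sym k) (sym h) (proj₂ (proj₁ (edge f))))
      }

    module _ (deg≥2 : ∀ v → S v ≡ true → 2 ≤ degIn H S v) where

      open Plane drawing using (Dart; tail; rev)

      tail-S : ∀ d → S (tail d) ≡ true
      tail-S (e , true)  = proj₁ (proj₂ (edge e))
      tail-S (e , false) = proj₂ (proj₂ (edge e))

      dart : ∀ {u v} → Edge H u v → S u ≡ true → S v ≡ true → Σ Dart λ d → tail d ≡ u × tail (rev d) ≡ v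
      dart {u} {v} a su sv = by (<-cmp (toℕ u) (toℕ v))
        where
        by : Tri (toℕ u < toℕ v) (toℕ u ≡ toℕ v) (toℕ v < toℕ u) → Σ Dart λ d → tail d ≡ u × tail (rev d) ≡ v
        by (tri< lt _ _) = let (e , h , k) = edge-at a su sv lt in (e , true) , h , k
        by (tri> _ _ gt) = let (e , h , k) = edge-at (trans (Graph.sym H v u) a) sv su gt in (e , false) , k , h
        by (tri≈ _ eq _) = ⊥-elim (true≢false a (subst (λ w → adj H u w ≡ false) (Fin.toℕ-injective {i = u} {j = v} eq) (irrefl H u)))

      branching : ∀ d → Σ Dart λ y → y ≢ d × tail y ≡ tail d
      branching d = let (u , p , ne) = other ; (a , su) = ∧-true {adj H (tail d) u} p ; (y , h , k) = dart {tail d} {u} a (tail-S d) su in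
        y , (λ e → ne (trans (sym k) (cong (λ c → tail (rev c)) e))) , h
        where
        other : Σ (Fin n) λ u → adj H (tail d) u ∧ S u ≡ true × u ≢ tail (rev d)
        other = count-other (λ u → adj H (tail d) u ∧ S u) (deg≥2 (tail d) (tail-S d)) (tail (rev d))

      min-degree-sparse : 1 ≤ size S → 6 * size S ≤ degSum H S → ⊥
      min-degree-sparse one le = Count.too-many drawing branching S (λ e → proj₂ (edge e)) one
        (*-cancelˡ-≤ 2 (≤-trans (≤-reflexive (sym (*-assoc 2 3 (size S)))) (≤-trans le degSum≤es)))

-- A smallest counterexample has minimum degree two: removing a vertex of smaller degree costs the
-- degree sum at most two but the bound six.
planar-sparse : ∀ {n} (H : Graph n) → Planar H → ∀ U → 1 ≤ size U → degSum H U < 6 * size U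
planar-sparse {n} H P U one = ≰⇒> λ le → ¬¬-minimal {A = Σ (Fin n → Bool) λ S → 1 ≤ size S × 6 * size S ≤ degSum H S} (size ∘ proj₁) (U , one , le)
  λ ((S , one , le) , least) → min-degree-sparse P S (λ v sv → ≰⇒> (λ deg≤1 → small S le least sv deg≤1)) one le
  where
  small : ∀ S → 6 * size S ≤ degSum H S → (∀ (W : Σ (Fin n → Bool) λ S → 1 ≤ size S × 6 * size S ≤ degSum H S) → size S ≤ size (proj₁ W)) →
          ∀ {v} → S v ≡ true → degIn H S v ≤ 1 → ⊥
  small S le least {v} sv deg≤1 = by (size W) refl
    where
    W = remove S v
    le′ : 6 * size W + 6 ≤ degSum H W + 2
    le′ = ≤-trans (≤-reflexive (trans (+-comm (6 * size W) 6) (sym (trans (cong (6 *_) (size-remove S sv)) (*-suc 6 (size W))))))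
      (≤-trans le (≤-trans (≤-reflexive (degSum-remove H S sv)) (+-monoʳ-≤ (degSum H W) (+-mono-≤ deg≤1 deg≤1))))
    by : ∀ k → size W ≡ k → ⊥
    by zero e = <⇒≱ (s≤s (s≤s (s≤s z≤n))) (≤-trans (m≤n+m 6 (6 * size W)) (≤-trans le′ (≤-reflexive (cong (_+ 2) empty))))
      where
      none : ∀ u → b2n (W u) ≡ 0
      none u = n≤0⇒n≡0 (≤-trans (∑-≥ u (λ u → b2n (W u))) (≤-reflexive e))
      empty : degSum H W ≡ 0
      empty = trans (∑-cong λ u → cong (_* degIn H W u) (none u)) (∑-zero n)
    by (suc k) e = 1+n≰n (≤-trans (≤-reflexive (sym (size-remove S sv))) (least (W , subst (1 ≤_) (sym e) (s≤s z≤n) ,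
      +-cancelʳ-≤ 2 _ _ (≤-trans (+-monoʳ-≤ (6 * size W) (s≤s (s≤s z≤n))) le′))))

-- Each of the `t` strict inequalities leaves a unit to spare, so their sum is strict because `t` is
-- positive.
union-sparse : ∀ {n t} (G : Graph n) (Hs : Fin t → Graph n) → 1 ≤ t →
  (∀ u v → Edge G u v → Σ (Fin t) λ i → Edge (Hs i) u v) → ∀ U s → (∀ i → degSum (Hs i) U < s) → degSum G U < t * s
union-sparse {n} {t} G Hs 1≤t cover U s sparse = ≤-trans (+-monoˡ-≤ (degSum G U) 1≤t) (begin
  t + degSum G U                                       ≤⟨ +-monoʳ-≤ t (∑-mono λ v → *-monoʳ-≤ (b2n (U v)) (∑-mono (pt v))) ⟩
  t + ∑ (λ v → b2n (U v) * ∑ (λ u → ∑ (λ i → f i v u))) ≡⟨ cong (t +_) (∑-cong λ v → cong (b2n (U v) *_) (sym (∑-swap (λ i u → f i v u)))) ⟩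
  t + ∑ (λ v → b2n (U v) * ∑ (λ i → ∑ (f i v)))        ≡⟨ cong (t +_) (∑-cong λ v → sym (∑-* (b2n (U v)) (λ i → ∑ (f i v)))) ⟩
  t + ∑ (λ v → ∑ (λ i → b2n (U v) * ∑ (f i v)))        ≡⟨ cong (t +_) (sym (∑-swap (λ i v → b2n (U v) * ∑ (f i v)))) ⟩
  t + ∑ (λ i → degSum (Hs i) U)                        ≡⟨ cong (_+ ∑ (λ i → degSum (Hs i) U)) (sym (trans (∑-const t 1) (*-identityʳ t))) ⟩
  ∑ {t} (λ _ → 1) + ∑ (λ i → degSum (Hs i) U)          ≡⟨ sym (∑-+ _ _) ⟩
  ∑ (λ i → suc (degSum (Hs i) U))                      ≤⟨ ∑-mono sparse ⟩
  ∑ {t} (λ _ → s)                                      ≡⟨ ∑-const t s ⟩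
  t * s                                                ∎)
  where
  open ≤-Reasoning
  f : Fin t → Fin n → Fin n → ℕ
  f i v u = b2n (adj (Hs i) v u ∧ U u)
  pt : ∀ v u → b2n (adj G v u ∧ U u) ≤ ∑ (λ i → f i v u)
  pt v u = go (adj G v u) refl
    where
    go : ∀ b → adj G v u ≡ b → b2n (b ∧ U u) ≤ ∑ (λ i → f i v u)
    go false _ = z≤n
    go true e = let (i , h) = cover v u e in ≤-trans (≤-reflexive (cong (λ b → b2n (b ∧ U u)) (sym h))) (∑-≥ i (λ i → f i v u))

-- The starting inequality for peeling, where `Y` is all of `U`: the part `δ * D` occurs on both
-- sides, and the edge bound pays for the remaining `γ * D`.
outweigh : ∀ γ δ b k t s D → 1 ≤ γ → 1 ≤ s → D < t * (6 * s) → γ * (t * 6) ≤ 2 * b * k → 2 * b ≡ δ + γ →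
           2 * b * D < 2 * (b * k) * s + δ * D
outweigh γ δ b k t s D 1≤γ 1≤s lt le e = begin-strict
  2 * b * D                    ≡⟨ trans (cong (_* D) e) (trans (*-distribʳ-+ D δ γ) (+-comm (δ * D) _)) ⟩
  γ * D + δ * D                <⟨ +-monoˡ-< (δ * D) (≤-trans (≤-reflexive (+-comm 1 (γ * D))) (≤-trans (+-monoʳ-≤ (γ * D) 1≤γ) (≤-reflexive (trans (+-comm (γ * D) γ) (sym (*-suc γ D)))))) ⟩
  γ * suc D + δ * D            ≤⟨ +-monoˡ-≤ (δ * D) (*-monoʳ-≤ γ lt) ⟩
  γ * (t * (6 * s)) + δ * D    ≡⟨ cong (_+ δ * D) (lem γ t s) ⟩
  γ * (t * 6) * s + δ * D      ≤⟨ +-monoˡ-≤ (δ * D) (*-monoˡ-≤ s le) ⟩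
  2 * b * k * s + δ * D        ≡⟨ cong (λ z → z * s + δ * D) (*-assoc 2 b k) ⟩
  2 * (b * k) * s + δ * D      ∎
  where
  open ≤-Reasoning
  lem : ∀ γ t s → γ * (t * (6 * s)) ≡ γ * (t * 6) * s
  lem = solve-∀

-- Rounding up: ⌈m / (suc d)⌉ is computed as (m + d) / (suc d).
ceiling : ∀ m d → m ≤ suc d * ((m + d) / suc d)
ceiling m d = +-cancelʳ-≤ d m _ (begin
  m + d                                          ≡⟨ m≡m%n+[m/n]*n (m + d) (suc d) ⟩
  (m + d) % suc d + (m + d) / suc d * suc d      ≤⟨ +-monoˡ-≤ _ (s≤s⁻¹ (m%n<n (m + d) (suc d))) ⟩
  d + (m + d) / suc d * suc d                    ≡⟨ trans (+-comm d _) (cong (_+ d) (*-comm ((m + d) / suc d) (suc d))) ⟩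
  suc d * ((m + d) / suc d) + d                  ∎)
  where open ≤-Reasoning

-- The three bounds for graphs of given thickness

module Final {n} (G : Graph n) (t : ℕ) (1≤t : 1 ≤ t) (T : PlanarDecomposition G t) where

  sparse : ∀ U → 1 ≤ size U → degSum G U < t * (6 * size U)
  sparse U h = let (Hs , _ , pl , cover) = T in
    union-sparse G Hs 1≤t cover U (6 * size U) (λ i → planar-sparse (Hs i) (pl i) U h)

  module Lists (L : Fin n → List ℕ) (k : ℕ) (hL : IsListAssignment L k) where

    L₀ : Fin n → List ℕ
    L₀ v = take k (L v)

    L₀-unique : ∀ v → Unique (L₀ v)
    L₀-unique v = Unique.take⁺ k (proj₁ (hL v))

    L₀-length : ∀ v → length (L₀ v) ≡ k
    L₀-length v = trans (length-take k (L v)) (m≤n⇒m⊓n≡m (proj₂ (hL v)))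

    L₀-⊆ : ∀ {v a} → a ∈ L₀ v → a ∈ L v
    L₀-⊆ {v} i = subst (_ ∈_) (take++drop≡id k (L v)) (∈-++⁺ˡ i)

    existence : 1 ≤ k → ∀ α ε γ → 1 ≤ γ → γ * (t * 6) ≤ 2 * (α + suc ε) * k → 2 * (α + suc ε) ≡ suc ε + γ →
      ∀ Q → Gluable Q →
      (∀ H L′ → (∀ v → Unique (L′ v)) → (∀ v → length (L′ v) ≤ k) →
        (∀ v → α * deg H v + ε * count (λ u → adj H v u ∧ (α * deg H u + 1 ≡ᵇ (α + suc ε) * length (L′ u))) + 1 ≤ (α + suc ε) * length (L′ v)) →
        ∀ c → IsLColouring L′ c → ¬ ¬ (Σ (Colouring n) λ c′ → IsLColouring L′ c′ × Q H c′)) →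
      ¬ ¬ (Σ (Colouring n) λ c → IsLColouring L c × Q G c)
    existence 1≤k α ε γ 1≤γ le e Q gl local r = Assemble.coloured G L₀ L₀-unique k L₀-length 1≤k α ε
      (λ U h → outweigh γ (suc ε) (α + suc ε) k t (size U) (degSum G U) 1≤γ h (sparse U h) le e) Q gl local
      λ (c , l , q) → r (c , L₀-⊆ ∘ l , q)

  private
    divides-positive : ∀ {a b} c d → 1 ≤ c → a ≤ d * b → c ≤ a → 1 ≤ b
    divides-positive {a} {zero} c d 1≤c le le′ = ≤-trans 1≤c (≤-trans le′ (≤-trans le (≤-reflexive (*-zeroʳ d))))
    divides-positive {a} {suc b} c d _ _ _ = s≤s z≤n

  defect-1 : ChoosableDefectClustering G ((9 * t + 1) / 2) 1 2
  defect-1 L hL = let (c , l , h) = find-defect G 1 L nn in c , l , h , defect-clustering G c h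
    where
    k = (9 * t + 1) / 2
    le : 9 * t ≤ 2 * k
    le = ceiling (9 * t) 1
    nn : ¬ ¬ (Σ (Colouring n) λ c → IsLColouring L c × HasDefect G c 1)
    -- With `α = 1` and `ε = 0`: `β = 2`, `δ = 1`, `γ = 3`, and the requirement `18 * t ≤ 4 * k` is
    -- `9 * t ≤ 2 * k`.
    nn = Lists.existence L k hL (divides-positive t 2 1≤t le (m≤n*m t 9)) 1 0 3 (s≤s z≤n)
      (≤-trans (≤-reflexive (lem t)) (≤-trans (*-monoʳ-≤ 2 le) (≤-reflexive (sym (*-assoc 2 2 k))))) refl
      _ (defect-gluable 1) λ H L′ un _ h c l → Matching.matching H L′ un
        (λ v → ≤-trans (≤-reflexive (cong (_+ 1) (sym (trans (+-identityʳ _) (+-identityʳ (deg H v)))))) (h v)) c l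
      where
      lem : ∀ t → 3 * (t * 6) ≡ 2 * (9 * t)
      lem = solve-∀

  clustering-9 : ChoosableClustering G ((21 * t + 4) / 5) 9
  clustering-9 L hL = find-clustering G 9 L nn
    where
    k = (21 * t + 4) / 5
    le : 21 * t ≤ 5 * k
    le = ceiling (21 * t) 4
    nn : ¬ ¬ (Σ (Colouring n) λ c → IsLColouring L c × HasClustering G c 9)
    -- With `α = ε = 2`: `β = 5`, `δ = 3`, `γ = 7`, and the requirement is `42 * t ≤ 10 * k`.
    nn = Lists.existence L k hL (divides-positive t 5 1≤t le (m≤n*m t 21)) 2 2 7 (s≤s z≤n)
      (≤-trans (≤-reflexive (lem t)) (≤-trans (*-monoʳ-≤ 2 le) (≤-reflexive (sym (*-assoc 2 5 k))))) refl
      _ (clustering-gluable 9 (s≤s z≤n)) λ H L′ un _ h c l → Nine.nine H L′ un h c l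
      where
      lem : ∀ t → 7 * (t * 6) ≡ 2 * (21 * t)
      lem = solve-∀

  clustering-linear : ChoosableClustering G (4 * t) (228 * t ∸ 51)
  clustering-linear L hL = subst (λ N → Σ (Colouring n) λ c → IsLColouring L c × HasClustering G c N) (cong (_∸ 51) (sym (*-assoc 57 4 t)))
    (find-clustering G N L nn)
    where
    k = 4 * t
    N = 57 * k ∸ 51
    2≤k : 2 ≤ k
    2≤k = ≤-trans (m≤m+n 2 2) (*-monoʳ-≤ 4 1≤t)
    nn : ¬ ¬ (Σ (Colouring n) λ c → IsLColouring L c × HasClustering G c N)
    -- With `α = ε = 1`: `β = 3`, `δ = 2`, `γ = 4`, and `24 * t ≤ 6 * k` holds with equality.
    nn = Lists.existence L k hL (≤-trans (s≤s z≤n) 2≤k) 1 1 4 (s≤s z≤n) (≤-reflexive (lem t)) refl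
      _ (clustering-gluable N (m<n⇒0<n∸m (≤-trans (m≤m+n 52 62) (*-monoʳ-≤ 57 2≤k)))) local
      where
      lem : ∀ t → 4 * (t * 6) ≡ 2 * 3 * (4 * t)
      lem = solve-∀
      local : ∀ H L′ → (∀ v → Unique (L′ v)) → (∀ v → length (L′ v) ≤ k) →
        (∀ v → 1 * deg H v + 1 * count (λ u → adj H v u ∧ (1 * deg H u + 1 ≡ᵇ 3 * length (L′ u))) + 1 ≤ 3 * length (L′ v)) →
        ∀ c → IsLColouring L′ c → ¬ ¬ (Σ (Colouring n) λ c′ → IsLColouring L′ c′ × HasClustering H c′ N)
      local H L′ un ℓ≤k h = Linear.linear H L′ un (λ v → ≤-trans (+-monoˡ-≤ 1 (m≤m+n (deg H v) _)) (h′ v)) no-pair k 2≤k ℓ≤k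
        where
        tight : Fin n → Bool
        tight u = deg H u + 1 ≡ᵇ 3 * length (L′ u)
        h′ : ∀ v → deg H v + count (λ u → adj H v u ∧ tight u) + 1 ≤ 3 * length (L′ v)
        h′ v = ≤-trans (≤-reflexive (cong₂ (λ x y → x + y + 1) (sym (*-identityˡ (deg H v)))
          (trans (∑-cong λ u → cong (λ d → b2n (adj H v u ∧ (d + 1 ≡ᵇ 3 * length (L′ u)))) (sym (*-identityˡ (deg H u)))) (sym (*-identityˡ _))))) (h v)
        -- A tight vertex leaves no room in `h′` for a tight neighbour.
        no-pair : ∀ u v → adj H u v ≡ true → tight u ≡ true → tight v ≡ true → ⊥
        no-pair u v e tu tv = <⇒≱ (≤-trans (≤-reflexive (lem₂ (deg H u))) (+-monoˡ-≤ 1 (+-monoʳ-≤ (deg H u)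
          (≤-trans (≤-reflexive (cong b2n (sym (∧-intro e tv)))) (∑-≥ v (λ x → b2n (adj H u x ∧ tight x)))))))
          (≤-trans (h′ u) (≤-reflexive (sym (≡ᵇ-true {deg H u + 1} tu))))
          where
          lem₂ : ∀ d → suc (d + 1) ≡ d + 1 + 1
          lem₂ = solve-∀

theorem24 : ∀ {n : ℕ} (G : Graph n) (t : ℕ) → 1 ≤ t → HasThickness G t →
    ChoosableDefectClustering G ((9 * t + 1) / 2) 1 2
    × ChoosableClustering G ((21 * t + 4) / 5) 9
    × ChoosableClustering G (4 * t) (228 * t ∸ 51)
theorem24 G t 1≤t (T , _) = defect-1 , clustering-9 , clustering-linear
  where open Final G t 1≤t T
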